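{- Let $k_1,k_2,k_3\in\mathbb{Z}_{\ge0}$. For each $p/q\in\mathbb{Q}\cap[0,\infty)$ and for $p/q=1/0$, the matrix $C_{p/q}$ is a $(k_1,k_2,k_3)$-CGC matrix, and for each vertex $(\frac pq,\frac{p+r}{q+s},\frac rs)$ of the Farey tree, the triple $(C_{p/q},C_{(p+r)/(q+s)},C_{r/s})$ is a $(k_1,k_2,k_3)$-CGC triple.
   Context: Indeterminates $x_1,x_2,x_3$; $\mathbf{x}^{(v_1,v_2,v_3)}=x_1^{v_1}x_2^{v_2}x_3^{v_3}$; $\widehat{x_1}=x_2/x_3$, $\widehat{x_2}=x_3/x_1$, $\widehat{x_3}=x_1/x_2$. Cluster structure: mutations $\mu_1(a,b,c)=(\frac{b^2+k_1bc+c^2}{a},b,c)$, $\mu_2(a,b,c)=(a,\frac{a^2+k_2ac+c^2}{b},c)$, $\mu_3(a,b,c)=(a,b,\frac{a^2+k_3ab+b^2}{c})$; labeled clusters are triples obtained from $(x_1,x_2,x_3)$ by finitely many mutations, non-labeled clusters their permutations, cluster variables their entries; a cluster variable $y$ occurs in a unique position $i$ and its parity is $k_y:=k_i$. $\mathscr{M}=\frac{x_1^2+x_2^2+x_3^2+k_1x_2x_3+k_2x_1x_3+k_3x_1x_2}{x_1x_2x_3}$; $S_P=\begin{bmatrix}\mathscr{M}p_{12}-\mathrm{tr}P&0\\(\mathscr{M}p_{12}-\mathrm{tr}P)\mathscr{M}&\mathscr{M}p_{12}-\mathrm{tr}P\end{bmatrix}$. A CGC matrix is $P\in SL(2,\mathbb{Z}[x_1^{\pm1},x_2^{\pm1},x_3^{\pm1}])$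 with $(1,2)$-entry $p_{12}$ a cluster variable and $\mathrm{tr}P=\mathscr{M}p_{12}-k_{p_{12}}$; a CGC triple is a triple $(P,Q,R)$ of CGC matrices with $Q=PR-S_Q$ and $(p_{12},q_{12},r_{12})$ a non-labeled cluster. Farey tree: root $(\frac01,\frac11,\frac10)$; vertex $(\frac ab,\frac cd,\frac ef)$ has children $(\frac ab,\frac{a+c}{b+d},\frac cd)$ and $(\frac cd,\frac{c+e}{d+f},\frac ef)$. Posets: fence posets with chronological ordering $\mathcal{P}(1),\dots,\mathcal{P}(h)$ (each consecutive pair comparable, order = transitive closure), $L=\mathcal{P}(1)$, $R=\mathcal{P}(h)$; $\mathcal{P}\nearrow\mathcal{P}'$ is the concatenation with extra relation $R_{\mathcal{P}}<L_{\mathcal{P}'}$. $\mathcal{W}(\mathcal{P})=\sum_I\prod_{x\in I}\mathrm{wt}(x)$ over order ideals $I$ (including $\emptyset$); $\mathcal{W}(\mathcal{P};R)$, $\mathcal{W}(\mathcal{P};\neg R)$, $\mathcal{W}(\mathcal{P};R,\neg L)$, $\mathcal{W}(\mathcal{P};\neg R,\neg L)$ restrict to ideals containing/not containing $R$, $L$ as indicated. For coprime $p,q>0$, $\mathcal{P}_{p/q}$: let $\Lambda$ be the lattice segments $(m,n)$–$(m+1,n)$ (label $x_3$), $(m,n)$–$(m,n+1)$ (label $x_2$), $(m,n+1)$–$(m+1,n)$ (label $x_1$); $\gamma$ the segment from $(0,0)$ to $(q,p)$ traversed from $(0,0)$, crossing $\tau_1,\dots,\tau_m\in\Lambda$ (away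 from its endpoints) in this order; left/right refer to the direction of travel. For $\tau_j$ labeled $x_a$: one element of weight $\widehat{x_a}^2$ if $k_a=0$, or two consecutive elements if $k_a>0$, the first greater than the second iff $\gamma$ crosses $\tau_j$ strictly closer to its right endpoint, the smaller weighted $k_a\widehat{x_a}$, the larger $\widehat{x_a}/k_a$; between the last element of $\tau_j$'s group and the first of $\tau_{j+1}$'s group, the former is greater iff their shared endpoint lies right of $\gamma$. $H$ is the chain consisting, top to bottom and enumerated top to bottom, of the $x_3$-, then $x_1$-, then $x_2$-elements, where for each $i$ there are, if $k_i>0$, two $x_i$-elements (upper weight $\widehat{x_i}/k_i$, lower $k_i\widehat{x_i}$), and if $k_i=0$ one of weight $\widehat{x_i}^2$. $\widetilde{\mathcal{P}}_{p/q}=\mathcal{P}_{p/q}\nearrow H$ for $p/q>0$; $\widetilde{\mathcal{P}}_{0/1}$ is $H$ with its $x_3$-elements removed (still enumerated top to bottom). $\mathbf{g}_{p/q}=(q-p-1,1-q,p+1)^\top$, $\mathbf{g}^\circ_{p/q}=(q-p,-q,p)^\top$ for $p/q>0$; $\mathbf{g}_{0/1}=(0,0,1)^\top$, $\mathbf{g}^\circ_{0/1}=(1,-1,0)^\top$. For $p/q\in\mathbb{Q}\cap[0,\infty)$, $C_{p/q}=\begin{bmatrix}\mathbf{x}^{\mathbf{g}^\circ_{p/q}}\mathcal{W}(\widetilde{\mathcal{P}}_{p/q};R)&\mathbf{x}^{\mathbf{g}_{p/q}}\mathcal{W}(\widetilde{\mathcal{P}}_{p/q};\neg R)\\ \mathbf{x}^{2\mathbf{g}^\circ_{p/q}-\mathbf{g}_{p/q}}\mathcal{W}(\widetilde{\mathcal{P}}_{p/q};R,\neg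 L)&\mathbf{x}^{\mathbf{g}^\circ_{p/q}}\mathcal{W}(\widetilde{\mathcal{P}}_{p/q};\neg R,\neg L)\end{bmatrix}$, and $C_{1/0}=\begin{bmatrix}x_2\mathscr{M}&x_2\\-k_2\mathscr{M}-\frac{1}{x_2}&-k_2\end{bmatrix}$. -}

module Defs where

open import Data.Nat as ℕ using (ℕ; zero; suc)
open import Data.Integer as ℤ using (ℤ; +_)
open import Data.Rational as ℚ using (ℚ)
open import Data.Bool using (Bool; true; false; _∧_; _∨_; not; if_then_else_)
open import Data.List using (List; []; _∷_; _++_; map; concatMap; foldr; upTo; length)
open import Data.Product using (_×_; _,_; Σ; ∃)
open import Data.Sum using (_⊎_)
open import Relation.Binary.PropositionalEquality using (_≡_)
open import Relation.Nullary.Decidable using (⌊_⌋)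

-- Laurent polynomials in x₁,x₂,x₃ with rational coefficients,
-- represented as finite formal sums of monomials c·x^e, e ∈ ℤ³.
-- Equality _≈_ is equality of all coefficients.

Exp : Set
Exp = ℤ × ℤ × ℤ

_+ₑ_ : Exp → Exp → Exp
(a , b , c) +ₑ (a' , b' , c') = (a ℤ.+ a' , b ℤ.+ b' , c ℤ.+ c')

_=ₑ_ : Exp → Exp → Bool
(a , b , c) =ₑ (a' , b' , c') = ⌊ a ℤ.≟ a' ⌋ ∧ ⌊ b ℤ.≟ b' ⌋ ∧ ⌊ c ℤ.≟ c' ⌋

LP : Set
LP = List (ℚ × Exp)

e₀ : Exp
e₀ = (+ 0 , + 0 , + 0)

mono : ℚ → Exp → LP
mono c e = (c , e) ∷ []

𝐱^ : Exp → LP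
𝐱^ v = mono ℚ.1ℚ v

0L : LP
0L = []

1L : LP
1L = 𝐱^ e₀

cst : ℤ → LP
cst n = mono (n ℚ./ 1) e₀

infixl 6 _⊕_ _⊖_
infixl 7 _⊗_

_⊕_ : LP → LP → LP
p ⊕ q = p ++ q

⊝ : LP → LP
⊝ = map (λ { (c , e) → (ℚ.- c , e) })

_⊖_ : LP → LP → LP
p ⊖ q = p ⊕ ⊝ q

_⊗_ : LP → LP → LP
p ⊗ q = concatMap (λ { (a , e) → map (λ { (b , f) → (a ℚ.* b , e +ₑ f) }) q }) p

coeff : LP → Exp → ℚ
coeff p e = foldr (λ { (c , f) acc → if f =ₑ e then c ℚ.+ acc else acc }) ℚ.0ℚ p

infix 4 _≈_
_≈_ : LP → LP → Set
p ≈ q = ∀ e → coeff p e ≡ coeff q e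

Integral : LP → Set
Integral p = ∀ e → ℚ.denominatorℕ (coeff p e) ≡ 1

X₁ X₂ X₃ : LP
X₁ = 𝐱^ (+ 1 , + 0 , + 0)
X₂ = 𝐱^ (+ 0 , + 1 , + 0)
X₃ = 𝐱^ (+ 0 , + 0 , + 1)

record M2 : Set where
  constructor mat
  field
    m₁₁ m₁₂ m₂₁ m₂₂ : LP
open M2 public

infixl 6 _-ₘ_
infixl 7 _·ₘ_

_·ₘ_ : M2 → M2 → M2
mat a b c d ·ₘ mat a' b' c' d' =
  mat (a ⊗ a' ⊕ b ⊗ c') (a ⊗ b' ⊕ b ⊗ d') (c ⊗ a' ⊕ d ⊗ c') (c ⊗ b' ⊕ d ⊗ d')

_-ₘ_ : M2 → M2 → M2
mat a b c d -ₘ mat a' b' c' d' = mat (a ⊖ a') (b ⊖ b') (c ⊖ c') (d ⊖ d')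

infix 4 _≈ₘ_
_≈ₘ_ : M2 → M2 → Set
mat a b c d ≈ₘ mat a' b' c' d' = (a ≈ a') × (b ≈ b') × (c ≈ c') × (d ≈ d')

tr : M2 → LP
tr (mat a _ _ d) = a ⊕ d

det : M2 → LP
det (mat a b c d) = a ⊗ d ⊖ b ⊗ c

InSL2 : M2 → Set
InSL2 P = Integral (m₁₁ P) × Integral (m₁₂ P) × Integral (m₂₁ P) × Integral (m₂₂ P)
          × (det P ≈ 1L)

-- Fence posets.  A fence is the list of its elements in chronological
-- order P(1),…,P(h); each entry carries its weight and a flag b saying
-- how it compares with the PREVIOUS element: b = true means
-- P(i-1) > P(i), b = false means P(i-1) < P(i).  The flag of the head
-- is irrelevant.

Fence : Set
Fence = List (Bool × LP)

markUp : Fence → Fence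
markUp [] = []
markUp ((_ , w) ∷ r) = (false , w) ∷ r

-- P ↗ P' : concatenation with the extra relation R_P < L_P'
_↗_ : Fence → Fence → Fence
P ↗ P' = P ++ markUp P'

subsets : ℕ → List (List Bool)
subsets zero = [] ∷ []
subsets (suc n) = map (true ∷_) (subsets n) ++ map (false ∷_) (subsets n)

-- order-ideal test: closure under each covering relation between
-- consecutive elements (the order is generated by these relations)
idealFrom : Bool → Fence → List Bool → Bool
idealFrom prev [] [] = true
idealFrom prev ((b , _) ∷ P) (i ∷ I) =
  (if b then (not prev ∨ i) else (not i ∨ prev)) ∧ idealFrom i P I
idealFrom _ _ _ = false

isIdeal : Fence → List Bool → Bool
isIdeal [] [] = true
isIdeal (_ ∷ P) (i ∷ I) = idealFrom i P I
isIdeal _ _ = false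

wtOf : Fence → List Bool → LP
wtOf ((_ , w) ∷ P) (true ∷ I) = w ⊗ wtOf P I
wtOf (_ ∷ P) (false ∷ I) = wtOf P I
wtOf _ _ = 1L

headB : List Bool → Bool
headB [] = false
headB (b ∷ _) = b

lastB : List Bool → Bool
lastB [] = false
lastB (b ∷ []) = b
lastB (_ ∷ bs) = lastB bs

Wsel : (Bool → Bool → Bool) → Fence → LP
Wsel sel P = foldr (λ I acc → if isIdeal P I ∧ sel (headB I) (lastB I)
                               then wtOf P I ⊕ acc else acc)
                   0L (subsets (length P))

W W[R] W[¬R] W[R,¬L] W[¬R,¬L] : Fence → LP
W = Wsel (λ _ _ → true)
W[R] = Wsel (λ _ r → r)
W[¬R] = Wsel (λ _ r → not r)
W[R,¬L] = Wsel (λ l r → r ∧ not l)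
W[¬R,¬L] = Wsel (λ l r → not r ∧ not l)

-- Geometry of the segment γ from (0,0) to (q,p)

Pt : Set
Pt = ℕ × ℕ

data Lbl : Set where
  ℓ₁ ℓ₂ ℓ₃ : Lbl

record Seg : Set where
  constructor seg
  field
    lbl : Lbl
    A B : Pt
open Seg public

-- f(x,y) = p x − q y : positive exactly to the right of γ
-- (w.r.t. the direction of travel (q,p))
side : ℕ → ℕ → Pt → ℤ
side p q (x , y) = (+ p ℤ.* + x) ℤ.- (+ q ℤ.* + y)

-- coordinate along γ (increasing in the direction of travel)
along : ℕ → ℕ → Pt → ℤ
along p q (x , y) = (+ q ℤ.* + x) ℤ.+ (+ p ℤ.* + y)

cellSegs : ℕ → ℕ → ℕ → ℕ → List Seg
cellSegs p q m n =
  (if m ℕ.<ᵇ q then seg ℓ₃ (m , n) (suc m , n) ∷ [] else [])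
  ++ (if n ℕ.<ᵇ p then seg ℓ₂ (m , n) (m , suc n) ∷ [] else [])
  ++ (if (m ℕ.<ᵇ q) ∧ (n ℕ.<ᵇ p) then seg ℓ₁ (m , suc n) (suc m , n) ∷ [] else [])

allSegs : ℕ → ℕ → List Seg
allSegs p q = concatMap (λ m → concatMap (λ n → cellSegs p q m n) (upTo (suc p))) (upTo (suc q))

crossesᵇ : ℕ → ℕ → Seg → Bool
crossesᵇ p q s = ⌊ (side p q (A s) ℤ.* side p q (B s)) ℤ.<? + 0 ⌋

crossed : ℕ → ℕ → List Seg
crossed p q = foldr (λ s acc → if crossesᵇ p q s then s ∷ acc else acc) [] (allSegs p q)

leftPt rightPt : ℕ → ℕ → Seg → Pt
leftPt p q s = if ⌊ side p q (A s) ℤ.<? + 0 ⌋ then A s else B s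
rightPt p q s = if ⌊ side p q (A s) ℤ.<? + 0 ⌋ then B s else A s

-- position along γ of the crossing point, as the fraction num/den (den > 0)
posNum posDen : ℕ → ℕ → Seg → ℤ
posNum p q s = (along p q (leftPt p q s) ℤ.* side p q (rightPt p q s))
               ℤ.- (side p q (leftPt p q s) ℤ.* along p q (rightPt p q s))
posDen p q s = side p q (rightPt p q s) ℤ.- side p q (leftPt p q s)

beforeᵇ : ℕ → ℕ → Seg → Seg → Bool
beforeᵇ p q s t = ⌊ (posNum p q s ℤ.* posDen p q t) ℤ.≤? (posNum p q t ℤ.* posDen p q s) ⌋

insertSeg : ℕ → ℕ → Seg → List Seg → List Seg
insertSeg p q s [] = s ∷ []
insertSeg p q s (t ∷ ts) = if beforeᵇ p q s t then s ∷ t ∷ ts else t ∷ insertSeg p q s ts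

sortSegs : ℕ → ℕ → List Seg → List Seg
sortSegs p q = foldr (insertSeg p q) []

τs : ℕ → ℕ → List Seg
τs p q = sortSegs p q (crossed p q)

-- γ crosses s strictly closer to its right endpoint: |f(R)| < |f(L)|
closerRightᵇ : ℕ → ℕ → Seg → Bool
closerRightᵇ p q s = ⌊ (side p q (rightPt p q s) ℤ.+ side p q (leftPt p q s)) ℤ.<? + 0 ⌋

_=ₚ_ : Pt → Pt → Bool
(a , b) =ₚ (c , d) = ⌊ a ℕ.≟ c ⌋ ∧ ⌊ b ℕ.≟ d ⌋

sharedRightᵇ : ℕ → ℕ → Seg → Seg → Bool
sharedRightᵇ p q s t = chk (A s) ∨ chk (B s)
  where
  chk : Pt → Bool
  chk P = ((P =ₚ A t) ∨ (P =ₚ B t)) ∧ ⌊ + 0 ℤ.<? side p q P ⌋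

module Setup (k₁ k₂ k₃ : ℕ) where

  kOf : Lbl → ℕ
  kOf ℓ₁ = k₁
  kOf ℓ₂ = k₂
  kOf ℓ₃ = k₃

  hatE : Lbl → Exp
  hatE ℓ₁ = (+ 0 , + 1 , ℤ.- + 1)
  hatE ℓ₂ = (ℤ.- + 1 , + 0 , + 1)
  hatE ℓ₃ = (+ 1 , ℤ.- + 1 , + 0)

  hat² : Lbl → LP
  hat² a = 𝐱^ (hatE a +ₑ hatE a)

  kHat : ℕ → Lbl → LP
  kHat k a = mono (+ k ℚ./ 1) (hatE a)

  hatOverK : (k : ℕ) → .{{_ : ℕ.NonZero k}} → Lbl → LP
  hatOverK k a = mono (+ 1 ℚ./ k) (hatE a)

  group : ℕ → ℕ → Bool → Seg → Fence
  group p q b s with kOf (lbl s)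
  ... | zero = (b , hat² (lbl s)) ∷ []
  ... | suc k = if closerRightᵇ p q s
                then (b , hatOverK (suc k) (lbl s)) ∷ (true , kHat (suc k) (lbl s)) ∷ []
                else (b , kHat (suc k) (lbl s)) ∷ (false , hatOverK (suc k) (lbl s)) ∷ []

  buildFrom : ℕ → ℕ → Seg → List Seg → Fence
  buildFrom p q prev [] = []
  buildFrom p q prev (s ∷ ss) = group p q (sharedRightᵇ p q prev s) s ++ buildFrom p q s ss

  pathFence : ℕ → ℕ → List Seg → Fence
  pathFence p q [] = []
  pathFence p q (s ∷ ss) = group p q false s ++ buildFrom p q s ss

  𝒫 : ℕ → ℕ → Fence
  𝒫 p q = pathFence p q (τs p q)

  -- x_i-elements of the chain H (top to bottom)
  hGroup : Lbl → Fence
  hGroup a with kOf a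
  ... | zero = (true , hat² a) ∷ []
  ... | suc k = (true , hatOverK (suc k) a) ∷ (true , kHat (suc k) a) ∷ []

  H : Fence
  H = hGroup ℓ₃ ++ hGroup ℓ₁ ++ hGroup ℓ₂

  𝒫̃ : ℕ → ℕ → Fence
  𝒫̃ p q = 𝒫 p q ↗ H

  𝒫̃₀ : Fence
  𝒫̃₀ = hGroup ℓ₁ ++ hGroup ℓ₂

  gv g°v : ℕ → ℕ → Exp
  gv p q = ((+ q ℤ.- + p) ℤ.- + 1 , + 1 ℤ.- + q , + p ℤ.+ + 1)
  g°v p q = (+ q ℤ.- + p , ℤ.- + q , + p)

  2g°-g : Exp → Exp → Exp
  2g°-g (a , b , c) (a' , b' , c') =
    ((+ 2 ℤ.* a) ℤ.- a' , (+ 2 ℤ.* b) ℤ.- b' , (+ 2 ℤ.* c) ℤ.- c')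

  Cgen : Exp → Exp → Fence → M2
  Cgen g g° P = mat (𝐱^ g° ⊗ W[R] P) (𝐱^ g ⊗ W[¬R] P)
                    (𝐱^ (2g°-g g° g) ⊗ W[R,¬L] P) (𝐱^ g° ⊗ W[¬R,¬L] P)

  𝓜 : LP
  𝓜 = (X₁ ⊗ X₁ ⊕ X₂ ⊗ X₂ ⊕ X₃ ⊗ X₃ ⊕ cst (+ k₁) ⊗ X₂ ⊗ X₃
        ⊕ cst (+ k₂) ⊗ X₁ ⊗ X₃ ⊕ cst (+ k₃) ⊗ X₁ ⊗ X₂)
      ⊗ 𝐱^ (ℤ.- + 1 , ℤ.- + 1 , ℤ.- + 1)

  C₁₀ : M2
  C₁₀ = mat (X₂ ⊗ 𝓜) X₂ (⊝ (cst (+ k₂) ⊗ 𝓜) ⊖ 𝐱^ (+ 0 , ℤ.- + 1 , + 0)) (⊝ (cst (+ k₂)))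

  -- C_{p/q} for a reduced fraction p/q (p,q coprime, 1/0 allowed)
  C : ℕ → ℕ → M2
  C zero q = Cgen (+ 0 , + 0 , + 1) (+ 1 , ℤ.- + 1 , + 0) 𝒫̃₀
  C (suc p) zero = C₁₀
  C (suc p) (suc q) = Cgen (gv (suc p) (suc q)) (g°v (suc p) (suc q)) (𝒫̃ (suc p) (suc q))

  -- Cluster structure.  Mutation μ₁(a,b,c) = (a',b,c) with
  -- a' = (b²+k₁bc+c²)/a, expressed as a'·a = b²+k₁bc+c².

  data LCluster : LP → LP → LP → Set where
    init : LCluster X₁ X₂ X₃
    μ₁ : ∀ {a b c} → LCluster a b c → (a' : LP) →
         a' ⊗ a ≈ b ⊗ b ⊕ cst (+ k₁) ⊗ b ⊗ c ⊕ c ⊗ c → LCluster a' b c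
    μ₂ : ∀ {a b c} → LCluster a b c → (b' : LP) →
         b' ⊗ b ≈ a ⊗ a ⊕ cst (+ k₂) ⊗ a ⊗ c ⊕ c ⊗ c → LCluster a b' c
    μ₃ : ∀ {a b c} → LCluster a b c → (c' : LP) →
         c' ⊗ c ≈ a ⊗ a ⊕ cst (+ k₃) ⊗ a ⊗ b ⊕ b ⊗ b → LCluster a b c'

  ClusterVarWithParity : LP → ℕ → Set
  ClusterVarWithParity y k =
    Σ LP λ a → Σ LP λ b → Σ LP λ c → LCluster a b c ×
      (((y ≈ a) × (k ≡ k₁)) ⊎ ((y ≈ b) × (k ≡ k₂)) ⊎ ((y ≈ c) × (k ≡ k₃)))

  NonLabeledCluster : LP → LP → LP → Set
  NonLabeledCluster y₁ y₂ y₃ =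
    Σ LP λ a → Σ LP λ b → Σ LP λ c → LCluster a b c ×
      (  ((y₁ ≈ a) × (y₂ ≈ b) × (y₃ ≈ c))
       ⊎ ((y₁ ≈ a) × (y₂ ≈ c) × (y₃ ≈ b))
       ⊎ ((y₁ ≈ b) × (y₂ ≈ a) × (y₃ ≈ c))
       ⊎ ((y₁ ≈ b) × (y₂ ≈ c) × (y₃ ≈ a))
       ⊎ ((y₁ ≈ c) × (y₂ ≈ a) × (y₃ ≈ b))
       ⊎ ((y₁ ≈ c) × (y₂ ≈ b) × (y₃ ≈ a)))

  IsCGC : M2 → Set
  IsCGC P = InSL2 P × Σ ℕ λ k → ClusterVarWithParity (m₁₂ P) k
                                 × (tr P ≈ 𝓜 ⊗ m₁₂ P ⊖ cst (+ k))

  S : M2 → M2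
  S P = mat s 0L (s ⊗ 𝓜) s
    where
    s : LP
    s = 𝓜 ⊗ m₁₂ P ⊖ tr P

  IsCGCTriple : M2 → M2 → M2 → Set
  IsCGCTriple P Q R = IsCGC P × IsCGC Q × IsCGC R
                      × (Q ≈ₘ (P ·ₘ R) -ₘ S Q)
                      × NonLabeledCluster (m₁₂ P) (m₁₂ Q) (m₁₂ R)

-- Vertices (a/b, c/d, e/f) of the Farey tree

data FareyVertex : ℕ → ℕ → ℕ → ℕ → ℕ → ℕ → Set where
  root : FareyVertex 0 1 1 1 1 0
  left : ∀ {a b c d e f} → FareyVertex a b c d e f →
         FareyVertex a b (a ℕ.+ c) (b ℕ.+ d) c d
  right : ∀ {a b c d e f} → FareyVertex a b c d e f →
          FareyVertex c d (c ℕ.+ e) (d ℕ.+ f) e f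

{-# OPTIONS --safe #-}

-- Order ideals of a fence are counted by a product of 2 × 2 transfer matrices.  After dividing
-- the matrix of each crossed segment by its x̂ it lies in SL₂ and, up to the constant matrix A
-- linking consecutive elements, it only depends on the label of the segment and on a flag (which
-- endpoint is closer); flipping the flag transposes it.  On the line x + y = c the segment γ
-- passes just left of the abscissa ⌈c q / (p + q)⌉, which turns the path of γ into an explicit
-- word w(p/q) in these letters, and C_{p/q} = K w(p/q) h d v K⁻¹ for a fixed K, where h, d, v are
-- the three letters of H (with C_{0/1} = K d v K⁻¹ and C_{1/0} = K v⁻¹ h d v K⁻¹).
--
-- For Farey neighbours p/q < r/s with mediant m/n the words of C_{p/q} C_{r/s} and of C_{m/n} have
-- the same letters except for the flag of the middle one, which γ crosses at its midpoint.
-- The word of m/n is a palindrome up to transposition, so it is U X Uᵗ with det U = 1, and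
-- flipping the middle flag adds k J with J = [0 1; −1 0] to X.  Since U J Uᵗ = J, this gives
-- C_{m/n} = C_{p/q} C_{r/s} − k T with T = [1 0; 𝓜 1].  Cayley–Hamilton then propagates det = 1,
-- tr = 𝓜 p₁₂ − k and the generalised Markov equation
-- p² + q² + r² + k_p q r + k_q p r + k_r p q = 𝓜 p q r of the (1,2)-entries down the Farey tree,
-- and Vieta jumping on this equation is cluster mutation.

module Submission where

-- Why the two words almost agree: the letters `h`, `d`, `v` of `H` are what the rule for letters
-- yields formally at an end of γ (the edge arriving there, the end point itself, the edge leaving
-- the next copy of the origin). The product `C_{p/q} C_{r/s}` therefore reads the broken line from
-- the origin through (q,p) to (n,m). The triangle between this line and the segment of m/n has area
-- 1/2 and contains no lattice point besides its corners, so the labels agree. A flag tests the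
-- doubled midpoint of a crossed segment, a lattice point of the triangle twice as large, and there
-- only (n,m), the doubled midpoint of the segment of m/n, gives different flags. Evaluated where γ
-- crosses nothing, the same words give the two base matrices, so the product formula has no special
-- cases.

-- Laurent polynomials as a commutative ring with constants from ℤ.

module LaurentRing where

  open import Defs
  open import Algebra.Bundles using (CommutativeRing; RawRing)
  open import Algebra.Structures using (IsCommutativeRing)
  open import Algebra.Solver.Ring.AlmostCommutativeRing using (AlmostCommutativeRing; fromCommutativeRing; _-Raw-AlmostCommutative⟶_)
  open import Data.Bool using (true; false; if_then_else_)
  open import Data.Integer as ℤ using (ℤ; +_)
  import Data.Integer.Properties as ℤₚ
  open import Data.List using (List; []; _∷_; map)
  import Data.List.Properties as List
  open import Data.List.Relation.Unary.All using (All; []; _∷_)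
  import Data.List.Relation.Unary.All.Properties as All
  open import Data.Nat using (suc)
  open import Data.Product using (_,_)
  open import Data.Rational as ℚ using (ℚ)
  import Data.Rational.Properties as ℚₚ
  import Data.Rational.Unnormalised as ℚᵘ
  import Data.Rational.Unnormalised.Properties as ℚᵘₚ
  open import Level using (0ℓ)
  open import Relation.Binary.PropositionalEquality
  open import Relation.Nullary using (yes; no; contradiction)

  negₑ : Exp → Exp
  negₑ (a , b , c) = (ℤ.- a , ℤ.- b , ℤ.- c)

  triple-≡ : ∀ {a a' b b' c c' : ℤ} → a ≡ a' → b ≡ b' → c ≡ c' → (a , b , c) ≡ (a' , b' , c')
  triple-≡ refl refl refl = refl

  +ₑ-comm : ∀ e f → e +ₑ f ≡ f +ₑ e
  +ₑ-comm (a , b , c) (a' , b' , c') =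
    triple-≡ (ℤₚ.+-comm a a') (ℤₚ.+-comm b b') (ℤₚ.+-comm c c')

  +ₑ-assoc : ∀ e f g → (e +ₑ f) +ₑ g ≡ e +ₑ (f +ₑ g)
  +ₑ-assoc (a , b , c) (a' , b' , c') (a'' , b'' , c'') =
    triple-≡ (ℤₚ.+-assoc a a' a'') (ℤₚ.+-assoc b b' b'') (ℤₚ.+-assoc c c' c'')

  +ₑ-identityˡ : ∀ e → e₀ +ₑ e ≡ e
  +ₑ-identityˡ (a , b , c) =
    triple-≡ (ℤₚ.+-identityˡ a) (ℤₚ.+-identityˡ b) (ℤₚ.+-identityˡ c)

  +ₑ-inverseʳ : ∀ e → e +ₑ negₑ e ≡ e₀
  +ₑ-inverseʳ (a , b , c) =
    triple-≡ (ℤₚ.+-inverseʳ a) (ℤₚ.+-inverseʳ b) (ℤₚ.+-inverseʳ c)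

  =ₑ-sound : ∀ e f → (e =ₑ f) ≡ true → e ≡ f
  =ₑ-sound (a , b , c) (a' , b' , c') h with a ℤ.≟ a' | b ℤ.≟ b' | c ℤ.≟ c'
  =ₑ-sound (a , b , c) (.a , .b , .c) h | yes refl | yes refl | yes refl = refl
  =ₑ-sound _ _ () | yes _ | yes _ | no _
  =ₑ-sound _ _ () | yes _ | no _  | _
  =ₑ-sound _ _ () | no _  | _     | _

  =ₑ-refl : ∀ e → (e =ₑ e) ≡ true
  =ₑ-refl (a , b , c) with a ℤ.≟ a | b ℤ.≟ b | c ℤ.≟ c
  ... | yes _ | yes _ | yes _ = refl
  ... | yes _ | yes _ | no ne = contradiction refl ne
  ... | yes _ | no ne | _     = contradiction refl ne
  ... | no ne | _     | _     = contradiction refl ne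

  =ₑ-transport : ∀ {e f e' f'} → (e ≡ f → e' ≡ f') → (e' ≡ f' → e ≡ f) → (e =ₑ f) ≡ (e' =ₑ f')
  =ₑ-transport {e} {f} {e'} {f'} to from with e =ₑ f in h | e' =ₑ f' in h'
  ... | true  | true  = refl
  ... | false | false = refl
  ... | true  | false =
    contradiction (trans (sym h') (trans (cong (_=ₑ f') (to (=ₑ-sound e f h))) (=ₑ-refl f'))) λ ()
  ... | false | true  =
    contradiction (trans (sym h) (trans (cong (_=ₑ f) (from (=ₑ-sound e' f' h'))) (=ₑ-refl f))) λ ()

  -- Multiplication by a monomial shifts exponents, so a coefficient of a product is read off from
  -- the factor at `e − f`.
  shift-=ₑ : ∀ f g e → ((f +ₑ g) =ₑ e) ≡ (g =ₑ (e +ₑ negₑ f))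
  shift-=ₑ f g e = =ₑ-transport to from
    where
    open ≡-Reasoning
    to : f +ₑ g ≡ e → g ≡ e +ₑ negₑ f
    to refl = sym (begin
      (f +ₑ g) +ₑ negₑ f ≡⟨ cong (_+ₑ negₑ f) (+ₑ-comm f g) ⟩
      (g +ₑ f) +ₑ negₑ f ≡⟨ +ₑ-assoc g f (negₑ f) ⟩
      g +ₑ (f +ₑ negₑ f) ≡⟨ cong (g +ₑ_) (+ₑ-inverseʳ f) ⟩
      g +ₑ e₀            ≡⟨ +ₑ-comm g e₀ ⟩
      e₀ +ₑ g            ≡⟨ +ₑ-identityˡ g ⟩
      g                  ∎)
    from : g ≡ e +ₑ negₑ f → f +ₑ g ≡ e
    from refl = begin
      f +ₑ (e +ₑ negₑ f) ≡⟨ +ₑ-comm f _ ⟩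
      (e +ₑ negₑ f) +ₑ f ≡⟨ +ₑ-assoc e (negₑ f) f ⟩
      e +ₑ (negₑ f +ₑ f) ≡⟨ cong (e +ₑ_) (trans (+ₑ-comm (negₑ f) f) (+ₑ-inverseʳ f)) ⟩
      e +ₑ e₀            ≡⟨ +ₑ-comm e e₀ ⟩
      e₀ +ₑ e            ≡⟨ +ₑ-identityˡ e ⟩
      e                  ∎

  at : ℚ → Exp → Exp → ℚ
  at c f e = if f =ₑ e then c else ℚ.0ℚ

  coeff-∷ : ∀ c f p e → coeff ((c , f) ∷ p) e ≡ at c f e ℚ.+ coeff p e
  coeff-∷ c f p e with f =ₑ e
  ... | true  = refl
  ... | false = sym (ℚₚ.+-identityˡ _)

  coeff-⊕ : ∀ p q e → coeff (p ⊕ q) e ≡ coeff p e ℚ.+ coeff q e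
  coeff-⊕ [] q e = sym (ℚₚ.+-identityˡ _)
  coeff-⊕ ((c , f) ∷ p) q e = begin
    coeff ((c , f) ∷ (p ⊕ q)) e                ≡⟨ coeff-∷ c f (p ⊕ q) e ⟩
    at c f e ℚ.+ coeff (p ⊕ q) e               ≡⟨ cong (at c f e ℚ.+_) (coeff-⊕ p q e) ⟩
    at c f e ℚ.+ (coeff p e ℚ.+ coeff q e)     ≡⟨ ℚₚ.+-assoc (at c f e) _ _ ⟨
    (at c f e ℚ.+ coeff p e) ℚ.+ coeff q e     ≡⟨ cong (ℚ._+ coeff q e) (coeff-∷ c f p e) ⟨
    coeff ((c , f) ∷ p) e ℚ.+ coeff q e        ∎
    where open ≡-Reasoning

  at-neg : ∀ c f e → at (ℚ.- c) f e ≡ ℚ.- at c f e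
  at-neg c f e with f =ₑ e
  ... | true  = refl
  ... | false = refl

  coeff-⊝ : ∀ p e → coeff (⊝ p) e ≡ ℚ.- coeff p e
  coeff-⊝ [] e = refl
  coeff-⊝ ((c , f) ∷ p) e = begin
    coeff ((ℚ.- c , f) ∷ ⊝ p) e              ≡⟨ coeff-∷ (ℚ.- c) f (⊝ p) e ⟩
    at (ℚ.- c) f e ℚ.+ coeff (⊝ p) e         ≡⟨ cong₂ ℚ._+_ (at-neg c f e) (coeff-⊝ p e) ⟩
    ℚ.- at c f e ℚ.+ ℚ.- coeff p e           ≡⟨ ℚₚ.neg-distrib-+ (at c f e) (coeff p e) ⟨
    ℚ.- (at c f e ℚ.+ coeff p e)             ≡⟨ cong ℚ.-_ (coeff-∷ c f p e) ⟨
    ℚ.- coeff ((c , f) ∷ p) e                ∎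
    where open ≡-Reasoning

  scale : ℚ → Exp → LP → LP
  scale a e = map (λ (b , f) → (a ℚ.* b , e +ₑ f))

  at-scale : ∀ a f c g e → at (a ℚ.* c) (f +ₑ g) e ≡ a ℚ.* at c g (e +ₑ negₑ f)
  at-scale a f c g e rewrite shift-=ₑ f g e with g =ₑ (e +ₑ negₑ f)
  ... | true  = refl
  ... | false = sym (ℚₚ.*-zeroʳ a)

  coeff-scale : ∀ a f q e → coeff (scale a f q) e ≡ a ℚ.* coeff q (e +ₑ negₑ f)
  coeff-scale a f [] e = sym (ℚₚ.*-zeroʳ a)
  coeff-scale a f ((c , g) ∷ q) e = begin
    coeff ((a ℚ.* c , f +ₑ g) ∷ scale a f q) e             ≡⟨ coeff-∷ (a ℚ.* c) (f +ₑ g) (scale a f q) e ⟩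
    at (a ℚ.* c) (f +ₑ g) e ℚ.+ coeff (scale a f q) e      ≡⟨ cong₂ ℚ._+_ (at-scale a f c g e) (coeff-scale a f q e) ⟩
    a ℚ.* at c g e' ℚ.+ a ℚ.* coeff q e'                   ≡⟨ ℚₚ.*-distribˡ-+ a _ _ ⟨
    a ℚ.* (at c g e' ℚ.+ coeff q e')                       ≡⟨ cong (a ℚ.*_) (coeff-∷ c g q e') ⟨
    a ℚ.* coeff ((c , g) ∷ q) e'                           ∎
    where
    open ≡-Reasoning
    e' = e +ₑ negₑ f

  coeff-⊗-∷ : ∀ a f p q e →
              coeff (((a , f) ∷ p) ⊗ q) e ≡ a ℚ.* coeff q (e +ₑ negₑ f) ℚ.+ coeff (p ⊗ q) e
  coeff-⊗-∷ a f p q e =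
    trans (coeff-⊕ (scale a f q) (p ⊗ q) e) (cong (ℚ._+ coeff (p ⊗ q) e) (coeff-scale a f q e))

  ⊕-cong : ∀ {p p' q q'} → p ≈ p' → q ≈ q' → p ⊕ q ≈ p' ⊕ q'
  ⊕-cong {p} {p'} {q} {q'} h h' e =
    trans (coeff-⊕ p q e) (trans (cong₂ ℚ._+_ (h e) (h' e)) (sym (coeff-⊕ p' q' e)))

  ⊕-comm : ∀ p q → p ⊕ q ≈ q ⊕ p
  ⊕-comm p q e = trans (coeff-⊕ p q e) (trans (ℚₚ.+-comm (coeff p e) _) (sym (coeff-⊕ q p e)))

  ⊝-cong : ∀ {p q} → p ≈ q → ⊝ p ≈ ⊝ q
  ⊝-cong {p} {q} h e = trans (coeff-⊝ p e) (trans (cong ℚ.-_ (h e)) (sym (coeff-⊝ q e)))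

  ⊝-inverseʳ : ∀ p → p ⊕ ⊝ p ≈ 0L
  ⊝-inverseʳ p e =
    trans (coeff-⊕ p (⊝ p) e) (trans (cong (coeff p e ℚ.+_) (coeff-⊝ p e)) (ℚₚ.+-inverseʳ (coeff p e)))

  ⊗-congʳ : ∀ p {q q'} → q ≈ q' → p ⊗ q ≈ p ⊗ q'
  ⊗-congʳ [] h e = refl
  ⊗-congʳ ((a , f) ∷ p) {q} {q'} h e = begin
    coeff (((a , f) ∷ p) ⊗ q) e                              ≡⟨ coeff-⊗-∷ a f p q e ⟩
    a ℚ.* coeff q (e +ₑ negₑ f) ℚ.+ coeff (p ⊗ q) e          ≡⟨ cong₂ (λ x y → a ℚ.* x ℚ.+ y) (h _) (⊗-congʳ p {q} {q'} h e) ⟩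
    a ℚ.* coeff q' (e +ₑ negₑ f) ℚ.+ coeff (p ⊗ q') e        ≡⟨ coeff-⊗-∷ a f p q' e ⟨
    coeff (((a , f) ∷ p) ⊗ q') e                             ∎
    where open ≡-Reasoning

  ⊗-zeroʳ : ∀ p → p ⊗ [] ≡ []
  ⊗-zeroʳ [] = refl
  ⊗-zeroʳ (_ ∷ p) = ⊗-zeroʳ p

  -- Products of lists unfold on the left factor by definition; the rule for the right factor holds
  -- only up to the order of the terms, and with it commutativity is an induction.
  ⊗-∷ʳ : ∀ q b g p → q ⊗ ((b , g) ∷ p) ≈ scale b g q ⊕ q ⊗ p
  ⊗-∷ʳ [] b g p e = refl
  ⊗-∷ʳ ((a , f) ∷ q) b g p e = begin
    coeff ((a ℚ.* b , f +ₑ g) ∷ (scale a f p ⊕ q ⊗ ((b , g) ∷ p))) e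
      ≡⟨ coeff-∷ (a ℚ.* b) (f +ₑ g) (scale a f p ⊕ q ⊗ ((b , g) ∷ p)) e ⟩
    at (a ℚ.* b) (f +ₑ g) e ℚ.+ coeff (scale a f p ⊕ q ⊗ ((b , g) ∷ p)) e
      ≡⟨ cong₂ ℚ._+_ (cong₂ (λ x y → at x y e) (ℚₚ.*-comm a b) (+ₑ-comm f g))
                     (trans (coeff-⊕ (scale a f p) _ e)
                       (cong (coeff (scale a f p) e ℚ.+_) (trans (⊗-∷ʳ q b g p e) (coeff-⊕ (scale b g q) (q ⊗ p) e)))) ⟩
    at (b ℚ.* a) (g +ₑ f) e ℚ.+ (coeff (scale a f p) e ℚ.+ (coeff (scale b g q) e ℚ.+ coeff (q ⊗ p) e))
      ≡⟨ swap (at (b ℚ.* a) (g +ₑ f) e) (coeff (scale a f p) e) (coeff (scale b g q) e) (coeff (q ⊗ p) e) ⟩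
    (at (b ℚ.* a) (g +ₑ f) e ℚ.+ coeff (scale b g q) e) ℚ.+ (coeff (scale a f p) e ℚ.+ coeff (q ⊗ p) e)
      ≡⟨ cong₂ ℚ._+_ (coeff-∷ (b ℚ.* a) (g +ₑ f) (scale b g q) e) (coeff-⊕ (scale a f p) (q ⊗ p) e) ⟨
    coeff (scale b g ((a , f) ∷ q)) e ℚ.+ coeff (((a , f) ∷ q) ⊗ p) e
      ≡⟨ coeff-⊕ (scale b g ((a , f) ∷ q)) (((a , f) ∷ q) ⊗ p) e ⟨
    coeff (scale b g ((a , f) ∷ q) ⊕ ((a , f) ∷ q) ⊗ p) e ∎
    where
    open ≡-Reasoning
    swap : ∀ x y z w → x ℚ.+ (y ℚ.+ (z ℚ.+ w)) ≡ (x ℚ.+ z) ℚ.+ (y ℚ.+ w)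
    swap x y z w = trans (cong (x ℚ.+_) (trans (sym (ℚₚ.+-assoc y z w))
      (trans (cong (ℚ._+ w) (ℚₚ.+-comm y z)) (ℚₚ.+-assoc z y w)))) (sym (ℚₚ.+-assoc x z (y ℚ.+ w)))

  ⊗-comm : ∀ p q → p ⊗ q ≈ q ⊗ p
  ⊗-comm [] q e = cong (λ r → coeff r e) (sym (⊗-zeroʳ q))
  ⊗-comm ((b , g) ∷ p) q e =
    trans (coeff-⊕ (scale b g q) (p ⊗ q) e)
      (trans (cong (coeff (scale b g q) e ℚ.+_) (⊗-comm p q e))
        (trans (sym (coeff-⊕ (scale b g q) (q ⊗ p) e)) (sym (⊗-∷ʳ q b g p e))))

  ⊗-cong : ∀ {p p' q q'} → p ≈ p' → q ≈ q' → p ⊗ q ≈ p' ⊗ q'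
  ⊗-cong {p} {p'} {q} {q'} h h' e =
    trans (⊗-congʳ p {q} {q'} h' e) (trans (⊗-comm p q' e) (trans (⊗-congʳ q' {p} {p'} h e) (⊗-comm q' p' e)))

  ⊗-distribʳ : ∀ r p q → (p ⊕ q) ⊗ r ≡ p ⊗ r ⊕ q ⊗ r
  ⊗-distribʳ r [] q = refl
  ⊗-distribʳ r ((a , f) ∷ p) q = trans (cong (scale a f r ⊕_) (⊗-distribʳ r p q)) (sym (List.++-assoc (scale a f r) (p ⊗ r) (q ⊗ r)))

  scale-scale : ∀ a f b g r → scale (a ℚ.* b) (f +ₑ g) r ≡ scale a f (scale b g r)
  scale-scale a f b g [] = refl
  scale-scale a f b g ((c , h) ∷ r) =
    cong₂ _∷_ (cong₂ _,_ (ℚₚ.*-assoc a b c) (+ₑ-assoc f g h)) (scale-scale a f b g r)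

  scale-⊗ : ∀ a f q r → scale a f q ⊗ r ≡ scale a f (q ⊗ r)
  scale-⊗ a f [] r = refl
  scale-⊗ a f ((b , g) ∷ q) r = trans (cong₂ _⊕_ (scale-scale a f b g r) (scale-⊗ a f q r))
    (sym (List.map-++ _ (scale b g r) (q ⊗ r)))

  ⊗-assoc : ∀ p q r → (p ⊗ q) ⊗ r ≡ p ⊗ (q ⊗ r)
  ⊗-assoc [] q r = refl
  ⊗-assoc ((a , f) ∷ p) q r = trans (⊗-distribʳ r (scale a f q) (p ⊗ q)) (cong₂ _⊕_ (scale-⊗ a f q r) (⊗-assoc p q r))

  scale-identity : ∀ p → scale ℚ.1ℚ e₀ p ≡ p
  scale-identity [] = refl
  scale-identity ((c , f) ∷ p) = cong₂ _∷_ (cong₂ _,_ (ℚₚ.*-identityˡ c) (+ₑ-identityˡ f)) (scale-identity p)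

  ⊗-identityˡ : ∀ p → 1L ⊗ p ≡ p
  ⊗-identityˡ p = trans (List.++-identityʳ (scale ℚ.1ℚ e₀ p)) (scale-identity p)

  -- A record version of _≈_, so that both sides can be inferred from a proof.
  infix 4 _≋_
  record _≋_ (p q : LP) : Set where
    constructor ⟨_⟩
    field
      coeffs : p ≈ q
  open _≋_ public

  ≡⇒≋ : ∀ {p q} → p ≡ q → p ≋ q
  ≡⇒≋ refl = ⟨ (λ e → refl) ⟩

  LP-ring : CommutativeRing 0ℓ 0ℓ
  LP-ring = record
    { Carrier = LP ; _≈_ = _≋_ ; _+_ = _⊕_ ; _*_ = _⊗_ ; -_ = ⊝ ; 0# = 0L ; 1# = 1L
    ; isCommutativeRing = record
      { isRing = record
        { +-isAbelianGroup = record
          { isGroup = record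
            { isMonoid = record
              { isSemigroup = record
                { isMagma = record
                  { isEquivalence = record
                    { refl = ≡⇒≋ refl
                    ; sym = λ h → ⟨ (λ e → sym (coeffs h e)) ⟩
                    ; trans = λ h h' → ⟨ (λ e → trans (coeffs h e) (coeffs h' e)) ⟩ }
                  ; ∙-cong = λ {p} {p'} {q} {q'} h h' → ⟨ ⊕-cong {p} {p'} {q} {q'} (coeffs h) (coeffs h') ⟩ }
                ; assoc = λ p q r → ≡⇒≋ (List.++-assoc p q r) }
              ; identity = (λ p → ≡⇒≋ refl) , (λ p → ≡⇒≋ (List.++-identityʳ p)) }
            ; inverse = (λ p → ⟨ (λ e → trans (⊕-comm (⊝ p) p e) (⊝-inverseʳ p e)) ⟩) , (λ p → ⟨ ⊝-inverseʳ p ⟩)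
            ; ⁻¹-cong = λ {p} {q} h → ⟨ ⊝-cong {p} {q} (coeffs h) ⟩ }
          ; comm = λ p q → ⟨ ⊕-comm p q ⟩ }
        ; *-cong = λ {p} {p'} {q} {q'} h h' → ⟨ ⊗-cong {p} {p'} {q} {q'} (coeffs h) (coeffs h') ⟩
        ; *-assoc = λ p q r → ≡⇒≋ (⊗-assoc p q r)
        ; *-identity = (λ p → ≡⇒≋ (⊗-identityˡ p))
                     , (λ p → ⟨ (λ e → trans (⊗-comm p 1L e) (cong (λ r → coeff r e) (⊗-identityˡ p))) ⟩)
        ; distrib = (λ r p q → ⟨ ⊗-distribˡ r p q ⟩) , (λ r p q → ≡⇒≋ (⊗-distribʳ r p q)) }
      ; *-comm = λ p q → ⟨ ⊗-comm p q ⟩ } }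
    where
    ⊗-distribˡ : ∀ r p q → r ⊗ (p ⊕ q) ≈ r ⊗ p ⊕ r ⊗ q
    ⊗-distribˡ r p q e =
      trans (⊗-comm r (p ⊕ q) e)
        (trans (cong (λ s → coeff s e) (⊗-distribʳ r p q))
          (⊕-cong {p ⊗ r} {r ⊗ p} {q ⊗ r} {r ⊗ q} (⊗-comm p r) (⊗-comm q r) e))

  -- `n ℚ./ 1` is normalised by a gcd that does not reduce for a variable `n`. Identities about it
  -- are therefore checked among unnormalised rationals, where cross-multiplication is enough.
  toℚᵘ-/1 : ∀ n → ℚ.toℚᵘ (n ℚ./ 1) ℚᵘ.≃ ℚᵘ.mkℚᵘ n 0
  toℚᵘ-/1 n = ℚₚ.toℚᵘ-fromℚᵘ (ℚᵘ.mkℚᵘ n 0)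

  /1-+ : ∀ m n → (m ℤ.+ n) ℚ./ 1 ≡ m ℚ./ 1 ℚ.+ n ℚ./ 1
  /1-+ m n = ℚₚ.toℚᵘ-injective (begin
    ℚ.toℚᵘ ((m ℤ.+ n) ℚ./ 1)                          ≈⟨ toℚᵘ-/1 (m ℤ.+ n) ⟩
    ℚᵘ.mkℚᵘ (m ℤ.+ n) 0                               ≈⟨ ℚᵘ.*≡* (cong (ℤ._* + 1) (cong₂ ℤ._+_ (sym (ℤₚ.*-identityʳ m)) (sym (ℤₚ.*-identityʳ n)))) ⟩
    ℚᵘ.mkℚᵘ m 0 ℚᵘ.+ ℚᵘ.mkℚᵘ n 0                      ≈⟨ ℚᵘₚ.+-cong (toℚᵘ-/1 m) (toℚᵘ-/1 n) ⟨
    ℚ.toℚᵘ (m ℚ./ 1) ℚᵘ.+ ℚ.toℚᵘ (n ℚ./ 1)            ≈⟨ ℚₚ.toℚᵘ-homo-+ (m ℚ./ 1) (n ℚ./ 1) ⟨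
    ℚ.toℚᵘ (m ℚ./ 1 ℚ.+ n ℚ./ 1)                      ∎)
    where open import Relation.Binary.Reasoning.Setoid ℚᵘₚ.≃-setoid

  /1-* : ∀ m n → (m ℤ.* n) ℚ./ 1 ≡ (m ℚ./ 1) ℚ.* (n ℚ./ 1)
  /1-* m n = ℚₚ.toℚᵘ-injective (begin
    ℚ.toℚᵘ ((m ℤ.* n) ℚ./ 1)                          ≈⟨ toℚᵘ-/1 (m ℤ.* n) ⟩
    ℚᵘ.mkℚᵘ (m ℤ.* n) 0                               ≈⟨ ℚᵘ.*≡* refl ⟩
    ℚᵘ.mkℚᵘ m 0 ℚᵘ.* ℚᵘ.mkℚᵘ n 0                      ≈⟨ ℚᵘₚ.*-cong (toℚᵘ-/1 m) (toℚᵘ-/1 n) ⟨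
    ℚ.toℚᵘ (m ℚ./ 1) ℚᵘ.* ℚ.toℚᵘ (n ℚ./ 1)            ≈⟨ ℚₚ.toℚᵘ-homo-* (m ℚ./ 1) (n ℚ./ 1) ⟨
    ℚ.toℚᵘ ((m ℚ./ 1) ℚ.* (n ℚ./ 1))                      ∎)
    where open import Relation.Binary.Reasoning.Setoid ℚᵘₚ.≃-setoid

  /1-neg : ∀ m → (ℤ.- m) ℚ./ 1 ≡ ℚ.- (m ℚ./ 1)
  /1-neg m = ℚₚ.toℚᵘ-injective (begin
    ℚ.toℚᵘ ((ℤ.- m) ℚ./ 1)      ≈⟨ toℚᵘ-/1 (ℤ.- m) ⟩
    ℚᵘ.- ℚᵘ.mkℚᵘ m 0            ≈⟨ ℚᵘₚ.-‿cong (toℚᵘ-/1 m) ⟨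
    ℚᵘ.- ℚ.toℚᵘ (m ℚ./ 1)       ≈⟨ ℚₚ.toℚᵘ-homo‿- (m ℚ./ 1) ⟨
    ℚ.toℚᵘ (ℚ.- (m ℚ./ 1))      ∎)
    where open import Relation.Binary.Reasoning.Setoid ℚᵘₚ.≃-setoid

  -- The factors `k` and `1/k` in the weights of a two-element group cancel, so every group has
  -- total weight `x̂²`.
  k*1/k : ∀ k → (+ suc k ℚ./ 1) ℚ.* (+ 1 ℚ./ suc k) ≡ ℚ.1ℚ
  k*1/k k = ℚₚ.toℚᵘ-injective (begin
    ℚ.toℚᵘ ((+ suc k ℚ./ 1) ℚ.* (+ 1 ℚ./ suc k))             ≈⟨ ℚₚ.toℚᵘ-homo-* (+ suc k ℚ./ 1) (+ 1 ℚ./ suc k) ⟩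
    ℚ.toℚᵘ (+ suc k ℚ./ 1) ℚᵘ.* ℚ.toℚᵘ (+ 1 ℚ./ suc k)     ≈⟨ ℚᵘₚ.*-cong (toℚᵘ-/1 (+ suc k)) (ℚₚ.toℚᵘ-fromℚᵘ (ℚᵘ.mkℚᵘ (+ 1) k)) ⟩
    ℚᵘ.mkℚᵘ (+ suc k) 0 ℚᵘ.* ℚᵘ.mkℚᵘ (+ 1) k               ≈⟨ ℚᵘ.*≡* (trans (ℤₚ.*-identityʳ _) (trans (ℤₚ.*-identityʳ (+ suc k)) (sym (trans (ℤₚ.*-identityˡ _) (cong +_ (ℕₚ.+-identityʳ (suc k))))))) ⟩
    ℚᵘ.1ℚᵘ                                                 ∎)
    where
    open import Relation.Binary.Reasoning.Setoid ℚᵘₚ.≃-setoid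
    import Data.Nat.Properties as ℕₚ

  mono-⊕ : ∀ a b e → mono (a ℚ.+ b) e ≈ mono a e ⊕ mono b e
  mono-⊕ a b e f with e =ₑ f
  ... | true  = ℚₚ.+-assoc a b ℚ.0ℚ
  ... | false = refl


  -- Copies of the ring operations that do not unfold: conversion checking of matrix
  -- entries would otherwise compute with lists of monomials.
  infixl 6 _⊞_
  infixl 7 _⊠_
  opaque
    _⊞_ _⊠_ : LP → LP → LP
    _⊞_ = _⊕_
    _⊠_ = _⊗_

    ⊟ : LP → LP
    ⊟ = ⊝

  opaque
    unfolding _⊞_ _⊠_ ⊟

    ⊞-⊠-isCommutativeRing : IsCommutativeRing _≋_ _⊞_ _⊠_ ⊟ 0L 1L
    ⊞-⊠-isCommutativeRing = CommutativeRing.isCommutativeRing LP-ring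

    cst-+ : ∀ m n → cst (m ℤ.+ n) ≋ cst m ⊞ cst n
    cst-+ m n = ⟨ (λ e → trans (cong (λ c → coeff (mono c e₀) e) (/1-+ m n)) (mono-⊕ (m ℚ./ 1) (n ℚ./ 1) e₀ e)) ⟩

    cst-* : ∀ m n → cst (m ℤ.* n) ≋ cst m ⊠ cst n
    cst-* m n = ≡⇒≋ (cong (λ c → mono c e₀) (/1-* m n))

    cst-neg : ∀ m → cst (ℤ.- m) ≋ ⊟ (cst m)
    cst-neg m = ≡⇒≋ (cong (λ c → mono c e₀) (/1-neg m))

  LP-almostRing : AlmostCommutativeRing 0ℓ 0ℓ
  LP-almostRing = fromCommutativeRing (record { isCommutativeRing = ⊞-⊠-isCommutativeRing })

  ℤ-rawRing : RawRing 0ℓ 0ℓ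
  ℤ-rawRing = AlmostCommutativeRing.rawRing (fromCommutativeRing ℤₚ.+-*-commutativeRing)

  -- The ring solver must compare coefficients. Integers have decidable equality, whereas `_≋_`
  -- quantifies over all exponents.
  cst-homo : ℤ-rawRing -Raw-AlmostCommutative⟶ LP-almostRing
  cst-homo = record
    { ⟦_⟧ = cst
    ; +-homo = cst-+
    ; *-homo = cst-*
    ; -‿homo = cst-neg
    -- `cst (+ 0)` is a one-term list with coefficient 0; it equals `0L` coefficientwise but not as
    -- a list.
    ; 0-homo = ⟨ zero-coeff ⟩
    ; 1-homo = ≡⇒≋ refl
    }
    where
    zero-coeff : ∀ e → coeff (cst (+ 0)) e ≡ ℚ.0ℚ
    zero-coeff e with e₀ =ₑ e
    ... | true  = refl
    ... | false = refl

-- Matrices of letters, and the algebra that passes CGC triples to their children.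

module MatrixAlgebra where

  open import Defs using (Lbl; ℓ₁; ℓ₂; ℓ₃)
  open LaurentRing
  open import Algebra.Solver.Ring.AlmostCommutativeRing using (AlmostCommutativeRing; _-Raw-AlmostCommutative⟶_)
  open import Data.Bool using (Bool; true; false; not)
  open import Data.Integer as ℤ using (ℤ; +_)
  open import Data.List using (List; []; _∷_; _++_)
  open import Data.Maybe using (Maybe; just; nothing)
  open import Data.Product using (_×_; _,_)
  open import Level using (0ℓ)
  open import Relation.Binary.Bundles using (Setoid)
  import Relation.Binary.PropositionalEquality as ≡
  open import Relation.Nullary using (yes; no)

  Letter : Set
  Letter = Lbl × Bool

  flip : Letter → Letter
  flip (ℓ , b) = ℓ , not b

  -- The operation on words that `word` turns into transposition.
  mirror : List Letter → List Letter
  mirror [] = []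
  mirror (l ∷ w) = mirror w ++ flip l ∷ []

  -- Over an arbitrary ring the entries stay variables, so no identity below is checked by computing
  -- with Laurent polynomials.
  module Matrices (R : AlmostCommutativeRing 0ℓ 0ℓ) (φ : ℤ-rawRing -Raw-AlmostCommutative⟶ R) where

    open AlmostCommutativeRing R public
    open _-Raw-AlmostCommutative⟶_ φ renaming (⟦_⟧ to constant) using ()

    constant-≟ : ∀ m n → Maybe (constant m ≈ constant n)
    constant-≟ m n with m ℤ.≟ n
    ... | yes ≡.refl = just refl
    ... | no _       = nothing

    open import Algebra.Solver.Ring ℤ-rawRing R φ constant-≟ public using (solve; _:=_; _:+_; _:*_; :-_; con; Polynomial)

    record Mat : Set where
      constructor mk
      field
        e₁₁ e₁₂ e₂₁ e₂₂ : Carrier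

    infix 4 _≈ᴹ_
    record _≈ᴹ_ (X Y : Mat) : Set where
      constructor entries
      private
        module X = Mat X
        module Y = Mat Y
      field
        ≈₁₁ : X.e₁₁ ≈ Y.e₁₁
        ≈₁₂ : X.e₁₂ ≈ Y.e₁₂
        ≈₂₁ : X.e₂₁ ≈ Y.e₂₁
        ≈₂₂ : X.e₂₂ ≈ Y.e₂₂
    open _≈ᴹ_ public

    Mat-setoid : Setoid 0ℓ 0ℓ
    Mat-setoid = record
      { Carrier = Mat ; _≈_ = _≈ᴹ_
      ; isEquivalence = record
        { refl = entries refl refl refl refl
        ; sym = λ (entries a b c d) → entries (sym a) (sym b) (sym c) (sym d)
        ; trans = λ (entries a b c d) (entries a' b' c' d') →
            entries (trans a a') (trans b b') (trans c c') (trans d d') } }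

    open Setoid Mat-setoid public using ()
      renaming (refl to ≈ᴹ-refl; sym to ≈ᴹ-sym; trans to ≈ᴹ-trans; reflexive to ≈ᴹ-reflexive)

    infixl 7 _·_
    _·_ : Mat → Mat → Mat
    mk a b c d · mk a' b' c' d' =
      mk (a * a' + b * c') (a * b' + b * d') (c * a' + d * c') (c * b' + d * d')

    infixl 6 _+ᴹ_
    _+ᴹ_ : Mat → Mat → Mat
    mk a b c d +ᴹ mk a' b' c' d' = mk (a + a') (b + b') (c + c') (d + d')

    infixr 8 _∙_
    _∙_ : Carrier → Mat → Mat
    s ∙ mk a b c d = mk (s * a) (s * b) (s * c) (s * d)

    -- Images of integers, so that they are literally the solver's `con (+ 0)` and `con (+ 1)`; `𝟘`
    -- is equal to the ring's `0#` only up to `_≈_`.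
    𝟘 𝟙 : Carrier
    𝟘 = constant (+ 0)
    𝟙 = constant (+ 1)

    I J 𝔸 𝔹 : Mat
    I = mk 𝟙 𝟘 𝟘 𝟙
    J = mk 𝟘 𝟙 (- 𝟙) 𝟘
    𝔸 = mk 𝟙 𝟙 𝟘 𝟙
    𝔹 = mk 𝟙 𝟘 𝟙 𝟙

    -- Rows stand for the previous element being in or out of an ideal, columns for the current one;
    -- an entry is 1 when the covering relation allows the pair.
    link : Bool → Mat
    link true  = 𝔹
    link false = 𝔸

    _ᵗ adj : Mat → Mat
    mk a b c d ᵗ = mk a c b d
    adj (mk a b c d) = mk d (- b) (- c) a

    detᴹ : Mat → Carrier
    detᴹ (mk a b c d) = a * d + - (b * c)

    ·-cong : ∀ {X X' Y Y'} → X ≈ᴹ X' → Y ≈ᴹ Y' → X · Y ≈ᴹ X' · Y'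
    ·-cong (entries a b c d) (entries a' b' c' d') = entries
      (+-cong (*-cong a a') (*-cong b c')) (+-cong (*-cong a b') (*-cong b d'))
      (+-cong (*-cong c a') (*-cong d c')) (+-cong (*-cong c b') (*-cong d d'))

    ·-congˡ : ∀ {X Y Y'} → Y ≈ᴹ Y' → X · Y ≈ᴹ X · Y'
    ·-congˡ = ·-cong ≈ᴹ-refl

    ·-congʳ : ∀ {X X' Y} → X ≈ᴹ X' → X · Y ≈ᴹ X' · Y
    ·-congʳ h = ·-cong h ≈ᴹ-refl

    +ᴹ-cong : ∀ {X X' Y Y'} → X ≈ᴹ X' → Y ≈ᴹ Y' → X +ᴹ Y ≈ᴹ X' +ᴹ Y'
    +ᴹ-cong (entries a b c d) (entries a' b' c' d') =
      entries (+-cong a a') (+-cong b b') (+-cong c c') (+-cong d d')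

    ∙-cong : ∀ {s s' X X'} → s ≈ s' → X ≈ᴹ X' → s ∙ X ≈ᴹ s' ∙ X'
    ∙-cong h (entries a b c d) = entries (*-cong h a) (*-cong h b) (*-cong h c) (*-cong h d)

    private
      assoc-entry : ∀ p q a b c d r s →
        (p * a + q * c) * r + (p * b + q * d) * s ≈ p * (a * r + b * s) + q * (c * r + d * s)
      assoc-entry = solve 8 (λ p q a b c d r s →
        (p :* a :+ q :* c) :* r :+ (p :* b :+ q :* d) :* s :=
        p :* (a :* r :+ b :* s) :+ q :* (c :* r :+ d :* s)) refl

    ·-assoc : ∀ X Y Z → (X · Y) · Z ≈ᴹ X · (Y · Z)
    ·-assoc (mk p q p' q') (mk a b c d) (mk r r' s s') = entries
      (assoc-entry p q a b c d r s) (assoc-entry p q a b c d r' s')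
      (assoc-entry p' q' a b c d r s) (assoc-entry p' q' a b c d r' s')

    ·-identityˡ : ∀ X → I · X ≈ᴹ X
    ·-identityˡ (mk a b c d) = entries (first a c) (first b d) (second a c) (second b d)
      where
      first : ∀ x y → 𝟙 * x + 𝟘 * y ≈ x
      first = solve 2 (λ x y → con (+ 1) :* x :+ con (+ 0) :* y := x) refl
      second : ∀ x y → 𝟘 * x + 𝟙 * y ≈ y
      second = solve 2 (λ x y → con (+ 0) :* x :+ con (+ 1) :* y := y) refl

    ·-identityʳ : ∀ X → X · I ≈ᴹ X
    ·-identityʳ (mk a b c d) = entries (first a b) (second a b) (first c d) (second c d)
      where
      first : ∀ x y → x * 𝟙 + y * 𝟘 ≈ x
      first = solve 2 (λ x y → x :* con (+ 1) :+ y :* con (+ 0) := x) refl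
      second : ∀ x y → x * 𝟘 + y * 𝟙 ≈ y
      second = solve 2 (λ x y → x :* con (+ 0) :+ y :* con (+ 1) := y) refl

    ·-distribʳ : ∀ X Y Z → (X +ᴹ Y) · Z ≈ᴹ X · Z +ᴹ Y · Z
    ·-distribʳ (mk a b c d) (mk a' b' c' d') (mk r r' s s') = entries
      (entry a b a' b' r s) (entry a b a' b' r' s') (entry c d c' d' r s) (entry c d c' d' r' s')
      where
      entry : ∀ a b a' b' r s → (a + a') * r + (b + b') * s ≈ (a * r + b * s) + (a' * r + b' * s)
      entry = solve 6 (λ a b a' b' r s →
        (a :+ a') :* r :+ (b :+ b') :* s := (a :* r :+ b :* s) :+ (a' :* r :+ b' :* s)) refl

    ·-distribˡ : ∀ X Y Z → X · (Y +ᴹ Z) ≈ᴹ X · Y +ᴹ X · Z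
    ·-distribˡ (mk r r' s s') (mk a b c d) (mk a' b' c' d') = entries
      (entry a c a' c' r r') (entry b d b' d' r r') (entry a c a' c' s s') (entry b d b' d' s s')
      where
      entry : ∀ a b a' b' r s → r * (a + a') + s * (b + b') ≈ (r * a + s * b) + (r * a' + s * b')
      entry = solve 6 (λ a b a' b' r s →
        r :* (a :+ a') :+ s :* (b :+ b') := (r :* a :+ s :* b) :+ (r :* a' :+ s :* b')) refl

    ∙-·ˡ : ∀ s X Y → (s ∙ X) · Y ≈ᴹ s ∙ (X · Y)
    ∙-·ˡ s (mk a b c d) (mk r r' t t') = entries
      (entry s a b r t) (entry s a b r' t') (entry s c d r t) (entry s c d r' t')
      where
      entry : ∀ s a b r t → (s * a) * r + (s * b) * t ≈ s * (a * r + b * t)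
      entry = solve 5 (λ s a b r t → (s :* a) :* r :+ (s :* b) :* t := s :* (a :* r :+ b :* t)) refl

    ∙-·ʳ : ∀ s X Y → X · (s ∙ Y) ≈ᴹ s ∙ (X · Y)
    ∙-·ʳ s (mk r r' t t') (mk a b c d) = entries
      (entry s a c r r') (entry s b d r r') (entry s a c t t') (entry s b d t t')
      where
      entry : ∀ s a b r t → r * (s * a) + t * (s * b) ≈ s * (r * a + t * b)
      entry = solve 5 (λ s a b r t → r :* (s :* a) :+ t :* (s :* b) := s :* (r :* a :+ t :* b)) refl

    ∙-∙ : ∀ s t X → s ∙ t ∙ X ≈ᴹ (s * t) ∙ X
    ∙-∙ s t (mk a b c d) = entries (sym (*-assoc s t a)) (sym (*-assoc s t b)) (sym (*-assoc s t c)) (sym (*-assoc s t d))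

    ∙-identity : ∀ X → 𝟙 ∙ X ≈ᴹ X
    ∙-identity (mk a b c d) = entries (one a) (one b) (one c) (one d)
      where
      one : ∀ x → 𝟙 * x ≈ x
      one = solve 1 (λ x → con (+ 1) :* x := x) refl

    ᵗ-· : ∀ X Y → (X · Y) ᵗ ≈ᴹ Y ᵗ · X ᵗ
    ᵗ-· (mk a b c d) (mk a' b' c' d') = entries
      (entry a b a' c') (entry c d a' c') (entry a b b' d') (entry c d b' d')
      where
      entry : ∀ x y z w → x * z + y * w ≈ z * x + w * y
      entry x y z w = +-cong (*-comm x z) (*-comm y w)

    det-cong : ∀ {X Y} → X ≈ᴹ Y → detᴹ X ≈ detᴹ Y
    det-cong (entries a b c d) = +-cong (*-cong a d) (-‿cong (*-cong b c))

    det-· : ∀ X Y → detᴹ (X · Y) ≈ detᴹ X * detᴹ Y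
    det-· (mk a b c d) (mk a' b' c' d') = solve 8 (λ a b c d a' b' c' d' →
      (a :* a' :+ b :* c') :* (c :* b' :+ d :* d') :+ :- ((a :* b' :+ b :* d') :* (c :* a' :+ d :* c')) :=
      (a :* d :+ :- (b :* c)) :* (a' :* d' :+ :- (b' :* c'))) refl a b c d a' b' c' d'


    private
      :0 :1 : ∀ {n} → Polynomial n
      :0 = con (+ 0)
      :1 = con (+ 1)

    -- J represents the determinant form, so it is preserved by congruence with U ∈ SL₂.
    J-congruence : ∀ U → detᴹ U ≈ 𝟙 → U · J · U ᵗ ≈ᴹ J
    J-congruence (mk a b c d) h = entries
      (solve 2 (λ a b → (a :* :0 :+ b :* :- :1) :* a :+ (a :* :1 :+ b :* :0) :* b := :0) refl a b)
      (trans (solve 4 (λ a b c d → (a :* :0 :+ b :* :- :1) :* c :+ (a :* :1 :+ b :* :0) :* d :=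
                                   a :* d :+ :- (b :* c)) refl a b c d) h)
      (trans (solve 4 (λ a b c d → (c :* :0 :+ d :* :- :1) :* a :+ (c :* :1 :+ d :* :0) :* b :=
                                   :- (a :* d :+ :- (b :* c))) refl a b c d) (-‿cong h))
      (solve 2 (λ c d → (c :* :0 :+ d :* :- :1) :* c :+ (c :* :1 :+ d :* :0) :* d := :0) refl c d)

    module Letters (x x⁻¹ k : Lbl → Carrier) where

      -- true: the first of the two elements is the greater one
      crossing : Lbl → Bool → Mat
      crossing ℓ true  = mk (x ℓ) 𝟘 (k ℓ) (x⁻¹ ℓ)
      crossing ℓ false = mk (x ℓ) (k ℓ) 𝟘 (x⁻¹ ℓ)

      -- Edges and diagonals alternate along γ. Each edge absorbs the links to both neighbouring
      -- diagonals, so that no link remains between letters.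
      letter : Letter → Mat
      letter (ℓ₁ , b) = crossing ℓ₁ b
      letter (ℓ₂ , b) = 𝔹 · crossing ℓ₂ b · 𝔸
      letter (ℓ₃ , b) = 𝔸 · crossing ℓ₃ b · 𝔹

      word : List Letter → Mat
      word [] = I
      word (l ∷ w) = letter l · word w

      word-++ : ∀ u w → word (u ++ w) ≈ᴹ word u · word w
      word-++ [] w = ≈ᴹ-sym (·-identityˡ (word w))
      word-++ (l ∷ u) w = ≈ᴹ-trans (·-congˡ (word-++ u w)) (≈ᴹ-sym (·-assoc (letter l) (word u) (word w)))

      crossing-flip : ∀ ℓ b → crossing ℓ (not b) ≈ᴹ crossing ℓ b ᵗ
      crossing-flip ℓ true  = ≈ᴹ-refl
      crossing-flip ℓ false = ≈ᴹ-refl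

      ᵗ-triple : ∀ X Y Z → (X · Y · Z) ᵗ ≈ᴹ Z ᵗ · Y ᵗ · X ᵗ
      ᵗ-triple X Y Z = ≈ᴹ-trans (ᵗ-· (X · Y) Z)
        (≈ᴹ-trans (·-congˡ (ᵗ-· X Y)) (≈ᴹ-sym (·-assoc (Z ᵗ) (Y ᵗ) (X ᵗ))))

      letter-flip : ∀ l → letter (flip l) ≈ᴹ letter l ᵗ
      letter-flip (ℓ₁ , b) = crossing-flip ℓ₁ b
      letter-flip (ℓ₂ , b) = ≈ᴹ-trans (·-congʳ (·-congˡ (crossing-flip ℓ₂ b))) (≈ᴹ-sym (ᵗ-triple 𝔹 (crossing ℓ₂ b) 𝔸))
      letter-flip (ℓ₃ , b) = ≈ᴹ-trans (·-congʳ (·-congˡ (crossing-flip ℓ₃ b))) (≈ᴹ-sym (ᵗ-triple 𝔸 (crossing ℓ₃ b) 𝔹))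

      module _ (inverse : ∀ ℓ → x ℓ * x⁻¹ ℓ ≈ 𝟙) where

        det-crossing : ∀ ℓ b → detᴹ (crossing ℓ b) ≈ 𝟙
        det-crossing ℓ true = trans
          (solve 3 (λ x y k → x :* y :+ :- (:0 :* k) := x :* y) refl (x ℓ) (x⁻¹ ℓ) (k ℓ)) (inverse ℓ)
        det-crossing ℓ false = trans
          (solve 3 (λ x y k → x :* y :+ :- (k :* :0) := x :* y) refl (x ℓ) (x⁻¹ ℓ) (k ℓ)) (inverse ℓ)

        det-·-𝟙 : ∀ X Y → detᴹ X ≈ 𝟙 → detᴹ Y ≈ 𝟙 → detᴹ (X · Y) ≈ 𝟙
        det-·-𝟙 X Y hX hY = trans (det-· X Y)
          (trans (*-cong hX hY) (solve 0 (:1 :* :1 := :1) refl))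

        det-𝔸 : detᴹ 𝔸 ≈ 𝟙
        det-𝔸 = solve 0 (:1 :* :1 :+ :- (:1 :* :0) := :1) refl

        det-𝔹 : detᴹ 𝔹 ≈ 𝟙
        det-𝔹 = solve 0 (:1 :* :1 :+ :- (:0 :* :1) := :1) refl

        det-letter : ∀ l → detᴹ (letter l) ≈ 𝟙
        det-letter (ℓ₁ , b) = det-crossing ℓ₁ b
        det-letter (ℓ₂ , b) = det-·-𝟙 (𝔹 · crossing ℓ₂ b) 𝔸 (det-·-𝟙 𝔹 (crossing ℓ₂ b) det-𝔹 (det-crossing ℓ₂ b)) det-𝔸
        det-letter (ℓ₃ , b) = det-·-𝟙 (𝔸 · crossing ℓ₃ b) 𝔹 (det-·-𝟙 𝔸 (crossing ℓ₃ b) det-𝔸 (det-crossing ℓ₃ b)) det-𝔹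

        det-word : ∀ w → detᴹ (word w) ≈ 𝟙
        det-word [] = solve 0 (:1 :* :1 :+ :- (:0 :* :0) := :1) refl
        det-word (l ∷ w) = det-·-𝟙 (letter l) (word w) (det-letter l) (det-word w)

        word-mirror : ∀ w → word (mirror w) ≈ᴹ word w ᵗ
        word-mirror [] = ≈ᴹ-refl
        word-mirror (l ∷ w) = ≈ᴹ-trans (word-++ (mirror w) (flip l ∷ []))
          (≈ᴹ-trans (·-cong (word-mirror w) (≈ᴹ-trans (·-identityʳ (letter (flip l))) (letter-flip l)))
                    (≈ᴹ-sym (ᵗ-· (letter l) (word w))))

        crossing-J : ∀ ℓ → crossing ℓ false ≈ᴹ crossing ℓ true +ᴹ k ℓ ∙ J
        crossing-J ℓ = entries
          (solve 2 (λ x k → x := x :+ k :* :0) refl (x ℓ) (k ℓ))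
          (solve 1 (λ k → k := :0 :+ k :* :1) refl (k ℓ))
          (solve 1 (λ k → :0 := k :+ k :* :- :1) refl (k ℓ))
          (solve 2 (λ x k → x := x :+ k :* :0) refl (x⁻¹ ℓ) (k ℓ))

        congruence-+J : ∀ U Y s → detᴹ U ≈ 𝟙 → U · (Y +ᴹ s ∙ J) · U ᵗ ≈ᴹ U · Y · U ᵗ +ᴹ s ∙ J
        congruence-+J U Y s h = begin
          U · (Y +ᴹ s ∙ J) · U ᵗ                  ≈⟨ ·-congʳ (·-distribˡ U Y (s ∙ J)) ⟩
          (U · Y +ᴹ U · (s ∙ J)) · U ᵗ            ≈⟨ ·-distribʳ (U · Y) (U · (s ∙ J)) (U ᵗ) ⟩
          U · Y · U ᵗ +ᴹ U · (s ∙ J) · U ᵗ        ≈⟨ +ᴹ-cong ≈ᴹ-refl (·-congʳ (∙-·ʳ s U J)) ⟩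
          U · Y · U ᵗ +ᴹ (s ∙ (U · J)) · U ᵗ      ≈⟨ +ᴹ-cong ≈ᴹ-refl (∙-·ˡ s (U · J) (U ᵗ)) ⟩
          U · Y · U ᵗ +ᴹ s ∙ (U · J · U ᵗ)        ≈⟨ +ᴹ-cong ≈ᴹ-refl (∙-cong refl (J-congruence U h)) ⟩
          U · Y · U ᵗ +ᴹ s ∙ J                    ∎
          where open import Relation.Binary.Reasoning.Setoid Mat-setoid

        letter-J : ∀ ℓ → letter (ℓ , false) ≈ᴹ letter (ℓ , true) +ᴹ k ℓ ∙ J
        letter-J ℓ₁ = crossing-J ℓ₁
        letter-J ℓ₂ = ≈ᴹ-trans (·-congʳ (·-congˡ (crossing-J ℓ₂))) (congruence-+J 𝔹 (crossing ℓ₂ true) (k ℓ₂) det-𝔹)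
        letter-J ℓ₃ = ≈ᴹ-trans (·-congʳ (·-congˡ (crossing-J ℓ₃))) (congruence-+J 𝔸 (crossing ℓ₃ true) (k ℓ₃) det-𝔸)

        word-palindrome : ∀ u l → word (u ++ l ∷ mirror u) ≈ᴹ word u · letter l · word u ᵗ
        word-palindrome u l = ≈ᴹ-trans (word-++ u (l ∷ mirror u))
          (≈ᴹ-trans (·-congˡ (·-congˡ (word-mirror u))) (≈ᴹ-sym (·-assoc (word u) (letter l) (word u ᵗ))))

        palindrome-J : ∀ u ℓ →
          word (u ++ (ℓ , false) ∷ mirror u) ≈ᴹ word (u ++ (ℓ , true) ∷ mirror u) +ᴹ k ℓ ∙ J
        palindrome-J u ℓ = begin
          word (u ++ (ℓ , false) ∷ mirror u)                       ≈⟨ word-palindrome u (ℓ , false) ⟩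
          word u · letter (ℓ , false) · word u ᵗ                   ≈⟨ ·-congʳ (·-congˡ (letter-J ℓ)) ⟩
          word u · (letter (ℓ , true) +ᴹ k ℓ ∙ J) · word u ᵗ       ≈⟨ congruence-+J (word u) (letter (ℓ , true)) (k ℓ) (det-word u) ⟩
          word u · letter (ℓ , true) · word u ᵗ +ᴹ k ℓ ∙ J         ≈⟨ +ᴹ-cong (word-palindrome u (ℓ , true)) ≈ᴹ-refl ⟨
          word (u ++ (ℓ , true) ∷ mirror u) +ᴹ k ℓ ∙ J             ∎
          where open import Relation.Binary.Reasoning.Setoid Mat-setoid

    -- The functional X ↦ tr X − M x₁₂ is X ↦ tr (X T⁻¹).
    module CGC (M : Carrier) where

      -- `S Q` is `k T` as soon as tr Q = 𝓜 q₁₂ - k.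
      T : Mat
      T = mk 𝟙 𝟘 M 𝟙

      F : Mat → Carrier
      F (mk a b c d) = a + d + - (M * b)

      F-cong : ∀ {X Y} → X ≈ᴹ Y → F X ≈ F Y
      F-cong (entries a b c d) = +-cong (+-cong a d) (-‿cong (*-cong refl b))

      -- Cayley-Hamilton, `P² = (tr P) P − (det P) I`, together with `F (P T) = tr P` and `F T = 2`.
      -- When `Q = P R − k T` has `F Q = −k`, the first term on the right vanishes.
      F-leftChild : ∀ P R k → F (P · (P · R +ᴹ (- k) ∙ T)) ≈
        (Mat.e₁₁ P + Mat.e₂₂ P) * (F (P · R +ᴹ (- k) ∙ T) + k) + - (detᴹ P * F R)
      F-leftChild (mk a b c d) (mk e f g h) k = solve 10 (λ a b c d e f g h k M →
        let q₁₁ = a :* e :+ b :* g :+ :- k :* :1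
            q₁₂ = a :* f :+ b :* h :+ :- k :* :0
            q₂₁ = c :* e :+ d :* g :+ :- k :* M
            q₂₂ = c :* f :+ d :* h :+ :- k :* :1
        in (a :* q₁₁ :+ b :* q₂₁) :+ (c :* q₁₂ :+ d :* q₂₂) :+ :- (M :* (a :* q₁₂ :+ b :* q₂₂)) :=
           (a :+ d) :* (q₁₁ :+ q₂₂ :+ :- (M :* q₁₂) :+ k)
             :+ :- ((a :* d :+ :- (b :* c)) :* (e :+ h :+ :- (M :* f)))) refl a b c d e f g h k M

      F-rightChild : ∀ P R k → F ((P · R +ᴹ (- k) ∙ T) · R) ≈
        (Mat.e₁₁ R + Mat.e₂₂ R) * (F (P · R +ᴹ (- k) ∙ T) + k) + - (detᴹ R * F P)
      F-rightChild (mk a b c d) (mk e f g h) k = solve 10 (λ a b c d e f g h k M →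
        let q₁₁ = a :* e :+ b :* g :+ :- k :* :1
            q₁₂ = a :* f :+ b :* h :+ :- k :* :0
            q₂₁ = c :* e :+ d :* g :+ :- k :* M
            q₂₂ = c :* f :+ d :* h :+ :- k :* :1
        in (q₁₁ :* e :+ q₁₂ :* g) :+ (q₂₁ :* f :+ q₂₂ :* h) :+ :- (M :* (q₁₁ :* f :+ q₁₂ :* h)) :=
           (e :+ h) :* (q₁₁ :+ q₂₂ :+ :- (M :* q₁₂) :+ k)
             :+ :- ((e :* h :+ :- (f :* g)) :* (a :+ d :+ :- (M :* b)))) refl a b c d e f g h k M

      F-shift : ∀ X k → F (X +ᴹ (- k) ∙ T) ≈ F X + - (k + k)
      F-shift (mk a b c d) k = solve 6 (λ a b c d k M →
        (a :+ :- k :* :1) :+ (d :+ :- k :* :1) :+ :- (M :* (b :+ :- k :* :0)) :=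
        a :+ d :+ :- (M :* b) :+ :- (k :+ k)) refl a b c d k M

      -- Polarisation of the determinant: since det T = 1, the mixed term is tr (X adj T) = `F X`.
      det-shift : ∀ X k → detᴹ (X +ᴹ (- k) ∙ T) ≈ detᴹ X + - (k * F X) + k * k
      det-shift (mk a b c d) k = solve 6 (λ a b c d k M →
        (a :+ :- k :* :1) :* (d :+ :- k :* :1) :+ :- ((b :+ :- k :* :0) :* (c :+ :- k :* M)) :=
        a :* d :+ :- (b :* c) :+ :- (k :* (a :+ d :+ :- (M :* b))) :+ k :* k) refl a b c d k M

      record IsC (k : Carrier) (X : Mat) : Set where
        constructor isC
        field
          det≈𝟙 : detᴹ X ≈ 𝟙
          F≈-k  : F X ≈ - k

      Rel : Carrier → Mat → Mat → Mat → Set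
      Rel k P Q R = Q ≈ᴹ P · R +ᴹ (- k) ∙ T

      -- `F (X · Y) ≈ k` is what lets both conditions survive the subtraction of `k T`: the
      -- determinant becomes 1 - k² + k² and the value of `F` becomes k - 2k.
      isC-product : ∀ {X Y N} k → detᴹ X ≈ 𝟙 → detᴹ Y ≈ 𝟙 → F (X · Y) ≈ k → Rel k X N Y → IsC k N
      isC-product {X} {Y} {N} k dX dY f r = isC
        (trans (det-cong r) (trans (det-shift (X · Y) k)
          (trans (+-cong (+-cong (trans (det-· X Y) (*-cong dX dY)) (-‿cong (*-cong refl f))) refl)
            (solve 1 (λ k → :1 :* :1 :+ :- (k :* k) :+ k :* k := :1) refl k))))
        (trans (F-cong r) (trans (F-shift (X · Y) k) (trans (+-cong f refl)
          (solve 1 (λ k → k :+ :- (k :+ k) := :- k) refl k))))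

      private
        collapse : ∀ t f k d g k' → f ≈ - k → d ≈ 𝟙 → g ≈ - k' → t * (f + k) + - (d * g) ≈ k'
        collapse t f k d g k' hf hd hg = trans
          (+-cong (*-cong refl (+-cong hf refl)) (-‿cong (*-cong hd hg)))
          (solve 3 (λ t k k' → t :* (:- k :+ k) :+ :- (:1 :* :- k') := k') refl t k k')

      isC-leftChild : ∀ {P Q R N kp kq kr} → IsC kp P → IsC kq Q → IsC kr R →
                      Rel kq P Q R → Rel kr P N Q → IsC kr N
      isC-leftChild {P} {Q} {R} {N} {kp} {kq} {kr} (isC dP fP) (isC dQ fQ) (isC dR fR) q n =
        isC-product {P} {Q} kr dP dQ
          (trans (F-cong (·-congˡ q)) (trans (F-leftChild P R kq)
            (collapse _ _ kq _ _ kr (trans (F-cong (≈ᴹ-sym q)) fQ) dP fR))) n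

      isC-rightChild : ∀ {P Q R N kp kq kr} → IsC kp P → IsC kq Q → IsC kr R →
                       Rel kq P Q R → Rel kp Q N R → IsC kp N
      isC-rightChild {P} {Q} {R} {N} {kp} {kq} {kr} (isC dP fP) (isC dQ fQ) (isC dR fR) q n =
        isC-product {Q} {R} kp dQ dR
          (trans (F-cong (·-congʳ q)) (trans (F-rightChild P R kq)
            (collapse _ _ kq _ _ kp (trans (F-cong (≈ᴹ-sym q)) fQ) dR fP))) n

      -- For fixed `p` and `q` the Markov equation is quadratic in `r`; this is its second root,
      -- obtained from the sum of the roots.
      jump : Carrier → Carrier → Carrier → Carrier → Carrier → Carrier
      jump p q r kp kq = (M * p + - kp) * q + - r + - (kq * p)

      trace : ∀ {X k} → IsC k X → Mat.e₁₁ X + Mat.e₂₂ X ≈ M * Mat.e₁₂ X + - k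
      trace {mk a b c d} {k} (isC _ f) = trans
        (solve 4 (λ a b d M → a :+ d := M :* b :+ (a :+ d :+ :- (M :* b))) refl a b d M)
        (+-cong refl f)

      -- Cayley-Hamilton applied to `P Q = P² R − kq P T`. As `T` has (1,2)-entry 0, subtracting its
      -- multiples does not affect the (1,2)-entries of `P R` and `P Q`.
      e₁₂-leftChild : ∀ {P Q R N kp kq kr} → IsC kp P → Rel kq P Q R → Rel kr P N Q →
                      Mat.e₁₂ N ≈ jump (Mat.e₁₂ P) (Mat.e₁₂ Q) (Mat.e₁₂ R) kp kq
      e₁₂-leftChild {mk a b c d} {Q} {mk e f g h} {N} {kp} {kq} {kr} P@(isC dP _) q n = begin
        Mat.e₁₂ N
          ≈⟨ ≈₁₂ n ⟩
        a * Mat.e₁₂ Q + b * Mat.e₂₂ Q + - kr * 𝟘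
          ≈⟨ +-cong (+-cong (*-cong refl (≈₁₂ q)) (*-cong refl (≈₂₂ q))) refl ⟩
        a * (a * f + b * h + - kq * 𝟘) + b * (c * f + d * h + - kq * 𝟙) + - kr * 𝟘
          ≈⟨ solve 8 (λ a b c d f h kq kr →
               a :* (a :* f :+ b :* h :+ :- kq :* :0) :+ b :* (c :* f :+ d :* h :+ :- kq :* :1) :+ :- kr :* :0 :=
               (a :+ d) :* (a :* f :+ b :* h :+ :- kq :* :0) :+ :- ((a :* d :+ :- (b :* c)) :* f) :+ :- (kq :* b))
               refl a b c d f h kq kr ⟩
        (a + d) * (a * f + b * h + - kq * 𝟘) + - ((a * d + - (b * c)) * f) + - (kq * b)
          ≈⟨ +-cong (+-cong (*-cong (trace P) (sym (≈₁₂ q))) (-‿cong (*-cong dP refl))) refl ⟩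
        (M * b + - kp) * Mat.e₁₂ Q + - (𝟙 * f) + - (kq * b)
          ≈⟨ solve 3 (λ u f v → u :+ :- (:1 :* f) :+ v := u :+ :- f :+ v) refl _ f _ ⟩
        (M * b + - kp) * Mat.e₁₂ Q + - f + - (kq * b) ∎
        where open import Relation.Binary.Reasoning.Setoid setoid

      e₁₂-rightChild : ∀ {P Q R N kp kq kr} → IsC kr R → Rel kq P Q R → Rel kp Q N R →
                       Mat.e₁₂ N ≈ jump (Mat.e₁₂ R) (Mat.e₁₂ Q) (Mat.e₁₂ P) kr kq
      e₁₂-rightChild {mk a b c d} {Q} {mk e f g h} {N} {kp} {kq} {kr} R@(isC dR _) q n = begin
        Mat.e₁₂ N
          ≈⟨ ≈₁₂ n ⟩
        Mat.e₁₁ Q * f + Mat.e₁₂ Q * h + - kp * 𝟘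
          ≈⟨ +-cong (+-cong (*-cong (≈₁₁ q) refl) (*-cong (≈₁₂ q) refl)) refl ⟩
        (a * e + b * g + - kq * 𝟙) * f + (a * f + b * h + - kq * 𝟘) * h + - kp * 𝟘
          ≈⟨ solve 8 (λ a b e f g h kq kp →
               (a :* e :+ b :* g :+ :- kq :* :1) :* f :+ (a :* f :+ b :* h :+ :- kq :* :0) :* h :+ :- kp :* :0 :=
               (e :+ h) :* (a :* f :+ b :* h :+ :- kq :* :0) :+ :- ((e :* h :+ :- (f :* g)) :* b) :+ :- (kq :* f))
               refl a b e f g h kq kp ⟩
        (e + h) * (a * f + b * h + - kq * 𝟘) + - ((e * h + - (f * g)) * b) + - (kq * f)
          ≈⟨ +-cong (+-cong (*-cong (trace R) (sym (≈₁₂ q))) (-‿cong (*-cong dR refl))) refl ⟩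
        (M * f + - kr) * Mat.e₁₂ Q + - (𝟙 * b) + - (kq * f)
          ≈⟨ solve 3 (λ u f v → u :+ :- (:1 :* f) :+ v := u :+ :- f :+ v) refl _ b _ ⟩
        (M * f + - kr) * Mat.e₁₂ Q + - b + - (kq * f) ∎
        where open import Relation.Binary.Reasoning.Setoid setoid

      Markov : Carrier → Carrier → Carrier → Carrier → Carrier → Carrier → Set
      Markov p q r kp kq kr =
        p * p + q * q + r * r + kp * q * r + kq * p * r + kr * p * q ≈ M * p * q * r

      Markov-swap : ∀ {p q r kp kq kr} → Markov p q r kp kq kr → Markov r q p kr kq kp
      Markov-swap {p} {q} {r} {kp} {kq} {kr} h = trans
        (solve 6 (λ p q r kp kq kr →
          r :* r :+ q :* q :+ p :* p :+ kr :* q :* p :+ kq :* r :* p :+ kp :* r :* q :=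
          p :* p :+ q :* q :+ r :* r :+ kp :* q :* r :+ kq :* p :* r :+ kr :* p :* q) refl p q r kp kq kr)
        (trans h (solve 4 (λ p q r M → M :* p :* q :* r := M :* r :* q :* p) refl p q r M))

      -- The product of the two roots is the constant term of the quadratic, which gives the
      -- exchange relation of the mutation at `r`.
      Vieta : ∀ {p q r n kp kq kr} → Markov p q r kp kq kr → n ≈ jump p q r kp kq →
              n * r ≈ p * p + kr * p * q + q * q
      Vieta {p} {q} {r} {n} {kp} {kq} {kr} h e = begin
        n * r ≈⟨ *-cong e refl ⟩
        ((M * p + - kp) * q + - r + - (kq * p)) * r
          ≈⟨ solve 7 (λ p q r kp kq kr M →
               ((M :* p :+ :- kp) :* q :+ :- r :+ :- (kq :* p)) :* r :=
               M :* p :* q :* r :+ :- (kp :* q :* r :+ r :* r :+ kq :* p :* r)) refl p q r kp kq kr M ⟩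
        M * p * q * r + - (kp * q * r + r * r + kq * p * r)
          ≈⟨ +-cong h refl ⟨
        p * p + q * q + r * r + kp * q * r + kq * p * r + kr * p * q + - (kp * q * r + r * r + kq * p * r)
          ≈⟨ solve 6 (λ p q r kp kq kr →
               p :* p :+ q :* q :+ r :* r :+ kp :* q :* r :+ kq :* p :* r :+ kr :* p :* q
                 :+ :- (kp :* q :* r :+ r :* r :+ kq :* p :* r) :=
               p :* p :+ kr :* p :* q :+ q :* q) refl p q r kp kq kr ⟩
        p * p + kr * p * q + q * q ∎
        where open import Relation.Binary.Reasoning.Setoid setoid

      -- The jump is a root of the same quadratic. Each parameter stays with its place in the
      -- cluster: the new variable inherits `kr`, and the triple is listed in the order of the left
      -- child.
      Markov-jump : ∀ {p q r n kp kq kr} → Markov p q r kp kq kr → n ≈ jump p q r kp kq →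
                    Markov p n q kp kr kq
      Markov-jump {p} {q} {r} {n} {kp} {kq} {kr} h e = begin
        p * p + n * n + q * q + kp * n * q + kr * p * q + kq * p * n
          ≈⟨ solve 6 (λ p q n kp kq kr →
               p :* p :+ n :* n :+ q :* q :+ kp :* n :* q :+ kr :* p :* q :+ kq :* p :* n :=
               (p :* p :+ kr :* p :* q :+ q :* q) :+ n :* (n :+ kp :* q :+ kq :* p)) refl p q n kp kq kr ⟩
        (p * p + kr * p * q + q * q) + n * (n + kp * q + kq * p)
          ≈⟨ +-cong (sym (Vieta h e)) (*-cong refl (+-cong (+-cong e refl) refl)) ⟩
        n * r + n * ((M * p + - kp) * q + - r + - (kq * p) + kp * q + kq * p)
          ≈⟨ solve 7 (λ p q r n kp kq M →
               n :* r :+ n :* ((M :* p :+ :- kp) :* q :+ :- r :+ :- (kq :* p) :+ kp :* q :+ kq :* p) :=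
               M :* p :* n :* q) refl p q r n kp kq M ⟩
        M * p * n * q ∎
        where open import Relation.Binary.Reasoning.Setoid setoid

      IsC-cong : ∀ {k X Y} → X ≈ᴹ Y → IsC k Y → IsC k X
      IsC-cong h (isC d f) = isC (trans (det-cong h) d) (trans (F-cong h) f)

      Markov-cong : ∀ {p q r p' r' kp kq kr} → p ≈ p' → r ≈ r' → Markov p' q r' kp kq kr → Markov p q r kp kq kr
      Markov-cong hp hr h = trans
        (+-cong (+-cong (+-cong (+-cong (+-cong (*-cong hp hp) refl) (*-cong hr hr)) (*-cong refl hr)) (*-cong (*-cong refl hp) hr)) (*-cong (*-cong refl hp) refl))
        (trans h (sym (*-cong (*-cong (*-cong refl hp) refl) hr)))

      jump-cong : ∀ {p q r p' q' kp kq} → p ≈ p' → q ≈ q' → jump p q r kp kq ≈ jump p' q' r kp kq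
      jump-cong hp hq = +-cong (+-cong (*-cong (+-cong (*-cong refl hp) refl) hq) refl) (-‿cong (*-cong refl hp))

      -- Uses `s` in place of `k`, and `- 0#`, so that after unfolding it is literally the relation
      -- with `_-ₘ S Q`.
      product-minus-S : ∀ {P Q R k} → IsC k Q → Rel k P Q R →
        let s = M * Mat.e₁₂ Q + - (Mat.e₁₁ Q + Mat.e₂₂ Q) in
        Q ≈ᴹ P · R +ᴹ mk (- s) (- 0#) (- (s * M)) (- s)
      product-minus-S {P} {Q} {R} {k} c r = ≈ᴹ-trans r (+ᴹ-cong ≈ᴹ-refl (entries
          (trans (solve 1 (λ k → :- k :* :1 := :- k) refl k) (-‿cong k≈s))
          (trans (solve 1 (λ k → :- k :* :0 := :- :0) refl k) (-‿cong (0-homo φ)))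
          (trans (solve 2 (λ k M → :- k :* M := :- (k :* M)) refl k M) (-‿cong (*-cong k≈s refl)))
          (trans (solve 1 (λ k → :- k :* :1 := :- k) refl k) (-‿cong k≈s))))
        where
        open _-Raw-AlmostCommutative⟶_ using (0-homo)
        k≈s : k ≈ M * Mat.e₁₂ Q + - (Mat.e₁₁ Q + Mat.e₂₂ Q)
        k≈s = trans (solve 2 (λ k w → k := w :+ :- (w :+ :- k)) refl k (M * Mat.e₁₂ Q)) (+-cong refl (-‿cong (sym (trace c))))

    mutation-cong : ∀ {n k x y z x' y' z'} → n * z ≈ x * x + k * x * y + y * y → x ≈ x' → y ≈ y' → z ≈ z' →
      n * z' ≈ x' * x' + k * x' * y' + y' * y'
    mutation-cong h hx hy hz = trans (*-cong refl (sym hz)) (trans h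
      (+-cong (+-cong (*-cong hx hx) (*-cong (*-cong refl hx) hy)) (*-cong hy hy)))

    mutation-swap : ∀ {n k x y z} → n * z ≈ x * x + k * x * y + y * y → n * z ≈ y * y + k * y * x + x * x
    mutation-swap {n} {k} {x} {y} {z} h = trans h (solve 3 (λ k x y →
      x :* x :+ k :* x :* y :+ y :* y := y :* y :+ k :* y :* x :+ x :* x) refl k x y)

-- The letters of p/q and the symmetry of its path under a half-turn.

module Staircases where

  open import Defs using (Lbl; ℓ₁; ℓ₂; ℓ₃)
  open MatrixAlgebra using (Letter; flip; mirror)
  open import Data.Bool using (Bool; true; false; not; if_then_else_; _xor_)
  import Data.Bool.Properties as Boolₚ
  open import Data.Empty using (⊥-elim)
  open import Data.Integer as ℤ using (ℤ; +_; -[1+_]; _+_; _*_; _-_; -_; _≤_; _<_)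
  import Data.Integer.Properties as ℤₚ
  open import Data.Integer.Tactic.RingSolver using (solve-∀)
  open import Data.List using (List; []; _∷_; _++_; applyUpTo)
  import Data.List.Properties as List
  open import Data.Nat as ℕ using (ℕ; zero; suc; ⌊_/2⌋; ⌈_/2⌉; z≤n; s≤s)
  import Data.Nat.Properties as ℕₚ
  import Data.Nat.Divisibility as ∣
  open import Data.Nat.Coprimality using (Coprime; coprime-divisor)
  open import Data.Product using (_×_; _,_; proj₁; proj₂)
  open import Data.Sum using (_⊎_; inj₁; inj₂)
  open import Function using (_∘_)
  open import Relation.Binary.PropositionalEquality
  open import Relation.Nullary using (Dec; yes; no; ¬_; contradiction)
  open import Relation.Nullary.Decidable using (⌊_⌋)

  private
    variable
      x y z : ℤ

  -- Every inequality is put in the form `+ 0 ≤ e`, with `x < 0` written `+ 0 ≤ - + 1 - x`. A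
  -- contradiction is then a certificate expressing -1 through sums and products of nonnegative
  -- terms, which the ring solver checks.
  by-≡ : x ≡ y → + 0 ≤ y → + 0 ≤ x
  by-≡ refl h = h

  0≤-+ : + 0 ≤ x → + 0 ≤ y → + 0 ≤ x + y
  0≤-+ = ℤₚ.+-mono-≤

  0≤-* : + 0 ≤ x → + 0 ≤ y → + 0 ≤ x * y
  0≤-* {+ m} {+ n} _ _ = subst (+ 0 ≤_) (ℤₚ.pos-* m n) (ℤ.+≤+ z≤n)

  0≤+ : ∀ {n} → + 0 ≤ + n
  0≤+ = ℤ.+≤+ z≤n

  0≤? : ∀ x → (+ 0 ≤ x) ⊎ (+ 0 ≤ - + 1 - x)
  0≤? (+ n)    = inj₁ 0≤+
  0≤? -[1+ n ] = inj₂ 0≤+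

  0≰-1 : ¬ (+ 0 ≤ - + 1)
  0≰-1 ()

  0≤-antisym : + 0 ≤ x - y → + 0 ≤ y - x → x ≡ y
  0≤-antisym h h' = ℤₚ.≤-antisym (ℤₚ.0≤i-j⇒j≤i h') (ℤₚ.0≤i-j⇒j≤i h)

  ≤⇒0≤ : ∀ {m n} → m ℕ.≤ n → + 0 ≤ + n - + m
  ≤⇒0≤ h = ℤₚ.i≤j⇒0≤j-i (ℤ.+≤+ h)

  <⇒0≤ : ∀ {m n} → m ℕ.< n → + 0 ≤ + n - (+ 1 + + m)
  <⇒0≤ = ≤⇒0≤

  flag-neg : + 0 ≤ - + 1 - x → ⌊ x ℤ.<? + 0 ⌋ ≡ true
  flag-neg {x} h with x ℤ.<? + 0
  ... | yes _ = refl
  flag-neg {+ n} h | no _ = ⊥-elim (0≰-1 (by-≡ (lem (+ n)) (0≤-+ h (0≤+ {n}))))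
    where
    lem : ∀ x → - + 1 ≡ - + 1 - x + x
    lem = solve-∀
  flag-neg { -[1+ n ]} h | no ¬p = contradiction ℤ.-<+ ¬p

  flag-nonneg : + 0 ≤ x → ⌊ x ℤ.<? + 0 ⌋ ≡ false
  flag-nonneg {x} h with x ℤ.<? + 0
  ... | yes p = contradiction p (ℤₚ.≤⇒≯ h)
  ... | no _  = refl

  -- positive to the right of the line through (0,0) and (q,p), in the
  -- coordinates (x, l = x + y).
  offset : ℕ → ℕ → ℤ → ℤ → ℤ
  offset p q x l = (+ p + + q) * x - + q * l

  bump : ∀ {A : Set} → Dec A → ℕ → ℕ
  bump (yes _) b = b
  bump (no _)  b = suc b

  -- up p q c = ⌈ c q / (p + q) ⌉: the first lattice point on x + y = c that is not
  -- to the left of the line has this abscissa.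
  opaque
    up : ℕ → ℕ → ℕ → ℕ
    up p q zero    = 0
    up p q (suc c) = bump (+ 0 ℤ.≤? offset p q (+ up p q c) (+ suc c)) (up p q c)

  opaque
    unfolding up

    up-zero : ∀ p q → up p q 0 ≡ 0
    up-zero p q = refl

    up-step : ∀ p q c → up p q (suc c) ≡ up p q c ⊎ up p q (suc c) ≡ suc (up p q c)
    up-step p q c with + 0 ℤ.≤? offset p q (+ up p q c) (+ suc c)
    ... | yes _ = inj₁ refl
    ... | no _  = inj₂ refl

    -- From `c` to `c + 1` the offset drops by `q`, and raising the abscissa by one adds `p + q`;
    -- hence one bump per step is enough.
    up-spec : ∀ p q → 1 ℕ.≤ p ℕ.+ q → ∀ c →
      (+ 0 ≤ offset p q (+ up p q c) (+ c)) × (+ 0 ≤ - + 1 - offset p q (+ up p q c - + 1) (+ c))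
    up-spec p q 1≤N zero = by-≡ (e (+ p) (+ q)) 0≤+ , by-≡ (e' (+ p) (+ q)) (≤⇒0≤ 1≤N)
      where
      e : ∀ P Q → (P + Q) * + 0 - Q * + 0 ≡ + 0
      e = solve-∀
      e' : ∀ P Q → - + 1 - ((P + Q) * (+ 0 - + 1) - Q * + 0) ≡ (P + Q) - + 1
      e' = solve-∀
    up-spec p q 1≤N (suc c) with up-spec p q 1≤N c | + 0 ℤ.≤? offset p q (+ up p q c) (+ suc c)
    ... | (h , h') | yes g = g , by-≡ (e (+ p) (+ q) (+ up p q c) (+ c)) (0≤-+ h' (0≤+ {q}))
      where
      e : ∀ P Q b c → - + 1 - ((P + Q) * (b - + 1) - Q * (+ 1 + c)) ≡ - + 1 - ((P + Q) * (b - + 1) - Q * c) + Q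
      e = solve-∀
    ... | (h , h') | no g  = by-≡ (e (+ p) (+ q) (+ up p q c) (+ c)) (0≤-+ h (0≤+ {p}))
                           , by-≡ (e' (+ p) (+ q) (+ up p q c) (+ c)) (lower _ g)
      where
      e : ∀ P Q b c → (P + Q) * (+ 1 + b) - Q * (+ 1 + c) ≡ (P + Q) * b - Q * c + P
      e = solve-∀
      e' : ∀ P Q b c → - + 1 - ((P + Q) * (+ 1 + b - + 1) - Q * (+ 1 + c)) ≡ - + 1 - ((P + Q) * b - Q * (+ 1 + c))
      e' = solve-∀
      lower : ∀ x → ¬ (+ 0 ≤ x) → + 0 ≤ - + 1 - x
      lower x ¬h with 0≤? x
      ... | inj₁ h = contradiction h ¬h
      ... | inj₂ h = h

  offset-unique : ∀ p q x y l →
    + 0 ≤ offset p q x l → + 0 ≤ - + 1 - offset p q (x - + 1) l →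
    + 0 ≤ offset p q y l → + 0 ≤ - + 1 - offset p q (y - + 1) l → x ≡ y
  offset-unique p q x y l hx hx' hy hy' = 0≤-antisym (half x y hx hy') (half y x hy hx')
    where
    e : ∀ P Q x y l → - + 1 ≡ (P + Q) * x - Q * l + (- + 1 - ((P + Q) * (y - + 1) - Q * l)) + (P + Q) * (- + 1 - (x - y))
    e = solve-∀
    half : ∀ x y → + 0 ≤ offset p q x l → + 0 ≤ - + 1 - offset p q (y - + 1) l → + 0 ≤ x - y
    half x y h h' with 0≤? (x - y)
    ... | inj₁ g = g
    ... | inj₂ g = ⊥-elim (0≰-1 (by-≡ (e (+ p) (+ q) x y l) (0≤-+ (0≤-+ h h') (0≤-* (0≤+ {p ℕ.+ q}) g))))

  up-unique : ∀ p q → 1 ℕ.≤ p ℕ.+ q → ∀ c x →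
    + 0 ≤ offset p q x (+ c) → + 0 ≤ - + 1 - offset p q (x - + 1) (+ c) → + up p q c ≡ x
  up-unique p q 1≤N c x h h' =
    offset-unique p q (+ up p q c) x (+ c) (proj₁ (up-spec p q 1≤N c)) (proj₂ (up-spec p q 1≤N c)) h h'

  -- For the letters, c ≤ c′ ≤ c + 1: the diagonal on x + y = c if c = c′, otherwise the
  -- edge crossed between the diagonals on x + y = c and x + y = c′.
  dev : ℕ → ℕ → ℕ → ℕ → ℤ
  dev p q c c' = offset p q (+ up p q c + + up p q c' - + 1) (+ c + + c')

  label : ℕ → ℕ → ℕ → ℕ → Lbl
  label p q c c' = if ⌊ c ℕ.≟ c' ⌋ then ℓ₁ else (if ⌊ up p q c ℕ.≟ up p q c' ⌋ then ℓ₃ else ℓ₂)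

  -- `dev` is the sum of the offsets of the two endpoints, one negative and one positive for a
  -- crossed segment, so its sign tells which endpoint is closer to γ.
  letterAt : ℕ → ℕ → ℕ → ℕ → Letter
  letterAt p q c c' = label p q c c' , ⌊ dev p q c c' ℤ.<? + 0 ⌋

  -- Positions along the path are doubled: `k = 2c` is the diagonal on `x + y = c`, and `k = 2c + 1`
  -- the edge between `c` and `c + 1`.
  lt : ℕ → ℕ → ℕ → Letter
  lt p q k = letterAt p q ⌊ k /2⌋ ⌈ k /2⌉

  ≟-cong : ∀ {a b c d} → (a ≡ b → c ≡ d) → (c ≡ d → a ≡ b) → ⌊ a ℕ.≟ b ⌋ ≡ ⌊ c ℕ.≟ d ⌋
  ≟-cong {a} {b} {c} {d} to from with a ℕ.≟ b | c ℕ.≟ d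
  ... | yes _ | yes _ = refl
  ... | no _  | no _  = refl
  ... | yes h | no g  = contradiction (to h) g
  ... | no h  | yes g = contradiction (from g) h

  coprime-sum : ∀ {p q} → Coprime p q → Coprime (p ℕ.+ q) q
  coprime-sum {p} {q} cop {d} (d∣N , d∣q) = cop (∣.∣m+n∣m⇒∣n (subst (d ∣.∣_) (ℕₚ.+-comm p q) d∣N) d∣q , d∣q)

  -- γ passes through no lattice point strictly between its ends: `(p + q) x = q c` would make
  -- `p + q` divide `c`.
  offset≢0 : ∀ p q → Coprime p q → ∀ x c → 0 ℕ.< c → c ℕ.< p ℕ.+ q → offset p q (+ x) (+ c) ≢ + 0
  offset≢0 p q cop x c 0<c c<N e = ℕₚ.<⇒≱ c<N (∣.∣⇒≤ {{ℕ.>-nonZero 0<c}} N∣c)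
    where
    e' : (p ℕ.+ q) ℕ.* x ≡ q ℕ.* c
    e' = ℤₚ.+-injective (trans (ℤₚ.pos-* (p ℕ.+ q) x) (trans (ℤₚ.i-j≡0⇒i≡j _ _ e) (sym (ℤₚ.pos-* q c))))
    N∣c : (p ℕ.+ q) ∣.∣ c
    N∣c = coprime-divisor (coprime-sum cop) (subst ((p ℕ.+ q) ∣.∣_) e' (∣.m∣m*n x))

  module Palindrome (p q : ℕ) (cop : Coprime p q) (1≤N : 1 ℕ.≤ p ℕ.+ q) where

    -- The half-turn about the midpoint of γ exchanges the lattice points next to γ on its right and
    -- on its left. These differ by one in abscissa, since no lattice point lies on γ itself; hence
    -- `q + 1` and not `q`.
    up-mirror : ∀ c d → c ℕ.+ d ≡ p ℕ.+ q → 0 ℕ.< c → 0 ℕ.< d → up p q c ℕ.+ up p q d ≡ suc q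
    up-mirror c d c+d≡N 0<c 0<d = ℤₚ.+-injective (trans (cong (λ z → + up p q c + z) up-d) (e (+ up p q c) (+ q)))
      where
      N≡ : + p + + q ≡ + c + + d
      N≡ = cong +_ (sym c+d≡N)
      e : ∀ b Q → b + (+ 1 + Q - b) ≡ + 1 + Q
      e = solve-∀
      h = proj₁ (up-spec p q 1≤N c)
      h' = proj₂ (up-spec p q 1≤N c)
      positive : ∀ x → + 0 ≤ x → x ≢ + 0 → + 0 ≤ x - + 1
      positive (+ zero) _ ne = contradiction refl ne
      positive (+ suc n) _ _ = by-≡ (lem (+ n)) (0≤+ {n})
        where
        lem : ∀ n → + 1 + n - + 1 ≡ n
        lem = solve-∀
      h₊ : + 0 ≤ offset p q (+ up p q c) (+ c) - + 1
      h₊ = positive _ h (offset≢0 p q cop (up p q c) c 0<c (subst (c ℕ.<_) c+d≡N (ℕₚ.m<m+n c 0<d)))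
      e₁ : ∀ P Q b c d → (P + Q) * (+ 1 + Q - b) - Q * d ≡ - + 1 - ((P + Q) * (b - + 1) - Q * c) + + 1 + Q * (P + Q - (c + d))
      e₁ = solve-∀
      e₂ : ∀ P Q b c d → - + 1 - ((P + Q) * (+ 1 + Q - b - + 1) - Q * d) ≡ (P + Q) * b - Q * c - + 1 - Q * (P + Q - (c + d))
      e₂ = solve-∀
      zeroN : + p + + q - (+ c + + d) ≡ + 0
      zeroN = trans (cong (_- (+ c + + d)) N≡) (ℤₚ.+-inverseʳ (+ c + + d))
      Q0 : + q * (+ p + + q - (+ c + + d)) ≡ + 0
      Q0 = trans (cong (λ z → + q * z) zeroN) (ℤₚ.*-zeroʳ (+ q))
      up-d : + up p q d ≡ + 1 + + q - + up p q c
      up-d = up-unique p q 1≤N d _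
        (by-≡ (e₁ (+ p) (+ q) (+ up p q c) (+ c) (+ d)) (0≤-+ (0≤-+ h' 0≤+) (by-≡ Q0 0≤+)))
        (by-≡ (e₂ (+ p) (+ q) (+ up p q c) (+ c) (+ d)) (0≤-+ h₊ (by-≡ (cong -_ Q0) 0≤+)))

    -- At the middle, the doubled midpoint of the crossed segment is (q,p) itself.
    dev-middle : ∀ c d → c ℕ.+ d ≡ p ℕ.+ q → 0 ℕ.< c → 0 ℕ.< d → dev p q c d ≡ + 0
    dev-middle c d c+d≡N 0<c 0<d = trans
      (cong₂ (offset p q) (cong (λ b → + b - + 1) (up-mirror c d c+d≡N 0<c 0<d)) (cong +_ c+d≡N)) (e (+ p) (+ q))
      where
      e : ∀ P Q → (P + Q) * (+ 1 + Q - + 1) - Q * (P + Q) ≡ + 0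
      e = solve-∀

    label-mirror : ∀ c c' d d' → c ℕ.+ d' ≡ p ℕ.+ q → c' ℕ.+ d ≡ p ℕ.+ q →
      0 ℕ.< c → 0 ℕ.< c' → 0 ℕ.< d → 0 ℕ.< d' → label p q d d' ≡ label p q c c'
    label-mirror c c' d d' h h' 0<c 0<c' 0<d 0<d' = cong₂ (λ u v → if u then ℓ₁ else (if v then ℓ₃ else ℓ₂))
      (≟-cong {d} {d'} {c} {c'} (λ { refl → ℕₚ.+-cancelʳ-≡ d c c' (trans h (sym h')) })
              (λ { refl → ℕₚ.+-cancelˡ-≡ c d d' (trans h' (sym h)) }))
      (≟-cong {up p q d} {up p q d'} {up p q c} {up p q c'} (λ e → ℕₚ.+-cancelʳ-≡ (up p q d) (up p q c) (up p q c') (trans (cong (up p q c ℕ.+_) e) (trans m (sym m'))))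
              (λ e → ℕₚ.+-cancelˡ-≡ (up p q c) (up p q d) (up p q d') (trans (cong (ℕ._+ up p q d) e) (trans m' (sym m)))))
      where
      m  = up-mirror c d' h 0<c 0<d'
      m' = up-mirror c' d h' 0<c' 0<d

    -- The half-turn exchanges the two sides of γ. In the computation `rest` collects the
    -- discrepancy, which vanishes once both sums of abscissas are `q + 1` and both sums of levels
    -- are `p + q`.
    dev-mirror : ∀ c c' d d' → c ℕ.+ d' ≡ p ℕ.+ q → c' ℕ.+ d ≡ p ℕ.+ q →
      0 ℕ.< c → 0 ℕ.< c' → 0 ℕ.< d → 0 ℕ.< d' → dev p q d d' ≡ - dev p q c c'
    dev-mirror c c' d d' h h' 0<c 0<c' 0<d 0<d' = begin
      dev p q d d' ≡⟨ e (+ p) (+ q) (+ up p q c) (+ up p q c') (+ up p q d) (+ up p q d') (+ c) (+ c') (+ d) (+ d') ⟩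
      - dev p q c c' + rest (+ up p q c + + up p q d') (+ up p q c' + + up p q d) (+ c + + d') (+ c' + + d)
        ≡⟨ cong (λ z → - dev p q c c' + z) (cong₂ (λ u v → rest u v (+ c + + d') (+ c' + + d)) (cong +_ m) (cong +_ m')) ⟩
      - dev p q c c' + rest (+ 1 + + q) (+ 1 + + q) (+ c + + d') (+ c' + + d)
        ≡⟨ cong (λ z → - dev p q c c' + z) (cong₂ (rest (+ 1 + + q) (+ 1 + + q)) (cong +_ h) (cong +_ h')) ⟩
      - dev p q c c' + rest (+ 1 + + q) (+ 1 + + q) (+ p + + q) (+ p + + q)
        ≡⟨ cong (λ z → - dev p q c c' + z) (e' (+ p) (+ q)) ⟩
      - dev p q c c' + + 0 ≡⟨ ℤₚ.+-identityʳ _ ⟩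
      - dev p q c c' ∎
      where
      open ≡-Reasoning
      m  = up-mirror c d' h 0<c 0<d'
      m' = up-mirror c' d h' 0<c' 0<d
      rest : ℤ → ℤ → ℤ → ℤ → ℤ
      rest u v w z = (+ p + + q) * (u + v - + 2) - + q * (w + z)
      e : ∀ P Q b b' β β' c c' d d' →
        (P + Q) * (β + β' - + 1) - Q * (d + d') ≡
        - ((P + Q) * (b + b' - + 1) - Q * (c + c')) + ((P + Q) * ((b + β') + (b' + β) - + 2) - Q * ((c + d') + (c' + d)))
      e = solve-∀
      e' : ∀ P Q → (P + Q) * ((+ 1 + Q) + (+ 1 + Q) - + 2) - Q * ((P + Q) + (P + Q)) ≡ + 0
      e' = solve-∀

    -- `dev = 0` forces `p + q` to divide `c + c'`, and the only multiple in the open range from 0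
    -- to `2 (p + q)` is `p + q`. So the middle letter is the only one whose flag is not negated by
    -- the half-turn.
    dev≢0 : ∀ c c' → 0 ℕ.< c ℕ.+ c' → c ℕ.+ c' ℕ.< (p ℕ.+ q) ℕ.+ (p ℕ.+ q) → c ℕ.+ c' ≢ p ℕ.+ q → dev p q c c' ≢ + 0
    dev≢0 c c' 0<k k<2N k≢N e = k≢N (only N∣k)
      where
      X = up p q c ℕ.+ up p q c'
      lem : ∀ P Q X k → (P + Q) * X ≡ ((P + Q) * (X - + 1) - Q * k) + ((P + Q) + Q * k)
      lem = solve-∀
      eq : (p ℕ.+ q) ℕ.* X ≡ (p ℕ.+ q) ℕ.+ q ℕ.* (c ℕ.+ c')
      eq = ℤₚ.+-injective (trans (ℤₚ.pos-* (p ℕ.+ q) X) (trans (lem (+ p) (+ q) (+ X) (+ (c ℕ.+ c')))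
        (trans (cong (_+ (+ (p ℕ.+ q) + + q * + (c ℕ.+ c'))) e)
          (trans (ℤₚ.+-identityˡ _) (cong (λ z → + (p ℕ.+ q) + z) (sym (ℤₚ.pos-* q (c ℕ.+ c'))))))))
      N∣k : (p ℕ.+ q) ∣.∣ (c ℕ.+ c')
      N∣k = coprime-divisor (coprime-sum cop) (∣.∣m+n∣m⇒∣n (subst ((p ℕ.+ q) ∣.∣_) eq (∣.m∣m*n X)) ∣.∣-refl)
      only : (p ℕ.+ q) ∣.∣ (c ℕ.+ c') → c ℕ.+ c' ≡ p ℕ.+ q
      only (∣.divides zero eq') = contradiction (subst (0 ℕ.<_) eq' 0<k) λ ()
      only (∣.divides (suc zero) eq') = trans eq' (ℕₚ.+-identityʳ _)
      only (∣.divides (suc (suc t)) eq') = contradiction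
        (subst (ℕ._< (p ℕ.+ q) ℕ.+ (p ℕ.+ q)) eq' k<2N)
        (ℕₚ.≤⇒≯ (ℕₚ.+-monoʳ-≤ (p ℕ.+ q) (ℕₚ.m≤m+n (p ℕ.+ q) _)))

    flag-opposite : ∀ x → x ≢ + 0 → ⌊ (- x) ℤ.<? + 0 ⌋ ≡ not ⌊ x ℤ.<? + 0 ⌋
    flag-opposite (+ zero) ne = contradiction refl ne
    flag-opposite (+ suc n) _ = refl
    flag-opposite -[1+ n ] _ = refl

    letter-mirror : ∀ c c' d d' → c ℕ.+ d' ≡ p ℕ.+ q → c' ℕ.+ d ≡ p ℕ.+ q →
      0 ℕ.< c → 0 ℕ.< c' → 0 ℕ.< d → 0 ℕ.< d' → c ℕ.+ c' ≢ p ℕ.+ q →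
      letterAt p q d d' ≡ flip (letterAt p q c c')
    letter-mirror c c' d d' h h' 0<c 0<c' 0<d 0<d' ne = cong₂ _,_
      (label-mirror c c' d d' h h' 0<c 0<c' 0<d 0<d')
      (trans (cong (λ z → ⌊ z ℤ.<? + 0 ⌋) (dev-mirror c c' d d' h h' 0<c 0<c' 0<d 0<d'))
        (flag-opposite (dev p q c c') (dev≢0 c c' (ℕₚ.≤-trans 0<c (ℕₚ.m≤m+n c c'))
          (subst₂ (λ u v → c ℕ.+ c' ℕ.< u ℕ.+ v) h h' (ℕₚ.+-mono-< (ℕₚ.m<m+n c 0<d') (ℕₚ.m<m+n c' 0<d))) ne)))

  odd : ℕ → Bool
  odd zero    = false
  odd (suc n) = not (odd n)

  odd-+ : ∀ m n → odd (m ℕ.+ n) ≡ odd m xor odd n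
  odd-+ zero n = refl
  odd-+ (suc m) n = trans (cong not (odd-+ m n)) (Boolₚ.not-distribˡ-xor (odd m) (odd n))

  odd-double : ∀ n → odd (n ℕ.+ n) ≡ false
  odd-double n = trans (odd-+ n n) (Boolₚ.xor-same (odd n))

  parity : Bool → Bool → Lbl
  parity false true  = ℓ₃
  parity true  false = ℓ₂
  parity _     _     = ℓ₁

  -- The position in a cluster of the variable attached to p/q.
  slot : ℕ → ℕ → Lbl
  slot p q = parity (odd p) (odd q)

  module _ (p q : ℕ) (cop : Coprime p q) (1≤N : 1 ℕ.≤ p ℕ.+ q) where
    open Palindrome p q cop 1≤N

    -- The middle segment shares its midpoint `(q/2, p/2)` with γ, so its direction is determined by
    -- the parities of `p` and `q`.
    label-middle : ∀ c c' → c ≡ c' ⊎ c' ≡ suc c → c ℕ.+ c' ≡ p ℕ.+ q → 0 ℕ.< c → 0 ℕ.< c' →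
                   label p q c c' ≡ slot p q
    label-middle c c' cc h 0<c 0<c' with c ℕ.≟ c'
    ... | yes refl = even (odd p) (odd q) (trans (sym (odd-+ p q)) (trans (cong odd (sym h)) (odd-double c)))
      where
      even : ∀ a b → a xor b ≡ false → ℓ₁ ≡ parity a b
      even false false _ = refl
      even true true _ = refl
    label-middle c c' (inj₁ e) h 0<c 0<c' | no ne = contradiction e ne
    label-middle c .(suc c) (inj₂ refl) h 0<c 0<c' | no ne = go (up-step p q c)
      where
      N-odd : odd p xor odd q ≡ true
      N-odd = trans (sym (odd-+ p q)) (trans (cong odd (trans (sym h) (ℕₚ.+-suc c c))) (cong not (odd-double c)))
      sum = up-mirror c (suc c) h 0<c 0<c'
      horizontal : ∀ a b → a xor b ≡ true → b ≡ true → ℓ₃ ≡ parity a b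
      horizontal false true _ _ = refl
      vertical : ∀ a b → a xor b ≡ true → b ≡ false → ℓ₂ ≡ parity a b
      vertical true false _ _ = refl
      go : up p q (suc c) ≡ up p q c ⊎ up p q (suc c) ≡ suc (up p q c) →
           (if ⌊ up p q c ℕ.≟ up p q (suc c) ⌋ then ℓ₃ else ℓ₂) ≡ slot p q
      go st with up p q c ℕ.≟ up p q (suc c)
      ... | yes e = horizontal (odd p) (odd q) N-odd (Boolₚ.not-injective (trans (cong odd (sym sum))
                      (trans (cong odd (cong (up p q c ℕ.+_) (sym e))) (odd-double (up p q c)))))
      go (inj₁ e) | no ne = contradiction (sym e) ne
      go (inj₂ e) | no ne = vertical (odd p) (odd q) N-odd (Boolₚ.not-injective (trans (cong odd (sym sum))
                      (trans (cong odd (trans (cong (up p q c ℕ.+_) e) (ℕₚ.+-suc (up p q c) (up p q c))))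
                        (cong not (odd-double (up p q c))))))

  halves : ∀ k → ⌊ k /2⌋ ≡ ⌈ k /2⌉ ⊎ ⌈ k /2⌉ ≡ suc ⌊ k /2⌋
  halves zero = inj₁ refl
  halves (suc zero) = inj₂ refl
  halves (suc (suc k)) with halves k
  ... | inj₁ h = inj₁ (cong suc h)
  ... | inj₂ h = inj₂ (cong suc h)

  ⌊double+/2⌋ : ∀ a k → ⌊ a ℕ.+ a ℕ.+ k /2⌋ ≡ a ℕ.+ ⌊ k /2⌋
  ⌊double+/2⌋ zero k = refl
  ⌊double+/2⌋ (suc a) k rewrite ℕₚ.+-suc a a = cong suc (⌊double+/2⌋ a k)

  ⌈double+/2⌉ : ∀ a k → ⌈ a ℕ.+ a ℕ.+ k /2⌉ ≡ a ℕ.+ ⌈ k /2⌉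
  ⌈double+/2⌉ a k = trans (cong ⌊_/2⌋ (sym (ℕₚ.+-suc (a ℕ.+ a) k))) (⌊double+/2⌋ a (suc k))

  halves-reflect : ∀ N k l → k ℕ.+ l ≡ N ℕ.+ N → (⌊ k /2⌋ ℕ.+ ⌈ l /2⌉ ≡ N) × (⌈ k /2⌉ ℕ.+ ⌊ l /2⌋ ≡ N)
  halves-reflect N k l h = first N k l h , trans (ℕₚ.+-comm ⌈ k /2⌉ ⌊ l /2⌋) (first N l k (trans (ℕₚ.+-comm l k) h))
    where
    first : ∀ N k l → k ℕ.+ l ≡ N ℕ.+ N → ⌊ k /2⌋ ℕ.+ ⌈ l /2⌉ ≡ N
    first N zero l refl = sym (ℕₚ.n≡⌈n+n/2⌉ N)
    first (suc N) (suc zero) l h = trans (cong ⌊_/2⌋ h) (sym (ℕₚ.n≡⌊n+n/2⌋ (suc N)))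
    first (suc N) (suc (suc k)) l h = cong suc (first N k l
      (ℕₚ.suc-injective (ℕₚ.suc-injective (trans h (cong suc (ℕₚ.+-suc N N))))))
    first zero (suc k) l ()

  applyUpTo-+ : ∀ {A : Set} (f : ℕ → A) m n → applyUpTo f (m ℕ.+ n) ≡ applyUpTo f m ++ applyUpTo (f ∘ (m ℕ.+_)) n
  applyUpTo-+ f zero n = refl
  applyUpTo-+ f (suc m) n = cong (f 0 ∷_) (applyUpTo-+ (f ∘ suc) m n)

  applyUpTo-cong : ∀ {A : Set} (f g : ℕ → A) n → (∀ i → i ℕ.< n → f i ≡ g i) → applyUpTo f n ≡ applyUpTo g n
  applyUpTo-cong f g zero h = refl
  applyUpTo-cong f g (suc n) h = cong₂ _∷_ (h 0 (s≤s z≤n)) (applyUpTo-cong (f ∘ suc) (g ∘ suc) n (λ i i<n → h (suc i) (s≤s i<n)))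

  applyUpTo-mirror : ∀ (g h : ℕ → Letter) n → (∀ i j → suc (i ℕ.+ j) ≡ n → h j ≡ flip (g i)) →
                     applyUpTo h n ≡ mirror (applyUpTo g n)
  applyUpTo-mirror g h zero e = refl
  applyUpTo-mirror g h (suc n) e = trans (sym (List.applyUpTo-∷ʳ h n))
    (cong₂ (λ u l → u ++ l ∷ []) (applyUpTo-mirror (g ∘ suc) h n (λ i j eq → e (suc i) j (cong suc eq)))
           (e 0 n refl))

  applyUpTo-palindrome : ∀ (g : ℕ → Letter) n → (∀ i j → i ℕ.< n → i ℕ.+ j ≡ n ℕ.+ n → g j ≡ flip (g i)) →
    applyUpTo g (n ℕ.+ suc n) ≡ applyUpTo g n ++ g n ∷ mirror (applyUpTo g n)
  applyUpTo-palindrome g n e = trans (applyUpTo-+ g n (suc n)) (cong (applyUpTo g n ++_)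
    (cong₂ _∷_ (cong g (ℕₚ.+-identityʳ n)) (applyUpTo-mirror g (λ j → g (n ℕ.+ suc j)) n
      (λ i j eq → e i (n ℕ.+ suc j) (subst (i ℕ.<_) eq (s≤s (ℕₚ.m≤m+n i j))) (shuffle i j eq)))))
    where
    shuffle : ∀ i j → suc (i ℕ.+ j) ≡ n → i ℕ.+ (n ℕ.+ suc j) ≡ n ℕ.+ n
    shuffle i j eq = trans (sym (ℕₚ.+-assoc i n (suc j))) (trans (cong (ℕ._+ suc j) (ℕₚ.+-comm i n))
      (trans (ℕₚ.+-assoc n i (suc j)) (cong (n ℕ.+_) (trans (ℕₚ.+-suc i j) eq))))

-- Comparing the path of a mediant with the paths of its Farey parents.

module Concatenations where

  open import Defs using (ℓ₁; ℓ₂; ℓ₃)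
  open Staircases
  open import Data.Bool using (true; if_then_else_)
  open import Data.Empty using (⊥-elim)
  open import Data.Integer as ℤ using (ℤ; +_; _+_; _*_; _-_; -_; _≤_; _<_)
  import Data.Integer.Properties as ℤₚ
  open import Data.Integer.Tactic.RingSolver using (solve-∀)
  open import Data.Nat as ℕ using (ℕ; zero; suc; z≤n; s≤s)
  import Data.Nat.Properties as ℕₚ
  import Data.Nat.Tactic.RingSolver as ℕ-Solver
  import Data.Nat.Divisibility as ∣
  open import Data.Nat.Coprimality using (Coprime)
  open import Data.Product using (_×_; _,_; proj₁; proj₂)
  open import Data.Sum using (_⊎_; inj₁; inj₂)
  open import Relation.Binary.PropositionalEquality
  open import Relation.Nullary using (contradiction)
  open import Relation.Nullary.Decidable using (⌊_⌋)

  coprime-det : ∀ {a b c d} → a ℕ.* b ≡ suc (c ℕ.* d) → Coprime c a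
  coprime-det {a} {b} {c} {d} h {i} (i∣c , i∣a) = ∣.∣1⇒≡1 (∣.∣m+n∣m⇒∣n
    (subst (i ∣.∣_) (trans h (ℕₚ.+-comm 1 (c ℕ.* d))) (∣.∣m⇒∣m*n b i∣a)) (∣.∣m⇒∣m*n d i∣c))

  product-positive : ∀ a b {c} → a ℕ.* b ≡ suc c → (1 ℕ.≤ a) × (1 ℕ.≤ b)
  product-positive (suc a) (suc b) _ = s≤s z≤n , s≤s z≤n
  product-positive (suc a) zero h = contradiction (trans (sym h) (ℕₚ.*-zeroʳ a)) λ ()

  module Concatenation (p q r s : ℕ) (det : q ℕ.* r ≡ suc (p ℕ.* s)) where

    private
      m n a b : ℕ
      m = p ℕ.+ r
      n = q ℕ.+ s
      a = p ℕ.+ q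
      b = r ℕ.+ s

    1≤q : 1 ℕ.≤ q
    1≤q = proj₁ (product-positive q r det)

    1≤r : 1 ℕ.≤ r
    1≤r = proj₂ (product-positive q r det)

    1≤a : 1 ℕ.≤ a
    1≤a = ℕₚ.≤-trans 1≤q (ℕₚ.m≤n+m q p)

    1≤b : 1 ℕ.≤ b
    1≤b = ℕₚ.≤-trans 1≤r (ℕₚ.m≤m+n r s)

    1≤m : 1 ℕ.≤ m
    1≤m = ℕₚ.≤-trans 1≤r (ℕₚ.m≤n+m r p)

    1≤n : 1 ℕ.≤ n
    1≤n = ℕₚ.≤-trans 1≤q (ℕₚ.m≤m+n q s)

    1≤N : 1 ℕ.≤ m ℕ.+ n
    1≤N = ℕₚ.≤-trans 1≤m (ℕₚ.m≤m+n m n)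

    N≡ : m ℕ.+ n ≡ a ℕ.+ b
    N≡ = shuffle p q r s
      where
      shuffle : ∀ p q r s → (p ℕ.+ r) ℕ.+ (q ℕ.+ s) ≡ (p ℕ.+ q) ℕ.+ (r ℕ.+ s)
      shuffle = ℕ-Solver.solve-∀

    det-left : n ℕ.* r ≡ suc (m ℕ.* s)
    det-left = trans (ℕₚ.*-distribʳ-+ r q s) (trans (cong (ℕ._+ s ℕ.* r) det) (cong suc (shuffle p r s)))
      where
      shuffle : ∀ p r s → p ℕ.* s ℕ.+ s ℕ.* r ≡ (p ℕ.+ r) ℕ.* s
      shuffle = ℕ-Solver.solve-∀

    coprime-mn : Coprime m n
    coprime-mn = coprime-det det-left

    detℤ : + q * + r - + p * + s ≡ + 1
    detℤ = trans (cong₂ _-_ (trans (sym (ℤₚ.pos-* q r)) (cong +_ det)) (sym (ℤₚ.pos-* p s)))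
                 (e (+ (p ℕ.* s)))
      where
      e : ∀ x → + 1 + x - x ≡ + 1
      e = solve-∀

    -- Cramer's rule in the basis (q,p), (s,r) of ℤ².
    cramer : ∀ x l → l ≡ offset r s x l * (+ p + + q) + (- offset p q x l) * (+ r + + s)
    cramer x l = trans (trans (sym (ℤₚ.*-identityʳ l)) (cong (l *_) (sym detℤ))) (e (+ p) (+ q) (+ r) (+ s) x l)
      where
      e : ∀ P Q R S x l → l * (Q * R - P * S) ≡
          ((R + S) * x - S * l) * (P + Q) + (- ((P + Q) * x - Q * l)) * (R + S)
      e = solve-∀

    offset-mn : ∀ x l → offset m n x l ≡ offset p q x l + offset r s x l
    offset-mn x l = e (+ p) (+ q) (+ r) (+ s) x l
      where
      e : ∀ P Q R S x l → ((P + R) + (Q + S)) * x - (Q + S) * l ≡ ((P + Q) * x - Q * l) + ((R + S) * x - S * l)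
      e = solve-∀

    -- The point `(q, p)` has offset `q r − p s = 1` for the slope m/n, so translating by `t (q, p)`
    -- adds `t`.
    offset-mn-shift : ∀ t x l → offset m n (t * + q + x) (t * (+ p + + q) + l) ≡ t + (offset p q x l + offset r s x l)
    offset-mn-shift t x l = trans (e (+ p) (+ q) (+ r) (+ s) t x l)
      (cong (_+ (offset p q x l + offset r s x l)) (trans (cong (t *_) detℤ) (ℤₚ.*-identityʳ t)))
      where
      e : ∀ P Q R S t x l → ((P + R) + (Q + S)) * (t * Q + x) - (Q + S) * (t * (P + Q) + l) ≡
          t * (Q * R - P * S) + (((P + Q) * x - Q * l) + ((R + S) * x - S * l))
      e = solve-∀

    private
      0≤a : + 0 ≤ + p + + q
      0≤a = 0≤+
      0≤b : + 0 ≤ + r + + s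
      0≤b = 0≤+

      module _ (x l : ℤ) where

        -- `α` and `−f` are the coordinates of the point in the basis `(q, p)`, `(s, r)`, and the
        -- offset for m/n is `f + α`.
        α f : ℤ
        α = offset r s x l
        f = offset p q x l

        cr : l ≡ α * (+ p + + q) + (- f) * (+ r + + s)
        cr = cramer x l

        cramer-cases : (u v w : ℤ) → w ≡ u * (+ p + + q) + v * (+ r + + s) →
          + 0 ≤ α - u → + 0 ≤ (- f) - v → + 0 ≤ l - w
        cramer-cases u v w hw h h' = by-≡ (trans (cong₂ _-_ cr hw) (e (+ p + + q) (+ r + + s) α f u v))
          (0≤-+ (0≤-* h 0≤a) (0≤-* h' 0≤b))
          where
          e : ∀ A B α f u v → (α * A + (- f) * B) - (u * A + v * B) ≡ (α - u) * A + ((- f) - v) * B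
          e = solve-∀

        cramer-cases' : (u v w : ℤ) → w ≡ u * (+ p + + q) + v * (+ r + + s) →
          + 0 ≤ u - α → + 0 ≤ v - (- f) → + 0 ≤ w - l
        cramer-cases' u v w hw h h' = by-≡ (trans (cong₂ _-_ hw cr) (e (+ p + + q) (+ r + + s) α f u v))
          (0≤-+ (0≤-* h 0≤a) (0≤-* h' 0≤b))
          where
          e : ∀ A B α f u v → (u * A + v * B) - (α * A + (- f) * B) ≡ (u - α) * A + (v - (- f)) * B
          e = solve-∀

        -- This and the next three implications bound one coordinate using `l = α a − f b` and the
        -- sign of the other one. The parameter `t` is taken to be 0 for points on the lines
        -- `x + y = c` and 1 for doubled midpoints.
        f≥0⇒α>0 : + 0 ≤ l - + 1 → + 0 ≤ f → + 0 ≤ α - + 1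
        f≥0⇒α>0 hl hf with 0≤? (α - + 1)
        ... | inj₁ h = h
        ... | inj₂ h = ⊥-elim (0≰-1 (by-≡ (e₂ l) (0≤-+ hl
          (cramer-cases' (+ 0) (+ 0) (+ 0) (e₀ (+ p + + q) (+ r + + s)) (by-≡ (e₁ α) h) (by-≡ (e₃ f) hf)))))
          where
          e₀ : ∀ A B → + 0 ≡ + 0 * A + + 0 * B
          e₀ = solve-∀
          e₁ : ∀ α → + 0 - α ≡ - + 1 - (α - + 1)
          e₁ = solve-∀
          e₂ : ∀ l → - + 1 ≡ (l - + 1) + (+ 0 - l)
          e₂ = solve-∀
          e₃ : ∀ f → + 0 - (- f) ≡ f
          e₃ = solve-∀

        α≥0⇒f≥-t : ∀ t → + 0 ≤ (t + + 1) * (+ r + + s) - + 1 - l → + 0 ≤ α → + 0 ≤ f + t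
        α≥0⇒f≥-t t hl hα with 0≤? (f + t)
        ... | inj₁ h = h
        ... | inj₂ h = ⊥-elim (0≰-1 (by-≡ (e₂ ((t + + 1) * (+ r + + s)) l) (0≤-+ hl
          (cramer-cases (+ 0) (t + + 1) ((t + + 1) * (+ r + + s)) (e₀ t (+ p + + q) (+ r + + s)) (by-≡ (e₁ α) hα) (by-≡ (e₃ f t) h)))))
          where
          e₀ : ∀ t A B → (t + + 1) * B ≡ + 0 * A + (t + + 1) * B
          e₀ = solve-∀
          e₁ : ∀ α → α - + 0 ≡ α
          e₁ = solve-∀
          e₂ : ∀ w l → - + 1 ≡ (w - + 1 - l) + (l - w)
          e₂ = solve-∀
          e₃ : ∀ f t → (- f) - (t + + 1) ≡ - + 1 - (f + t)
          e₃ = solve-∀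

        f<0⇒α≤t : ∀ t → + 0 ≤ (t + + 1) * (+ p + + q) - l → + 0 ≤ - + 1 - f → + 0 ≤ t - α
        f<0⇒α≤t t hl hf with 0≤? (t - α)
        ... | inj₁ h = h
        ... | inj₂ h = ⊥-elim (0≰-1 (by-≡ (e₂ t (+ p + + q) (+ r + + s) l)
          (0≤-+ (0≤-+ hl (≤⇒0≤ 1≤b))
          (cramer-cases (t + + 1) (+ 1) ((t + + 1) * (+ p + + q) + + 1 * (+ r + + s)) refl
            (by-≡ (e₁ t α) h) (by-≡ (e₃ f) hf)))))
          where
          e₁ : ∀ t α → α - (t + + 1) ≡ - + 1 - (t - α)
          e₁ = solve-∀
          e₂ : ∀ t A B l → - + 1 ≡ ((t + + 1) * A - l) + (B - + 1) + (l - ((t + + 1) * A + + 1 * B))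
          e₂ = solve-∀
          e₃ : ∀ f → (- f) - + 1 ≡ - + 1 - f
          e₃ = solve-∀

        α<0⇒f<0 : + 0 ≤ l → + 0 ≤ - + 1 - α → + 0 ≤ - + 1 - f
        α<0⇒f<0 hl hα with 0≤? (- + 1 - f)
        ... | inj₁ h = h
        ... | inj₂ h = ⊥-elim (0≰-1 (by-≡ (e₂ (+ p + + q) (+ r + + s) l)
          (0≤-+ (0≤-+ hl (≤⇒0≤ 1≤a))
          (cramer-cases' (- + 1) (+ 0) ((- + 1) * (+ p + + q) + + 0 * (+ r + + s)) refl hα (by-≡ (e₃ f) h)))))
          where
          e₂ : ∀ A B l → - + 1 ≡ l + (A - + 1) + (((- + 1) * A + + 0 * B) - l)
          e₂ = solve-∀
          e₃ : ∀ f → + 0 - (- f) ≡ - + 1 - (- + 1 - f)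
          e₃ = solve-∀

        -- If the flags disagree then α = 1 and f = −1, so l = a + b.
        tie : + 0 ≤ + 1 - α → + 0 ≤ - + 1 - f → + 0 ≤ f + α → l ≡ (+ p + + q) + (+ r + + s)
        tie hα hf h = trans cr (trans (cong₂ (λ u v → u * (+ p + + q) + (- v) * (+ r + + s)) α≡1 f≡-1) (e (+ p + + q) (+ r + + s)))
          where
          e : ∀ A B → + 1 * A + (- (- + 1)) * B ≡ A + B
          e = solve-∀
          e₁ : ∀ α f → α - + 1 ≡ (f + α) + (- + 1 - f)
          e₁ = solve-∀
          e₂ : ∀ α f → f - - + 1 ≡ (f + α) + (+ 1 - α)
          e₂ = solve-∀
          α≡1 : α ≡ + 1
          α≡1 = 0≤-antisym (by-≡ (e₁ α f) (0≤-+ h hf)) hα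
          f≡-1 : f ≡ - + 1
          f≡-1 = 0≤-antisym (by-≡ (e₂ α f) (0≤-+ h hα)) hf

    -- On the lines `0 < x + y ≤ a` the conditions `f ≥ 0` and `f + α ≥ 0` agree: no lattice point
    -- fits between the lines of slopes p/q and m/n.
    up-left : ∀ c → 0 ℕ.< c → c ℕ.≤ a → up m n c ≡ up p q c
    up-left c 0<c c≤a = ℤₚ.+-injective (up-unique m n 1≤N c (+ up p q c)
      (by-≡ (offset-mn _ _) (0≤-+ hR (by-≡ (e₁ (offset r s (+ up p q c) (+ c))) (0≤-+ (f≥0⇒α>0 (+ up p q c) (+ c) (<⇒0≤ 0<c) hR) 0≤+))))
      (by-≡ (trans (cong (λ z → - + 1 - z) (offset-mn xL (+ c))) (e₂ (offset p q xL (+ c)) (offset r s xL (+ c))))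
        (0≤-+ hL (f<0⇒α≤t (+ up p q c - + 1) (+ c) (+ 0) (by-≡ (e₃ (+ p + + q) (+ c)) (≤⇒0≤ c≤a)) hL))))
      where
      xL = + up p q c - + 1
      hR = proj₁ (up-spec p q 1≤a c)
      hL = proj₂ (up-spec p q 1≤a c)
      e₁ : ∀ x → x ≡ (x - + 1) + + 1
      e₁ = solve-∀
      e₂ : ∀ x y → - + 1 - (x + y) ≡ (- + 1 - x) + (+ 0 - y)
      e₂ = solve-∀
      e₃ : ∀ A c → (+ 0 + + 1) * A - c ≡ A - c
      e₃ = solve-∀

    -- Translation by `(q, p)` carries the path of r/s to the second leg of the broken line, where
    -- the offset for m/n reads `1 + f + α`.
    up-right : ∀ c → c ℕ.< b → up m n (a ℕ.+ c) ≡ q ℕ.+ up r s c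
    up-right c c<b = ℤₚ.+-injective (up-unique m n 1≤N (a ℕ.+ c) (+ q + + up r s c)
      (by-≡ (trans (cong₂ (offset m n) (e₁ (+ q) (+ up r s c)) (e₁ (+ a) (+ c))) (offset-mn-shift (+ 1) _ _))
        (0≤-+ {+ 1} 0≤+ (0≤-+ (by-≡ (e₄ (offset p q (+ up r s c) (+ c))) (α≥0⇒f≥-t (+ up r s c) (+ c) (+ 0)
            (by-≡ (e₅ (+ r + + s) (+ c)) (<⇒0≤ c<b)) hR)) hR)))
      (by-≡ (trans (cong (λ z → - + 1 - z)
                     (trans (cong₂ (offset m n) (e₂ (+ q) (+ up r s c)) (e₁ (+ a) (+ c))) (offset-mn-shift (+ 1) _ _)))
                   (e₃ (offset p q xL (+ c)) (offset r s xL (+ c))))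
        (0≤-+ (α<0⇒f<0 (+ up r s c - + 1) (+ c) 0≤+ hL) hL)))
      where
      xL = + up r s c - + 1
      hR = proj₁ (up-spec r s 1≤b c)
      hL = proj₂ (up-spec r s 1≤b c)
      e₁ : ∀ x y → x + y ≡ + 1 * x + y
      e₁ = solve-∀
      e₂ : ∀ x y → x + y - + 1 ≡ + 1 * x + (y - + 1)
      e₂ = solve-∀
      e₃ : ∀ x y → - + 1 - (+ 1 + (x + y)) ≡ (- + 1 - x) + (- + 1 - y)
      e₃ = solve-∀
      e₄ : ∀ x → x ≡ x + + 0
      e₄ = solve-∀
      e₅ : ∀ B c → (+ 0 + + 1) * B - + 1 - c ≡ B - (+ 1 + c)
      e₅ = solve-∀

    private
      X : ℕ → ℕ → ℕ → ℕ → ℤ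
      X p q c c' = + up p q c + + up p q c' - + 1

      label-cong : ∀ {p q p' q' c c' d d'} → (c ≡ c' → d ≡ d') → (d ≡ d' → c ≡ c') →
        (up p q c ≡ up p q c' → up p' q' d ≡ up p' q' d') →
        (up p' q' d ≡ up p' q' d' → up p q c ≡ up p q c') → label p q c c' ≡ label p' q' d d'
      label-cong {p} {q} {p'} {q'} {c} {c'} {d} {d'} h₁ h₂ h₃ h₄ = cong₂ (λ u v → if u then ℓ₁ else (if v then ℓ₃ else ℓ₂))
        (≟-cong {c} {c'} {d} {d'} h₁ h₂) (≟-cong {up p q c} {up p q c'} {up p' q' d} {up p' q' d'} h₃ h₄)

    module _ (c c' : ℕ) (0<c : 0 ℕ.< c) (0<c' : 0 ℕ.< c') (c≤a : c ℕ.≤ a) (c'≤a : c' ℕ.≤ a) where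

      X-left : X m n c c' ≡ X p q c c'
      X-left = cong₂ (λ u v → + u + + v - + 1) (up-left c 0<c c≤a) (up-left c' 0<c' c'≤a)

      label-left : label m n c c' ≡ label p q c c'
      label-left = label-cong {m} {n} {p} {q} {c} {c'} (λ h → h) (λ h → h)
        (λ h → trans (sym e) (trans h e')) (λ h → trans e (trans h (sym e')))
        where
        e = up-left c 0<c c≤a
        e' = up-left c' 0<c' c'≤a

      -- Doubled midpoints satisfy `l ≤ 2a`. There the signs of `f` and `f + α` disagree only if
      -- `α = 1` and `f = −1`, which is the point `(n, m)`, the doubled midpoint of the segment of
      -- m/n.
      flag-left : c ℕ.+ c' ≢ m ℕ.+ n → ⌊ dev m n c c' ℤ.<? + 0 ⌋ ≡ ⌊ dev p q c c' ℤ.<? + 0 ⌋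
      flag-left ne = trans (cong (λ z → ⌊ z ℤ.<? + 0 ⌋) dev≡) (go (0≤? f'))
        where
        x = X p q c c'
        l = + c + + c'
        f' = offset p q x l
        α' = offset r s x l
        dev≡ : dev m n c c' ≡ f' + α'
        dev≡ = trans (cong (λ z → offset m n z l) X-left) (offset-mn x l)
        hl : + 0 ≤ l - + 1
        hl = ≤⇒0≤ (ℕₚ.≤-trans 0<c (ℕₚ.m≤m+n c c'))
        hl' : + 0 ≤ (+ 1 + + 1) * (+ p + + q) - l
        hl' = by-≡ (e (+ p + + q) l) (≤⇒0≤ (ℕₚ.+-mono-≤ c≤a c'≤a))
          where
          e : ∀ A l → (+ 1 + + 1) * A - l ≡ (A + A) - l
          e = solve-∀
        e₁ : ∀ α → α ≡ (α - + 1) + + 1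
        e₁ = solve-∀
        go : (+ 0 ≤ f') ⊎ (+ 0 ≤ - + 1 - f') → ⌊ (f' + α') ℤ.<? + 0 ⌋ ≡ ⌊ f' ℤ.<? + 0 ⌋
        go (inj₁ h) = trans (flag-nonneg (0≤-+ h (by-≡ (e₁ α') (0≤-+ (f≥0⇒α>0 x l hl h) 0≤+)))) (sym (flag-nonneg h))
        go (inj₂ h) with 0≤? (f' + α')
        ... | inj₂ g = trans (flag-neg g) (sym (flag-neg h))
        ... | inj₁ g = contradiction (trans (ℤₚ.+-injective (tie x l (f<0⇒α≤t x l (+ 1) hl' h) h g)) (sym N≡)) ne

      letter-left : c ℕ.+ c' ≢ m ℕ.+ n → letterAt m n c c' ≡ letterAt p q c c'
      letter-left ne = cong₂ _,_ label-left (flag-left ne)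

      -- At the exceptional letter `dev` is -1 for p/q but 0 for m/n, so the product has flag `true`
      -- where the mediant has `false`.
      letter-left-middle : c ℕ.+ c' ≡ m ℕ.+ n → letterAt p q c c' ≡ (label m n c c' , true)
      letter-left-middle h = cong₂ _,_ (sym label-left) (flag-neg (by-≡ e 0≤+))
        where
        open Palindrome m n coprime-mn 1≤N
        e₁ : ∀ P Q R S → - + 1 - ((P + Q) * (+ 1 + (Q + S) - + 1) - Q * ((P + Q) + (R + S))) ≡ (Q * R - P * S) - + 1
        e₁ = solve-∀
        x≡ : X p q c c' ≡ + 1 + (+ q + + s) - + 1
        x≡ = trans (sym X-left) (cong (λ z → + z - + 1) (up-mirror c c' h 0<c 0<c'))
        e : - + 1 - dev p q c c' ≡ + 0
        e = trans (cong₂ (λ u v → - + 1 - offset p q u v) x≡ (cong +_ (trans h N≡)))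
          (trans (e₁ (+ p) (+ q) (+ r) (+ s)) (cong (_- + 1) detℤ))

    module _ (c c' : ℕ) (0<k : 0 ℕ.< c ℕ.+ c') (c<b : c ℕ.< b) (c'<b : c' ℕ.< b) where

      X-right : X m n (a ℕ.+ c) (a ℕ.+ c') ≡ + 2 * + q + X r s c c'
      X-right = trans (cong₂ (λ u v → + u + + v - + 1) (up-right c c<b) (up-right c' c'<b))
                      (e (+ q) (+ up r s c) (+ up r s c'))
        where
        e : ∀ Q u v → (Q + u) + (Q + v) - + 1 ≡ + 2 * Q + (u + v - + 1)
        e = solve-∀

      label-right : label m n (a ℕ.+ c) (a ℕ.+ c') ≡ label r s c c'
      label-right = label-cong {m} {n} {r} {s} {a ℕ.+ c} {a ℕ.+ c'}
        (ℕₚ.+-cancelˡ-≡ a c c') (cong (a ℕ.+_))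
        (λ h → ℕₚ.+-cancelˡ-≡ q _ _ (trans (sym e) (trans h e')))
        (λ h → trans e (trans (cong (q ℕ.+_) h) (sym e')))
        where
        e = up-right c c<b
        e' = up-right c' c'<b

      dev-right : dev m n (a ℕ.+ c) (a ℕ.+ c') ≡ + 2 + (dev r s c c' + offset p q (X r s c c') (+ c + + c'))
      dev-right = trans (cong₂ (offset m n) X-right (e (+ a) (+ c) (+ c')))
        (trans (offset-mn-shift (+ 2) (X r s c c') (+ c + + c'))
          (cong (λ z → + 2 + z) (ℤₚ.+-comm (offset p q (X r s c c') (+ c + + c')) (dev r s c c'))))
        where
        e : ∀ A c c' → (A + c) + (A + c') ≡ + 2 * A + (c + c')
        e = solve-∀

      -- After translation by `2 (q, p)` the exceptional case becomes `α = f = −1`, once more the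
      -- doubled midpoint of the segment of m/n.
      flag-right : (a ℕ.+ c) ℕ.+ (a ℕ.+ c') ≢ m ℕ.+ n →
                   ⌊ dev m n (a ℕ.+ c) (a ℕ.+ c') ℤ.<? + 0 ⌋ ≡ ⌊ dev r s c c' ℤ.<? + 0 ⌋
      flag-right ne = trans (cong (λ z → ⌊ z ℤ.<? + 0 ⌋) dev-right) (go (0≤? α'))
        where
        x = X r s c c'
        l = + c + + c'
        f' = offset p q x l
        α' = offset r s x l
        hl : + 0 ≤ l
        hl = 0≤+
        hl' : + 0 ≤ (+ 1 + + 1) * (+ r + + s) - + 1 - l
        hl' = by-≡ (e (+ r + + s) (+ c) (+ c')) (0≤-+ (0≤-+ (<⇒0≤ c<b) (<⇒0≤ c'<b)) (0≤+ {1}))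
          where
          e : ∀ B c c' → (+ 1 + + 1) * B - + 1 - (c + c') ≡ (B - (+ 1 + c)) + (B - (+ 1 + c')) + + 1
          e = solve-∀
        e₁ : ∀ f α → + 2 + (α + f) ≡ α + (f + + 1) + + 1
        e₁ = solve-∀
        go : (+ 0 ≤ α') ⊎ (+ 0 ≤ - + 1 - α') → ⌊ (+ 2 + (α' + f')) ℤ.<? + 0 ⌋ ≡ ⌊ α' ℤ.<? + 0 ⌋
        go (inj₁ h) = trans (flag-nonneg (by-≡ (e₁ f' α') (0≤-+ (0≤-+ h (α≥0⇒f≥-t x l (+ 1) hl' h)) 0≤+))) (sym (flag-nonneg h))
        go (inj₂ h) with 0≤? (+ 2 + (α' + f'))
        ... | inj₂ g = trans (flag-neg g) (sym (flag-neg h))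
        ... | inj₁ g = contradiction (ℤₚ.+-injective l≡) ne
          where
          hf = α<0⇒f<0 x l hl h
          e₂ : ∀ f α → α - - + 1 ≡ (+ 2 + (α + f)) + (- + 1 - f)
          e₂ = solve-∀
          e₃ : ∀ f α → f - - + 1 ≡ (+ 2 + (α + f)) + (- + 1 - α)
          e₃ = solve-∀
          α≡-1 : α' ≡ - + 1
          α≡-1 = 0≤-antisym (by-≡ (e₂ f' α') (0≤-+ g hf)) h
          f≡-1 : f' ≡ - + 1
          f≡-1 = 0≤-antisym (by-≡ (e₃ f' α') (0≤-+ g h)) hf
          e₄ : ∀ A c c' → (A + c) + (A + c') ≡ (A + A) + (c + c')
          e₄ = solve-∀
          e₅ : ∀ P Q R S → ((P + Q) + (P + Q)) + ((- + 1) * (P + Q) + (- (- + 1)) * (R + S)) ≡ (P + R) + (Q + S)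
          e₅ = solve-∀
          l≡ : + ((a ℕ.+ c) ℕ.+ (a ℕ.+ c')) ≡ + (m ℕ.+ n)
          l≡ = trans (e₄ (+ p + + q) (+ c) (+ c')) (trans
            (cong (λ z → ((+ p + + q) + (+ p + + q)) + z)
              (trans (cramer x l) (cong₂ (λ u v → u * (+ p + + q) + (- v) * (+ r + + s)) α≡-1 f≡-1)))
            (e₅ (+ p) (+ q) (+ r) (+ s)))

      letter-right : (a ℕ.+ c) ℕ.+ (a ℕ.+ c') ≢ m ℕ.+ n →
                     letterAt m n (a ℕ.+ c) (a ℕ.+ c') ≡ letterAt r s c c'
      letter-right ne = cong₂ _,_ label-right (flag-right ne)

      letter-right-middle : (a ℕ.+ c) ℕ.+ (a ℕ.+ c') ≡ m ℕ.+ n →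
                            letterAt r s c c' ≡ (label m n (a ℕ.+ c) (a ℕ.+ c') , true)
      letter-right-middle h = cong₂ _,_ (sym label-right) (flag-neg (by-≡ e 0≤+))
        where
        open Palindrome m n coprime-mn 1≤N
        0<a+ : ∀ d → 0 ℕ.< a ℕ.+ d
        0<a+ d = ℕₚ.≤-trans 1≤a (ℕₚ.m≤m+n a d)
        e₁ : ∀ P Q R S → - + 1 - ((R + S) * (+ 1 + (Q + S) - + 1 - + 2 * Q) - S * (((P + R) + (Q + S)) - + 2 * (P + Q))) ≡ (Q * R - P * S) - + 1
        e₁ = solve-∀
        e₂ : ∀ x y → y ≡ (x + y) - x
        e₂ = solve-∀
        e₃ : ∀ A c c' → c + c' ≡ ((A + c) + (A + c')) - + 2 * A
        e₃ = solve-∀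
        x≡ : X r s c c' ≡ + 1 + (+ q + + s) - + 1 - + 2 * + q
        x≡ = trans (e₂ (+ 2 * + q) (X r s c c')) (cong (_- + 2 * + q) (trans (sym X-right)
          (cong (λ z → + z - + 1) (up-mirror (a ℕ.+ c) (a ℕ.+ c') h (0<a+ c) (0<a+ c')))))
        e : - + 1 - dev r s c c' ≡ + 0
        e = trans (cong₂ (λ u v → - + 1 - offset r s u v) x≡
            (trans (e₃ (+ a) (+ c) (+ c')) (cong (λ z → + z - + 2 * (+ p + + q)) h)))
          (trans (e₁ (+ p) (+ q) (+ r) (+ s)) (cong (_- + 1) detℤ))

-- The words of the two factors and of the mediant.

module Words where

  open import Defs using (ℓ₁; ℓ₂; ℓ₃)
  open MatrixAlgebra using (Letter; flip; mirror)
  open Staircases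
  open Concatenations
  open import Data.Bool using (true; false; if_then_else_)
  open import Data.Integer as ℤ using (ℤ; +_)
  open import Data.Integer.Tactic.RingSolver using (solve-∀)
  open import Data.List using (List; []; _∷_; _++_; applyUpTo)
  open import Data.Nat using (ℕ; suc; ⌊_/2⌋; ⌈_/2⌉; z≤n; s≤s; _+_; _*_; _≤_; _<_; _≟_)
  open import Data.Nat.Properties
  import Data.Integer.Properties as ℤₚ
  import Data.Nat.Tactic.RingSolver as ℕ-Solver
  open import Data.Nat.Coprimality using (Coprime)
  open import Data.Product using (_,_; proj₁; proj₂)
  open import Relation.Binary.PropositionalEquality
  open import Relation.Nullary using (Dec; yes; no; contradiction)
  open import Relation.Nullary.Decidable using (⌊_⌋)

  -- With `p + q = 2 + M` the keys are `2, …, 2 (p + q) − 2`, one for each segment that γ crosses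
  -- away from its ends.
  coreWord : ℕ → ℕ → ℕ → List Letter
  coreWord p q M = applyUpTo (λ i → lt p q (2 + i)) (M + suc M)

  module Middle (p q : ℕ) (cop : Coprime p q) (M : ℕ) (N≡ : p + q ≡ 2 + M) where

    1≤N : 1 ≤ p + q
    1≤N = subst (1 ≤_) (sym N≡) (s≤s z≤n)

    open Palindrome p q cop 1≤N

    lt-mirror : ∀ i j → i ≢ M → i + j ≡ M + M → lt p q (2 + j) ≡ flip (lt p q (2 + i))
    lt-mirror i j i≢M i+j = letter-mirror ⌊ 2 + i /2⌋ ⌈ 2 + i /2⌉ ⌊ 2 + j /2⌋ ⌈ 2 + j /2⌉
      (proj₁ reflect) (proj₂ reflect) (s≤s z≤n) (s≤s z≤n) (s≤s z≤n) (s≤s z≤n)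
      (λ e → i≢M (suc-injective (suc-injective (trans (sym (⌊n/2⌋+⌈n/2⌉≡n (2 + i))) (trans e N≡)))))
      where
      shuffle : ∀ i j → (2 + i) + (2 + j) ≡ 4 + (i + j)
      shuffle = ℕ-Solver.solve-∀
      shuffle' : ∀ M → 4 + (M + M) ≡ (2 + M) + (2 + M)
      shuffle' = ℕ-Solver.solve-∀
      reflect = halves-reflect (p + q) (2 + i) (2 + j)
        (trans (shuffle i j) (trans (cong (λ z → 4 + z) i+j) (trans (shuffle' M) (sym (cong₂ _+_ N≡ N≡)))))

    private
      c+c' : ⌊ 2 + M /2⌋ + ⌈ 2 + M /2⌉ ≡ p + q
      c+c' = trans (⌊n/2⌋+⌈n/2⌉≡n (2 + M)) (sym N≡)

    lt-middle : lt p q (2 + M) ≡ (slot p q , false)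
    lt-middle = cong₂ _,_
      (label-middle p q cop 1≤N ⌊ 2 + M /2⌋ ⌈ 2 + M /2⌉ (halves (2 + M)) c+c' (s≤s z≤n) (s≤s z≤n))
      (cong (λ z → ⌊ z ℤ.<? + 0 ⌋) (dev-middle ⌊ 2 + M /2⌋ ⌈ 2 + M /2⌉ c+c' (s≤s z≤n) (s≤s z≤n)))

    coreWord-palindrome : let u = applyUpTo (λ i → lt p q (2 + i)) M in
      coreWord p q M ≡ u ++ (slot p q , false) ∷ mirror u
    coreWord-palindrome = trans
      (applyUpTo-palindrome (λ i → lt p q (2 + i)) M (λ i j i<M → lt-mirror i j (<⇒≢ i<M)))
      (cong (λ l → applyUpTo (λ i → lt p q (2 + i)) M ++ l ∷ mirror (applyUpTo (λ i → lt p q (2 + i)) M)) lt-middle)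

  -- Between the cores of the two factors a product carries `h d v`. With `p + q = suc A` the left
  -- word adds the keys `2 (p + q) − 1` and `2 (p + q)` to the core, which gives `h d`; with
  -- `r + s = suc B` the right word starts at key 1, which gives `v`.
  leftWord rightWord : ℕ → ℕ → ℕ → List Letter
  leftWord p q A = applyUpTo (λ i → lt p q (2 + i)) (suc (A + A))
  rightWord r s B = applyUpTo (λ i → lt r s (1 + i)) (B + B)

  module _ (p q r s : ℕ) (det : q * r ≡ suc (p * s)) (A B : ℕ) (a≡ : p + q ≡ suc A) (b≡ : r + s ≡ suc B) where
    open Concatenation p q r s det

    private
      m n M : ℕ
      m = p + r
      n = q + s
      M = A + B

    N≡2+M : m + n ≡ 2 + M
    N≡2+M = trans N≡ (trans (cong₂ _+_ a≡ b≡) (cong suc (+-suc A B)))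

    private
      open Middle m n coprime-mn M N≡2+M using (lt-mirror; lt-middle)

      set : ∀ {i} → Dec (i ≡ M) → Letter → Letter
      set (yes _) l = slot m n , true
      set (no _)  l = l

      -- the core word of m/n with its middle letter flipped
      g : ℕ → Letter
      g i = set (i ≟ M) (lt m n (2 + i))

      g-≢ : ∀ i → i ≢ M → g i ≡ lt m n (2 + i)
      g-≢ i ne with i ≟ M
      ... | yes e = contradiction e ne
      ... | no _  = refl

      g-M : ∀ i → i ≡ M → g i ≡ (slot m n , true)
      g-M i e with i ≟ M
      ... | yes _ = refl
      ... | no ne = contradiction e ne

      g-palindrome : applyUpTo g (M + suc M) ≡
        applyUpTo (λ i → lt m n (2 + i)) M ++ (slot m n , true) ∷ mirror (applyUpTo (λ i → lt m n (2 + i)) M)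
      g-palindrome = trans (applyUpTo-palindrome g M mir)
        (cong₂ (λ u l → u ++ l ∷ mirror u) (applyUpTo-cong _ _ M (λ i i<M → g-≢ i (<⇒≢ i<M))) (g-M M refl))
        where
        mir : ∀ i j → i < M → i + j ≡ M + M → g j ≡ flip (g i)
        mir i j i<M e = trans (g-≢ j j≢M) (trans (lt-mirror i j (<⇒≢ i<M) e) (cong flip (sym (g-≢ i (<⇒≢ i<M)))))
          where
          j≢M : j ≢ M
          j≢M refl = <⇒≢ i<M (+-cancelʳ-≡ M i M e)

      by-cases : ∀ i (l : Letter) → (2 + i ≢ m + n → lt m n (2 + i) ≡ l) →
                 (2 + i ≡ m + n → l ≡ (proj₁ (lt m n (2 + i)) , true)) → l ≡ g i
      by-cases i l h h' with i ≟ M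
      ... | yes refl = trans (h' (sym N≡2+M)) (cong (λ z → proj₁ z , true) lt-middle)
      ... | no ne    = sym (h (λ e → ne (suc-injective (suc-injective (trans e N≡2+M)))))

      left-letters : ∀ i → i < suc (A + A) → lt p q (2 + i) ≡ g i
      left-letters i i<2a-1 = by-cases i (lt p q (2 + i))
        (λ ne → letter-left ⌊ 2 + i /2⌋ ⌈ 2 + i /2⌉ (s≤s z≤n) (s≤s z≤n) c≤a c'≤a (λ e → ne (trans (sym k≡) e)))
        (λ e → letter-left-middle ⌊ 2 + i /2⌋ ⌈ 2 + i /2⌉ (s≤s z≤n) (s≤s z≤n) c≤a c'≤a (trans k≡ e))
        where
        k≡ = ⌊n/2⌋+⌈n/2⌉≡n (2 + i)
        c'≤a : ⌈ 2 + i /2⌉ ≤ p + q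
        c'≤a = subst (⌈ 2 + i /2⌉ ≤_) (trans (sym (n≡⌈n+n/2⌉ (suc A))) (sym a≡))
          (⌈n/2⌉-mono (≤-trans (s≤s i<2a-1) (≤-reflexive (cong suc (sym (+-suc A A))))))
        c≤a : ⌊ 2 + i /2⌋ ≤ p + q
        c≤a = ≤-trans (⌊n/2⌋≤⌈n/2⌉ (2 + i)) c'≤a

      right-letters : ∀ j → j < B + B → lt r s (1 + j) ≡ g (suc (A + A) + j)
      right-letters j j<2b = by-cases (suc (A + A) + j) (lt r s (1 + j))
        (λ ne → trans eq (letter-right ⌊ 1 + j /2⌋ ⌈ 1 + j /2⌉ 0<k c<b c'<b (λ e → ne (trans (sym k≡) e))))
        (λ e → trans (letter-right-middle ⌊ 1 + j /2⌋ ⌈ 1 + j /2⌉ 0<k c<b c'<b (trans k≡ e)) (cong (λ z → proj₁ z , true) (sym eq)))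
        where
        a = p + q
        key : 2 + (suc (A + A) + j) ≡ a + a + (1 + j)
        key = trans (shuffle A j) (cong (_+ (1 + j)) (sym (cong₂ _+_ a≡ a≡)))
          where
          shuffle : ∀ A j → 2 + (suc (A + A) + j) ≡ suc A + suc A + (1 + j)
          shuffle = ℕ-Solver.solve-∀
        eq : lt m n (2 + (suc (A + A) + j)) ≡ letterAt m n (a + ⌊ 1 + j /2⌋) (a + ⌈ 1 + j /2⌉)
        eq = trans (cong (lt m n) key) (cong₂ (letterAt m n) (⌊double+/2⌋ a (1 + j)) (⌈double+/2⌉ a (1 + j)))
        k≡ : (a + ⌊ 1 + j /2⌋) + (a + ⌈ 1 + j /2⌉) ≡ 2 + (suc (A + A) + j)
        k≡ = trans (shuffle a ⌊ 1 + j /2⌋ ⌈ 1 + j /2⌉) (trans (cong (λ z → a + a + z) (⌊n/2⌋+⌈n/2⌉≡n (1 + j))) (sym key))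
          where
          shuffle : ∀ a x y → (a + x) + (a + y) ≡ a + a + (x + y)
          shuffle = ℕ-Solver.solve-∀
        0<k : 0 < ⌊ 1 + j /2⌋ + ⌈ 1 + j /2⌉
        0<k = subst (0 <_) (sym (⌊n/2⌋+⌈n/2⌉≡n (1 + j))) (s≤s z≤n)
        c'<b : ⌈ 1 + j /2⌉ < r + s
        c'<b = subst (⌈ 1 + j /2⌉ <_) (sym b≡) (s≤s (subst (⌈ 1 + j /2⌉ ≤_) (sym (n≡⌈n+n/2⌉ B)) (⌈n/2⌉-mono j<2b)))
        c<b : ⌊ 1 + j /2⌋ < r + s
        c<b = ≤-<-trans (⌊n/2⌋≤⌈n/2⌉ (1 + j)) c'<b

    leftWord++rightWord : let u = applyUpTo (λ i → lt m n (2 + i)) M in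
      leftWord p q A ++ rightWord r s B ≡ u ++ (slot m n , true) ∷ mirror u
    leftWord++rightWord = trans
      (cong₂ _++_ (applyUpTo-cong _ g (suc (A + A)) left-letters)
                  (applyUpTo-cong _ (λ j → g (suc (A + A) + j)) (B + B) right-letters))
      (trans (sym (applyUpTo-+ g (suc (A + A)) (B + B)))
        (trans (cong (applyUpTo g) (shuffle A B)) g-palindrome))
      where
      shuffle : ∀ A B → suc (A + A) + (B + B) ≡ (A + B) + suc (A + B)
      shuffle = ℕ-Solver.solve-∀

  -- The keys 1, `2N − 1` and `2N` involve an end of γ and are not crossings; the rule for letters
  -- nevertheless returns the three letters of `H` there.
  module Boundary (p q : ℕ) (M : ℕ) (N≡ : suc p + suc q ≡ 2 + M) where
    private
      P Q N : ℕ
      P = suc p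
      Q = suc q
      N = P + Q
      1≤N : 1 ≤ N
      1≤N = s≤s z≤n

    open import Data.Integer using () renaming (_+_ to _+ᶻ_; _*_ to _*ᶻ_; _-_ to _-ᶻ_; -_ to -ᶻ_)

    up-N : up P Q N ≡ Q
    up-N = ℤₚ.+-injective (up-unique P Q 1≤N N (+ Q) (by-≡ (e (+ P) (+ Q)) 0≤+) (by-≡ (e' (+ P) (+ Q)) (≤⇒0≤ 1≤N)))
      where
      e : ∀ P Q → (P +ᶻ Q) *ᶻ Q -ᶻ Q *ᶻ (P +ᶻ Q) ≡ + 0
      e = solve-∀
      e' : ∀ P Q → -ᶻ (+ 1) -ᶻ ((P +ᶻ Q) *ᶻ (Q -ᶻ + 1) -ᶻ Q *ᶻ (P +ᶻ Q)) ≡ (P +ᶻ Q) -ᶻ + 1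
      e' = solve-∀

    up-N-1 : up P Q (suc M) ≡ Q
    up-N-1 = ℤₚ.+-injective (up-unique P Q 1≤N (suc M) (+ Q)
      (by-≡ (trans (e (+ P) (+ Q) (+ suc M)) (cong (λ z → + Q *ᶻ z) N-M)) 0≤Q)
      (by-≡ (trans (e' (+ P) (+ Q) (+ suc M)) (trans (cong (λ z → + P -ᶻ + 1 -ᶻ + Q *ᶻ (z -ᶻ + 1)) N-M) (e₂ (+ p) (+ Q)))) (0≤+ {p})))
      where
      0≤Q : + 0 ℤ.≤ + Q *ᶻ + 1
      0≤Q = by-≡ (ℤₚ.*-identityʳ (+ Q)) 0≤+
      N-M : (+ P +ᶻ + Q) -ᶻ + suc M ≡ + 1
      N-M = trans (cong (λ z → + z -ᶻ + suc M) N≡) (e₃ (+ M))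
        where
        e₃ : ∀ M → (+ 2 +ᶻ M) -ᶻ (+ 1 +ᶻ M) ≡ + 1
        e₃ = solve-∀
      e : ∀ P Q c → (P +ᶻ Q) *ᶻ Q -ᶻ Q *ᶻ c ≡ Q *ᶻ ((P +ᶻ Q) -ᶻ c)
      e = solve-∀
      e' : ∀ P Q c → -ᶻ (+ 1) -ᶻ ((P +ᶻ Q) *ᶻ (Q -ᶻ + 1) -ᶻ Q *ᶻ c) ≡ P -ᶻ + 1 -ᶻ Q *ᶻ (((P +ᶻ Q) -ᶻ c) -ᶻ + 1)
      e' = solve-∀
      e₂ : ∀ p Q → (+ 1 +ᶻ p) -ᶻ + 1 -ᶻ Q *ᶻ (+ 1 -ᶻ + 1) ≡ p
      e₂ = solve-∀

    up-1 : up P Q 1 ≡ 1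
    up-1 = ℤₚ.+-injective (up-unique P Q 1≤N 1 (+ 1)
      (by-≡ (e (+ P) (+ Q)) 0≤+) (by-≡ (e' (+ P) (+ q)) 0≤+))
      where
      e : ∀ P Q → (P +ᶻ Q) *ᶻ + 1 -ᶻ Q *ᶻ + 1 ≡ P
      e = solve-∀
      e' : ∀ P q → -ᶻ (+ 1) -ᶻ ((P +ᶻ (+ 1 +ᶻ q)) *ᶻ (+ 1 -ᶻ + 1) -ᶻ (+ 1 +ᶻ q) *ᶻ + 1) ≡ q
      e' = solve-∀

    lt-1 : lt P Q 1 ≡ (ℓ₂ , true)
    lt-1 = cong₂ _,_ (cong₂ (λ u v → if ⌊ u ≟ v ⌋ then ℓ₃ else ℓ₂) (up-zero P Q) up-1)
      (flag-neg (by-≡ (trans (cong₂ (λ u v → -ᶻ (+ 1) -ᶻ offset P Q (+ u +ᶻ + v -ᶻ + 1) (+ 0 +ᶻ + 1)) (up-zero P Q) up-1) (e' (+ P) (+ q))) 0≤+))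
      where
      e' : ∀ P q → -ᶻ (+ 1) -ᶻ ((P +ᶻ (+ 1 +ᶻ q)) *ᶻ (+ 0 +ᶻ + 1 -ᶻ + 1) -ᶻ (+ 1 +ᶻ q) *ᶻ (+ 0 +ᶻ + 1)) ≡ q
      e' = solve-∀

    private
      k₁≡ : 2 + (M + suc M) ≡ suc M + suc M + 1
      -- The solver needs a universally quantified goal, so the identity is proved for all `M` and
      -- then instantiated.
      k₁≡ = (λ (f : ∀ M → 2 + (M + suc M) ≡ suc M + suc M + 1) → f M) ℕ-Solver.solve-∀
      k₂≡ : 2 + (M + suc M + 1) ≡ (2 + M) + (2 + M) + 0
      k₂≡ = (λ (f : ∀ M → 2 + (M + suc M + 1) ≡ (2 + M) + (2 + M) + 0) → f M) ℕ-Solver.solve-∀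

    lt-2N-1 : lt P Q (2 + (M + suc M)) ≡ (ℓ₃ , true)
    lt-2N-1 = trans (cong (lt P Q) k₁≡) (trans
      (cong₂ (letterAt P Q) (trans (⌊double+/2⌋ (suc M) 1) (+-identityʳ _))
                            (trans (⌈double+/2⌉ (suc M) 1) (trans (+-comm (suc M) 1) (sym N≡))))
      (cong₂ _,_ lab (flag-neg (by-≡ eqn (0≤+ {p})))))
      where
      lab : label P Q (suc M) N ≡ ℓ₃
      lab with suc M ≟ N
      ... | yes e = contradiction (trans e N≡) (<⇒≢ ≤-refl)
      ... | no _ = trans (cong₂ (λ u v → if ⌊ u ≟ v ⌋ then ℓ₃ else ℓ₂) up-N-1 up-N) (dec Q)
        where
        dec : ∀ Q → (if ⌊ Q ≟ Q ⌋ then ℓ₃ else ℓ₂) ≡ ℓ₃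
        dec Q with Q ≟ Q
        ... | yes _ = refl
        ... | no ne = contradiction refl ne
      eqn : -ᶻ (+ 1) -ᶻ dev P Q (suc M) N ≡ + p
      eqn = trans (cong₂ (λ u v → -ᶻ (+ 1) -ᶻ offset P Q (+ u +ᶻ + v -ᶻ + 1) (+ suc M +ᶻ + N)) up-N-1 up-N)
        (trans (cong (λ z → -ᶻ (+ 1) -ᶻ offset P Q (+ Q +ᶻ + Q -ᶻ + 1) z) l≡) (e (+ p) (+ Q)))
        where
        l≡ : + suc M +ᶻ + N ≡ (+ N -ᶻ + 1) +ᶻ + N
        l≡ = cong (_+ᶻ + N) (trans (e₁ (+ M)) (cong (λ z → + z -ᶻ + 1) (sym N≡)))
          where
          e₁ : ∀ M → + 1 +ᶻ M ≡ (+ 2 +ᶻ M) -ᶻ + 1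
          e₁ = solve-∀
        e : ∀ p Q → -ᶻ (+ 1) -ᶻ (((+ 1 +ᶻ p) +ᶻ Q) *ᶻ (Q +ᶻ Q -ᶻ + 1) -ᶻ Q *ᶻ (((+ 1 +ᶻ p) +ᶻ Q -ᶻ + 1) +ᶻ ((+ 1 +ᶻ p) +ᶻ Q))) ≡ p
        e = solve-∀

    lt-2N : lt P Q (2 + (M + suc M + 1)) ≡ (ℓ₁ , true)
    lt-2N = trans (cong (lt P Q) k₂≡) (trans
      (cong₂ (letterAt P Q) (trans (⌊double+/2⌋ (2 + M) 0) (trans (+-identityʳ _) (sym N≡)))
                            (trans (⌈double+/2⌉ (2 + M) 0) (trans (+-identityʳ _) (sym N≡))))
      (cong₂ _,_ lab (flag-neg (by-≡ eqn 0≤+))))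
      where
      lab : label P Q N N ≡ ℓ₁
      lab with N ≟ N
      ... | yes _ = refl
      ... | no ne = contradiction refl ne
      eqn : -ᶻ (+ 1) -ᶻ dev P Q N N ≡ + (p + Q)
      eqn = trans (cong (λ u → -ᶻ (+ 1) -ᶻ offset P Q (+ u +ᶻ + u -ᶻ + 1) (+ N +ᶻ + N)) up-N) (e (+ p) (+ Q))
        where
        e : ∀ p Q → -ᶻ (+ 1) -ᶻ (((+ 1 +ᶻ p) +ᶻ Q) *ᶻ (Q +ᶻ Q -ᶻ + 1) -ᶻ Q *ᶻ (((+ 1 +ᶻ p) +ᶻ Q) +ᶻ ((+ 1 +ᶻ p) +ᶻ Q))) ≡ p +ᶻ Q
        e = solve-∀

    leftWord-core : leftWord P Q (suc M) ≡ coreWord P Q M ++ (ℓ₃ , true) ∷ (ℓ₁ , true) ∷ []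
    leftWord-core = trans (cong (applyUpTo f) (shuffle M)) (trans (applyUpTo-+ f (M + suc M) 2)
      (cong₂ (λ u v → applyUpTo f (M + suc M) ++ u ∷ v ∷ [])
        (trans (cong f (+-identityʳ (M + suc M))) lt-2N-1) lt-2N))
      where
      f : ℕ → Letter
      f i = lt P Q (2 + i)
      shuffle : ∀ M → suc (suc M + suc M) ≡ (M + suc M) + 2
      shuffle = ℕ-Solver.solve-∀

    rightWord-core : rightWord P Q (suc M) ≡ (ℓ₂ , true) ∷ coreWord P Q M
    rightWord-core = cong (_∷ coreWord P Q M) lt-1

-- The segments crossed by γ, indexed by the lines x + y = c.

module SegmentShapes where

  open import Defs
  open Staircases
  open import Data.Bool using (true; false; if_then_else_)
  open import Data.Empty using (⊥-elim)
  open import Data.Integer as ℤ using (ℤ; +_)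
  import Data.Integer.Properties as ℤₚ
  open import Data.Integer.Tactic.RingSolver using (solve-∀)
  open import Data.Nat using (ℕ; zero; suc; z≤n; s≤s; _+_; _*_; _≤_; _<_; _≟_; _∸_)
  open import Data.Nat.Properties
  open import Data.Nat.Coprimality using (Coprime)
  open import Data.Product using (_×_; _,_; proj₁; proj₂)
  open import Data.Sum using (_⊎_; inj₁; inj₂)
  open import Relation.Binary.PropositionalEquality
  open import Relation.Nullary using (yes; no; ¬_; contradiction)
  open import Relation.Nullary.Decidable using (⌊_⌋)
  open import Data.Integer using () renaming (_+_ to _+ᶻ_; _*_ to _*ᶻ_; _-_ to _-ᶻ_; -_ to -ᶻ_)

  <-lower : ∀ {x} → ⌊ x ℤ.<? + 0 ⌋ ≡ true → + 0 ℤ.≤ -ᶻ (+ 1) -ᶻ x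
  <-lower {x} h with 0≤? x
  ... | inj₂ g = g
  ... | inj₁ g = contradiction (trans (sym h) (flag-nonneg g)) λ ()

  pos⇒nonneg : ∀ {x} → + 0 ℤ.≤ x -ᶻ + 1 → + 0 ℤ.≤ x
  pos⇒nonneg {x} h = by-≡ (e x) (0≤-+ h (0≤+ {1}))
    where
    e : ∀ x → x ≡ x -ᶻ + 1 +ᶻ + 1
    e = solve-∀

  neg*pos<0 : ∀ {x y} → + 0 ℤ.≤ -ᶻ (+ 1) -ᶻ x → + 0 ℤ.≤ y -ᶻ + 1 → + 0 ℤ.≤ -ᶻ (+ 1) -ᶻ x *ᶻ y
  neg*pos<0 {x} {y} h g = by-≡ (e x y) (0≤-+ (0≤-* h (pos⇒nonneg g)) g)
    where
    e : ∀ x y → -ᶻ (+ 1) -ᶻ x *ᶻ y ≡ (-ᶻ (+ 1) -ᶻ x) *ᶻ y +ᶻ (y -ᶻ + 1)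
    e = solve-∀

  opposite-signs : ∀ x y → + 0 ℤ.≤ y -ᶻ x → + 0 ℤ.≤ -ᶻ (+ 1) -ᶻ x *ᶻ y →
                   (+ 0 ℤ.≤ -ᶻ (+ 1) -ᶻ x) × (+ 0 ℤ.≤ y -ᶻ + 1)
  opposite-signs x y x≤y xy<0 = x<0 (0≤? x) , y>0 (0≤? (y -ᶻ + 1))
    where
    e : ∀ x y → -ᶻ (+ 1) ≡ (-ᶻ (+ 1) -ᶻ x *ᶻ y) +ᶻ (x *ᶻ x +ᶻ x *ᶻ (y -ᶻ x))
    e = solve-∀
    e' : ∀ x y → -ᶻ (+ 1) ≡ (-ᶻ (+ 1) -ᶻ x *ᶻ y) +ᶻ (-ᶻ (+ 1) -ᶻ (y -ᶻ + 1)) *ᶻ ((-ᶻ (+ 1) -ᶻ (y -ᶻ + 1)) +ᶻ (y -ᶻ x))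
    e' = solve-∀
    x<0 : (+ 0 ℤ.≤ x) ⊎ (+ 0 ℤ.≤ -ᶻ (+ 1) -ᶻ x) → + 0 ℤ.≤ -ᶻ (+ 1) -ᶻ x
    x<0 (inj₂ h) = h
    x<0 (inj₁ h) = ⊥-elim (0≰-1 (by-≡ (e x y) (0≤-+ xy<0 (0≤-+ (0≤-* h h) (0≤-* h x≤y)))))
    y>0 : (+ 0 ℤ.≤ y -ᶻ + 1) ⊎ (+ 0 ℤ.≤ -ᶻ (+ 1) -ᶻ (y -ᶻ + 1)) → + 0 ℤ.≤ y -ᶻ + 1
    y>0 (inj₁ h) = h
    y>0 (inj₂ h) = ⊥-elim (0≰-1 (by-≡ (e' x y) (0≤-+ xy<0 (0≤-* h (0≤-+ h x≤y)))))

  module Shapes (p q : ℕ) (1≤p : 1 ≤ p) (1≤q : 1 ≤ q) (cop : Coprime p q) where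

    1≤N : 1 ≤ p + q
    1≤N = ≤-trans 1≤p (m≤m+n p q)

    Neg Pos : Pt → Set
    Neg z = + 0 ℤ.≤ -ᶻ (+ 1) -ᶻ side p q z
    Pos z = + 0 ℤ.≤ side p q z -ᶻ + 1

    side-offset : ∀ x y → side p q (x , y) ≡ offset p q (+ x) (+ (x + y))
    side-offset x y = e (+ p) (+ q) (+ x) (+ y)
      where
      e : ∀ P Q X Y → (P *ᶻ X) -ᶻ (Q *ᶻ Y) ≡ (P +ᶻ Q) *ᶻ X -ᶻ Q *ᶻ (X +ᶻ Y)
      e = solve-∀

    -- The segment crossed between the lines x + y = c and x + y = c′.
    data Shape : ℕ → ℕ → Seg → Set where
      diag  : ∀ m n → Neg (m , suc n) → Pos (suc m , n) → m < q → n < p →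
              Shape (suc (m + n)) (suc (m + n)) (seg ℓ₁ (m , suc n) (suc m , n))
      horiz : ∀ m n → Neg (m , suc n) → Pos (suc m , suc n) → m < q → suc n ≤ p →
              Shape (suc (m + n)) (suc (suc (m + n))) (seg ℓ₃ (m , suc n) (suc m , suc n))
      vert  : ∀ m n → Pos (suc m , n) → Neg (suc m , suc n) → suc m ≤ q → n < p →
              Shape (suc (m + n)) (suc (suc (m + n))) (seg ℓ₂ (suc m , n) (suc m , suc n))

    private
      Q : ℤ
      Q = + q
      P : ℤ
      P = + p

    neg-up : ∀ m n → Neg (m , n) → Neg (m , suc n)
    neg-up m n h = by-≡ (e P Q (+ m) (+ n)) (0≤-+ h (0≤+ {q}))
      where
      e : ∀ P Q m n → -ᶻ (+ 1) -ᶻ (P *ᶻ m -ᶻ Q *ᶻ (+ 1 +ᶻ n)) ≡ -ᶻ (+ 1) -ᶻ (P *ᶻ m -ᶻ Q *ᶻ n) +ᶻ Q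
      e = solve-∀

    neg-left : ∀ m n → Neg (suc m , n) → Neg (m , n)
    neg-left m n h = by-≡ (e P Q (+ m) (+ n)) (0≤-+ h (0≤+ {p}))
      where
      e : ∀ P Q m n → -ᶻ (+ 1) -ᶻ (P *ᶻ m -ᶻ Q *ᶻ n) ≡ -ᶻ (+ 1) -ᶻ (P *ᶻ (+ 1 +ᶻ m) -ᶻ Q *ᶻ n) +ᶻ P
      e = solve-∀

    pos-down : ∀ m n → Pos (m , suc n) → Pos (m , n)
    pos-down m n h = by-≡ (e P Q (+ m) (+ n)) (0≤-+ h (0≤+ {q}))
      where
      e : ∀ P Q m n → (P *ᶻ m -ᶻ Q *ᶻ n) -ᶻ + 1 ≡ (P *ᶻ m -ᶻ Q *ᶻ (+ 1 +ᶻ n)) -ᶻ + 1 +ᶻ Q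
      e = solve-∀

    pos-right : ∀ m n → Pos (m , n) → Pos (suc m , n)
    pos-right m n h = by-≡ (e P Q (+ m) (+ n)) (0≤-+ h (0≤+ {p}))
      where
      e : ∀ P Q m n → (P *ᶻ (+ 1 +ᶻ m) -ᶻ Q *ᶻ n) -ᶻ + 1 ≡ (P *ᶻ m -ᶻ Q *ᶻ n) -ᶻ + 1 +ᶻ P
      e = solve-∀

    up≡ : ∀ m n → Neg (m , suc n) → Pos (suc m , n) → up p q (suc (m + n)) ≡ suc m
    up≡ m n h g = ℤₚ.+-injective (up-unique p q 1≤N (suc (m + n)) (+ suc m)
      (by-≡ (sym (side-offset (suc m) n)) (pos⇒nonneg g))
      (by-≡ (trans (e P Q (+ m) (+ n)) refl) h))
      where
      e : ∀ P Q m n → -ᶻ (+ 1) -ᶻ ((P +ᶻ Q) *ᶻ (+ 1 +ᶻ m -ᶻ + 1) -ᶻ Q *ᶻ (+ 1 +ᶻ (m +ᶻ n))) ≡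
                      -ᶻ (+ 1) -ᶻ (P *ᶻ m -ᶻ Q *ᶻ (+ 1 +ᶻ n))
      e = solve-∀

    -- The two lattice points on `x + y = c` next to γ: `(m, suc n)` on its left and `(suc m, n)` on
    -- its right.
    record At (c : ℕ) : Set where
      constructor mkAt
      field
        m n : ℕ
        c≡ : c ≡ suc (m + n)
        u≡ : up p q c ≡ suc m
        neg : Neg (m , suc n)
        pos : Pos (suc m , n)
        m<q : m < q
        n<p : n < p

    private
      ℕ-from : ∀ {a b} → ¬ (+ 0 ℤ.≤ + b -ᶻ + a) → b < a
      ℕ-from {a} {b} h = ≰⇒> λ a≤b → h (≤⇒0≤ a≤b)

    -- `up` alone gives a nonnegative offset on the right; coprimality makes it positive. The
    -- remaining bounds keep both points inside the rectangle spanned by γ.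
    at : ∀ c → 0 < c → c < p + q → At c
    at c 0<c c<N with up p q c in u | up-spec p q 1≤N c
    ... | zero | (h , _) = ⊥-elim (0≰-1 (by-≡ (e P Q (+ c)) (0≤-+ (0≤-+ h (0≤-* (≤⇒0≤ 1≤q) (0≤+ {c}))) (≤⇒0≤ 0<c))))
      where
      e : ∀ P Q c → -ᶻ (+ 1) ≡ ((P +ᶻ Q) *ᶻ + 0 -ᶻ Q *ᶻ c) +ᶻ (Q -ᶻ + 1) *ᶻ c +ᶻ (c -ᶻ + 1)
      e = solve-∀
    ... | suc m | (h , h') = mkAt m n c≡ u neg pos m<q n<p
      where
      m<c : m < c
      m<c = ℕ-from λ c≤m → 0≰-1 (by-≡ (e P Q (+ m) (+ c)) (0≤-+ (0≤-+ h' (0≤-* (0≤+ {p + q}) c≤m)) (0≤-* (0≤+ {p}) (0≤+ {c}))))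
        where
        e : ∀ P Q m c → -ᶻ (+ 1) ≡ (-ᶻ (+ 1) -ᶻ ((P +ᶻ Q) *ᶻ (+ 1 +ᶻ m -ᶻ + 1) -ᶻ Q *ᶻ c)) +ᶻ (P +ᶻ Q) *ᶻ (m -ᶻ c) +ᶻ P *ᶻ c
        e = solve-∀
      n = c ∸ suc m
      c≡ : c ≡ suc (m + n)
      c≡ = sym (m+[n∸m]≡n m<c)
      neg : Neg (m , suc n)
      neg = by-≡ (trans (e P Q (+ m) (+ n)) (cong (λ z → -ᶻ (+ 1) -ᶻ offset p q (+ suc m -ᶻ + 1) (+ z)) (sym c≡))) h'
        where
        e : ∀ P Q m n → -ᶻ (+ 1) -ᶻ (P *ᶻ m -ᶻ Q *ᶻ (+ 1 +ᶻ n)) ≡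
                        -ᶻ (+ 1) -ᶻ ((P +ᶻ Q) *ᶻ (+ 1 +ᶻ m -ᶻ + 1) -ᶻ Q *ᶻ (+ 1 +ᶻ (m +ᶻ n)))
        e = solve-∀
      positive : ∀ x → + 0 ℤ.≤ x → x ≢ + 0 → + 0 ℤ.≤ x -ᶻ + 1
      positive (+ zero) _ ne = contradiction refl ne
      positive (+ suc k) _ _ = ≤⇒0≤ (s≤s z≤n)
      pos : Pos (suc m , n)
      pos = by-≡ (cong (_-ᶻ + 1) (trans (side-offset (suc m) n) (cong (λ z → offset p q (+ suc m) (+ z)) (sym c≡))))
        (positive _ h (offset≢0 p q cop (suc m) c 0<c c<N))
      m<q : m < q
      m<q = ℕ-from λ q≤m → 0≰-1 (by-≡ (e P Q (+ m) (+ n))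
        (0≤-+ (0≤-+ (0≤-+ (0≤-+ neg (0≤-* (0≤+ {q}) (<⇒0≤ (subst (_< p + q) c≡ c<N)))) (0≤-* (0≤+ {p}) q≤m)) (0≤-* (0≤+ {q}) q≤m)) (0≤+ {q})))
        where
        e : ∀ P Q m n → -ᶻ (+ 1) ≡ (-ᶻ (+ 1) -ᶻ (P *ᶻ m -ᶻ Q *ᶻ (+ 1 +ᶻ n))) +ᶻ Q *ᶻ ((P +ᶻ Q) -ᶻ (+ 1 +ᶻ (+ 1 +ᶻ (m +ᶻ n))))
                          +ᶻ P *ᶻ (m -ᶻ Q) +ᶻ Q *ᶻ (m -ᶻ Q) +ᶻ Q
        e = solve-∀
      n<p : n < p
      n<p = ℕ-from λ p≤n → 0≰-1 (by-≡ (e P Q (+ m) (+ n))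
        (0≤-+ (0≤-+ pos (0≤-* (0≤+ {p}) (<⇒0≤ m<q))) (0≤-* (0≤+ {q}) p≤n)))
        where
        e : ∀ P Q m n → -ᶻ (+ 1) ≡ ((P *ᶻ (+ 1 +ᶻ m) -ᶻ Q *ᶻ n) -ᶻ + 1) +ᶻ P *ᶻ (Q -ᶻ (+ 1 +ᶻ m)) +ᶻ Q *ᶻ (n -ᶻ P)
        e = solve-∀

    ≟-true : ∀ {a b} → a ≡ b → ⌊ a ≟ b ⌋ ≡ true
    ≟-true {a} {b} e with a ≟ b
    ... | yes _ = refl
    ... | no ne = contradiction e ne

    ≟-false : ∀ {a b} → a ≢ b → ⌊ a ≟ b ⌋ ≡ false
    ≟-false {a} {b} ne with a ≟ b
    ... | yes e = contradiction e ne
    ... | no _ = refl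

    opaque
      -- The truncated subtractions are exact for `0 < c < p + q`, where `0 < up p q c ≤ c`; the
      -- values outside that range are arbitrary.
      segAt : ℕ → ℕ → Seg
      segAt c c' = let m = up p q c ∸ 1 ; n = c ∸ up p q c in
        if ⌊ c ≟ c' ⌋ then seg ℓ₁ (m , suc n) (suc m , n)
        else (if ⌊ up p q c ≟ up p q c' ⌋ then seg ℓ₃ (m , suc n) (suc m , suc n)
                                          else seg ℓ₂ (suc m , n) (suc m , suc n))

    opaque
      unfolding segAt

      segAt-diag : ∀ m n c → c ≡ suc (m + n) → up p q c ≡ suc m → segAt c c ≡ seg ℓ₁ (m , suc n) (suc m , n)
      segAt-diag m n c refl u rewrite ≟-true {c} refl | u | m+n∸m≡n m n = refl

      segAt-horiz : ∀ m n c → c ≡ suc (m + n) → up p q c ≡ suc m → up p q (suc c) ≡ suc m →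
                    segAt c (suc c) ≡ seg ℓ₃ (m , suc n) (suc m , suc n)
      segAt-horiz m n c refl u u' rewrite ≟-false (<⇒≢ (n<1+n c)) | u | u' | ≟-true {suc m} refl | m+n∸m≡n m n = refl

      segAt-vert : ∀ m n c → c ≡ suc (m + n) → up p q c ≡ suc m → up p q (suc c) ≡ suc (suc m) →
                   segAt c (suc c) ≡ seg ℓ₂ (suc m , n) (suc m , suc n)
      segAt-vert m n c refl u u' rewrite ≟-false (<⇒≢ (n<1+n c)) | u | u' | ≟-false {suc m} {suc (suc m)} (λ ()) | m+n∸m≡n m n = refl

    up-horiz : ∀ m n → Neg (m , suc n) → Pos (suc m , suc n) →
               (up p q (suc (m + n)) ≡ suc m) × (up p q (suc (suc (m + n))) ≡ suc m)
    up-horiz m n h g = up≡ m n h (pos-down (suc m) n g)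
      , trans (cong (λ z → up p q (suc z)) (sym (+-suc m n))) (up≡ m (suc n) (neg-up m (suc n) h) g)

    up-vert : ∀ m n → Pos (suc m , n) → Neg (suc m , suc n) →
              (up p q (suc (m + n)) ≡ suc m) × (up p q (suc (suc (m + n))) ≡ suc (suc m))
    up-vert m n g h = up≡ m n (neg-left m (suc n) h) g , up≡ (suc m) n h (pos-right (suc m) n g)

    -- Crossed segments with the same pair `(c, c')` coincide, so the pair can serve as a sorting
    -- key.
    shape⇒segAt : ∀ {c c' s} → Shape c c' s → segAt c c' ≡ s
    shape⇒segAt (diag m n h g _ _) = segAt-diag m n _ refl (up≡ m n h g)
    shape⇒segAt (horiz m n h g _ _) = segAt-horiz m n _ refl (proj₁ (up-horiz m n h g)) (proj₂ (up-horiz m n h g))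
    shape⇒segAt (vert m n g h _ _) = segAt-vert m n _ refl (proj₁ (up-vert m n g h)) (proj₂ (up-vert m n g h))

    -- From `c` to `c + 1` the abscissa `up` either stays, and γ crosses a horizontal edge, or grows
    -- by one, and γ crosses a vertical edge.
    shape : ∀ c c' → 0 < c → c' < p + q → c ≡ c' ⊎ c' ≡ suc c → Shape c c' (segAt c c')
    shape c .c 0<c c<N (inj₁ refl) with at c 0<c c<N
    ... | mkAt m n refl u neg pos m<q n<p =
      subst (Shape _ _) (sym (segAt-diag m n _ refl u)) (diag m n neg pos m<q n<p)
    shape c .(suc c) 0<c c'<N (inj₂ refl) with at c 0<c (<-trans (n<1+n c) c'<N) | at (suc c) (s≤s z≤n) c'<N | up-step p q c
    ... | mkAt m n refl u neg pos m<q n<p | mkAt m' n' c≡' u' neg' pos' m<q' n<p' | inj₁ st =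
      subst (Shape _ _) (sym (segAt-horiz m n _ refl u (trans st u)))
        (horiz m n neg (subst₂ (λ x y → Pos (suc x , y)) m'≡m n'≡ pos') m<q (subst (_≤ p) n'≡ (<⇒≤ n<p')))
      where
      m'≡m : m' ≡ m
      m'≡m = suc-injective (trans (sym u') (trans st u))
      n'≡ : n' ≡ suc n
      n'≡ = +-cancelˡ-≡ m n' (suc n) (trans (cong (_+ n') (sym m'≡m)) (trans (suc-injective (sym c≡')) (sym (+-suc m n))))
    ... | mkAt m n refl u neg pos m<q n<p | mkAt m' n' c≡' u' neg' pos' m<q' n<p' | inj₂ st =
      subst (Shape _ _) (sym (segAt-vert m n _ refl u (trans st (cong suc u))))
        (vert m n pos (subst₂ (λ x y → Neg (x , suc y)) m'≡ n'≡ neg') m<q n<p)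
      where
      m'≡ : m' ≡ suc m
      m'≡ = suc-injective (trans (sym u') (trans st (cong suc u)))
      n'≡ : n' ≡ n
      n'≡ = +-cancelˡ-≡ (suc m) n' n (trans (cong (_+ n') (sym m'≡)) (suc-injective (sym c≡')))

-- Crossings occur along γ in the order of x + y.

module CrossingOrder where

  open import Defs
  open Staircases
  open SegmentShapes
  open import Data.Bool using (Bool; true; false; if_then_else_; T)
  import Data.Bool.Properties as Boolₚ
  open import Data.Empty using (⊥; ⊥-elim)
  open import Data.Integer as ℤ using (ℤ; +_)
  import Data.Integer.Properties as ℤₚ
  open import Data.Integer.Tactic.RingSolver using (solve-∀)
  open import Data.List using (List; []; _∷_; upTo; concatMap; foldr; filterᵇ)
  open import Data.List.Membership.Propositional using (_∈_; find; lose)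
  open import Data.List.Membership.Propositional.Properties
  open import Data.List.Relation.Unary.All as All using (All; []; _∷_)
  import Data.List.Relation.Unary.All.Properties as Allₚ
  open import Data.List.Relation.Unary.AllPairs as AllPairs using (AllPairs; []; _∷_)
  import Data.List.Relation.Unary.AllPairs.Properties as AllPairsₚ
  open import Data.List.Relation.Unary.Any using (here; there)
  open import Data.List.Relation.Unary.Unique.Propositional using (Unique)
  import Data.List.Relation.Unary.Unique.Propositional.Properties as Uniqueₚ
  open import Data.Nat using (ℕ; zero; suc; z≤n; s≤s; _+_; _*_; _≤_; _<_; _≟_; _<ᵇ_; pred; s≤s⁻¹)
  open import Data.Nat.Properties
  open import Data.Nat.Coprimality using (Coprime)
  open import Data.Product using (_×_; _,_; proj₁; proj₂; ∃)
  open import Data.Sum using (_⊎_; inj₁; inj₂)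
  open import Data.Unit using (tt)
  open import Relation.Binary.PropositionalEquality
  open import Relation.Nullary using (yes; no; ¬_; contradiction)
  open import Data.Integer using () renaming (_+_ to _+ᶻ_; _*_ to _*ᶻ_; _-_ to _-ᶻ_; -_ to -ᶻ_)

  -- The retraction `π` recovers the index from an element, which makes the blocks `f x` disjoint.
  concatMap-unique : ∀ {A B : Set} (f : A → List B) (π : B → A) →
    (∀ x {y} → y ∈ f x → π y ≡ x) → (∀ x → Unique (f x)) → ∀ {xs} → Unique xs → Unique (concatMap f xs)
  concatMap-unique f π h u {xs} uxs = Uniqueₚ.concat⁺
    (Allₚ.map⁺ (All.universal u xs))
    (AllPairsₚ.map⁺ (AllPairs.map (λ {x} {y} x≢y {v} (v∈x , v∈y) → x≢y (trans (sym (h x v∈x)) (h y v∈y))) uxs))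

  data InCell (p q m n : ℕ) : Seg → Set where
    horizontal : m < q → InCell p q m n (seg ℓ₃ (m , n) (suc m , n))
    vertical   : n < p → InCell p q m n (seg ℓ₂ (m , n) (m , suc n))
    diagonal   : m < q → n < p → InCell p q m n (seg ℓ₁ (m , suc n) (suc m , n))

  <ᵇ-true : ∀ {m n} → (m <ᵇ n) ≡ true → m < n
  <ᵇ-true {m} {n} h = <ᵇ⇒< m n (subst T (sym h) tt)

  <⇒<ᵇ-true : ∀ {m n} → m < n → (m <ᵇ n) ≡ true
  <⇒<ᵇ-true h = Boolₚ.T-≡ .Function.Bundles.Equivalence.to (<⇒<ᵇ h)
    where import Function.Bundles

  ∈-cellSegs⁻ : ∀ p q m n {s} → s ∈ cellSegs p q m n → InCell p q m n s
  ∈-cellSegs⁻ p q m n s∈ with m <ᵇ q in hm | n <ᵇ p in hn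
  ∈-cellSegs⁻ p q m n (here refl) | true | true = horizontal (<ᵇ-true hm)
  ∈-cellSegs⁻ p q m n (there (here refl)) | true | true = vertical (<ᵇ-true hn)
  ∈-cellSegs⁻ p q m n (there (there (here refl))) | true | true = diagonal (<ᵇ-true hm) (<ᵇ-true hn)
  ∈-cellSegs⁻ p q m n (here refl) | true | false = horizontal (<ᵇ-true hm)
  ∈-cellSegs⁻ p q m n (here refl) | false | true = vertical (<ᵇ-true hn)

  ∈-cellSegs⁺ : ∀ p q m n {s} → InCell p q m n s → s ∈ cellSegs p q m n
  ∈-cellSegs⁺ p q m n (horizontal h) rewrite <⇒<ᵇ-true h = here refl
  ∈-cellSegs⁺ p q m n (vertical g) rewrite <⇒<ᵇ-true g with m <ᵇ q
  ... | true  = there (here refl)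
  ... | false = here refl
  ∈-cellSegs⁺ p q m n (diagonal h g) rewrite <⇒<ᵇ-true h | <⇒<ᵇ-true g = there (there (here refl))

  cellSegs-unique : ∀ p q m n → Unique (cellSegs p q m n)
  cellSegs-unique p q m n with m <ᵇ q | n <ᵇ p
  ... | true  | true  = ((λ ()) ∷ (λ ()) ∷ []) ∷ ((λ ()) ∷ []) ∷ [] ∷ []
  ... | true  | false = [] ∷ []
  ... | false | true  = [] ∷ []
  ... | false | false = []

  column row : Seg → ℕ
  column s = proj₁ (A s)
  -- A diagonal stores its upper left corner first, one row above the corner that names its cell.
  row (seg ℓ₁ (_ , y) _) = pred y
  row (seg ℓ₂ (_ , y) _) = y
  row (seg ℓ₃ (_ , y) _) = y

  InCell-column : ∀ {p q m n s} → InCell p q m n s → column s ≡ m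
  InCell-column (horizontal _) = refl
  InCell-column (vertical _) = refl
  InCell-column (diagonal _ _) = refl

  InCell-row : ∀ {p q m n s} → InCell p q m n s → row s ≡ n
  InCell-row (horizontal _) = refl
  InCell-row (vertical _) = refl
  InCell-row (diagonal _ _) = refl

  ∈-columnSegs⁻ : ∀ p q m {s} → s ∈ concatMap (λ n → cellSegs p q m n) (upTo (suc p)) →
    ∃ λ n → n ≤ p × InCell p q m n s
  ∈-columnSegs⁻ p q m s∈ with find (∈-concatMap⁻ (λ n → cellSegs p q m n) {xs = upTo (suc p)} s∈)
  ... | n , n∈ , s∈' = n , s≤s⁻¹ (∈-upTo⁻ n∈) , ∈-cellSegs⁻ p q m n s∈'

  ∈-allSegs⁻ : ∀ p q {s} → s ∈ allSegs p q → ∃ λ m → ∃ λ n → m ≤ q × n ≤ p × InCell p q m n s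
  ∈-allSegs⁻ p q s∈ with find (∈-concatMap⁻ (λ m → concatMap (λ n → cellSegs p q m n) (upTo (suc p))) {xs = upTo (suc q)} s∈)
  ... | m , m∈ , s∈' with ∈-columnSegs⁻ p q m s∈'
  ...   | n , n≤p , c = m , n , s≤s⁻¹ (∈-upTo⁻ m∈) , n≤p , c

  ∈-allSegs⁺ : ∀ p q {m n s} → m ≤ q → n ≤ p → InCell p q m n s → s ∈ allSegs p q
  ∈-allSegs⁺ p q {m} {n} m≤q n≤p c = ∈-concatMap⁺ (λ m → concatMap (λ n → cellSegs p q m n) (upTo (suc p)))
    (lose (∈-upTo⁺ (s≤s m≤q)) (∈-concatMap⁺ (λ n → cellSegs p q m n) (lose (∈-upTo⁺ (s≤s n≤p)) (∈-cellSegs⁺ p q m n c))))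

  allSegs-unique : ∀ p q → Unique (allSegs p q)
  allSegs-unique p q = concatMap-unique _ column
    (λ m s∈ → InCell-column (proj₂ (proj₂ (∈-columnSegs⁻ p q m s∈))))
    (λ m → concatMap-unique (λ n → cellSegs p q m n) row (λ n s∈ → InCell-row (∈-cellSegs⁻ p q m n s∈))
             (cellSegs-unique p q m) (Uniqueₚ.upTo⁺ (suc p)))
    (Uniqueₚ.upTo⁺ (suc q))

  foldr-filter : ∀ {A : Set} (f : A → Bool) xs →
    foldr (λ s acc → if f s then s ∷ acc else acc) [] xs ≡ filterᵇ f xs
  foldr-filter f [] = refl
  foldr-filter f (x ∷ xs) with f x
  ... | true  = cong (x ∷_) (foldr-filter f xs)
  ... | false = foldr-filter f xs

  module Sorting (p q : ℕ) (1≤p : 1 ≤ p) (1≤q : 1 ≤ q) (cop : Coprime p q) where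
    open Shapes p q 1≤p 1≤q cop

    Crossing : Seg → Set
    Crossing s = ∃ λ c → ∃ λ c' → Shape c c' s × 0 < c × c' < p + q

    private
      Q P : ℤ
      Q = + q
      P = + p

      side-end : ∀ {x y} → x ≡ q → y ≡ p → side p q (x , y) ≡ + 0
      side-end refl refl = trans (cong (λ z → z -ᶻ Q *ᶻ P) (ℤₚ.*-comm P Q)) (ℤₚ.+-inverseʳ (Q *ᶻ P))

      neg-irrefl : ∀ {z} → side p q z ≡ + 0 → Neg z → ⊥
      neg-irrefl e h = 0≰-1 (by-≡ (sym (cong (λ t → -ᶻ (+ 1) -ᶻ t) e)) h)

      pos-irrefl : ∀ {z} → side p q z ≡ + 0 → Pos z → ⊥
      pos-irrefl e h = 0≰-1 (by-≡ (sym (cong (λ t → t -ᶻ + 1) e)) h)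

      corner : ∀ x y → x ≤ q → y ≤ p → ¬ (x ≡ q × y ≡ p) → x + y < p + q
      corner x y x≤q y≤p ne with x ≟ q
      ... | no x≢q = subst (x + y <_) (+-comm q p) (+-mono-<-≤ (≤∧≢⇒< x≤q x≢q) y≤p)
      ... | yes refl = subst (x + y <_) (+-comm x p) (+-monoʳ-< x (≤∧≢⇒< y≤p (λ y≡p → ne (refl , y≡p))))

    -- Segments on the axes are excluded because no point `(m, 0)` is left of γ and no point
    -- `(0, n)` is right of it; segments ending at `(q, p)` are excluded because that point lies on
    -- γ.
    crossing : ∀ {s} → s ∈ allSegs p q → crossesᵇ p q s ≡ true → Crossing s
    crossing {s} s∈ cr with ∈-allSegs⁻ p q s∈
    ... | m , n , m≤q , n≤p , horizontal m<q = go n n≤p (proj₁ signs) (proj₂ signs)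
      where
      e : ∀ P Q m n → (P *ᶻ (+ 1 +ᶻ m) -ᶻ Q *ᶻ n) -ᶻ (P *ᶻ m -ᶻ Q *ᶻ n) ≡ P
      e = solve-∀
      e° : ∀ P Q m → -ᶻ (+ 1) ≡ (-ᶻ (+ 1) -ᶻ (P *ᶻ m -ᶻ Q *ᶻ + 0)) +ᶻ P *ᶻ m
      e° = solve-∀
      signs = opposite-signs (side p q (m , n)) (side p q (suc m , n)) (by-≡ (e P Q (+ m) (+ n)) 0≤+) (<-lower cr)
      go : ∀ n → n ≤ p → Neg (m , n) → Pos (suc m , n) → Crossing (seg ℓ₃ (m , n) (suc m , n))
      go zero _ h g = ⊥-elim (0≰-1 (by-≡ (e° P Q (+ m)) (0≤-+ h (0≤-* (0≤+ {p}) (0≤+ {m})))))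
      go (suc n) n≤p h g = _ , _ , horiz m n h g m<q n≤p , s≤s z≤n
        , subst (_< p + q) (cong suc (+-suc m n)) (corner (suc m) (suc n) m<q n≤p (λ (x , y) → pos-irrefl (side-end x y) g))
    ... | m , n , m≤q , n≤p , vertical n<p = go m m≤q (proj₁ signs) (proj₂ signs)
      where
      e : ∀ P Q m n → (P *ᶻ m -ᶻ Q *ᶻ n) -ᶻ (P *ᶻ m -ᶻ Q *ᶻ (+ 1 +ᶻ n)) ≡ Q
      e = solve-∀
      e° : ∀ P Q n → -ᶻ (+ 1) ≡ ((P *ᶻ + 0 -ᶻ Q *ᶻ n) -ᶻ + 1) +ᶻ Q *ᶻ n
      e° = solve-∀
      signs = opposite-signs (side p q (m , suc n)) (side p q (m , n)) (by-≡ (e P Q (+ m) (+ n)) 0≤+)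
        (subst (λ z → + 0 ℤ.≤ -ᶻ (+ 1) -ᶻ z) (ℤₚ.*-comm (side p q (m , n)) (side p q (m , suc n))) (<-lower cr))
      go : ∀ m → m ≤ q → Neg (m , suc n) → Pos (m , n) → Crossing (seg ℓ₂ (m , n) (m , suc n))
      go zero _ h g = ⊥-elim (0≰-1 (by-≡ (e° P Q (+ n)) (0≤-+ g (0≤-* (0≤+ {q}) (0≤+ {n})))))
      go (suc m) m≤q h g = _ , _ , vert m n g h m≤q n<p , s≤s z≤n
        , subst (_< p + q) (cong suc (+-suc m n)) (corner (suc m) (suc n) m≤q n<p (λ (x , y) → neg-irrefl (side-end x y) h))
    ... | m , n , m≤q , n≤p , diagonal m<q n<p = _ , _ , diag m n (proj₁ signs) (proj₂ signs) m<q n<p , s≤s z≤n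
        , subst (suc (m + n) <_) (+-comm q p) (+-mono-≤-< m<q n<p)
      where
      e : ∀ P Q m n → (P *ᶻ (+ 1 +ᶻ m) -ᶻ Q *ᶻ n) -ᶻ (P *ᶻ m -ᶻ Q *ᶻ (+ 1 +ᶻ n)) ≡ P +ᶻ Q
      e = solve-∀
      signs = opposite-signs (side p q (m , suc n)) (side p q (suc m , n)) (by-≡ (e P Q (+ m) (+ n)) 0≤+) (<-lower cr)

    rank : Pt → ℕ
    rank (x , y) = x + y

    key : Seg → ℕ
    key s = rank (A s) + rank (B s)

    -- Uniform access to the two endpoints: a vertical edge stores its right endpoint first, the
    -- other two kinds their left one.
    record Ends (c c' : ℕ) (s : Seg) : Set where
      field
        L R : Pt
        left≡ : leftPt p q s ≡ L
        right≡ : rightPt p q s ≡ R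
        negative : Neg L
        positive : Pos R
        ranks : (rank L ≡ c × rank R ≡ c') ⊎ (rank L ≡ c' × rank R ≡ c)
        close : c ≡ c' ⊎ c' ≡ suc c

    private
      leftPt-A : ∀ {l} z w → Neg z → leftPt p q (seg l z w) ≡ z
      leftPt-A z w h = cong (λ b → if b then z else w) (flag-neg {side p q z} h)

      rightPt-B : ∀ {l} z w → Neg z → rightPt p q (seg l z w) ≡ w
      rightPt-B z w h = cong (λ b → if b then w else z) (flag-neg {side p q z} h)

      leftPt-B : ∀ {l} z w → Pos z → leftPt p q (seg l z w) ≡ w
      leftPt-B z w h = cong (λ b → if b then z else w) (flag-nonneg {side p q z} (pos⇒nonneg h))

      rightPt-A : ∀ {l} z w → Pos z → rightPt p q (seg l z w) ≡ z
      rightPt-A z w h = cong (λ b → if b then w else z) (flag-nonneg {side p q z} (pos⇒nonneg h))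

    ends : ∀ {c c' s} → Shape c c' s → Ends c c' s
    ends (diag m n h g _ _) = record { left≡ = leftPt-A {ℓ₁} _ _ h ; right≡ = rightPt-B {ℓ₁} _ _ h ; negative = h ; positive = g
      ; ranks = inj₁ (+-suc m n , refl) ; close = inj₁ refl }
    ends (horiz m n h g _ _) = record { left≡ = leftPt-A {ℓ₃} _ _ h ; right≡ = rightPt-B {ℓ₃} _ _ h ; negative = h ; positive = g
      ; ranks = inj₁ (+-suc m n , cong suc (+-suc m n)) ; close = inj₂ refl }
    ends (vert m n g h _ _) = record { left≡ = leftPt-B {ℓ₂} _ _ g ; right≡ = rightPt-A {ℓ₂} _ _ g ; negative = h ; positive = g
      ; ranks = inj₂ (cong suc (+-suc m n) , refl) ; close = inj₂ refl }

    key-shape : ∀ {c c' s} → Shape c c' s → key s ≡ c + c'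
    key-shape (diag m n _ _ _ _) = cong (_+ suc (m + n)) (+-suc m n)
    key-shape (horiz m n _ _ _ _) = cong₂ _+_ (+-suc m n) (cong suc (+-suc m n))
    key-shape (vert m n _ _ _ _) = cong (λ z → suc (m + n) + z) (cong suc (+-suc m n))

    private
      weight : Pt → Pt → ℤ
      weight z w = + rank z *ᶻ side p q w -ᶻ side p q z *ᶻ + rank w

      gap : Pt → Pt → ℤ
      gap z w = side p q w -ᶻ side p q z

      -- Along γ the coordinate used to order the crossings is proportional to x + y.
      along-rank : ∀ z w → (P +ᶻ Q) *ᶻ (along p q z *ᶻ side p q w -ᶻ side p q z *ᶻ along p q w) ≡
                           (P *ᶻ P +ᶻ Q *ᶻ Q) *ᶻ weight z w
      along-rank (x , y) (x' , y') = e P Q (+ x) (+ y) (+ x') (+ y')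
        where
        e : ∀ P Q x y x' y' →
          (P +ᶻ Q) *ᶻ ((Q *ᶻ x +ᶻ P *ᶻ y) *ᶻ (P *ᶻ x' -ᶻ Q *ᶻ y') -ᶻ (P *ᶻ x -ᶻ Q *ᶻ y) *ᶻ (Q *ᶻ x' +ᶻ P *ᶻ y')) ≡
          (P *ᶻ P +ᶻ Q *ᶻ Q) *ᶻ ((x +ᶻ y) *ᶻ (P *ᶻ x' -ᶻ Q *ᶻ y') -ᶻ (P *ᶻ x -ᶻ Q *ᶻ y) *ᶻ (x' +ᶻ y'))
        e = solve-∀

      module Bounds {c c' s} (E : Ends c c' s) where
        open Ends E
        D : ℤ
        D = gap L R
        x : ℤ
        x = weight L R

        D>0 : + 0 ℤ.≤ D -ᶻ + 1
        D>0 = by-≡ (e (side p q L) (side p q R)) (0≤-+ (0≤-+ negative positive) (0≤+ {1}))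
          where
          e : ∀ l r → r -ᶻ l -ᶻ + 1 ≡ (-ᶻ (+ 1) -ᶻ l) +ᶻ (r -ᶻ + 1) +ᶻ + 1
          e = solve-∀

        -- `x / D` is the value of `x + y` at the crossing, which lies between `c` and `c'`. For an
        -- edge the slack `c' − c = 1` records, in integers, that it lies strictly between them.
        bounds : (+ 0 ℤ.≤ x -ᶻ + c *ᶻ D -ᶻ (+ c' -ᶻ + c)) × (+ 0 ℤ.≤ + c' *ᶻ D -ᶻ x -ᶻ (+ c' -ᶻ + c))
        bounds = go close ranks
          where
          l = side p q L
          r = side p q R
          X : ℕ → ℕ → ℤ
          X a b = + a *ᶻ r -ᶻ l *ᶻ + b
          e₁ : ∀ c l r → c *ᶻ r -ᶻ l *ᶻ c -ᶻ c *ᶻ (r -ᶻ l) -ᶻ (c -ᶻ c) ≡ + 0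
          e₁ = solve-∀
          e₂ : ∀ c l r → c *ᶻ (r -ᶻ l) -ᶻ (c *ᶻ r -ᶻ l *ᶻ c) -ᶻ (c -ᶻ c) ≡ + 0
          e₂ = solve-∀
          e₃ : ∀ c l r → c *ᶻ r -ᶻ l *ᶻ (+ 1 +ᶻ c) -ᶻ c *ᶻ (r -ᶻ l) -ᶻ ((+ 1 +ᶻ c) -ᶻ c) ≡ -ᶻ (+ 1) -ᶻ l
          e₃ = solve-∀
          e₄ : ∀ c l r → (+ 1 +ᶻ c) *ᶻ (r -ᶻ l) -ᶻ (c *ᶻ r -ᶻ l *ᶻ (+ 1 +ᶻ c)) -ᶻ ((+ 1 +ᶻ c) -ᶻ c) ≡ r -ᶻ + 1
          e₄ = solve-∀
          e₅ : ∀ c l r → (+ 1 +ᶻ c) *ᶻ r -ᶻ l *ᶻ c -ᶻ c *ᶻ (r -ᶻ l) -ᶻ ((+ 1 +ᶻ c) -ᶻ c) ≡ r -ᶻ + 1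
          e₅ = solve-∀
          e₆ : ∀ c l r → (+ 1 +ᶻ c) *ᶻ (r -ᶻ l) -ᶻ ((+ 1 +ᶻ c) *ᶻ r -ᶻ l *ᶻ c) -ᶻ ((+ 1 +ᶻ c) -ᶻ c) ≡ -ᶻ (+ 1) -ᶻ l
          e₆ = solve-∀
          Goal : ℤ → Set
          Goal x = (+ 0 ℤ.≤ x -ᶻ + c *ᶻ D -ᶻ (+ c' -ᶻ + c)) × (+ 0 ℤ.≤ + c' *ᶻ D -ᶻ x -ᶻ (+ c' -ᶻ + c))
          go : c ≡ c' ⊎ c' ≡ suc c → (rank L ≡ c × rank R ≡ c') ⊎ (rank L ≡ c' × rank R ≡ c) → Goal x
          go (inj₁ refl) (inj₁ (a , b)) = subst Goal (sym (cong₂ X a b)) (by-≡ (e₁ (+ c) l r) 0≤+ , by-≡ (e₂ (+ c) l r) 0≤+)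
          go (inj₁ refl) (inj₂ (a , b)) = subst Goal (sym (cong₂ X a b)) (by-≡ (e₁ (+ c) l r) 0≤+ , by-≡ (e₂ (+ c) l r) 0≤+)
          go (inj₂ refl) (inj₁ (a , b)) = subst Goal (sym (cong₂ X a b)) (by-≡ (e₃ (+ c) l r) negative , by-≡ (e₄ (+ c) l r) positive)
          go (inj₂ refl) (inj₂ (a , b)) = subst Goal (sym (cong₂ X a b)) (by-≡ (e₅ (+ c) l r) positive , by-≡ (e₆ (+ c) l r) negative)

      separated : ∀ {c c' d d'} → c ≡ c' ⊎ c' ≡ suc c → d ≡ d' ⊎ d' ≡ suc d → c + c' < d + d' → c' ≤ d
      separated {c} {c'} {d} {d'} cc dd h = ≮⇒≥ λ d<c' → <⇒≱ h (+-mono-≤ (low cc d<c') (≤-trans (high dd) d<c'))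
        where
        low : c ≡ c' ⊎ c' ≡ suc c → d < c' → d ≤ c
        low (inj₁ refl) d<c' = <⇒≤ d<c'
        low (inj₂ refl) d<c' = s≤s⁻¹ d<c'
        high : d ≡ d' ⊎ d' ≡ suc d → d' ≤ suc d
        high (inj₁ refl) = n≤1+n d
        high (inj₂ refl) = ≤-refl

      σ≥0 : ∀ {c c'} → c ≡ c' ⊎ c' ≡ suc c → + 0 ℤ.≤ + c' -ᶻ + c
      σ≥0 {c} (inj₁ refl) = ≤⇒0≤ (≤-refl {c})
      σ≥0 {c} (inj₂ refl) = ≤⇒0≤ (n≤1+n c)

    -- By `along-rank` the cross-multiplied comparison along γ is a positive multiple of the
    -- comparison of `x + y` at the two crossings, and those values lie in intervals separated by
    -- `c' ≤ d`.
    position-< : ∀ {c c' d d' s t} → Shape c c' s → Shape d d' t → c + c' < d + d' →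
      + 0 ℤ.≤ posNum p q t *ᶻ posDen p q s -ᶻ posNum p q s *ᶻ posDen p q t -ᶻ + 1
    position-< {c} {c'} {d} {d'} {s} {t} S T k<l = subst (λ z → + 0 ℤ.≤ z -ᶻ + 1) (sym diff≡) diff>0
      where
      Eₛ = ends S
      Eₜ = ends T
      module 𝑠 = Ends Eₛ
      module 𝑡 = Ends Eₜ
      module 𝑆 = Bounds Eₛ
      module 𝑇 = Bounds Eₜ
      num : Pt → Pt → ℤ
      num z w = along p q z *ᶻ side p q w -ᶻ side p q z *ᶻ along p q w
      nₛ = num 𝑠.L 𝑠.R
      nₜ = num 𝑡.L 𝑡.R
      diff = nₜ *ᶻ 𝑆.D -ᶻ nₛ *ᶻ 𝑇.D
      diff≡ : posNum p q t *ᶻ posDen p q s -ᶻ posNum p q s *ᶻ posDen p q t ≡ diff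
      diff≡ = cong₂ _-ᶻ_ (cong₂ _*ᶻ_ (cong₂ num 𝑡.left≡ 𝑡.right≡) (cong₂ gap 𝑠.left≡ 𝑠.right≡))
                         (cong₂ _*ᶻ_ (cong₂ num 𝑠.left≡ 𝑠.right≡) (cong₂ gap 𝑡.left≡ 𝑡.right≡))
      y = 𝑇.x *ᶻ 𝑆.D -ᶻ 𝑆.x *ᶻ 𝑇.D
      scaled : (P +ᶻ Q) *ᶻ diff ≡ (P *ᶻ P +ᶻ Q *ᶻ Q) *ᶻ y
      scaled = trans (e₁ (P +ᶻ Q) nₜ 𝑆.D nₛ 𝑇.D) (trans
        (cong₂ (λ a b → a *ᶻ 𝑆.D -ᶻ b *ᶻ 𝑇.D) (along-rank 𝑡.L 𝑡.R) (along-rank 𝑠.L 𝑠.R))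
        (sym (e₁ (P *ᶻ P +ᶻ Q *ᶻ Q) 𝑇.x 𝑆.D 𝑆.x 𝑇.D)))
        where
        e₁ : ∀ N a b c d → N *ᶻ (a *ᶻ b -ᶻ c *ᶻ d) ≡ (N *ᶻ a) *ᶻ b -ᶻ (N *ᶻ c) *ᶻ d
        e₁ = solve-∀
      u = + d -ᶻ + c'
      u≥0 : + 0 ℤ.≤ u
      u≥0 = ≤⇒0≤ (separated 𝑠.close 𝑡.close k<l)
      σₛ = + c' -ᶻ + c
      σₜ = + d' -ᶻ + d
      -- The two intervals and the gap between them cannot all have length 0, because the keys
      -- differ; this is where strictness comes from.
      total : + 0 ℤ.≤ u +ᶻ σₛ +ᶻ σₜ -ᶻ + 1
      total with 0≤? (u +ᶻ σₛ +ᶻ σₜ -ᶻ + 1)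
      ... | inj₁ h = h
      ... | inj₂ h = ⊥-elim (0≰-1 (by-≡ (e (+ c) (+ c') (+ d) (+ d'))
              (0≤-+ (0≤-+ (<⇒0≤ k<l) (0≤-+ h h)) (0≤-+ (σ≥0 𝑠.close) (σ≥0 𝑡.close)))))
        where
        e : ∀ c c' d d' → -ᶻ (+ 1) ≡ ((d +ᶻ d') -ᶻ (+ 1 +ᶻ (c +ᶻ c'))) +ᶻ
          ((-ᶻ (+ 1) -ᶻ (((d -ᶻ c') +ᶻ (c' -ᶻ c) +ᶻ (d' -ᶻ d)) -ᶻ + 1)) +ᶻ (-ᶻ (+ 1) -ᶻ (((d -ᶻ c') +ᶻ (c' -ᶻ c) +ᶻ (d' -ᶻ d)) -ᶻ + 1)))
          +ᶻ ((c' -ᶻ c) +ᶻ (d' -ᶻ d))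
        e = solve-∀
      D≥0 : ∀ {x} → + 0 ℤ.≤ x -ᶻ + 1 → + 0 ℤ.≤ x
      D≥0 = pos⇒nonneg
      y>0 : + 0 ℤ.≤ y -ᶻ + 1
      y>0 = by-≡ (e 𝑆.D 𝑇.D 𝑆.x 𝑇.x (+ c) (+ c') (+ d) (+ d'))
        (0≤-+ (0≤-+ (0≤-+ (0≤-+ (0≤-+ (0≤-* (proj₁ 𝑇.bounds) (D≥0 𝑆.D>0)) (0≤-* (proj₂ 𝑆.bounds) (D≥0 𝑇.D>0)))
          (0≤-* u≥0 (0≤-+ (0≤-* 𝑆.D>0 (D≥0 𝑇.D>0)) 𝑇.D>0))) (0≤-* (σ≥0 𝑡.close) 𝑆.D>0)) (0≤-* (σ≥0 𝑠.close) 𝑇.D>0)) total)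
        where
        e : ∀ D E x z c c' d d' → (z *ᶻ D -ᶻ x *ᶻ E) -ᶻ + 1 ≡
          (z -ᶻ d *ᶻ E -ᶻ (d' -ᶻ d)) *ᶻ D +ᶻ (c' *ᶻ D -ᶻ x -ᶻ (c' -ᶻ c)) *ᶻ E
          +ᶻ (d -ᶻ c') *ᶻ ((D -ᶻ + 1) *ᶻ E +ᶻ (E -ᶻ + 1)) +ᶻ (d' -ᶻ d) *ᶻ (D -ᶻ + 1) +ᶻ (c' -ᶻ c) *ᶻ (E -ᶻ + 1)
          +ᶻ ((d -ᶻ c') +ᶻ (c' -ᶻ c) +ᶻ (d' -ᶻ d) -ᶻ + 1)
        e = solve-∀
      W>0 : + 0 ℤ.≤ P *ᶻ P +ᶻ Q *ᶻ Q -ᶻ + 1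
      W>0 = by-≡ (e P Q) (0≤-+ (0≤-+ (0≤-* (0≤+ {p}) (0≤+ {p})) (0≤-* (≤⇒0≤ 1≤q) (0≤+ {q}))) (≤⇒0≤ 1≤q))
        where
        e : ∀ P Q → P *ᶻ P +ᶻ Q *ᶻ Q -ᶻ + 1 ≡ P *ᶻ P +ᶻ (Q -ᶻ + 1) *ᶻ Q +ᶻ (Q -ᶻ + 1)
        e = solve-∀
      diff>0 : + 0 ℤ.≤ diff -ᶻ + 1
      diff>0 with 0≤? (diff -ᶻ + 1)
      ... | inj₁ h = h
      ... | inj₂ h = ⊥-elim (0≰-1 (by-≡ lem (0≤-+ (0≤-+ (0≤-* W>0 (D≥0 y>0)) y>0) (0≤-* (0≤+ {p + q}) h))))
        where
        e : ∀ N W f y → (W -ᶻ + 1) *ᶻ y +ᶻ (y -ᶻ + 1) +ᶻ N *ᶻ (-ᶻ (+ 1) -ᶻ (f -ᶻ + 1)) ≡ -ᶻ (+ 1) +ᶻ (W *ᶻ y -ᶻ N *ᶻ f)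
        e = solve-∀
        lem : -ᶻ (+ 1) ≡ ((P *ᶻ P +ᶻ Q *ᶻ Q) -ᶻ + 1) *ᶻ y +ᶻ (y -ᶻ + 1) +ᶻ (P +ᶻ Q) *ᶻ (-ᶻ (+ 1) -ᶻ (diff -ᶻ + 1))
        lem = sym (trans (e (P +ᶻ Q) (P *ᶻ P +ᶻ Q *ᶻ Q) diff y)
          (cong (λ z → -ᶻ (+ 1) +ᶻ z) (trans (cong (λ z → z -ᶻ (P +ᶻ Q) *ᶻ diff) (sym scaled)) (ℤₚ.+-inverseʳ ((P +ᶻ Q) *ᶻ diff)))))

    before-true : ∀ {s t} → Crossing s → Crossing t → key s < key t → beforeᵇ p q s t ≡ true
    before-true {s} {t} (c , c' , S , _) (d , d' , T , _) k<l
      with (posNum p q s *ᶻ posDen p q t) ℤ.≤? (posNum p q t *ᶻ posDen p q s)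
    ... | yes _ = refl
    ... | no ¬h = contradiction (ℤₚ.0≤i-j⇒j≤i (pos⇒nonneg (position-< S T (subst₂ _<_ (key-shape S) (key-shape T) k<l)))) ¬h

    before-false : ∀ {s t} → Crossing s → Crossing t → key t < key s → beforeᵇ p q s t ≡ false
    before-false {s} {t} (c , c' , S , _) (d , d' , T , _) k<l
      with (posNum p q s *ᶻ posDen p q t) ℤ.≤? (posNum p q t *ᶻ posDen p q s)
    ... | no _ = refl
    ... | yes h = ⊥-elim (0≰-1 (by-≡ (e (posNum p q s *ᶻ posDen p q t) (posNum p q t *ᶻ posDen p q s)) (0≤-+ (position-< T S (subst₂ _<_ (key-shape T) (key-shape S) k<l)) (ℤₚ.i≤j⇒0≤j-i h))))
      where
      e : ∀ x y → -ᶻ (+ 1) ≡ (x -ᶻ y -ᶻ + 1) +ᶻ (y -ᶻ x)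
      e = solve-∀

-- The sorted list of crossings in closed form.

module SortedCrossings where

  open import Defs
  open Staircases
  open SegmentShapes
  open CrossingOrder
  open import Data.Bool using (Bool; true; false)
  import Data.Bool.Properties as Boolₚ
  open import Data.List using (List; []; _∷_; applyUpTo; filterᵇ)
  open import Data.List.Membership.Propositional using (_∈_)
  open import Data.List.Membership.Propositional.Properties
  open import Data.List.Relation.Unary.All as All using (All; []; _∷_)
  open import Data.List.Relation.Unary.AllPairs as AllPairs using (AllPairs; []; _∷_)
  import Data.List.Relation.Unary.AllPairs.Properties as AllPairsₚ
  open import Data.List.Relation.Unary.Any using (here; there)
  open import Data.List.Relation.Unary.Unique.Propositional using (Unique)
  import Data.List.Relation.Unary.Unique.Propositional.Properties as Uniqueₚ
  open import Data.Integer using (+_)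
  open import Data.Nat using (ℕ; suc; z≤n; s≤s; _+_; _≤_; _<_; ⌊_/2⌋; ⌈_/2⌉; s≤s⁻¹)
  open import Data.Nat.Properties
  open import Data.Nat.Coprimality using (Coprime)
  open import Data.Product using (_×_; _,_; proj₁; proj₂; ∃)
  open import Data.Sum using (_⊎_; inj₁; inj₂)
  open import Function using (_∘_)
  import Function.Bundles
  open import Relation.Binary.Definitions using (tri<; tri≈; tri>)
  open import Relation.Binary.PropositionalEquality
  open import Relation.Nullary using (contradiction)
  open import Relation.Nullary.Decidable using (T?)

  module SortedSegs (p q : ℕ) (1≤p : 1 ≤ p) (1≤q : 1 ≤ q) (cop : Coprime p q) where
    open Shapes p q 1≤p 1≤q cop
    open Sorting p q 1≤p 1≤q cop

    Increasing : List Seg → Set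
    Increasing = AllPairs (λ s t → key s < key t)

    -- A strictly increasing list is determined by its elements, so the result of the insertion sort
    -- is found from membership alone.
    increasing-unique : ∀ {xs ys} → Increasing xs → Increasing ys →
      (∀ {s} → s ∈ xs → s ∈ ys) → (∀ {s} → s ∈ ys → s ∈ xs) → xs ≡ ys
    increasing-unique [] [] _ _ = refl
    increasing-unique [] (_ ∷ _) _ from = contradiction (from (here refl)) λ ()
    increasing-unique (_ ∷ _) [] to _ = contradiction (to (here refl)) λ ()
    increasing-unique {x ∷ xs} {y ∷ ys} (x< ∷ ixs) (y< ∷ iys) to from = cong₂ _∷_ x≡y (increasing-unique ixs iys to' from')
      where
      x≡y : x ≡ y
      x≡y with to (here refl) | from (here refl)
      ... | here e   | _        = e
      ... | there _  | here e   = sym e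
      ... | there x∈ | there y∈ = contradiction (All.lookup x< y∈) (<-asym (All.lookup y< x∈))
      to' : ∀ {s} → s ∈ xs → s ∈ ys
      to' s∈ with to (there s∈)
      ... | there s∈' = s∈'
      ... | here refl = contradiction (cong key x≡y) (<⇒≢ (All.lookup x< s∈))
      from' : ∀ {s} → s ∈ ys → s ∈ xs
      from' s∈ with from (there s∈)
      ... | there s∈' = s∈'
      ... | here refl = contradiction (cong key (sym x≡y)) (<⇒≢ (All.lookup y< s∈))

    insert-All : ∀ {Pr : Seg → Set} s ts → Pr s → All Pr ts → All Pr (insertSeg p q s ts)
    insert-All s [] ps [] = ps ∷ []
    insert-All s (t ∷ ts) ps (pt ∷ pts) with beforeᵇ p q s t
    ... | true  = ps ∷ pt ∷ pts
    ... | false = pt ∷ insert-All s ts ps pts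

    insert-∈⁻ : ∀ s ts {x} → x ∈ insertSeg p q s ts → x ∈ s ∷ ts
    insert-∈⁻ s [] x∈ = x∈
    insert-∈⁻ s (t ∷ ts) x∈ with beforeᵇ p q s t
    insert-∈⁻ s (t ∷ ts) x∈ | true = x∈
    insert-∈⁻ s (t ∷ ts) (here e) | false = there (here e)
    insert-∈⁻ s (t ∷ ts) (there x∈) | false with insert-∈⁻ s ts x∈
    ... | here e   = here e
    ... | there x∈' = there (there x∈')

    insert-∈⁺ : ∀ s ts {x} → x ∈ s ∷ ts → x ∈ insertSeg p q s ts
    insert-∈⁺ s [] x∈ = x∈
    insert-∈⁺ s (t ∷ ts) x∈ with beforeᵇ p q s t
    insert-∈⁺ s (t ∷ ts) x∈ | true = x∈
    insert-∈⁺ s (t ∷ ts) (here e) | false = there (insert-∈⁺ s ts (here e))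
    insert-∈⁺ s (t ∷ ts) (there (here e)) | false = here e
    insert-∈⁺ s (t ∷ ts) (there (there x∈)) | false = there (insert-∈⁺ s ts (there x∈))

    insert-increasing : ∀ s ts → Crossing s → All Crossing ts → All (λ t → key s ≢ key t) ts →
                        Increasing ts → Increasing (insertSeg p q s ts)
    insert-increasing s [] _ _ _ _ = [] ∷ []
    insert-increasing s (t ∷ ts) cs (ct ∷ cts) (ne ∷ nes) (t< ∷ its) with <-cmp (key s) (key t)
    ... | tri≈ _ e _ = contradiction e ne
    ... | tri< s<t _ _ rewrite before-true cs ct s<t = (s<t ∷ All.map (<-trans s<t) t<) ∷ t< ∷ its
    ... | tri> _ _ t<s rewrite before-false cs ct t<s =
      insert-All s ts t<s t< ∷ insert-increasing s ts cs cts nes its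

    sort-∈⁻ : ∀ xs {x} → x ∈ sortSegs p q xs → x ∈ xs
    sort-∈⁻ (y ∷ xs) x∈ with insert-∈⁻ y (sortSegs p q xs) x∈
    ... | here e   = here e
    ... | there x∈' = there (sort-∈⁻ xs x∈')

    sort-∈⁺ : ∀ xs {x} → x ∈ xs → x ∈ sortSegs p q xs
    sort-∈⁺ (y ∷ xs) (here e) = insert-∈⁺ y (sortSegs p q xs) (here e)
    sort-∈⁺ (y ∷ xs) (there x∈) = insert-∈⁺ y (sortSegs p q xs) (there (sort-∈⁺ xs x∈))

    sort-All : ∀ {Pr : Seg → Set} xs → All Pr xs → All Pr (sortSegs p q xs)
    sort-All [] [] = []
    sort-All (x ∷ xs) (px ∷ pxs) = insert-All x (sortSegs p q xs) px (sort-All xs pxs)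

    sort-increasing : ∀ xs → All Crossing xs → AllPairs (λ s t → key s ≢ key t) xs → Increasing (sortSegs p q xs)
    sort-increasing [] _ _ = []
    sort-increasing (x ∷ xs) (cx ∷ cxs) (nx ∷ nxs) =
      insert-increasing x (sortSegs p q xs) cx (sort-All xs cxs) (sort-All xs nx) (sort-increasing xs cxs nxs)

    segKey : ℕ → Seg
    segKey k = segAt ⌊ k /2⌋ ⌈ k /2⌉

    private
      half-sum : ∀ {c c'} → c ≡ c' ⊎ c' ≡ suc c → (⌊ c + c' /2⌋ ≡ c) × (⌈ c + c' /2⌉ ≡ c')
      half-sum {c} (inj₁ refl) = sym (n≡⌊n+n/2⌋ c) , sym (n≡⌈n+n/2⌉ c)
      half-sum {c} (inj₂ refl) = trans (cong ⌊_/2⌋ (+-suc c c)) (sym (n≡⌈n+n/2⌉ c))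
        , trans (cong ⌈_/2⌉ (+-suc c c)) (cong suc (sym (n≡⌊n+n/2⌋ c)))

    crossing-segKey : ∀ {s} → Crossing s → s ≡ segKey (key s)
    crossing-segKey {s} (c , c' , S , _) = trans (sym (shape⇒segAt S)) (sym (trans (cong segKey (key-shape S))
      (cong₂ segAt (proj₁ halves≡) (proj₂ halves≡))))
      where halves≡ = half-sum (Ends.close (ends S))

    crossed-filter : crossed p q ≡ filterᵇ (crossesᵇ p q) (allSegs p q)
    crossed-filter = foldr-filter (crossesᵇ p q) (allSegs p q)

    ∈-crossed⁻ : ∀ {s} → s ∈ crossed p q → Crossing s
    ∈-crossed⁻ {s} s∈ with ∈-filter⁻ (T? ∘ crossesᵇ p q) {xs = allSegs p q} (subst (s ∈_) crossed-filter s∈)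
    ... | s∈' , t = crossing s∈' (Boolₚ.T-≡ .Function.Bundles.Equivalence.to t)

    ∈-crossed⁺ : ∀ {c c' s} → Shape c c' s → s ∈ crossed p q
    ∈-crossed⁺ {s = s} S = subst (s ∈_) (sym crossed-filter)
      (∈-filter⁺ (T? ∘ crossesᵇ p q) (member S) (Boolₚ.T-≡ .Function.Bundles.Equivalence.from (crosses S)))
      where
      member : ∀ {c c' s} → Shape c c' s → s ∈ allSegs p q
      member (diag m n _ _ m<q n<p) = ∈-allSegs⁺ p q (<⇒≤ m<q) (<⇒≤ n<p) (diagonal m<q n<p)
      member (horiz m n _ _ m<q n≤p) = ∈-allSegs⁺ p q (<⇒≤ m<q) n≤p (horizontal m<q)
      member (vert m n _ _ m≤q n<p) = ∈-allSegs⁺ p q m≤q (<⇒≤ n<p) (vertical n<p)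
      crosses : ∀ {c c' s} → Shape c c' s → crossesᵇ p q s ≡ true
      crosses (diag m n h g _ _) = flag-neg (neg*pos<0 {side p q (m , suc n)} h g)
      crosses (horiz m n h g _ _) = flag-neg (neg*pos<0 {side p q (m , suc n)} h g)
      crosses (vert m n g h _ _) = flag-neg (by-≡ (cong (λ z → ℤ.- (+ 1) ℤ.- z) (ℤₚ.*-comm (side p q (suc m , n)) (side p q (suc m , suc n))))
        (neg*pos<0 {side p q (suc m , suc n)} h g))
        where
        import Data.Integer as ℤ
        import Data.Integer.Properties as ℤₚ

    crossed-unique : Unique (crossed p q)
    crossed-unique = subst Unique (sym crossed-filter) (Uniqueₚ.filter⁺ (T? ∘ crossesᵇ p q) (allSegs-unique p q))

    crossed-keys : ∀ xs → (∀ {s} → s ∈ xs → Crossing s) → Unique xs → AllPairs (λ s t → key s ≢ key t) xs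
    crossed-keys [] _ _ = []
    crossed-keys (x ∷ xs) h (x∉ ∷ u) = All.tabulate (λ {t} t∈ e → All.lookup x∉ t∈
        (trans (crossing-segKey (h (here refl))) (trans (cong segKey e) (sym (crossing-segKey (h (there t∈)))))))
      ∷ crossed-keys xs (h ∘ there) u

    module _ (M : ℕ) (N≡ : p + q ≡ 2 + M) where

      private
        ⌈⌉<N : ∀ i → i < M + suc M → ⌈ 2 + i /2⌉ < p + q
        ⌈⌉<N i i< = subst (⌈ 2 + i /2⌉ <_) (sym N≡) (s≤s (subst (⌈ 2 + i /2⌉ ≤_) (sym (n≡⌈n+n/2⌉ (suc M)))
          (⌈n/2⌉-mono (s≤s i<))))

        shape-key : ∀ i → i < M + suc M → Shape ⌊ 2 + i /2⌋ ⌈ 2 + i /2⌉ (segKey (2 + i))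
        shape-key i i< = shape ⌊ 2 + i /2⌋ ⌈ 2 + i /2⌉ (s≤s z≤n) (⌈⌉<N i i<) (halves (2 + i))

        key-segKey : ∀ i → i < M + suc M → key (segKey (2 + i)) ≡ 2 + i
        key-segKey i i< = trans (key-shape (shape-key i i<)) (⌊n/2⌋+⌈n/2⌉≡n (2 + i))

      τs-segKey : τs p q ≡ applyUpTo (λ i → segKey (2 + i)) (M + suc M)
      τs-segKey = increasing-unique
        (sort-increasing (crossed p q) (All.tabulate ∈-crossed⁻) (crossed-keys (crossed p q) ∈-crossed⁻ crossed-unique))
        (AllPairsₚ.applyUpTo⁺₁ (λ i → segKey (2 + i)) (M + suc M) (λ {i} {j} i<j j< →
          subst₂ _<_ (sym (key-segKey i (<-trans i<j j<))) (sym (key-segKey j j<)) (s≤s (s≤s i<j))))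
        to from
        where
        to : ∀ {s} → s ∈ τs p q → s ∈ applyUpTo (λ i → segKey (2 + i)) (M + suc M)
        to {s} s∈ = go (∈-crossed⁻ (sort-∈⁻ (crossed p q) s∈))
          where
          bound : ∀ {c c'} → c ≤ c' → 0 < c → c' < p + q → ∃ λ i → (2 + i ≡ c + c') × i < M + suc M
          bound {suc c} {suc c'} c≤c' _ c'<N = c + c' , cong suc (sym (+-suc c c')) ,
            ≤-<-trans (+-mono-≤ (s≤s⁻¹ c≤c') (≤-refl {c'})) (+-mono-≤-< c'≤M (s≤s c'≤M))
            where
            c'≤M : c' ≤ M
            c'≤M = s≤s⁻¹ (s≤s⁻¹ (subst (suc (suc c') ≤_) N≡ c'<N))
          go : Crossing s → s ∈ applyUpTo (λ i → segKey (2 + i)) (M + suc M)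
          go C@(c , c' , S , 0<c , c'<N) with bound (c≤ (Ends.close (ends S))) 0<c c'<N
            where
            c≤ : c ≡ c' ⊎ c' ≡ suc c → c ≤ c'
            c≤ (inj₁ e) = ≤-reflexive e
            c≤ (inj₂ e) = ≤-trans (n≤1+n c) (≤-reflexive (sym e))
          ... | i , 2+i≡ , i< = subst (_∈ applyUpTo (λ i → segKey (2 + i)) (M + suc M))
            (sym (trans (crossing-segKey C) (cong segKey (trans (key-shape S) (sym 2+i≡)))))
            (∈-applyUpTo⁺ (λ i → segKey (2 + i)) i<)
        from : ∀ {s} → s ∈ applyUpTo (λ i → segKey (2 + i)) (M + suc M) → s ∈ τs p q
        from s∈ with ∈-applyUpTo⁻ (λ i → segKey (2 + i)) s∈
        ... | i , i< , refl = sort-∈⁺ (crossed p q) (∈-crossed⁺ (shape-key i i<))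

-- Weighted sums over order ideals as products of matrices.

module TransferMatrices where

  open import Defs
  open LaurentRing
  open MatrixAlgebra
  open import Algebra.Bundles using (CommutativeRing)
  open import Data.Bool using (Bool; true; false; if_then_else_; _∧_; _∨_; not)
  import Data.Bool.Properties as Boolₚ
  open import Data.Integer using (+_)
  open import Data.List using (List; []; _∷_; _++_; map; foldr; length)
  open import Data.Product using (_×_; _,_; proj₁; proj₂)
  open import Function using (_∘_; id)
  open import Relation.Binary.PropositionalEquality as ≡ using (_≡_; cong; cong₂)

  module T = CommutativeRing LP-ring
  module M = Matrices LP-almostRing cst-homo
  open M using (Mat; mk; _≈ᴹ_; _·_; link; I; ≈ᴹ-refl; ≈ᴹ-sym; ≈ᴹ-trans; ·-cong; ·-assoc; solve; _:=_; _:+_; _:*_; con; refl; sym; trans; 𝟘; 𝟙)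

  ⊗-congˡ : ∀ w {x y} → x ≋ y → w ⊗ x ≋ w ⊗ y
  ⊗-congˡ w {x} {y} h = T.*-cong {w} {w} {x} {y} refl h

  sumIf : (List Bool → Bool) → (List Bool → LP) → List (List Bool) → LP
  sumIf c g = foldr (λ I acc → if c I then g I ⊕ acc else acc) 0L

  sumIf-++ : ∀ c g xs ys → sumIf c g (xs ++ ys) ≡ sumIf c g xs ⊕ sumIf c g ys
  sumIf-++ c g [] ys = ≡.refl
  sumIf-++ c g (x ∷ xs) ys with c x
  ... | true  = ≡.trans (cong (g x ⊕_) (sumIf-++ c g xs ys)) (≡.sym (List.++-assoc (g x) (sumIf c g xs) (sumIf c g ys)))
    where import Data.List.Properties as List
  ... | false = sumIf-++ c g xs ys

  sumIf-map : ∀ c g f xs → sumIf c g (map f xs) ≡ sumIf (c ∘ f) (g ∘ f) xs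
  sumIf-map c g f [] = ≡.refl
  sumIf-map c g f (x ∷ xs) with c (f x)
  ... | true  = cong (g (f x) ⊕_) (sumIf-map c g f xs)
  ... | false = sumIf-map c g f xs

  sumIf-cong : ∀ {c c'} g xs → (∀ x → c x ≡ c' x) → sumIf c g xs ≡ sumIf c' g xs
  sumIf-cong g [] h = ≡.refl
  sumIf-cong g (x ∷ xs) h = cong₂ (λ b r → if b then g x ⊕ r else r) (h x) (sumIf-cong g xs h)

  sumIf-false : ∀ g xs → sumIf (λ _ → false) g xs ≡ 0L
  sumIf-false g [] = ≡.refl
  sumIf-false g (x ∷ xs) = sumIf-false g xs

  sumIf-scale : ∀ c w g xs → sumIf c (λ I → w ⊗ g I) xs ≋ w ⊗ sumIf c g xs
  sumIf-scale c w g [] = ≡⇒≋ (≡.sym (⊗-zeroʳ w))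
  sumIf-scale c w g (x ∷ xs) with c x
  ... | true  = trans (T.+-cong refl (sumIf-scale c w g xs)) (sym (T.distribˡ w (g x) (sumIf c g xs)))
  ... | false = sumIf-scale c w g xs

  -- The ideals of a fence whose (virtual) predecessor has state i.
  idealSum : Bool → (Bool → Bool) → Fence → LP
  idealSum i sel P = sumIf (λ I → idealFrom i P I ∧ sel (lastB (i ∷ I))) (wtOf P) (subsets (length P))

  when : Bool → LP → LP
  when b x = if b then x else 0L

  allowed : Bool → Bool → Bool → Bool
  allowed b i j = if b then (not i ∨ j) else (not j ∨ i)

  sumIf-∧ : ∀ a c g xs → sumIf (λ I → a ∧ c I) g xs ≡ when a (sumIf c g xs)
  sumIf-∧ true c g xs = ≡.refl
  sumIf-∧ false c g xs = sumIf-false g xs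

  when-cong : ∀ b {x y} → x ≋ y → when b x ≋ when b y
  when-cong true h = h
  when-cong false h = refl

  idealSum-∷ : ∀ i sel b w P → idealSum i sel ((b , w) ∷ P) ≋
    when (allowed b i true) (w ⊗ idealSum true sel P) ⊕ when (allowed b i false) (idealSum false sel P)
  idealSum-∷ i sel b w P = trans
    (≡⇒≋ (≡.trans (sumIf-++ c (wtOf F) (map (true ∷_) S) (map (false ∷_) S))
      (cong₂ _⊕_ (≡.trans (sumIf-map c (wtOf F) (true ∷_) S) (part true (λ I → w ⊗ wtOf P I)))
                 (≡.trans (sumIf-map c (wtOf F) (false ∷_) S) (part false (wtOf P))))))
    (T.+-cong (when-cong (allowed b i true) (sumIf-scale (λ I → idealFrom true P I ∧ sel (lastB (true ∷ I))) w (wtOf P) S)) refl)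
    where
    F = (b , w) ∷ P
    S = subsets (length P)
    c : List Bool → Bool
    c I = idealFrom i F I ∧ sel (lastB (i ∷ I))
    part : ∀ j g → sumIf (λ I → c (j ∷ I)) g S ≡ when (allowed b i j) (sumIf (λ I → idealFrom j P I ∧ sel (lastB (j ∷ I))) g S)
    part j g = ≡.trans (sumIf-cong g S (λ I → Boolₚ.∧-assoc (allowed b i j) (idealFrom j P I) (sel (lastB (j ∷ I)))))
      (sumIf-∧ (allowed b i j) _ g S)

  diagonalᴹ : LP → Mat
  diagonalᴹ w = mk w 𝟘 𝟘 𝟙

  transfer : Fence → Mat
  transfer [] = I
  transfer ((b , w) ∷ P) = link b · diagonalᴹ w · transfer P

  transfer-++ : ∀ P Q → transfer (P ++ Q) ≈ᴹ transfer P · transfer Q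
  transfer-++ [] Q = ≈ᴹ-sym (M.·-identityˡ (transfer Q))
  transfer-++ ((b , w) ∷ P) Q = ≈ᴹ-trans (·-cong {link b · diagonalᴹ w} ≈ᴹ-refl (transfer-++ P Q))
    (≈ᴹ-sym (·-assoc (link b · diagonalᴹ w) (transfer P) (transfer Q)))

  private
    𝟘≋0L : 𝟘 ≋ 0L
    𝟘≋0L = M.trans (solve 1 (λ x → con (+ 0) := con (+ 0) :* x) refl 0L) (M.zeroʳ 𝟘)

    -- The three forms below are the possible rows `(w, 0)`, `(w, 1)` and `(0, 1)` of
    -- `link b · diagonalᴹ w`, applied to a column and left in the unreduced form that the matrix
    -- product produces.
    row-in-true : ∀ w x y → w ⊠ x ⊞ 0L ≋ (𝟙 ⊠ w ⊞ 𝟘 ⊠ 𝟘) ⊠ x ⊞ (𝟙 ⊠ 𝟘 ⊞ 𝟘 ⊠ 𝟙) ⊠ y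
    row-in-true w x y = trans (M.+-cong refl (sym 𝟘≋0L)) (solve 3 (λ w x y → w :* x :+ con (+ 0) :=
      (con (+ 1) :* w :+ con (+ 0) :* con (+ 0)) :* x :+ (con (+ 1) :* con (+ 0) :+ con (+ 0) :* con (+ 1)) :* y) refl w x y)
    row-both : ∀ w x y → w ⊠ x ⊞ y ≋ (𝟙 ⊠ w ⊞ 𝟙 ⊠ 𝟘) ⊠ x ⊞ (𝟙 ⊠ 𝟘 ⊞ 𝟙 ⊠ 𝟙) ⊠ y
    row-both = solve 3 (λ w x y → w :* x :+ y :=
      (con (+ 1) :* w :+ con (+ 1) :* con (+ 0)) :* x :+ (con (+ 1) :* con (+ 0) :+ con (+ 1) :* con (+ 1)) :* y) refl
    row-out-false : ∀ w x y → 0L ⊞ y ≋ (𝟘 ⊠ w ⊞ 𝟙 ⊠ 𝟘) ⊠ x ⊞ (𝟘 ⊠ 𝟘 ⊞ 𝟙 ⊠ 𝟙) ⊠ y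
    row-out-false w x y = trans (M.+-cong (sym 𝟘≋0L) refl) (solve 3 (λ w x y → con (+ 0) :+ y :=
      (con (+ 0) :* w :+ con (+ 1) :* con (+ 0)) :* x :+ (con (+ 0) :* con (+ 0) :+ con (+ 1) :* con (+ 1)) :* y) refl w x y)

  opaque
    unfolding _⊞_ _⊠_ ⊟

    column-step : ∀ b w sel P x y → idealSum true sel P ≋ x → idealSum false sel P ≋ y →
      let X = link b · diagonalᴹ w in
      (idealSum true sel ((b , w) ∷ P) ≋ Mat.e₁₁ X ⊠ x ⊞ Mat.e₁₂ X ⊠ y) ×
      (idealSum false sel ((b , w) ∷ P) ≋ Mat.e₂₁ X ⊠ x ⊞ Mat.e₂₂ X ⊠ y)
    column-step true w sel P x y hx hy =
        trans (idealSum-∷ true sel true w P) (trans (T.+-cong (⊗-congˡ w hx) refl) (row-in-true w x y))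
      , trans (idealSum-∷ false sel true w P) (trans (T.+-cong (⊗-congˡ w hx) hy) (row-both w x y))
    column-step false w sel P x y hx hy =
        trans (idealSum-∷ true sel false w P) (trans (T.+-cong (⊗-congˡ w hx) hy) (row-both w x y))
      , trans (idealSum-∷ false sel false w P) (trans (T.+-cong refl hy) (row-out-false w x y))

  -- Requiring the last element to be in the ideal selects the first column, and excluding it the
  -- second. For the empty fence the state of the virtual predecessor counts as the last membership.
  transfer-R : ∀ P → (idealSum true id P ≋ Mat.e₁₁ (transfer P)) × (idealSum false id P ≋ Mat.e₂₁ (transfer P))
  transfer-R [] = ≡⇒≋ ≡.refl , sym 𝟘≋0L
  transfer-R ((b , w) ∷ P) = column-step b w id P _ _ (proj₁ (transfer-R P)) (proj₂ (transfer-R P))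

  transfer-¬R : ∀ P → (idealSum true not P ≋ Mat.e₁₂ (transfer P)) × (idealSum false not P ≋ Mat.e₂₂ (transfer P))
  transfer-¬R [] = sym 𝟘≋0L , ≡⇒≋ ≡.refl
  transfer-¬R ((b , w) ∷ P) = column-step b w not P _ _ (proj₁ (transfer-¬R P)) (proj₂ (transfer-¬R P))

  Wsel-∷ : ∀ sel b w P → Wsel sel ((b , w) ∷ P) ≋ w ⊗ idealSum true (sel true) P ⊕ idealSum false (sel false) P
  Wsel-∷ sel b w P = trans
    (≡⇒≋ (≡.trans (sumIf-++ c (wtOf F) (map (true ∷_) S) (map (false ∷_) S))
      (cong₂ _⊕_ (sumIf-map c (wtOf F) (true ∷_) S) (sumIf-map c (wtOf F) (false ∷_) S))))
    (T.+-cong (sumIf-scale (λ I → idealFrom true P I ∧ sel true (lastB (true ∷ I))) w (wtOf P) S) refl)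
    where
    F = (b , w) ∷ P
    S = subsets (length P)
    c : List Bool → Bool
    c I = isIdeal F I ∧ sel (headB I) (lastB I)

  idealSum-none : ∀ i P → idealSum i (λ _ → false) P ≡ 0L
  idealSum-none i P = ≡.trans (sumIf-cong (wtOf P) S (λ I → Boolₚ.∧-zeroʳ (idealFrom i P I))) (sumIf-false (wtOf P) S)
    where S = subsets (length P)

  idealSum-sel : ∀ i {sel sel'} P → (∀ r → sel r ≡ sel' r) → idealSum i sel P ≡ idealSum i sel' P
  idealSum-sel i P h = sumIf-cong (wtOf P) (subsets (length P)) (λ I → cong (idealFrom i P I ∧_) (h (lastB (i ∷ I))))

  module _ (b : Bool) (w : LP) (P : Fence) where
    private
      -- The head flag `false` places a virtual element below `L`. If it is in the ideal, `L` is
      -- free, which gives the first row; if it is out, so is `L`, which gives the second. The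
      -- entries are thus the four sums in `C`.
      U : Mat
      U = transfer (markUp ((b , w) ∷ P))

    opaque
      unfolding _⊞_ _⊠_ ⊟

      W[R]-transfer : W[R] ((b , w) ∷ P) ≋ Mat.e₁₁ U
      W[R]-transfer = trans (Wsel-∷ (λ _ r → r) b w P) (trans (T.+-cong (⊗-congˡ w (proj₁ (transfer-R P))) (proj₂ (transfer-R P))) (row-both w _ _))

      W[¬R]-transfer : W[¬R] ((b , w) ∷ P) ≋ Mat.e₁₂ U
      W[¬R]-transfer = trans (Wsel-∷ (λ _ r → not r) b w P) (trans (T.+-cong (⊗-congˡ w (proj₁ (transfer-¬R P))) (proj₂ (transfer-¬R P))) (row-both w _ _))

      no-first : ∀ sel → (∀ r → sel true r ≡ false) → Wsel sel ((b , w) ∷ P) ≋ 0L ⊕ idealSum false (sel false) P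
      no-first sel h = trans (Wsel-∷ sel b w P) (T.+-cong
          (trans (⊗-congˡ w (≡⇒≋ (≡.trans (idealSum-sel true P h) (idealSum-none true P)))) (≡⇒≋ (⊗-zeroʳ w))) refl)

      W[R,¬L]-transfer : W[R,¬L] ((b , w) ∷ P) ≋ Mat.e₂₁ U
      W[R,¬L]-transfer = trans (no-first (λ l r → r ∧ not l) Boolₚ.∧-zeroʳ)
        (trans (T.+-cong refl (trans (≡⇒≋ (idealSum-sel false P Boolₚ.∧-identityʳ)) (proj₂ (transfer-R P)))) (row-out-false w _ _))

      W[¬R,¬L]-transfer : W[¬R,¬L] ((b , w) ∷ P) ≋ Mat.e₂₂ U
      W[¬R,¬L]-transfer = trans (no-first (λ l r → not r ∧ not l) (λ r → Boolₚ.∧-zeroʳ (not r)))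
        (trans (T.+-cong refl (trans (≡⇒≋ (idealSum-sel false P (λ r → Boolₚ.∧-identityʳ (not r)))) (proj₂ (transfer-¬R P)))) (row-out-false w _ _))

-- Conjugation by K, the chain H, and the identities at the root.

module ConjugationAlgebra where

  open import Defs using (Lbl; ℓ₁; ℓ₂; ℓ₃)
  open LaurentRing
  open MatrixAlgebra
  open import Algebra.Solver.Ring.AlmostCommutativeRing using (AlmostCommutativeRing; _-Raw-AlmostCommutative⟶_)
  open import Data.Bool using (true; false)
  open import Data.Integer using (+_)
  open import Data.List using (List; []; _∷_; _++_)
  open import Data.Nat using (ℕ)
  open import Data.Product using (_,_)
  open import Level using (0ℓ)

  module Conjugation (R : AlmostCommutativeRing 0ℓ 0ℓ) (φ : ℤ-rawRing -Raw-AlmostCommutative⟶ R) where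
    open Matrices R φ

    private
      :0 :1 : ∀ {n} → Polynomial n
      :0 = con (+ 0)
      :1 = con (+ 1)

    adj-inverseˡ : ∀ X → detᴹ X ≈ 𝟙 → adj X · X ≈ᴹ I
    adj-inverseˡ (mk a b c d) h = entries
      (trans (solve 4 (λ a b c d → d :* a :+ :- b :* c := a :* d :+ :- (b :* c)) refl a b c d) h)
      (solve 2 (λ b d → d :* b :+ :- b :* d := :0) refl b d)
      (solve 2 (λ a c → :- c :* a :+ a :* c := :0) refl a c)
      (trans (solve 4 (λ a b c d → :- c :* b :+ a :* d := a :* d :+ :- (b :* c)) refl a b c d) h)

    adj-inverseʳ : ∀ X → detᴹ X ≈ 𝟙 → X · adj X ≈ᴹ I
    adj-inverseʳ (mk a b c d) h = entries
      (trans (solve 4 (λ a b c d → a :* d :+ b :* :- c := a :* d :+ :- (b :* c)) refl a b c d) h)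
      (solve 2 (λ a b → a :* :- b :+ b :* a := :0) refl a b)
      (solve 2 (λ c d → c :* d :+ d :* :- c := :0) refl c d)
      (trans (solve 4 (λ a b c d → c :* :- b :+ d :* a := a :* d :+ :- (b :* c)) refl a b c d) h)

    ∙-·-∙ : ∀ s t X Y → (s ∙ X) · (t ∙ Y) ≈ᴹ (s * t) ∙ (X · Y)
    ∙-·-∙ s t X Y = ≈ᴹ-trans (∙-·ˡ s X (t ∙ Y)) (≈ᴹ-trans (∙-cong refl (∙-·ʳ t X Y)) (∙-∙ s t (X · Y)))

    ∙-·-∙-·-∙ : ∀ s t u X Y Z → (s ∙ X) · ((t ∙ Y) · (u ∙ Z)) ≈ᴹ (s * (t * u)) ∙ (X · (Y · Z))
    ∙-·-∙-·-∙ s t u X Y Z = ≈ᴹ-trans (·-congˡ (∙-·-∙ t u Y Z)) (∙-·-∙ s (t * u) X (Y · Z))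

    path-step : ∀ {G G' Y} s t u L C L' C' W → G ≈ᴹ s ∙ (L · C) → G' ≈ᴹ t ∙ (L' · C') → Y ≈ᴹ u ∙ W →
      G · (G' · Y) ≈ᴹ (s * (t * u)) ∙ ((L · C · L') · (C' · W))
    path-step s t u L C L' C' W g g' y = ≈ᴹ-trans (·-cong g (·-cong g' y))
      (≈ᴹ-trans (∙-·-∙-·-∙ s t u (L · C) (L' · C') W)
        (∙-cong refl (≈ᴹ-trans (·-congˡ (·-assoc L' C' W)) (≈ᴹ-sym (·-assoc (L · C) L' (C' · W))))))

    private
      diagonal : Carrier → Mat
      diagonal w = mk w 𝟘 𝟘 𝟙

      pull : ∀ L D Y x X → D · Y ≈ᴹ x ∙ X → L · D · Y ≈ᴹ x ∙ (L · X)
      pull L D Y x X h = ≈ᴹ-trans (·-assoc L D Y) (≈ᴹ-trans (·-congˡ h) (∙-·ʳ x L X))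

    -- `diagonal w · 𝔹 · diagonal w'` has rows `(w w', 0)` and `(w', 1)`. For the weights `x/k` and
    -- `k x` this is `x` times a matrix of determinant 1 in which `1/k` no longer occurs.
    descending-pair : ∀ L w w' x x⁻¹ k → w * w' ≈ x * x → w' ≈ x * k → x * x⁻¹ ≈ 𝟙 →
      L · diagonal w · (𝔹 · diagonal w' · I) ≈ᴹ x ∙ (L · mk x 𝟘 k x⁻¹)
    descending-pair L w w' x x⁻¹ k h h' inv = pull L _ _ x _ (entries
      (trans (solve 2 (λ w w' → w :* ((:1 :* w' :+ :0 :* :0) :* :1 :+ (:1 :* :0 :+ :0 :* :1) :* :0) :+
                      :0 :* ((:1 :* w' :+ :1 :* :0) :* :1 :+ (:1 :* :0 :+ :1 :* :1) :* :0) := w :* w') refl w w') h)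
      (solve 3 (λ w w' x → w :* ((:1 :* w' :+ :0 :* :0) :* :0 :+ (:1 :* :0 :+ :0 :* :1) :* :1) :+
                      :0 :* ((:1 :* w' :+ :1 :* :0) :* :0 :+ (:1 :* :0 :+ :1 :* :1) :* :1) := x :* :0) refl w w' x)
      (trans (solve 2 (λ w w' → :0 :* ((:1 :* w' :+ :0 :* :0) :* :1 :+ (:1 :* :0 :+ :0 :* :1) :* :0) :+
                      :1 :* ((:1 :* w' :+ :1 :* :0) :* :1 :+ (:1 :* :0 :+ :1 :* :1) :* :0) := w') refl w w') h')
      (trans (solve 1 (λ w' → :0 :* ((:1 :* w' :+ :0 :* :0) :* :0 :+ (:1 :* :0 :+ :0 :* :1) :* :1) :+
                      :1 :* ((:1 :* w' :+ :1 :* :0) :* :0 :+ (:1 :* :0 :+ :1 :* :1) :* :1) := :1) refl w') (sym inv)))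

    ascending-pair : ∀ L w w' x x⁻¹ k → w * w' ≈ x * x → w ≈ x * k → x * x⁻¹ ≈ 𝟙 →
      L · diagonal w · (𝔸 · diagonal w' · I) ≈ᴹ x ∙ (L · mk x k 𝟘 x⁻¹)
    ascending-pair L w w' x x⁻¹ k h h' inv = pull L _ _ x _ (entries
      (trans (solve 2 (λ w w' → w :* ((:1 :* w' :+ :1 :* :0) :* :1 :+ (:1 :* :0 :+ :1 :* :1) :* :0) :+
                      :0 :* ((:0 :* w' :+ :1 :* :0) :* :1 :+ (:0 :* :0 :+ :1 :* :1) :* :0) := w :* w') refl w w') h)
      (trans (solve 2 (λ w w' → w :* ((:1 :* w' :+ :1 :* :0) :* :0 :+ (:1 :* :0 :+ :1 :* :1) :* :1) :+
                      :0 :* ((:0 :* w' :+ :1 :* :0) :* :0 :+ (:0 :* :0 :+ :1 :* :1) :* :1) := w) refl w w') h')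
      (solve 2 (λ w' x → :0 :* ((:1 :* w' :+ :1 :* :0) :* :1 :+ (:1 :* :0 :+ :1 :* :1) :* :0) :+
                      :1 :* ((:0 :* w' :+ :1 :* :0) :* :1 :+ (:0 :* :0 :+ :1 :* :1) :* :0) := x :* :0) refl w' x)
      (trans (solve 1 (λ w' → :0 :* ((:1 :* w' :+ :1 :* :0) :* :0 :+ (:1 :* :0 :+ :1 :* :1) :* :1) :+
                      :1 :* ((:0 :* w' :+ :1 :* :0) :* :0 :+ (:0 :* :0 :+ :1 :* :1) :* :1) := :1) refl w') (sym inv)))

    single : ∀ L w x x⁻¹ → w ≈ x * x → x * x⁻¹ ≈ 𝟙 → L · diagonal w · I ≈ᴹ x ∙ (L · mk x 𝟘 𝟘 x⁻¹)
    single L w x x⁻¹ h inv = pull L _ _ x _ (entries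
      (trans (solve 1 (λ w → w :* :1 :+ :0 :* :0 := w) refl w) h)
      (solve 2 (λ w x → w :* :0 :+ :0 :* :1 := x :* :0) refl w x)
      (solve 2 (λ w x → :0 :* :1 :+ :1 :* :0 := x :* :0) refl w x)
      (trans (solve 0 (:0 :* :0 :+ :1 :* :1 := :1) refl) (sym inv)))

    neg-one : ∀ m n → m * 𝟙 ≈ n → - n ≈ - 𝟙 * m
    neg-one m n h = trans (-‿cong (sym h)) (solve 1 (λ m → :- (m :* :1) := :- :1 :* m) refl m)

    module Conjugate (x x⁻¹ k : Lbl → Carrier) (inverse : ∀ ℓ → x ℓ * x⁻¹ ℓ ≈ 𝟙)
                     (ξ ξ⁻¹ : Carrier) (ξ-inverse : ξ * ξ⁻¹ ≈ 𝟙) where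
      open Letters x x⁻¹ k

      -- `ξ` will be the quotient of the prefactors `x^g` and `x^g°`, which is `x₂x₃/x₁` for every
      -- slope. The factor `𝔸` in `K = Ξ 𝔸` is the link in front of the first element of a fence.
      K K⁻¹ Ξ Ξ⁻¹ : Mat
      K = mk ξ ξ 𝟘 𝟙
      K⁻¹ = mk ξ⁻¹ (- 𝟙) 𝟘 𝟙
      Ξ = mk ξ 𝟘 𝟘 𝟙
      Ξ⁻¹ = mk ξ⁻¹ 𝟘 𝟘 𝟙

      κ : Mat → Mat
      κ X = K · X · K⁻¹

      κ-cong : ∀ {X Y} → X ≈ᴹ Y → κ X ≈ᴹ κ Y
      κ-cong h = ·-congʳ (·-congˡ h)

      K⁻¹·K : K⁻¹ · K ≈ᴹ I
      K⁻¹·K = entries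
        (trans (solve 2 (λ x y → y :* x :+ :- :1 :* :0 := x :* y) refl ξ ξ⁻¹) ξ-inverse)
        (trans (solve 2 (λ x y → y :* x :+ :- :1 :* :1 := x :* y :+ :- :1) refl ξ ξ⁻¹)
          (trans (+-cong ξ-inverse refl) (solve 0 (:1 :+ :- :1 := :0) refl)))
        (solve 1 (λ x → :0 :* x :+ :1 :* :0 := :0) refl ξ)
        (solve 1 (λ x → :0 :* x :+ :1 :* :1 := :1) refl ξ)

      κ-· : ∀ X Y → κ X · κ Y ≈ᴹ κ (X · Y)
      κ-· X Y = begin
        (K · X · K⁻¹) · (K · Y · K⁻¹)    ≈⟨ ·-assoc (K · X) K⁻¹ _ ⟩
        K · X · (K⁻¹ · (K · Y · K⁻¹))    ≈⟨ ·-congˡ (·-assoc K⁻¹ (K · Y) K⁻¹) ⟨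
        K · X · (K⁻¹ · (K · Y) · K⁻¹)    ≈⟨ ·-congˡ (·-congʳ (·-assoc K⁻¹ K Y)) ⟨
        K · X · (K⁻¹ · K · Y · K⁻¹)      ≈⟨ ·-congˡ (·-congʳ (·-congʳ K⁻¹·K)) ⟩
        K · X · (I · Y · K⁻¹)            ≈⟨ ·-congˡ (·-congʳ (·-identityˡ Y)) ⟩
        K · X · (Y · K⁻¹)                ≈⟨ ·-assoc (K · X) Y K⁻¹ ⟨
        K · X · Y · K⁻¹                  ≈⟨ ·-congʳ (·-assoc K X Y) ⟩
        κ (X · Y)                        ∎
        where open import Relation.Binary.Reasoning.Setoid Mat-setoid

      κ-+ : ∀ X s Y → κ (X +ᴹ s ∙ Y) ≈ᴹ κ X +ᴹ s ∙ κ Y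
      κ-+ X s Y = begin
        K · (X +ᴹ s ∙ Y) · K⁻¹               ≈⟨ ·-congʳ (·-distribˡ K X (s ∙ Y)) ⟩
        (K · X +ᴹ K · (s ∙ Y)) · K⁻¹         ≈⟨ ·-distribʳ (K · X) (K · (s ∙ Y)) K⁻¹ ⟩
        κ X +ᴹ K · (s ∙ Y) · K⁻¹             ≈⟨ +ᴹ-cong ≈ᴹ-refl (·-congʳ (∙-·ʳ s K Y)) ⟩
        κ X +ᴹ (s ∙ (K · Y)) · K⁻¹           ≈⟨ +ᴹ-cong ≈ᴹ-refl (∙-·ˡ s (K · Y) K⁻¹) ⟩
        κ X +ᴹ s ∙ κ Y                       ∎
        where open import Relation.Binary.Reasoning.Setoid Mat-setoid

      v : Mat
      v = letter (ℓ₂ , true)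

      tailWord : List Letter
      tailWord = (ℓ₃ , true) ∷ (ℓ₁ , true) ∷ (ℓ₂ , true) ∷ []

      tail : Mat
      tail = word tailWord

      det-v : detᴹ v ≈ 𝟙
      det-v = det-letter inverse (ℓ₂ , true)

      left-form : ∀ w → word w · tail ≈ᴹ word (w ++ (ℓ₃ , true) ∷ (ℓ₁ , true) ∷ []) · v
      left-form w = begin
        word w · (h · (d · (v · I)))     ≈⟨ ·-congˡ (·-congˡ (·-congˡ (·-identityʳ v))) ⟩
        word w · (h · (d · v))           ≈⟨ ·-congˡ (·-assoc h d v) ⟨
        word w · (h · d · v)             ≈⟨ ·-assoc (word w) (h · d) v ⟨
        word w · (h · d) · v             ≈⟨ ·-congʳ (·-congˡ (·-congˡ (·-identityʳ d))) ⟨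
        word w · (h · (d · I)) · v       ≈⟨ ·-congʳ (word-++ w _) ⟨
        word (w ++ (ℓ₃ , true) ∷ (ℓ₁ , true) ∷ []) · v ∎
        where
        open import Relation.Binary.Reasoning.Setoid Mat-setoid
        h d : Mat
        h = letter (ℓ₃ , true)
        d = letter (ℓ₁ , true)

      -- Moves a `v` into the word, as its letter at key 1, at the cost of a leading `adj v`; in
      -- `product-form` that factor cancels the trailing `v` of the left factor.
      right-form : ∀ w → word w · tail ≈ᴹ adj v · (word ((ℓ₂ , true) ∷ w) · tail)
      right-form w = ≈ᴹ-sym (begin
        adj v · (v · word w · tail)      ≈⟨ ·-congˡ (·-assoc v (word w) tail) ⟩
        adj v · (v · (word w · tail))    ≈⟨ ·-assoc (adj v) v (word w · tail) ⟨
        adj v · v · (word w · tail)      ≈⟨ ·-congʳ (adj-inverseˡ v det-v) ⟩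
        I · (word w · tail)              ≈⟨ ·-identityˡ _ ⟩
        word w · tail                    ∎)
        where open import Relation.Binary.Reasoning.Setoid Mat-setoid

      product-form : ∀ w w' → κ (word w · v) · κ (adj v · (word w' · tail)) ≈ᴹ κ (word (w ++ w') · tail)
      product-form w w' = ≈ᴹ-trans (κ-· (word w · v) _) (κ-cong (begin
        word w · v · (adj v · (word w' · tail))      ≈⟨ ·-assoc (word w) v _ ⟩
        word w · (v · (adj v · (word w' · tail)))    ≈⟨ ·-congˡ (·-assoc v (adj v) _) ⟨
        word w · (v · adj v · (word w' · tail))      ≈⟨ ·-congˡ (·-congʳ (adj-inverseʳ v det-v)) ⟩
        word w · (I · (word w' · tail))              ≈⟨ ·-congˡ (·-identityˡ _) ⟩
        word w · (word w' · tail)                    ≈⟨ ·-assoc (word w) (word w') tail ⟨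
        word w · word w' · tail                      ≈⟨ ·-congʳ (word-++ w w') ⟨
        word (w ++ w') · tail                        ∎))
        where open import Relation.Binary.Reasoning.Setoid Mat-setoid

      palindrome-form : ∀ u ℓ → κ (word (u ++ (ℓ , false) ∷ mirror u) · tail) ≈ᴹ
                                κ (word (u ++ (ℓ , true) ∷ mirror u) · tail) +ᴹ k ℓ ∙ κ (J · tail)
      palindrome-form u ℓ = ≈ᴹ-trans (κ-cong (≈ᴹ-trans (·-congʳ (palindrome-J inverse u ℓ))
          (≈ᴹ-trans (·-distribʳ (word (u ++ (ℓ , true) ∷ mirror u)) (k ℓ ∙ J) tail) (+ᴹ-cong ≈ᴹ-refl (∙-·ˡ (k ℓ) J tail)))))
        (κ-+ (word (u ++ (ℓ , true) ∷ mirror u) · tail) (k ℓ) (J · tail))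

      private
        r₃ r₁ r₂ : Mat
        r₃ = crossing ℓ₃ true
        r₁ = crossing ℓ₁ true
        r₂ = crossing ℓ₂ true

      -- These lack the final `𝔸` that the letter `v` carries; conjugation removes it, by
      -- `𝔸 K⁻¹ = Ξ⁻¹`.
      H-mat H₀-mat : Mat
      H-mat = (𝔸 · r₃) · ((𝔹 · r₁) · (𝔹 · r₂))
      H₀-mat = (𝔸 · r₁) · (𝔹 · r₂)

      K-Ξ : K ≈ᴹ Ξ · 𝔸
      K-Ξ = entries (solve 1 (λ x → x := x :* :1 :+ :0 :* :0) refl ξ) (solve 1 (λ x → x := x :* :1 :+ :0 :* :1) refl ξ)
                    (solve 0 (:0 := :0 :* :1 :+ :1 :* :0) refl) (solve 0 (:1 := :0 :* :1 :+ :1 :* :1) refl)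

      𝔸-K⁻¹ : 𝔸 · K⁻¹ ≈ᴹ Ξ⁻¹
      𝔸-K⁻¹ = entries (solve 1 (λ x → :1 :* x :+ :1 :* :0 := x) refl ξ⁻¹) (solve 0 (:1 :* :- :1 :+ :1 :* :1 := :0) refl)
                      (solve 1 (λ x → :0 :* x :+ :1 :* :0 := :0) refl ξ⁻¹) (solve 0 (:0 :* :- :1 :+ :1 :* :1 := :1) refl)

      private
        v-K⁻¹ : v · I · K⁻¹ ≈ᴹ 𝔹 · r₂ · Ξ⁻¹
        v-K⁻¹ = ≈ᴹ-trans (·-congʳ (·-identityʳ v)) (≈ᴹ-trans (·-assoc (𝔹 · r₂) 𝔸 K⁻¹) (·-congˡ 𝔸-K⁻¹))

        dv-K⁻¹ : r₁ · (v · I) · K⁻¹ ≈ᴹ r₁ · (𝔹 · r₂) · Ξ⁻¹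
        dv-K⁻¹ = ≈ᴹ-trans (·-assoc r₁ (v · I) K⁻¹) (≈ᴹ-trans (·-congˡ v-K⁻¹) (≈ᴹ-sym (·-assoc r₁ (𝔹 · r₂) Ξ⁻¹)))

      unfold-κ : ∀ X Y → K · X · Y ≈ᴹ Ξ · ((𝔸 · X) · Y)
      unfold-κ X Y = ≈ᴹ-trans (·-congʳ (≈ᴹ-trans (·-congʳ K-Ξ) (·-assoc Ξ 𝔸 X))) (·-assoc Ξ (𝔸 · X) Y)

      κ-core : ∀ X → κ (X · tail) ≈ᴹ Ξ · ((𝔸 · X) · H-mat) · Ξ⁻¹
      κ-core X = begin
        K · (X · tail) · K⁻¹                       ≈⟨ ·-congʳ (≈ᴹ-sym (·-assoc K X tail)) ⟩
        K · X · tail · K⁻¹                         ≈⟨ ·-assoc (K · X) tail K⁻¹ ⟩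
        K · X · (tail · K⁻¹)                       ≈⟨ ·-congˡ tail-K⁻¹ ⟩
        K · X · (H-mat · Ξ⁻¹)                      ≈⟨ unfold-κ X (H-mat · Ξ⁻¹) ⟩
        Ξ · ((𝔸 · X) · (H-mat · Ξ⁻¹))              ≈⟨ ·-congˡ (·-assoc (𝔸 · X) H-mat Ξ⁻¹) ⟨
        Ξ · ((𝔸 · X) · H-mat · Ξ⁻¹)                ≈⟨ ·-assoc Ξ ((𝔸 · X) · H-mat) Ξ⁻¹ ⟨
        Ξ · ((𝔸 · X) · H-mat) · Ξ⁻¹                ∎
        where
        open import Relation.Binary.Reasoning.Setoid Mat-setoid
        tail-K⁻¹ : tail · K⁻¹ ≈ᴹ H-mat · Ξ⁻¹
        tail-K⁻¹ = begin
          (𝔸 · r₃ · 𝔹) · (r₁ · (v · I)) · K⁻¹           ≈⟨ ·-assoc (𝔸 · r₃ · 𝔹) (r₁ · (v · I)) K⁻¹ ⟩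
          (𝔸 · r₃ · 𝔹) · (r₁ · (v · I) · K⁻¹)           ≈⟨ ·-congˡ dv-K⁻¹ ⟩
          (𝔸 · r₃ · 𝔹) · (r₁ · (𝔹 · r₂) · Ξ⁻¹)          ≈⟨ ·-assoc (𝔸 · r₃ · 𝔹) (r₁ · (𝔹 · r₂)) Ξ⁻¹ ⟨
          (𝔸 · r₃ · 𝔹) · (r₁ · (𝔹 · r₂)) · Ξ⁻¹          ≈⟨ ·-congʳ (·-assoc (𝔸 · r₃) 𝔹 _) ⟩
          (𝔸 · r₃) · (𝔹 · (r₁ · (𝔹 · r₂))) · Ξ⁻¹        ≈⟨ ·-congʳ (·-congˡ (·-assoc 𝔹 r₁ (𝔹 · r₂))) ⟨
          H-mat · Ξ⁻¹                                   ∎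

      κ-0/1 : κ (word ((ℓ₁ , true) ∷ []) · v) ≈ᴹ Ξ · H₀-mat · Ξ⁻¹
      κ-0/1 = begin
        K · (r₁ · I · v) · K⁻¹               ≈⟨ κ-cong (·-congʳ (·-identityʳ r₁)) ⟩
        K · (r₁ · v) · K⁻¹                   ≈⟨ ·-congʳ (≈ᴹ-sym (·-assoc K r₁ v)) ⟩
        K · r₁ · v · K⁻¹                     ≈⟨ ·-assoc (K · r₁) v K⁻¹ ⟩
        K · r₁ · (v · K⁻¹)                   ≈⟨ ·-congˡ (≈ᴹ-trans (·-assoc (𝔹 · r₂) 𝔸 K⁻¹) (·-congˡ 𝔸-K⁻¹)) ⟩
        K · r₁ · ((𝔹 · r₂) · Ξ⁻¹)            ≈⟨ unfold-κ r₁ _ ⟩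
        Ξ · ((𝔸 · r₁) · ((𝔹 · r₂) · Ξ⁻¹))    ≈⟨ ·-congˡ (·-assoc (𝔸 · r₁) (𝔹 · r₂) Ξ⁻¹) ⟨
        Ξ · (H₀-mat · Ξ⁻¹)                   ≈⟨ ·-assoc Ξ H₀-mat Ξ⁻¹ ⟨
        Ξ · H₀-mat · Ξ⁻¹                     ∎
        where open import Relation.Binary.Reasoning.Setoid Mat-setoid

      Ξ-conjugate : ∀ X → Ξ · X · Ξ⁻¹ ≈ᴹ mk (Mat.e₁₁ X) (ξ * Mat.e₁₂ X) (ξ⁻¹ * Mat.e₂₁ X) (Mat.e₂₂ X)
      Ξ-conjugate (mk a b c d) = entries
        (trans (solve 6 (λ x y a b c d → (x :* a :+ :0 :* c) :* y :+ (x :* b :+ :0 :* d) :* :0 := (x :* y) :* a) refl ξ ξ⁻¹ a b c d)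
          (trans (*-cong ξ-inverse refl) (solve 1 (λ a → :1 :* a := a) refl a)))
        (solve 5 (λ x a b c d → (x :* a :+ :0 :* c) :* :0 :+ (x :* b :+ :0 :* d) :* :1 := x :* b) refl ξ a b c d)
        (solve 5 (λ y a b c d → (:0 :* a :+ :1 :* c) :* y :+ (:0 :* b :+ :1 :* d) :* :0 := y :* c) refl ξ⁻¹ a b c d)
        (solve 4 (λ a b c d → (:0 :* a :+ :1 :* c) :* :0 :+ (:0 :* b :+ :1 :* d) :* :1 := d) refl a b c d)

      private
        -- Matrices of solver expressions: a long product is written once and each of its entries is
        -- handed to the solver as one polynomial.
        record PMat (n : ℕ) : Set where
          constructor pm
          field
            p₁₁ p₁₂ p₂₁ p₂₂ : Polynomial n
        open PMat

        infixr 7 _·ᵖ_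
        _·ᵖ_ : ∀ {n} → PMat n → PMat n → PMat n
        pm a b c d ·ᵖ pm a' b' c' d' =
          pm (a :* a' :+ b :* c') (a :* b' :+ b :* d') (c :* a' :+ d :* c') (c :* b' :+ d :* d')

        κJ : ∀ {n} (a b c a' b' c' k₃ k₁ k₂ x y : Polynomial n) → PMat n
        κJ a b c a' b' c' k₃ k₁ k₂ x y =
          (pm x x :0 :1 ·ᵖ (pm :0 :1 (:- :1) :0 ·ᵖ
            (((pm :1 :1 :0 :1 ·ᵖ pm a :0 k₃ a') ·ᵖ pm :1 :0 :1 :1) ·ᵖ (pm b :0 k₁ b' ·ᵖ
              ((((pm :1 :0 :1 :1 ·ᵖ pm c :0 k₂ c') ·ᵖ pm :1 :1 :0 :1)) ·ᵖ pm :1 :0 :0 :1)))))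
          ·ᵖ pm y (:- :1) :0 :1

      -- Only x₁x₂x₃ = 1 and ξ ξ⁻¹ = 1 are missing to recognise −T here.
      κ-J-tail : let a = x ℓ₃ ; b = x ℓ₁ ; c = x ℓ₂ ; a' = x⁻¹ ℓ₃ ; b' = x⁻¹ ℓ₁ ; c' = x⁻¹ ℓ₂ in
        κ (J · tail) ≈ᴹ mk (- ((ξ * ξ⁻¹) * (a * b * c))) 𝟘
          (- (ξ⁻¹ * (a * b * c + k ℓ₃ * (b * c) + a' * b * c + k ℓ₁ * (a' * c) + a' * b' * c + k ℓ₂ * (a' * b'))))
          (- (a' * b' * c'))
      κ-J-tail = entries
        (solve 11 (λ a b c a' b' c' k₃ k₁ k₂ x y → p₁₁ (κJ a b c a' b' c' k₃ k₁ k₂ x y) :=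
          :- ((x :* y) :* (a :* b :* c))) refl (x ℓ₃) (x ℓ₁) (x ℓ₂) (x⁻¹ ℓ₃) (x⁻¹ ℓ₁) (x⁻¹ ℓ₂) (k ℓ₃) (k ℓ₁) (k ℓ₂) ξ ξ⁻¹)
        (solve 11 (λ a b c a' b' c' k₃ k₁ k₂ x y → p₁₂ (κJ a b c a' b' c' k₃ k₁ k₂ x y) :=
          :0) refl (x ℓ₃) (x ℓ₁) (x ℓ₂) (x⁻¹ ℓ₃) (x⁻¹ ℓ₁) (x⁻¹ ℓ₂) (k ℓ₃) (k ℓ₁) (k ℓ₂) ξ ξ⁻¹)
        (solve 11 (λ a b c a' b' c' k₃ k₁ k₂ x y → p₂₁ (κJ a b c a' b' c' k₃ k₁ k₂ x y) :=
          :- (y :* (a :* b :* c :+ k₃ :* (b :* c) :+ a' :* b :* c :+ k₁ :* (a' :* c) :+ a' :* b' :* c :+ k₂ :* (a' :* b'))))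
          refl (x ℓ₃) (x ℓ₁) (x ℓ₂) (x⁻¹ ℓ₃) (x⁻¹ ℓ₁) (x⁻¹ ℓ₂) (k ℓ₃) (k ℓ₁) (k ℓ₂) ξ ξ⁻¹)
        (solve 11 (λ a b c a' b' c' k₃ k₁ k₂ x y → p₂₂ (κJ a b c a' b' c' k₃ k₁ k₂ x y) :=
          :- (a' :* b' :* c')) refl (x ℓ₃) (x ℓ₁) (x ℓ₂) (x⁻¹ ℓ₃) (x⁻¹ ℓ₁) (x⁻¹ ℓ₂) (k ℓ₃) (k ℓ₁) (k ℓ₂) ξ ξ⁻¹)

      -- The left factor is `K v⁻¹ J⁻¹ K⁻¹`. Splitting it off leaves the matrix `κ (J · tail)`
      -- computed above, so `h d v` need not be expanded again.
      κ-1/0 : κ (adj v · (word [] · tail)) ≈ᴹ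
              mk 𝟘 (- (ξ * x⁻¹ ℓ₂)) (x ℓ₂ * ξ⁻¹) (k ℓ₂) · κ (J · tail)
      κ-1/0 = begin
        K · (adj v · (I · tail)) · K⁻¹    ≈⟨ κ-cong (·-congˡ (·-identityˡ tail)) ⟩
        K · (adj v · tail) · K⁻¹          ≈⟨ ·-congʳ (·-assoc K (adj v) tail) ⟨
        K · adj v · tail · K⁻¹            ≈⟨ ·-congʳ (·-congʳ K-adj) ⟩
        W₀ · (K · J) · tail · K⁻¹         ≈⟨ ·-congʳ (·-assoc W₀ (K · J) tail) ⟩
        W₀ · (K · J · tail) · K⁻¹         ≈⟨ ·-congʳ (·-congˡ (·-assoc K J tail)) ⟩
        W₀ · (K · (J · tail)) · K⁻¹       ≈⟨ ·-assoc W₀ (K · (J · tail)) K⁻¹ ⟩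
        W₀ · κ (J · tail)                 ∎
        where
        open import Relation.Binary.Reasoning.Setoid Mat-setoid
        W₀ : Mat
        W₀ = mk 𝟘 (- (ξ * x⁻¹ ℓ₂)) (x ℓ₂ * ξ⁻¹) (k ℓ₂)
        adjᵖ vᵖ : ∀ {n} → PMat n → PMat n
        adjᵖ (pm a b c d) = pm d (:- b) (:- c) a
        vᵖ X = (pm :1 :0 :1 :1 ·ᵖ X) ·ᵖ pm :1 :1 :0 :1
        lhs rhs : ∀ {n} (c c' k x y : Polynomial n) → PMat n
        lhs c c' k x y = pm x x :0 :1 ·ᵖ adjᵖ (vᵖ (pm c :0 k c'))
        rhs c c' k x y = pm :0 (:- (x :* c')) (c :* y) k ·ᵖ (pm x x :0 :1 ·ᵖ pm :0 :1 (:- :1) :0)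
        fix : ∀ z → z * 𝟙 ≈ z * (ξ * ξ⁻¹)
        fix z = *-cong refl (sym ξ-inverse)
        K-adj : K · adj v ≈ᴹ W₀ · (K · J)
        K-adj = entries
          (solve 5 (λ c c' k x y → p₁₁ (lhs c c' k x y) := p₁₁ (rhs c c' k x y)) refl (x ℓ₂) (x⁻¹ ℓ₂) (k ℓ₂) ξ ξ⁻¹)
          (solve 5 (λ c c' k x y → p₁₂ (lhs c c' k x y) := p₁₂ (rhs c c' k x y)) refl (x ℓ₂) (x⁻¹ ℓ₂) (k ℓ₂) ξ ξ⁻¹)
          (trans (solve 5 (λ c c' k x y → p₂₁ (lhs c c' k x y) := :- (c :* :1) :+ :- k) refl (x ℓ₂) (x⁻¹ ℓ₂) (k ℓ₂) ξ ξ⁻¹)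
            (trans (+-cong (-‿cong (fix (x ℓ₂))) refl)
              (solve 5 (λ c c' k x y → :- (c :* (x :* y)) :+ :- k := p₂₁ (rhs c c' k x y)) refl (x ℓ₂) (x⁻¹ ℓ₂) (k ℓ₂) ξ ξ⁻¹)))
          (trans (solve 5 (λ c c' k x y → p₂₂ (lhs c c' k x y) := c :* :1) refl (x ℓ₂) (x⁻¹ ℓ₂) (k ℓ₂) ξ ξ⁻¹)
            (trans (fix (x ℓ₂))
              (solve 5 (λ c c' k x y → c :* (x :* y) := p₂₂ (rhs c c' k x y)) refl (x ℓ₂) (x⁻¹ ℓ₂) (k ℓ₂) ξ ξ⁻¹)))

      H₀-entries : let b = x ℓ₁ ; c = x ℓ₂ ; b' = x⁻¹ ℓ₁ ; c' = x⁻¹ ℓ₂ in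
        Ξ · H₀-mat · Ξ⁻¹ ≈ᴹ mk (b * c + k ℓ₁ * c + b' * c + k ℓ₂ * b') (ξ * (b' * c'))
          (k ℓ₁ * (ξ⁻¹ * c) + ξ⁻¹ * (b' * c) + k ℓ₂ * (ξ⁻¹ * b')) (b' * c')
      H₀-entries = ≈ᴹ-trans (Ξ-conjugate H₀-mat) (entries
        (solve 6 (λ b c b' c' k₁ k₂ → p₁₁ (hᵖ b c b' c' k₁ k₂) := b :* c :+ k₁ :* c :+ b' :* c :+ k₂ :* b') refl b c b' c' (k ℓ₁) (k ℓ₂))
        (solve 7 (λ b c b' c' k₁ k₂ x → x :* p₁₂ (hᵖ b c b' c' k₁ k₂) := x :* (b' :* c')) refl b c b' c' (k ℓ₁) (k ℓ₂) ξ)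
        (solve 7 (λ b c b' c' k₁ k₂ y → y :* p₂₁ (hᵖ b c b' c' k₁ k₂) := k₁ :* (y :* c) :+ y :* (b' :* c) :+ k₂ :* (y :* b')) refl b c b' c' (k ℓ₁) (k ℓ₂) ξ⁻¹)
        (solve 6 (λ b c b' c' k₁ k₂ → p₂₂ (hᵖ b c b' c' k₁ k₂) := b' :* c') refl b c b' c' (k ℓ₁) (k ℓ₂)))
        where
        b = x ℓ₁
        c = x ℓ₂
        b' = x⁻¹ ℓ₁
        c' = x⁻¹ ℓ₂
        hᵖ : ∀ {n} (b c b' c' k₁ k₂ : Polynomial n) → PMat n
        hᵖ b c b' c' k₁ k₂ = (pm :1 :1 :0 :1 ·ᵖ pm b :0 k₁ b') ·ᵖ (pm :1 :0 :1 :1 ·ᵖ pm c :0 k₂ c')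

      det-κ : ∀ X → detᴹ X ≈ 𝟙 → detᴹ (κ X) ≈ 𝟙
      det-κ X h = trans (det-· (K · X) K⁻¹) (trans (*-cong (trans (det-· K X) (*-cong refl h)) refl)
        (trans (solve 2 (λ x y → ((x :* :1 :+ :- (x :* :0)) :* :1) :* (y :* :1 :+ :- (:- :1 :* :0)) := x :* y) refl ξ ξ⁻¹) ξ-inverse))

    module Root (M : Carrier) where
      open CGC M

      -T-product : ∀ a b k N → N ≈ᴹ (- 𝟙) ∙ T →
        mk 𝟘 (- a) b k · N ≈ᴹ mk (a * M) a (- (k * M) + - b) (- k)
      -T-product a b k N h = ≈ᴹ-trans (·-congˡ h) (entries
        (solve 2 (λ a M → :0 :* (:- :1 :* :1) :+ :- a :* (:- :1 :* M) := a :* M) refl a M)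
        (solve 1 (λ a → :0 :* (:- :1 :* :0) :+ :- a :* (:- :1 :* :1) := a) refl a)
        (solve 3 (λ b k M → b :* (:- :1 :* :1) :+ k :* (:- :1 :* M) := :- (k :* M) :+ :- b) refl b k M)
        (solve 2 (λ b k → b :* (:- :1 :* :0) :+ k :* (:- :1 :* :1) := :- k) refl b k))

      -∙-T : ∀ k N X → N ≈ᴹ (- 𝟙) ∙ T → X +ᴹ k ∙ N ≈ᴹ X +ᴹ (- k) ∙ T
      -∙-T k N X h = +ᴹ-cong ≈ᴹ-refl (≈ᴹ-trans (∙-cong refl h) (≈ᴹ-trans (∙-∙ k (- 𝟙) T)
        (∙-cong (solve 1 (λ k → k :* :- :1 := :- k) refl k) ≈ᴹ-refl)))

      right-root : ∀ y y' k → y * y' ≈ 𝟙 → IsC k (mk (y * M) y (- (k * M) + - y') (- k))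
      right-root y y' k h = isC
        (trans (solve 4 (λ y y' k M → (y :* M) :* :- k :+ :- (y :* (:- (k :* M) :+ :- y')) := y :* y') refl y y' k M) h)
        (solve 3 (λ y k M → y :* M :+ :- k :+ :- (M :* y) := :- k) refl y k M)

      -- The `sᵢ` and `tᵢ` stand for monomials in the entries of C_{0/1}. The few relations between
      -- them that matter are hypotheses, so the solver can treat them as variables.
      module _ (s₁ s₂ s₃ s₄ s₅ t₂ t₃ t₄ z y y' x k₁ k₂ k₃ : Carrier)
               (hM : M * z ≈ s₅ + (s₁ + k₁ * s₂ + s₃ + k₂ * s₄) + k₃) where

        private
          P₀ R₀ : Mat
          P₀ = mk (s₁ + k₁ * s₂ + s₃ + k₂ * s₄) z (k₁ * t₂ + t₃ + k₂ * t₄) s₅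
          R₀ = mk (y * M) y (- (k₂ * M) + - y') (- k₂)

        left-root : F P₀ ≈ - k₃
        left-root = trans (+-cong refl (-‿cong hM))
          (solve 8 (λ s₁ s₂ s₃ s₄ s₅ k₁ k₂ k₃ → (s₁ :+ k₁ :* s₂ :+ s₃ :+ k₂ :* s₄) :+ s₅ :+
            :- (s₅ :+ (s₁ :+ k₁ :* s₂ :+ s₃ :+ k₂ :* s₄) :+ k₃) := :- k₃) refl s₁ s₂ s₃ s₄ s₅ k₁ k₂ k₃)

        -- Provides the hypothesis of `isC-product` for 1/1, where there is no parent triple to
        -- derive it from.
        middle-root : t₂ * y ≈ 𝟙 → t₃ * y ≈ z * y' → t₄ * y ≈ s₅ → F (P₀ · R₀) ≈ k₁
        middle-root h₂ h₃ h₄ = trans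
          (solve 11 (λ u z t₂ t₃ t₄ s₅ y y' k₁ k₂ M →
            (u :* (y :* M) :+ z :* (:- (k₂ :* M) :+ :- y')) :+ ((k₁ :* t₂ :+ t₃ :+ k₂ :* t₄) :* y :+ s₅ :* :- k₂)
              :+ :- (M :* (u :* y :+ z :* :- k₂)) :=
            k₁ :* (t₂ :* y) :+ t₃ :* y :+ k₂ :* (t₄ :* y) :+ :- (z :* y') :+ :- (k₂ :* s₅))
            refl (s₁ + k₁ * s₂ + s₃ + k₂ * s₄) z t₂ t₃ t₄ s₅ y y' k₁ k₂ M)
          (trans (+-cong (+-cong (+-cong (+-cong (*-cong refl h₂) h₃) (*-cong refl h₄)) refl) refl)
            (solve 4 (λ k₁ k₂ s₅ w → k₁ :* :1 :+ w :+ k₂ :* s₅ :+ :- w :+ :- (k₂ :* s₅) := k₁) refl k₁ k₂ s₅ (z * y')))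

        -- The initial cluster takes the place of the missing parent triple: the variable at 1/1 is
        -- the jump that replaces `x₁`.
        jump-root : s₅ * y ≈ x → ∀ k → Mat.e₁₂ (P₀ · R₀ +ᴹ (- k) ∙ T) ≈ jump z y x k₃ k₂
        jump-root h₅ k = trans
          -- `k₃` is added and subtracted, and `s₅` in the next step, so that the right side of `hM`
          -- appears.
          (solve 6 (λ u z y k k₂ k₃ → u :* y :+ z :* :- k₂ :+ :- k :* :0 := (u :+ k₃ :+ :- k₃) :* y :+ :- (k₂ :* z))
            refl (s₁ + k₁ * s₂ + s₃ + k₂ * s₄) z y k k₂ k₃)
          (trans (solve 6 (λ u z y k₂ k₃ s₅ → (u :+ k₃ :+ :- k₃) :* y :+ :- (k₂ :* z) :=
              (s₅ :+ u :+ k₃ :+ :- k₃) :* y :+ :- (s₅ :* y) :+ :- (k₂ :* z)) refl (s₁ + k₁ * s₂ + s₃ + k₂ * s₄) z y k₂ k₃ s₅)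
            (+-cong (+-cong (*-cong (+-cong (sym hM) refl) refl) (-‿cong h₅)) refl))

      Markov-root : ∀ x y z u k₁ k₂ k₃ → M ≈ (x * x + y * y + z * z + k₁ * y * z + k₂ * x * z + k₃ * x * y) * u →
        u * (x * y * z) ≈ 𝟙 → Markov z y x k₃ k₂ k₁
      Markov-root x y z u k₁ k₂ k₃ hM hu = sym (begin
        M * z * y * x
          ≈⟨ *-cong (*-cong (*-cong hM refl) refl) refl ⟩
        (x * x + y * y + z * z + k₁ * y * z + k₂ * x * z + k₃ * x * y) * u * z * y * x
          ≈⟨ solve 5 (λ S u x y z → S :* u :* z :* y :* x := S :* (u :* (x :* y :* z))) refl _ u x y z ⟩
        (x * x + y * y + z * z + k₁ * y * z + k₂ * x * z + k₃ * x * y) * (u * (x * y * z))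
          ≈⟨ *-cong refl hu ⟩
        (x * x + y * y + z * z + k₁ * y * z + k₂ * x * z + k₃ * x * y) * 𝟙
          ≈⟨ solve 6 (λ x y z k₁ k₂ k₃ →
               (x :* x :+ y :* y :+ z :* z :+ k₁ :* y :* z :+ k₂ :* x :* z :+ k₃ :* x :* y) :* :1 :=
               z :* z :+ y :* y :+ x :* x :+ k₃ :* y :* x :+ k₂ :* z :* x :+ k₁ :* z :* y) refl x y z k₁ k₂ k₃ ⟩
        z * z + y * y + x * x + k₃ * y * x + k₂ * z * x + k₁ * z * y ∎)
        where open import Relation.Binary.Reasoning.Setoid setoid

      invariant-expansion : ∀ x y z u k₁ k₂ k₃ → M ≈ (x * x + y * y + z * z + k₁ * y * z + k₂ * x * z + k₃ * x * y) * u →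
        ∀ w → M * w ≈ x * x * u * w + y * y * u * w + z * z * u * w + k₁ * (y * z * u * w) + k₂ * (x * z * u * w) + k₃ * (x * y * u * w)
      invariant-expansion x y z u k₁ k₂ k₃ hM w = trans (*-cong hM refl) (solve 8 (λ x y z u k₁ k₂ k₃ w →
        (x :* x :+ y :* y :+ z :* z :+ k₁ :* y :* z :+ k₂ :* x :* z :+ k₃ :* x :* y) :* u :* w :=
        x :* x :* u :* w :+ y :* y :* u :* w :+ z :* z :* u :* w :+ k₁ :* (y :* z :* u :* w) :+ k₂ :* (x :* z :* u :* w) :+ k₃ :* (x :* y :* u :* w))
        refl x y z u k₁ k₂ k₃ w)

      invariant-regroup : ∀ s₁ s₂ s₃ s₄ s₅ k₁ k₂ k₃ →
        s₅ + s₁ + s₃ + k₁ * s₂ + k₂ * s₄ + k₃ * 𝟙 ≈ s₅ + (s₁ + k₁ * s₂ + s₃ + k₂ * s₄) + k₃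
      invariant-regroup = solve 8 (λ s₁ s₂ s₃ s₄ s₅ k₁ k₂ k₃ →
        s₅ :+ s₁ :+ s₃ :+ k₁ :* s₂ :+ k₂ :* s₄ :+ k₃ :* :1 := s₅ :+ (s₁ :+ k₁ :* s₂ :+ s₃ :+ k₂ :* s₄) :+ k₃) refl

      distribute : ∀ c a b d e f g k₁ k₂ k₃ → c * (a + k₃ * b + d + k₁ * e + f + k₂ * g) ≈
        c * a + c * d + c * f + k₁ * (c * e) + k₂ * (c * g) + k₃ * (c * b)
      distribute = solve 10 (λ c a b d e f g k₁ k₂ k₃ → c :* (a :+ k₃ :* b :+ d :+ k₁ :* e :+ f :+ k₂ :* g) :=
        c :* a :+ c :* d :+ c :* f :+ k₁ :* (c :* e) :+ k₂ :* (c :* g) :+ k₃ :* (c :* b)) refl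

-- Groups of a fence as letters, and the role of the g-vectors.

module FenceMatrices where

  open import Defs
  open LaurentRing
  open MatrixAlgebra
  open TransferMatrices
  open ConjugationAlgebra
  open import Data.Bool using (Bool; true; false; if_then_else_)
  open import Data.Integer as ℤ using (ℤ; +_)
  open import Data.List using ([]; _∷_; _++_)
  open import Data.Nat using (ℕ; zero; suc)
  open import Data.Product using (_,_)
  import Data.Rational as ℚ
  import Data.Rational.Properties as ℚₚ
  open import Relation.Binary.PropositionalEquality as ≡ using (_≡_; cong; cong₂)
  open M using (Mat; mk; _≈ᴹ_; entries; ≈₁₁; ≈₁₂; ≈₂₁; ≈₂₂; _·_; _∙_; link; 𝔸; 𝔹; ≈ᴹ-refl; ≈ᴹ-sym; ≈ᴹ-trans; refl; sym; trans; 𝟘; 𝟙)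

  module Cj = Conjugation LP-almostRing cst-homo

  module Fences (k₁ k₂ k₃ : ℕ) where
    open Setup k₁ k₂ k₃

    x x⁻¹ κs : Lbl → LP
    x ℓ = 𝐱^ (hatE ℓ)
    x⁻¹ ℓ = 𝐱^ (negₑ (hatE ℓ))
    κs ℓ = cst (+ kOf ℓ)

    opaque
      unfolding _⊞_ _⊠_ ⊟

      x-inverse : ∀ ℓ → x ℓ ⊠ x⁻¹ ℓ ≋ 𝟙
      x-inverse ℓ₁ = refl
      x-inverse ℓ₂ = refl
      x-inverse ℓ₃ = refl

    open M.Letters x x⁻¹ κs public

    ξ ξ⁻¹ : LP
    ξ = 𝐱^ (ℤ.- + 1 , + 1 , + 1)
    ξ⁻¹ = 𝐱^ (+ 1 , ℤ.- + 1 , ℤ.- + 1)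

    opaque
      unfolding _⊞_ _⊠_ ⊟

      ξ-inverse : ξ ⊠ ξ⁻¹ ≋ 𝟙
      ξ-inverse = refl

    open Cj.Conjugate x x⁻¹ κs x-inverse ξ ξ⁻¹ ξ-inverse public

    -- `group` and `hGroup` branch on `kOf a`; with the number as an argument, proofs can split on
    -- it directly. Groups of `H` are pieces with flag `true`.
    pieceOf : ℕ → Bool → Bool → Lbl → Fence
    pieceOf zero b c a = (b , hat² a) ∷ []
    pieceOf (suc k) b c a = if c then (b , hatOverK (suc k) a) ∷ (true , kHat (suc k) a) ∷ []
                                 else (b , kHat (suc k) a) ∷ (false , hatOverK (suc k) a) ∷ []

    piece : Bool → Bool → Lbl → Fence
    piece b c a = pieceOf (kOf a) b c a

    group-piece : ∀ p q b s → group p q b s ≡ piece b (closerRightᵇ p q s) (lbl s)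
    group-piece p q b s with kOf (lbl s)
    ... | zero  = ≡.refl
    ... | suc k = ≡.refl

    hGroup-piece : ∀ a → hGroup a ≡ piece true true a
    hGroup-piece a with kOf a
    ... | zero  = ≡.refl
    ... | suc k = ≡.refl

    private
      hat-square : ∀ k a → hatOverK (suc k) a ⊗ kHat (suc k) a ≡ x a ⊗ x a
      hat-square k a = cong (λ c → mono c (hatE a +ₑ hatE a))
        (≡.trans (ℚₚ.*-comm (+ 1 ℚ./ suc k) (+ suc k ℚ./ 1)) (k*1/k k))

      hat-square' : ∀ k a → kHat (suc k) a ⊗ hatOverK (suc k) a ≡ x a ⊗ x a
      hat-square' k a = cong (λ c → mono c (hatE a +ₑ hatE a)) (k*1/k k)

      kHat-≡ : ∀ k a → kHat (suc k) a ≡ x a ⊗ cst (+ suc k)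
      kHat-≡ k a = ≡.sym (cong₂ mono (ℚₚ.*-identityˡ (+ suc k ℚ./ 1)) (≡.trans (+ₑ-comm (hatE a) e₀) (+ₑ-identityˡ (hatE a))))

    crossingOf : ℕ → Lbl → Bool → Mat
    crossingOf k a true  = mk (x a) 𝟘 (cst (+ k)) (x⁻¹ a)
    crossingOf k a false = mk (x a) (cst (+ k)) 𝟘 (x⁻¹ a)

    crossingOf-≡ : ∀ a c → crossingOf (kOf a) a c ≡ crossing a c
    crossingOf-≡ a true  = ≡.refl
    crossingOf-≡ a false = ≡.refl

    opaque
      unfolding _⊞_ _⊠_ ⊟

      pieceOf-transfer : ∀ k b c a → transfer (pieceOf k b c a) ≈ᴹ x a ∙ (link b · crossingOf k a c)
      pieceOf-transfer zero b true a = Cj.single (link b) (hat² a) (x a) (x⁻¹ a) refl (x-inverse a)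
      pieceOf-transfer zero b false a = Cj.single (link b) (hat² a) (x a) (x⁻¹ a) refl (x-inverse a)
      pieceOf-transfer (suc k) b true a = Cj.descending-pair (link b) (hatOverK (suc k) a) (kHat (suc k) a) (x a) (x⁻¹ a)
        (cst (+ suc k)) (≡⇒≋ (hat-square k a)) (≡⇒≋ (kHat-≡ k a)) (x-inverse a)
      pieceOf-transfer (suc k) b false a = Cj.ascending-pair (link b) (kHat (suc k) a) (hatOverK (suc k) a) (x a) (x⁻¹ a)
        (cst (+ suc k)) (≡⇒≋ (hat-square' k a)) (≡⇒≋ (kHat-≡ k a)) (x-inverse a)

    piece-transfer : ∀ b c a → transfer (piece b c a) ≈ᴹ x a ∙ (link b · crossing a c)
    piece-transfer b c a = ≡.subst (λ X → transfer (piece b c a) ≈ᴹ x a ∙ (link b · X)) (crossingOf-≡ a c) (pieceOf-transfer (kOf a) b c a)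

    record IdealSums (F : Fence) (U : Mat) : Set where
      field
        sum-R : W[R] F ≋ Mat.e₁₁ U
        sum-¬R : W[¬R] F ≋ Mat.e₁₂ U
        sum-R¬L : W[R,¬L] F ≋ Mat.e₂₁ U
        sum-¬R¬L : W[¬R,¬L] F ≋ Mat.e₂₂ U

    idealSums-∷ : ∀ b w P → IdealSums ((b , w) ∷ P) (transfer ((false , w) ∷ P))
    idealSums-∷ b w P = record { sum-R = W[R]-transfer b w P ; sum-¬R = W[¬R]-transfer b w P
      ; sum-R¬L = W[R,¬L]-transfer b w P ; sum-¬R¬L = W[¬R,¬L]-transfer b w P }

    idealSums-pieceOf : ∀ k b c a X → IdealSums (pieceOf k b c a ++ X) (transfer (pieceOf k false c a ++ X))
    idealSums-pieceOf zero b c a X = idealSums-∷ b _ X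
    idealSums-pieceOf (suc k) b true a X = idealSums-∷ b _ _
    idealSums-pieceOf (suc k) b false a X = idealSums-∷ b _ _

    markUp-pieceOf : ∀ k b c a X → markUp (pieceOf k b c a ++ X) ≡ pieceOf k false c a ++ X
    markUp-pieceOf zero b c a X = ≡.refl
    markUp-pieceOf (suc k) b true a X = ≡.refl
    markUp-pieceOf (suc k) b false a X = ≡.refl

    markUp-H : markUp H ≡ piece false true ℓ₃ ++ (piece true true ℓ₁ ++ piece true true ℓ₂)
    markUp-H = ≡.trans (cong markUp (cong₂ _++_ (hGroup-piece ℓ₃) (cong₂ _++_ (hGroup-piece ℓ₁) (hGroup-piece ℓ₂))))
      (markUp-pieceOf k₃ true true ℓ₃ _)

    opaque
      unfolding _⊞_ _⊠_ ⊟

      -- The scalars taken out of the three letters of `H` cancel, so `H` contributes no monomial.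
      x-product : x ℓ₃ ⊠ (x ℓ₁ ⊠ x ℓ₂) ≋ 𝟙
      x-product = refl

      x₁x₂ : x ℓ₁ ⊠ x ℓ₂ ≋ 𝐱^ (ℤ.- + 1 , + 1 , + 0)
      x₁x₂ = refl

      mono-cancel : ∀ e f g V → e +ₑ f ≡ g → 𝐱^ e ⊗ (𝐱^ f ⊠ V) ≋ 𝐱^ g ⊠ V
      mono-cancel e f g V h = trans (≡⇒≋ (≡.sym (⊗-assoc (𝐱^ e) (𝐱^ f) V))) (≡⇒≋ (cong (λ z → 𝐱^ z ⊗ V) h))

      mono-cancel-1 : ∀ e f V → e +ₑ f ≡ e₀ → 𝐱^ e ⊗ (𝐱^ f ⊠ V) ≋ V
      mono-cancel-1 e f V h = trans (mono-cancel e f e₀ V h) (≡⇒≋ (⊗-identityˡ V))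

    transfer-H : transfer (markUp H) ≈ᴹ H-mat
    transfer-H = ≈ᴹ-trans (M.≈ᴹ-reflexive (cong transfer markUp-H)) (≈ᴹ-trans
      (transfer-++ (piece false true ℓ₃) _)
      (≈ᴹ-trans (M.·-cong (piece-transfer false true ℓ₃) (≈ᴹ-trans (transfer-++ (piece true true ℓ₁) (piece true true ℓ₂))
                   (M.·-cong (piece-transfer true true ℓ₁) (piece-transfer true true ℓ₂))))
        (≈ᴹ-trans (Cj.∙-·-∙-·-∙ (x ℓ₃) (x ℓ₁) (x ℓ₂) (𝔸 · crossing ℓ₃ true) (𝔹 · crossing ℓ₁ true) (𝔹 · crossing ℓ₂ true))
          (≈ᴹ-trans (M.∙-cong x-product ≈ᴹ-refl) (M.∙-identity H-mat)))))

    M2⇒Mat : M2 → Mat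
    M2⇒Mat (mat a b c d) = mk a b c d

    opaque
      -- Opaque, so that comparing matrices does not evaluate the sums over order ideals.
      Cᴹ : ℕ → ℕ → Mat
      Cᴹ p q = M2⇒Mat (C p q)

    -- `E` is the exponent taken out of the letters. The g-vectors satisfy `g° = −E` and
    -- `g = g° + (−1, 1, 1)`, so the prefactors remove that monomial and leave only the conjugation
    -- by `Ξ`.
    Cgen-matrix : ∀ g g° E F U V → IdealSums F U → U ≈ᴹ 𝐱^ E ∙ V →
      g° +ₑ E ≡ e₀ → g +ₑ E ≡ (ℤ.- + 1 , + 1 , + 1) → 2g°-g g° g +ₑ E ≡ (+ 1 , ℤ.- + 1 , ℤ.- + 1) →
      M2⇒Mat (Cgen g g° F) ≈ᴹ Ξ · V · Ξ⁻¹
    Cgen-matrix g g° E F U V S h e₁ e₂ e₃ = ≈ᴹ-trans (entries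
        (trans (⊗-congˡ (𝐱^ g°) (trans sum-R (≈₁₁ h))) (mono-cancel-1 g° E (Mat.e₁₁ V) e₁))
        (trans (⊗-congˡ (𝐱^ g) (trans sum-¬R (≈₁₂ h))) (mono-cancel g E _ (Mat.e₁₂ V) e₂))
        (trans (⊗-congˡ (𝐱^ (2g°-g g° g)) (trans sum-R¬L (≈₂₁ h))) (mono-cancel (2g°-g g° g) E _ (Mat.e₂₁ V) e₃))
        (trans (⊗-congˡ (𝐱^ g°) (trans sum-¬R¬L (≈₂₂ h))) (mono-cancel-1 g° E (Mat.e₂₂ V) e₁)))
      (≈ᴹ-sym (Ξ-conjugate V))
      where open IdealSums S

    opaque
      unfolding Cᴹ

      C-0/1 : Cᴹ 0 1 ≈ᴹ κ (word ((ℓ₁ , true) ∷ []) · v)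
      C-0/1 = ≈ᴹ-trans (Cgen-matrix (+ 0 , + 0 , + 1) (+ 1 , ℤ.- + 1 , + 0) (ℤ.- + 1 , + 1 , + 0) 𝒫̃₀ (transfer (piece false true ℓ₁ ++ piece true true ℓ₂)) H₀-mat sums transfer≈ ≡.refl ≡.refl ≡.refl) (≈ᴹ-sym κ-0/1)
        where
        F≡ : 𝒫̃₀ ≡ piece true true ℓ₁ ++ piece true true ℓ₂
        F≡ = cong₂ _++_ (hGroup-piece ℓ₁) (hGroup-piece ℓ₂)
        sums : IdealSums 𝒫̃₀ (transfer (piece false true ℓ₁ ++ piece true true ℓ₂))
        sums = ≡.subst (λ F → IdealSums F (transfer (piece false true ℓ₁ ++ piece true true ℓ₂))) (≡.sym F≡)
          (idealSums-pieceOf k₁ true true ℓ₁ (piece true true ℓ₂))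
        transfer≈ : transfer (piece false true ℓ₁ ++ piece true true ℓ₂) ≈ᴹ 𝐱^ (ℤ.- + 1 , + 1 , + 0) ∙ H₀-mat
        transfer≈ = ≈ᴹ-trans (transfer-++ (piece false true ℓ₁) (piece true true ℓ₂))
          (≈ᴹ-trans (M.·-cong (piece-transfer false true ℓ₁) (piece-transfer true true ℓ₂))
            (≈ᴹ-trans (Cj.∙-·-∙ (x ℓ₁) (x ℓ₂) (𝔸 · crossing ℓ₁ true) (𝔹 · crossing ℓ₂ true)) (M.∙-cong x₁x₂ ≈ᴹ-refl)))

-- Alternation of edges and diagonals, and their shared endpoints.

module PathLinks where

  open import Defs
  open Staircases
  open SegmentShapes
  open CrossingOrder
  open import Data.Bool using (true; false; if_then_else_; _∧_; _∨_)
  open import Data.Integer as ℤ using (ℤ; +_)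
  import Data.Integer.Properties as ℤₚ
  open import Data.Integer.Tactic.RingSolver using (solve-∀)
  open import Data.Integer using () renaming (_+_ to _+ᶻ_; _*_ to _*ᶻ_; _-_ to _-ᶻ_; -_ to -ᶻ_)
  open import Data.List using (List; []; _∷_; applyUpTo)
  open import Data.Nat using (ℕ; zero; suc; _+_; _≤_; _≟_; ⌊_/2⌋; ⌈_/2⌉)
  open import Data.Nat.Properties
  open import Data.Nat.Coprimality using (Coprime)
  open import Data.Product using (_×_; _,_; proj₁; proj₂)
  open import Data.Sum using (_⊎_; inj₁; inj₂)
  open import Relation.Binary.PropositionalEquality as ≡ using (_≡_; _≢_; cong; cong₂)
  open import Relation.Nullary using (yes; no; contradiction)
  open import Relation.Nullary.Decidable using (⌊_⌋)

  module _ {X : Set} (g : ℕ → ℕ → X) where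

    -- The list over doubled keys with the halvings resolved: each step is an edge and the diagonal
    -- after it, which suits induction along the path.
    alternate : ℕ → ℕ → List X
    alternate c zero    = []
    alternate c (suc j) = g c (suc c) ∷ g (suc c) (suc c) ∷ alternate (suc c) j

    private
      G : ℕ → X
      G k = g ⌊ k /2⌋ ⌈ k /2⌉

      odd-key : ∀ c → G (suc (c + c) + 0) ≡ g c (suc c)
      odd-key c = ≡.trans (cong G (≡.trans (+-identityʳ (suc (c + c))) (+-comm 1 (c + c))))
        (cong₂ g (≡.trans (⌊double+/2⌋ c 1) (+-identityʳ c)) (≡.trans (⌈double+/2⌉ c 1) (+-comm c 1)))

      even-key : ∀ c → G (suc (c + c) + 1) ≡ g (suc c) (suc c)
      even-key c = ≡.trans (cong G (≡.trans (≡.sym (+-suc (c + c) 1)) ≡.refl))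
        (cong₂ g (≡.trans (⌊double+/2⌋ c 2) (+-comm c 1)) (≡.trans (⌈double+/2⌉ c 2) (+-comm c 1)))

      next-key : ∀ c i → suc (c + c) + suc (suc i) ≡ suc (suc c + suc c) + i
      next-key c i = cong suc (≡.trans (+-suc (c + c) (suc i)) (cong suc (≡.trans (+-suc (c + c) i) (cong (_+ i) (≡.sym (+-suc c c))))))

    alternate-applyUpTo : ∀ c j → applyUpTo (λ i → G (suc (c + c) + i)) (j + j) ≡ alternate c j
    alternate-applyUpTo c zero = ≡.refl
    alternate-applyUpTo c (suc j) = ≡.trans (cong (applyUpTo (λ i → G (suc (c + c) + i))) (cong suc (+-suc j j)))
      (cong₂ (λ u w → u ∷ w) (odd-key c) (cong₂ _∷_ (even-key c)
        (≡.trans (applyUpTo-cong _ _ (j + j) (λ i _ → cong G (next-key c i))) (alternate-applyUpTo (suc c) j))))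

    core-alternate : ∀ m → applyUpTo (λ i → G (2 + i)) (m + suc m) ≡ g 1 1 ∷ alternate 1 m
    core-alternate m = ≡.trans (cong (applyUpTo (λ i → G (2 + i))) (+-suc m m)) (cong (g 1 1 ∷_) (alternate-applyUpTo 1 m))

  =ₚ-refl : ∀ z → (z =ₚ z) ≡ true
  =ₚ-refl (a , b) with a ≟ a | b ≟ b
  ... | yes _ | yes _ = ≡.refl
  ... | yes _ | no ne = contradiction ≡.refl ne
  ... | no ne | _     = contradiction ≡.refl ne

  =ₚ-≢ : ∀ z w → z ≢ w → (z =ₚ w) ≡ false
  =ₚ-≢ (a , b) (c , d) ne with a ≟ c | b ≟ d
  ... | yes ≡.refl | yes ≡.refl = contradiction ≡.refl ne
  ... | yes _ | no _ = ≡.refl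
  ... | no _ | _ = ≡.refl

  module Path (p q : ℕ) (1≤p : 1 ≤ p) (1≤q : 1 ≤ q) (cop : Coprime p q) where
    open Shapes p q 1≤p 1≤q cop
    open Sorting p q 1≤p 1≤q cop hiding (crossing)

    private
      left-flag : ∀ {z} → Neg z → ⌊ + 0 ℤ.<? side p q z ⌋ ≡ false
      left-flag {z} h with + 0 ℤ.<? side p q z
      ... | no _ = ≡.refl
      ... | yes g = contradiction (by-≡ (e (side p q z)) (0≤-+ h (ℤₚ.i≤j⇒0≤j-i (ℤₚ.<⇒≤ g)))) 0≰-1
        where
        e : ∀ s → -ᶻ (+ 1) ≡ (-ᶻ (+ 1) -ᶻ s) +ᶻ (s -ᶻ + 0)
        e = solve-∀

      right-flag : ∀ {z} → Pos z → ⌊ + 0 ℤ.<? side p q z ⌋ ≡ true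
      right-flag {z} h with + 0 ℤ.<? side p q z
      ... | yes _ = ≡.refl
      ... | no g = contradiction (by-≡ (e (side p q z)) (0≤-+ h (ℤₚ.i≤j⇒0≤j-i (ℤₚ.≮⇒≥ g)))) 0≰-1
        where
        e : ∀ s → -ᶻ (+ 1) ≡ (s -ᶻ + 1) +ᶻ (+ 0 -ᶻ s)
        e = solve-∀

      shared : ∀ s t {a b c d e f} → (A s =ₚ A t) ≡ a → (A s =ₚ B t) ≡ b → (B s =ₚ A t) ≡ c → (B s =ₚ B t) ≡ d →
        ⌊ + 0 ℤ.<? side p q (A s) ⌋ ≡ e → ⌊ + 0 ℤ.<? side p q (B s) ⌋ ≡ f →
        sharedRightᵇ p q s t ≡ ((a ∨ b) ∧ e) ∨ ((c ∨ d) ∧ f)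
      shared s t ≡.refl ≡.refl ≡.refl ≡.refl ≡.refl ≡.refl = ≡.refl

      x≢ : ∀ {m n n' : ℕ} → (m , n) ≢ (suc m , n')
      x≢ ()
      x≢' : ∀ {m n n' : ℕ} → (suc m , n) ≢ (m , n')
      x≢' ()
      y≢ : ∀ {m m' n : ℕ} → (m , n) ≢ (m' , suc n)
      y≢ ()

      closer : ∀ s L R c c' → leftPt p q s ≡ L → rightPt p q s ≡ R → side p q R +ᶻ side p q L ≡ dev p q c c' →
               closerRightᵇ p q s ≡ ⌊ dev p q c c' ℤ.<? + 0 ⌋
      closer s L R c c' l r e = cong (λ z → ⌊ z ℤ.<? + 0 ⌋) (≡.trans (cong₂ (λ u v → side p q u +ᶻ side p q v) r l) e)

    shape-letter : ∀ {c c' s} → Shape c c' s → letterAt p q c c' ≡ (lbl s , closerRightᵇ p q s)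
    shape-letter S@(diag m n h g _ _) = cong₂ _,_ lab (≡.sym (closer (seg ℓ₁ (m , suc n) (suc m , n)) (m , suc n) (suc m , n) c c (Ends.left≡ (ends S)) (Ends.right≡ (ends S))
        (≡.trans (e (+ p) (+ q) (+ m) (+ n)) (≡.sym (cong (λ u → offset p q (+ u +ᶻ + u -ᶻ + 1) (+ c +ᶻ + c)) (up≡ m n h g))))))
      where
      c = suc (m + n)
      lab : label p q c c ≡ ℓ₁
      lab = cong (λ b → if b then ℓ₁ else (if ⌊ up p q c ≟ up p q c ⌋ then ℓ₃ else ℓ₂)) (≟-true {c} ≡.refl)
      e : ∀ P Q m n → (P *ᶻ (+ 1 +ᶻ m) -ᶻ Q *ᶻ n) +ᶻ (P *ᶻ m -ᶻ Q *ᶻ (+ 1 +ᶻ n)) ≡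
        (P +ᶻ Q) *ᶻ ((+ 1 +ᶻ m) +ᶻ (+ 1 +ᶻ m) -ᶻ + 1) -ᶻ Q *ᶻ ((+ 1 +ᶻ (m +ᶻ n)) +ᶻ (+ 1 +ᶻ (m +ᶻ n)))
      e = solve-∀
    shape-letter S@(horiz m n h g _ _) = cong₂ _,_ lab (≡.sym (closer (seg ℓ₃ (m , suc n) (suc m , suc n)) (m , suc n) (suc m , suc n) c (suc c) (Ends.left≡ (ends S)) (Ends.right≡ (ends S))
        (≡.trans (e (+ p) (+ q) (+ m) (+ n)) (≡.sym (cong₂ (λ u u' → offset p q (+ u +ᶻ + u' -ᶻ + 1) (+ c +ᶻ + suc c)) (proj₁ ups) (proj₂ ups))))))
      where
      c = suc (m + n)
      ups = up-horiz m n h g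
      lab : label p q c (suc c) ≡ ℓ₃
      lab = cong₂ (λ b b' → if b then ℓ₁ else (if b' then ℓ₃ else ℓ₂)) (≟-false (<⇒≢ (n<1+n c))) (≟-true (≡.trans (proj₁ ups) (≡.sym (proj₂ ups))))
      e : ∀ P Q m n → (P *ᶻ (+ 1 +ᶻ m) -ᶻ Q *ᶻ (+ 1 +ᶻ n)) +ᶻ (P *ᶻ m -ᶻ Q *ᶻ (+ 1 +ᶻ n)) ≡
        (P +ᶻ Q) *ᶻ ((+ 1 +ᶻ m) +ᶻ (+ 1 +ᶻ m) -ᶻ + 1) -ᶻ Q *ᶻ ((+ 1 +ᶻ (m +ᶻ n)) +ᶻ (+ 1 +ᶻ (+ 1 +ᶻ (m +ᶻ n))))
      e = solve-∀
    shape-letter S@(vert m n g h _ _) = cong₂ _,_ lab (≡.sym (closer (seg ℓ₂ (suc m , n) (suc m , suc n)) (suc m , suc n) (suc m , n) c (suc c) (Ends.left≡ (ends S)) (Ends.right≡ (ends S))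
        (≡.trans (e (+ p) (+ q) (+ m) (+ n)) (≡.sym (cong₂ (λ u u' → offset p q (+ u +ᶻ + u' -ᶻ + 1) (+ c +ᶻ + suc c)) (proj₁ ups) (proj₂ ups))))))
      where
      c = suc (m + n)
      ups = up-vert m n g h
      lab : label p q c (suc c) ≡ ℓ₂
      lab = cong₂ (λ b b' → if b then ℓ₁ else (if b' then ℓ₃ else ℓ₂)) (≟-false (<⇒≢ (n<1+n c)))
        (≟-false (λ e → <⇒≢ (n<1+n (suc m)) (≡.trans (≡.sym (proj₁ ups)) (≡.trans e (proj₂ ups)))))
      e : ∀ P Q m n → (P *ᶻ (+ 1 +ᶻ m) -ᶻ Q *ᶻ n) +ᶻ (P *ᶻ (+ 1 +ᶻ m) -ᶻ Q *ᶻ (+ 1 +ᶻ n)) ≡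
        (P +ᶻ Q) *ᶻ ((+ 1 +ᶻ m) +ᶻ (+ 1 +ᶻ (+ 1 +ᶻ m)) -ᶻ + 1) -ᶻ Q *ᶻ ((+ 1 +ᶻ (m +ᶻ n)) +ᶻ (+ 1 +ᶻ (+ 1 +ᶻ (m +ᶻ n))))
      e = solve-∀

    -- An edge joins two consecutive diagonals. A horizontal edge meets the first at its left
    -- endpoint and the second at its right one; for a vertical edge it is the other way round.
    turns : ∀ {c c' s} → Shape c c' s → c' ≡ suc c →
      (lbl s ≡ ℓ₃ × sharedRightᵇ p q (segAt c c) s ≡ false × sharedRightᵇ p q s (segAt (suc c) (suc c)) ≡ true)
      ⊎ (lbl s ≡ ℓ₂ × sharedRightᵇ p q (segAt c c) s ≡ true × sharedRightᵇ p q s (segAt (suc c) (suc c)) ≡ false)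
    turns (diag m n _ _ _ _) e = contradiction e (<⇒≢ (n<1+n (suc (m + n))))
    turns (horiz m n h g _ _) _ = inj₁ (≡.refl ,
        ≡.trans (cong (λ d → sharedRightᵇ p q d s) (segAt-diag m n _ ≡.refl (proj₁ ups)))
          (shared (seg ℓ₁ (m , suc n) (suc m , n)) s (=ₚ-refl (m , suc n)) (=ₚ-≢ (m , suc n) _ x≢) (=ₚ-≢ (suc m , n) _ x≢') (=ₚ-≢ (suc m , n) _ y≢) (left-flag h) ≡.refl) ,
        ≡.trans (cong (sharedRightᵇ p q s) (segAt-diag m (suc n) _ (cong suc (≡.sym (+-suc m n))) (proj₂ ups)))
          (shared s (seg ℓ₁ (m , suc (suc n)) (suc m , suc n)) (=ₚ-≢ (m , suc n) _ y≢) (=ₚ-≢ (m , suc n) _ x≢) (=ₚ-≢ (suc m , suc n) _ x≢') (=ₚ-refl (suc m , suc n)) (left-flag h) (right-flag g)))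
      where
      s = seg ℓ₃ (m , suc n) (suc m , suc n)
      ups = up-horiz m n h g
    turns (vert m n g h _ _) _ = inj₂ (≡.refl ,
        ≡.trans (cong (λ d → sharedRightᵇ p q d s) (segAt-diag m n _ ≡.refl (proj₁ ups)))
          (shared (seg ℓ₁ (m , suc n) (suc m , n)) s {e = false} (=ₚ-≢ (m , suc n) _ x≢) (=ₚ-≢ (m , suc n) _ x≢) (=ₚ-refl (suc m , n)) (=ₚ-≢ (suc m , n) _ y≢)
            (left-flag (neg-left m (suc n) h)) (right-flag g)) ,
        ≡.trans (cong (sharedRightᵇ p q s) (segAt-diag (suc m) n _ ≡.refl (proj₂ ups)))
          (shared s (seg ℓ₁ (suc m , suc n) (suc (suc m) , n)) (=ₚ-≢ (suc m , n) _ y≢) (=ₚ-≢ (suc m , n) _ x≢) (=ₚ-refl (suc m , suc n)) (=ₚ-≢ (suc m , suc n) _ x≢) (right-flag g) (left-flag h)))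
      where
      s = seg ℓ₂ (suc m , n) (suc m , suc n)
      ups = up-vert m n g h

-- The matrix of a path as a monomial times a word.

module PathMatrices where

  open import Defs
  open LaurentRing
  open MatrixAlgebra
  open Staircases
  open SegmentShapes
  open ConjugationAlgebra
  open PathLinks
  open import Algebra.Solver.Ring.AlmostCommutativeRing using (AlmostCommutativeRing; _-Raw-AlmostCommutative⟶_)
  open import Level using (0ℓ)
  open import Data.Bool using (Bool; false; if_then_else_)
  open import Data.List using (List; []; _∷_)
  open import Data.Nat using (ℕ; zero; suc; _+_; _≤_; _<_; _≟_; z≤n; s≤s)
  open import Data.Nat.Properties
  open import Data.Nat.Coprimality using (Coprime)
  open import Data.Product using (_,_; proj₁)
  open import Data.Sum using (inj₁; inj₂)
  open import Relation.Binary.PropositionalEquality as ≡ using (_≡_; cong; cong₂)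
  open import Relation.Nullary.Decidable using (⌊_⌋)

  module PathMatrix (R : AlmostCommutativeRing 0ℓ 0ℓ) (φ : ℤ-rawRing -Raw-AlmostCommutative⟶ R)
                    (p q : ℕ) (1≤p : 1 ≤ p) (1≤q : 1 ≤ q) (cop : Coprime p q) where
    open Matrices R φ using (Carrier; _*_; refl; Mat; _≈ᴹ_; _·_; _∙_; link; I; 𝔸; 𝔹; 𝟙; ≈ᴹ-refl; ≈ᴹ-sym; ≈ᴹ-trans; ≈ᴹ-reflexive; ·-congˡ; ·-assoc; ∙-cong; ∙-identity; module Letters)
    open Conjugation R φ
    open Shapes p q 1≤p 1≤q cop
    open Path p q 1≤p 1≤q cop

    module _ (x x⁻¹ k : Lbl → Carrier) where
      open Letters x x⁻¹ k

      pieceMat : Bool → Seg → Mat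
      pieceMat b s = x (lbl s) ∙ (link b · crossing (lbl s) (closerRightᵇ p q s))

      pathMat : Seg → List Seg → Mat
      pathMat prev [] = I
      pathMat prev (s ∷ ss) = pieceMat (sharedRightᵇ p q prev s) s · pathMat s ss

      weight : List Letter → Carrier
      weight [] = 𝟙
      weight ((ℓ , _) ∷ w) = x ℓ * weight w

      private
        cr : Seg → Mat
        cr s = crossing (lbl s) (closerRightᵇ p q s)

        diag-lbl : ∀ c → 0 < c → c < p + q → lbl (segAt c c) ≡ ℓ₁
        diag-lbl c 0<c c<N = ≡.trans (cong proj₁ (≡.sym (shape-letter (shape c c 0<c c<N (inj₁ ≡.refl)))))
          (cong (λ b → if b then ℓ₁ else (if ⌊ up p q c ≟ up p q c ⌋ then ℓ₃ else ℓ₂)) (≟-true {c} ≡.refl))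

        cr-diag : ∀ c → 0 < c → c < p + q → cr (segAt c c) ≡ letter (letterAt p q c c)
        cr-diag c 0<c c<N = ≡.trans (cong (λ l → crossing l (closerRightᵇ p q (segAt c c))) (diag-lbl c 0<c c<N))
          (cong letter (≡.sym (≡.trans (shape-letter (shape c c 0<c c<N (inj₁ ≡.refl)))
            (cong (_, closerRightᵇ p q (segAt c c)) (diag-lbl c 0<c c<N)))))

        cr-edge : ∀ c → 0 < c → suc c < p + q → let s = segAt c (suc c) in
          link (sharedRightᵇ p q (segAt c c) s) · cr s · link (sharedRightᵇ p q s (segAt (suc c) (suc c))) ≡ letter (letterAt p q c (suc c))
        cr-edge c 0<c c'<N with shape c (suc c) 0<c c'<N (inj₂ ≡.refl)
        ... | S with turns S ≡.refl
        ...   | inj₁ (l , b , b') = ≡.trans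
          (cong₂ (λ u u' → link u · cr (segAt c (suc c)) · link u') b b')
          (≡.trans (cong (λ ℓ → 𝔸 · crossing ℓ (closerRightᵇ p q (segAt c (suc c))) · 𝔹) l)
            (cong letter (≡.sym (≡.trans (shape-letter S) (cong (_, closerRightᵇ p q (segAt c (suc c))) l)))))
        ...   | inj₂ (l , b , b') = ≡.trans
          (cong₂ (λ u u' → link u · cr (segAt c (suc c)) · link u') b b')
          (≡.trans (cong (λ ℓ → 𝔹 · crossing ℓ (closerRightᵇ p q (segAt c (suc c))) · 𝔸) l)
            (cong letter (≡.sym (≡.trans (shape-letter S) (cong (_, closerRightᵇ p q (segAt c (suc c))) l)))))

      pathMat-alternate : ∀ c j → 0 < c → c + j < p + q →
        pathMat (segAt c c) (alternate segAt c j) ≈ᴹ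
        weight (alternate (letterAt p q) c j) ∙ word (alternate (letterAt p q) c j)
      pathMat-alternate c zero _ _ = ≈ᴹ-sym (∙-identity I)
      pathMat-alternate c (suc j) 0<c c+j<N = ≈ᴹ-trans
        (path-step (x (lbl e)) (x (lbl D)) (weight w) (link b) (cr e) (link b') (cr D) (word w)
          ≈ᴹ-refl ≈ᴹ-refl (pathMat-alternate (suc c) j (s≤s z≤n) sc+j<N))
        (≈ᴹ-reflexive (≡.trans
          (cong₂ (λ l l' → (x l * (x l' * weight w)) ∙ ((link b · cr e · link b') · (cr D · word w)))
            (cong proj₁ (≡.sym (shape-letter (shape c (suc c) 0<c sc<N (inj₂ ≡.refl)))))
            (cong proj₁ (≡.sym (shape-letter (shape (suc c) (suc c) (s≤s z≤n) sc<N (inj₁ ≡.refl))))))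
          (cong₂ (λ X Y → weight (alternate (letterAt p q) c (suc j)) ∙ (X · (Y · word w)))
            (cr-edge c 0<c sc<N) (cr-diag (suc c) (s≤s z≤n) sc<N))))
        where
        e = segAt c (suc c)
        D = segAt (suc c) (suc c)
        b = sharedRightᵇ p q (segAt c c) e
        b' = sharedRightᵇ p q e D
        w = alternate (letterAt p q) (suc c) j
        sc+j<N : suc c + j < p + q
        sc+j<N = ≡.subst (_< p + q) (+-suc c j) c+j<N
        sc<N : suc c < p + q
        sc<N = ≤-<-trans (m≤m+n (suc c) j) sc+j<N

      -- Only the link in front of the first diagonal has no edge to absorb it; it is the `𝔸` that
      -- later goes into `K`.
      pathMat-core : ∀ m → p + q ≡ 2 + m →
        pieceMat false (segAt 1 1) · pathMat (segAt 1 1) (alternate segAt 1 m) ≈ᴹ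
        weight (letterAt p q 1 1 ∷ alternate (letterAt p q) 1 m) ∙ (𝔸 · word (letterAt p q 1 1 ∷ alternate (letterAt p q) 1 m))
      pathMat-core m N≡ = ≈ᴹ-trans (·-congˡ (pathMat-alternate 1 m (s≤s z≤n) (≡.subst (suc m <_) (≡.sym N≡) ≤-refl)))
        (≈ᴹ-trans (∙-·-∙ (x (lbl D)) (weight w) (𝔸 · cr D) (word w))
          (≈ᴹ-trans (∙-cong refl (·-assoc 𝔸 (cr D) (word w)))
            (≈ᴹ-reflexive (cong₂ (λ l X → (x l * weight w) ∙ (𝔸 · (X · word w)))
              (cong proj₁ (≡.sym (shape-letter (shape 1 1 (s≤s z≤n) 1<N (inj₁ ≡.refl))))) (cr-diag 1 (s≤s z≤n) 1<N)))))
        where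
        D = segAt 1 1
        w = alternate (letterAt p q) 1 m
        1<N : 1 < p + q
        1<N = ≡.subst (1 <_) (≡.sym N≡) (s≤s (s≤s z≤n))

-- The monomial taken out along the path.

module PathExponents where

  open import Defs
  open LaurentRing
  open MatrixAlgebra
  open Staircases
  open SegmentShapes
  open TransferMatrices
  open FenceMatrices
  open PathLinks
  open PathMatrices
  open import Data.Bool using (Bool; false; if_then_else_)
  open import Data.Integer using (+_)
  import Data.Integer.Properties as ℤₚ
  open import Data.Integer.Tactic.RingSolver using (solve-∀)
  open import Data.Integer using () renaming (_+_ to _+ᶻ_; _*_ to _*ᶻ_; _-_ to _-ᶻ_; -_ to -ᶻ_)
  open import Data.List using (List; []; _∷_)
  open import Data.Nat using (ℕ; zero; suc; _+_; _≤_; _≟_)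
  open import Data.Nat.Properties
  open import Data.Nat.Coprimality using (Coprime)
  open import Data.Product using (_,_)
  open import Data.Sum using (_⊎_; inj₁; inj₂)
  open import Relation.Binary.PropositionalEquality as ≡ using (_≡_; cong; cong₂)
  open import Relation.Nullary.Decidable using (⌊_⌋)

  open M using (Mat; _≈ᴹ_; _·_; ≈ᴹ-refl; ≈ᴹ-trans)

  module PathFences (k₁ k₂ k₃ : ℕ) (p q : ℕ) (1≤p : 1 ≤ p) (1≤q : 1 ≤ q) (cop : Coprime p q) where
    open Setup k₁ k₂ k₃
    open Fences k₁ k₂ k₃
    open Shapes p q 1≤p 1≤q cop
    module PM = PathMatrix LP-almostRing cst-homo p q 1≤p 1≤q cop

    pathMat : Seg → List Seg → Mat
    pathMat = PM.pathMat x x⁻¹ κs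

    pieceMat : Bool → Seg → Mat
    pieceMat = PM.pieceMat x x⁻¹ κs

    weight : List Letter → LP
    weight = PM.weight x x⁻¹ κs

    group-transfer : ∀ b s → transfer (group p q b s) ≈ᴹ pieceMat b s
    group-transfer b s = ≡.subst (λ F → transfer F ≈ᴹ pieceMat b s) (≡.sym (group-piece p q b s))
      (piece-transfer b (closerRightᵇ p q s) (lbl s))

    buildFrom-transfer : ∀ prev ss → transfer (buildFrom p q prev ss) ≈ᴹ pathMat prev ss
    buildFrom-transfer prev [] = ≈ᴹ-refl
    buildFrom-transfer prev (s ∷ ss) = ≈ᴹ-trans (transfer-++ (group p q b s) (buildFrom p q s ss))
      (M.·-cong {transfer (group p q b s)} {pieceMat b s} {transfer (buildFrom p q s ss)} {pathMat s ss}
        (group-transfer b s) (buildFrom-transfer s ss))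
      where b = sharedRightᵇ p q prev s

    pathFence-transfer : ∀ s ss → transfer (pathFence p q (s ∷ ss)) ≈ᴹ pieceMat false s · pathMat s ss
    pathFence-transfer s ss = ≈ᴹ-trans (transfer-++ (group p q false s) (buildFrom p q s ss))
      (M.·-cong {transfer (group p q false s)} {pieceMat false s} {transfer (buildFrom p q s ss)} {pathMat s ss}
        (group-transfer false s) (buildFrom-transfer s ss))

    expo : List Letter → Exp
    expo [] = e₀
    expo ((ℓ , _) ∷ w) = hatE ℓ +ₑ expo w

    opaque
      unfolding _⊞_ _⊠_ ⊟

      weight-expo : ∀ w → weight w ≡ 𝐱^ (expo w)
      weight-expo [] = ≡.refl
      weight-expo ((ℓ , _) ∷ w) = cong (λ z → x ℓ ⊗ z) (weight-expo w)

    -- Each step of the path adds x̂₁x̂₃ (horizontal) or x̂₁x̂₂ (vertical).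
    expo-alternate : ∀ c j → let u = + up p q (c + j) -ᶻ + up p q c in
      expo (alternate (letterAt p q) c j) ≡ (+ j -ᶻ + 2 *ᶻ u , u , u -ᶻ + j)
    expo-alternate c zero = ≡.sym (triple-≡ (e₁ (+ up p q c) (+ up p q (c + 0)) u≡) (e₂ _ _ u≡) (e₃ _ _ u≡))
      where
      u≡ : + up p q (c + 0) ≡ + up p q c
      u≡ = cong (λ z → + up p q z) (+-identityʳ c)
      zero-u : ∀ a b → b ≡ a → b -ᶻ a ≡ + 0
      zero-u a b h = ≡.trans (cong (_-ᶻ a) h) (ℤₚ.+-inverseʳ a)
      e₁ : ∀ a b → b ≡ a → + 0 -ᶻ + 2 *ᶻ (b -ᶻ a) ≡ + 0
      e₁ a b h = cong (λ z → + 0 -ᶻ + 2 *ᶻ z) (zero-u a b h)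
      e₂ : ∀ a b → b ≡ a → b -ᶻ a ≡ + 0
      e₂ = zero-u
      e₃ : ∀ a b → b ≡ a → (b -ᶻ a) -ᶻ + 0 ≡ + 0
      e₃ a b h = cong (_-ᶻ + 0) (zero-u a b h)
    expo-alternate c (suc j) = ≡.trans
      (cong₂ (λ l l' → hatE l +ₑ (hatE l' +ₑ expo (alternate (letterAt p q) (suc c) j))) edge-label diag-label)
      (≡.trans (cong (λ z → hatE edge +ₑ (hatE ℓ₁ +ₑ z)) (expo-alternate (suc c) j)) (go (up-step p q c)))
      where
      edge = if ⌊ up p q c ≟ up p q (suc c) ⌋ then ℓ₃ else ℓ₂
      edge-label : label p q c (suc c) ≡ edge
      edge-label = cong (λ b → if b then ℓ₁ else edge) (≟-false (<⇒≢ (n<1+n c)))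
      diag-label : label p q (suc c) (suc c) ≡ ℓ₁
      diag-label = cong (λ b → if b then ℓ₁ else (if ⌊ up p q (suc c) ≟ up p q (suc c) ⌋ then ℓ₃ else ℓ₂)) (≟-true {suc c} ≡.refl)
      U = + up p q (suc c + j)
      U≡ : + up p q (c + suc j) ≡ U
      U≡ = cong (λ z → + up p q z) (+-suc c j)
      a = + up p q c
      Goal : Lbl → Set
      Goal l = hatE l +ₑ (hatE ℓ₁ +ₑ (+ j -ᶻ + 2 *ᶻ (U -ᶻ + up p q (suc c)) , U -ᶻ + up p q (suc c) , (U -ᶻ + up p q (suc c)) -ᶻ + j)) ≡
        (+ suc j -ᶻ + 2 *ᶻ (+ up p q (c + suc j) -ᶻ a) , + up p q (c + suc j) -ᶻ a , (+ up p q (c + suc j) -ᶻ a) -ᶻ + suc j)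
      go : up p q (suc c) ≡ up p q c ⊎ up p q (suc c) ≡ suc (up p q c) → Goal edge
      go (inj₁ st) = ≡.subst Goal (≡.sym (cong (λ b → if b then ℓ₃ else ℓ₂) (≟-true (≡.sym st))))
        (≡.trans (cong (λ z → hatE ℓ₃ +ₑ (hatE ℓ₁ +ₑ (+ j -ᶻ + 2 *ᶻ (U -ᶻ z) , U -ᶻ z , (U -ᶻ z) -ᶻ + j))) (cong +_ st))
          (≡.trans (triple-≡ (f₁ (+ j) U a) (f₂ (+ j) U a) (f₃ (+ j) U a))
            (cong (λ z → (+ suc j -ᶻ + 2 *ᶻ (z -ᶻ a) , z -ᶻ a , (z -ᶻ a) -ᶻ + suc j)) (≡.sym U≡))))
        where
        f₁ : ∀ j U a → + 1 +ᶻ (+ 0 +ᶻ (j -ᶻ + 2 *ᶻ (U -ᶻ a))) ≡ (+ 1 +ᶻ j) -ᶻ + 2 *ᶻ (U -ᶻ a)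
        f₁ = solve-∀
        f₂ : ∀ j U a → -ᶻ (+ 1) +ᶻ (+ 1 +ᶻ (U -ᶻ a)) ≡ U -ᶻ a
        f₂ = solve-∀
        f₃ : ∀ j U a → + 0 +ᶻ (-ᶻ (+ 1) +ᶻ ((U -ᶻ a) -ᶻ j)) ≡ (U -ᶻ a) -ᶻ (+ 1 +ᶻ j)
        f₃ = solve-∀
      go (inj₂ st) = ≡.subst Goal (≡.sym (cong (λ b → if b then ℓ₃ else ℓ₂) (≟-false (λ e → <⇒≢ (n<1+n (up p q c)) (≡.trans e st)))))
        (≡.trans (cong (λ z → hatE ℓ₂ +ₑ (hatE ℓ₁ +ₑ (+ j -ᶻ + 2 *ᶻ (U -ᶻ z) , U -ᶻ z , (U -ᶻ z) -ᶻ + j))) (cong +_ st))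
          (≡.trans (triple-≡ (f₁ (+ j) U a) (f₂ (+ j) U a) (f₃ (+ j) U a))
            (cong (λ z → (+ suc j -ᶻ + 2 *ᶻ (z -ᶻ a) , z -ᶻ a , (z -ᶻ a) -ᶻ + suc j)) (≡.sym U≡))))
        where
        f₁ : ∀ j U a → -ᶻ (+ 1) +ᶻ (+ 0 +ᶻ (j -ᶻ + 2 *ᶻ (U -ᶻ (+ 1 +ᶻ a)))) ≡ (+ 1 +ᶻ j) -ᶻ + 2 *ᶻ (U -ᶻ a)
        f₁ = solve-∀
        f₂ : ∀ j U a → + 0 +ᶻ (+ 1 +ᶻ (U -ᶻ (+ 1 +ᶻ a))) ≡ U -ᶻ a
        f₂ = solve-∀
        f₃ : ∀ j U a → + 1 +ᶻ (-ᶻ (+ 1) +ᶻ ((U -ᶻ (+ 1 +ᶻ a)) -ᶻ j)) ≡ (U -ᶻ a) -ᶻ (+ 1 +ᶻ j)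
        f₃ = solve-∀

-- The matrix of p/q as the conjugate of its core word.

module CoreMatrices where

  open import Defs
  open LaurentRing
  open MatrixAlgebra
  open Staircases
  open Words
  open SegmentShapes
  open SortedCrossings
  open TransferMatrices
  open FenceMatrices
  open PathLinks
  open PathExponents
  open import Data.Bool using (false)
  open import Data.Integer using (+_)
  open import Data.Integer.Tactic.RingSolver using (solve-∀)
  open import Data.Integer using () renaming (_+_ to _+ᶻ_; _*_ to _*ᶻ_; _-_ to _-ᶻ_; -_ to -ᶻ_)
  open import Data.List using (List; _∷_; _++_)
  import Data.List.Properties as List
  open import Data.Nat using (ℕ; suc; _+_; z≤n; s≤s)
  open import Data.Nat.Properties
  open import Data.Nat.Coprimality using (Coprime)
  open import Data.Product using (_,_)
  open import Relation.Binary.PropositionalEquality as ≡ using (_≡_; cong; cong₂)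

  open M using (_≈ᴹ_; _·_; _∙_; 𝔸; ≈ᴹ-sym; ≈ᴹ-trans)

  module _ (k₁ k₂ k₃ : ℕ) (p q : ℕ) (cop : Coprime (suc p) (suc q)) where
    open Setup k₁ k₂ k₃
    open Fences k₁ k₂ k₃
    open Shapes (suc p) (suc q) (s≤s z≤n) (s≤s z≤n) cop
    open SortedSegs (suc p) (suc q) (s≤s z≤n) (s≤s z≤n) cop
    open PathFences k₁ k₂ k₃ (suc p) (suc q) (s≤s z≤n) (s≤s z≤n) cop

    private
      P Q m : ℕ
      P = suc p
      Q = suc q
      m = p + q

      N≡ : P + Q ≡ 2 + m
      N≡ = cong suc (+-suc p q)

      D : Seg
      D = segAt 1 1

      rest : List Seg
      rest = alternate segAt 1 m

      core : List Letter
      core = letterAt P Q 1 1 ∷ alternate (letterAt P Q) 1 m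

      core≡ : coreWord P Q m ≡ core
      core≡ = core-alternate (letterAt P Q) m

      τs≡ : τs P Q ≡ D ∷ rest
      τs≡ = ≡.trans (τs-segKey m N≡) (core-alternate segAt m)

      F : Fence
      F = pathFence P Q (D ∷ rest) ++ markUp H

      sums : IdealSums F (transfer F)
      sums = ≡.subst (λ G → IdealSums G (transfer G)) (≡.sym F≡)
        (idealSums-pieceOf (kOf (lbl D)) false (closerRightᵇ P Q D) (lbl D) (buildFrom P Q D rest ++ markUp H))
        where
        F≡ : F ≡ piece false (closerRightᵇ P Q D) (lbl D) ++ (buildFrom P Q D rest ++ markUp H)
        F≡ = ≡.trans (List.++-assoc (group P Q false D) (buildFrom P Q D rest) (markUp H))
          (cong (λ G → G ++ (buildFrom P Q D rest ++ markUp H)) (group-piece P Q false D))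

      F-transfer : transfer F ≈ᴹ 𝐱^ (expo core) ∙ ((𝔸 · word core) · H-mat)
      F-transfer = ≡.subst (λ w → transfer F ≈ᴹ w ∙ ((𝔸 · word core) · H-mat)) (weight-expo core) (≈ᴹ-trans
        (transfer-++ (pathFence P Q (D ∷ rest)) (markUp H))
        (≈ᴹ-trans (M.·-cong {transfer (pathFence P Q (D ∷ rest))} {weight core ∙ (𝔸 · word core)} {transfer (markUp H)} {H-mat}
            (≈ᴹ-trans (pathFence-transfer D rest) (PM.pathMat-core x x⁻¹ κs m N≡)) transfer-H)
          (M.∙-·ˡ (weight core) (𝔸 · word core) H-mat)))

      -- Along the core `up` grows from 1 to `Q`, so γ crosses `Q − 1` vertical edges. Together with
      -- the length of the core this determines the exponent, which is minus `g°v P Q`.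
      expo-core : expo core ≡ (+ p -ᶻ + q , + 1 +ᶻ + q , -ᶻ (+ 1) -ᶻ + p)
      expo-core = ≡.trans (cong₂ (λ l z → hatE l +ₑ z) lab (≡.trans (expo-alternate 1 m)
          (cong (λ u → (+ m -ᶻ + 2 *ᶻ u , u , u -ᶻ + m)) (cong₂ (λ a b → + a -ᶻ + b) (Boundary.up-N-1 p q m N≡) (Boundary.up-1 p q m N≡)))))
        (triple-≡ (f₁ (+ p) (+ q)) (f₂ (+ p) (+ q)) (f₃ (+ p) (+ q)))
        where
        lab : label P Q 1 1 ≡ ℓ₁
        lab = ≡.refl
        f₁ : ∀ p q → + 0 +ᶻ ((p +ᶻ q) -ᶻ + 2 *ᶻ ((+ 1 +ᶻ q) -ᶻ + 1)) ≡ p -ᶻ q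
        f₁ = solve-∀
        f₂ : ∀ p q → + 1 +ᶻ ((+ 1 +ᶻ q) -ᶻ + 1) ≡ + 1 +ᶻ q
        f₂ = solve-∀
        f₃ : ∀ p q → -ᶻ (+ 1) +ᶻ (((+ 1 +ᶻ q) -ᶻ + 1) -ᶻ (p +ᶻ q)) ≡ -ᶻ (+ 1) -ᶻ p
        f₃ = solve-∀

      shift° : g°v P Q +ₑ (+ p -ᶻ + q , + 1 +ᶻ + q , -ᶻ (+ 1) -ᶻ + p) ≡ e₀
      shift° = triple-≡ (f₁ (+ p) (+ q)) (f₂ (+ q)) (f₃ (+ p))
        where
        f₁ : ∀ p q → ((+ 1 +ᶻ q) -ᶻ (+ 1 +ᶻ p)) +ᶻ (p -ᶻ q) ≡ + 0
        f₁ = solve-∀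
        f₂ : ∀ q → -ᶻ (+ 1 +ᶻ q) +ᶻ (+ 1 +ᶻ q) ≡ + 0
        f₂ = solve-∀
        f₃ : ∀ p → (+ 1 +ᶻ p) +ᶻ (-ᶻ (+ 1) -ᶻ p) ≡ + 0
        f₃ = solve-∀

      shift : gv P Q +ₑ (+ p -ᶻ + q , + 1 +ᶻ + q , -ᶻ (+ 1) -ᶻ + p) ≡ (-ᶻ (+ 1) , + 1 , + 1)
      shift = triple-≡ (f₁ (+ p) (+ q)) (f₂ (+ q)) (f₃ (+ p))
        where
        f₁ : ∀ p q → (((+ 1 +ᶻ q) -ᶻ (+ 1 +ᶻ p)) -ᶻ + 1) +ᶻ (p -ᶻ q) ≡ -ᶻ (+ 1)
        f₁ = solve-∀
        f₂ : ∀ q → (+ 1 -ᶻ (+ 1 +ᶻ q)) +ᶻ (+ 1 +ᶻ q) ≡ + 1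
        f₂ = solve-∀
        f₃ : ∀ p → ((+ 1 +ᶻ p) +ᶻ + 1) +ᶻ (-ᶻ (+ 1) -ᶻ p) ≡ + 1
        f₃ = solve-∀

      shift⁻ : 2g°-g (g°v P Q) (gv P Q) +ₑ (+ p -ᶻ + q , + 1 +ᶻ + q , -ᶻ (+ 1) -ᶻ + p) ≡ (+ 1 , -ᶻ (+ 1) , -ᶻ (+ 1))
      shift⁻ = triple-≡ (f₁ (+ p) (+ q)) (f₂ (+ q)) (f₃ (+ p))
        where
        f₁ : ∀ p q → (+ 2 *ᶻ ((+ 1 +ᶻ q) -ᶻ (+ 1 +ᶻ p)) -ᶻ (((+ 1 +ᶻ q) -ᶻ (+ 1 +ᶻ p)) -ᶻ + 1)) +ᶻ (p -ᶻ q) ≡ + 1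
        f₁ = solve-∀
        f₂ : ∀ q → (+ 2 *ᶻ (-ᶻ (+ 1 +ᶻ q)) -ᶻ (+ 1 -ᶻ (+ 1 +ᶻ q))) +ᶻ (+ 1 +ᶻ q) ≡ -ᶻ (+ 1)
        f₂ = solve-∀
        f₃ : ∀ p → (+ 2 *ᶻ (+ 1 +ᶻ p) -ᶻ ((+ 1 +ᶻ p) +ᶻ + 1)) +ᶻ (-ᶻ (+ 1) -ᶻ p) ≡ -ᶻ (+ 1)
        f₃ = solve-∀

    private
      finish : ∀ Z w w' → w' ≡ w → Z ≈ᴹ Ξ · ((𝔸 · word w) · H-mat) · Ξ⁻¹ → Z ≈ᴹ κ (word w' · tail)
      finish Z w .w ≡.refl h = ≈ᴹ-trans h (≈ᴹ-sym (κ-core (word w)))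

      sums' : IdealSums (𝒫̃ P Q) (transfer F)
      sums' = ≡.subst (λ ts → IdealSums (pathFence P Q ts ++ markUp H) (transfer F)) (≡.sym τs≡) sums

      C≡ : C (suc p) (suc q) ≡ Cgen (gv P Q) (g°v P Q) (𝒫̃ P Q)
      C≡ = ≡.refl

    opaque
      unfolding Cᴹ

      C-core : Cᴹ (suc p) (suc q) ≈ᴹ κ (word (coreWord (suc p) (suc q) (p + q)) · tail)
      C-core = ≡.subst (λ Z → M2⇒Mat Z ≈ᴹ κ (word (coreWord (suc p) (suc q) (p + q)) · tail)) (≡.sym C≡)
        (finish _ core (coreWord (suc p) (suc q) (p + q)) core≡
          (Cgen-matrix (gv P Q) (g°v P Q) (expo core) (𝒫̃ P Q) (transfer F) ((𝔸 · word core) · H-mat) sums' F-transfer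
            (≡.trans (cong (g°v P Q +ₑ_) expo-core) shift°)
            (≡.trans (cong (gv P Q +ₑ_) expo-core) shift)
            (≡.trans (cong (2g°-g (g°v P Q) (gv P Q) +ₑ_) expo-core) shift⁻)))

-- Word forms including 0/1 and 1/0, the product formula, and data at the root.

module WordForms where

  open import Defs
  open LaurentRing
  open MatrixAlgebra
  open Staircases
  open Concatenations
  open Words
  open TransferMatrices
  open FenceMatrices
  open CoreMatrices
  open import Data.Bool using (true; false)
  open import Data.Integer as ℤ using (ℤ; +_)
  open import Data.List using ([]; _∷_; _++_; applyUpTo)
  open import Data.Nat using (ℕ; zero; suc; _+_; _*_; _≤_)
  open import Data.Nat.Properties
  open import Data.Nat.Coprimality using (Coprime)
  open import Data.Product using (_×_; _,_; proj₁; proj₂)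
  open import Relation.Binary.PropositionalEquality as ≡ using (_≡_; cong)
  open import Relation.Nullary using (contradiction)
  open import Relation.Nullary.Decidable using (⌊_⌋)
  open M using (Mat; mk; _≈ᴹ_; entries; _·_; _∙_; _+ᴹ_; J; adj; 𝟘; 𝟙; ≈ᴹ-refl; ≈ᴹ-sym; ≈ᴹ-trans; refl; sym; trans)

  opaque
    unfolding up

    up-0/1 : up 0 1 1 ≡ 1
    up-0/1 = ≡.refl

  -- With no crossing there is no core, but the left word still exists: it is the single letter at
  -- key 2, the `d` of C_{0/1}.
  leftWord-0/1 : leftWord 0 1 0 ≡ (ℓ₁ , true) ∷ []
  leftWord-0/1 = cong (λ u → (ℓ₁ , ⌊ offset 0 1 (+ u ℤ.+ + u ℤ.- + 1) (+ 2) ℤ.<? + 0 ⌋) ∷ []) up-0/1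

  module Forms (k₁ k₂ k₃ : ℕ) where
    open Setup k₁ k₂ k₃
    open Fences k₁ k₂ k₃

    core-form : ∀ m n M → 1 ≤ m → 1 ≤ n → Coprime m n → m + n ≡ 2 + M → Cᴹ m n ≈ᴹ κ (word (coreWord m n M) · tail)
    core-form (suc p) (suc q) M _ _ cop N≡ = ≡.subst
      (λ M → Cᴹ (suc p) (suc q) ≈ᴹ κ (word (coreWord (suc p) (suc q) M) · tail))
      (suc-injective (≡.trans (≡.sym (+-suc p q)) (suc-injective N≡))) (C-core k₁ k₂ k₃ p q cop)

    private
      transport : ∀ X w w' → w' ≡ w → X ≈ᴹ κ (word w · v) → X ≈ᴹ κ (word w' · v)
      transport X w .w ≡.refl h = h

      transport' : ∀ X w w' → w' ≡ w → X ≈ᴹ κ (adj v · (word w · tail)) → X ≈ᴹ κ (adj v · (word w' · tail))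
      transport' X w .w ≡.refl h = h

    left-word-form : ∀ p q A → 1 ≤ q → Coprime p q → p + q ≡ suc A → Cᴹ p q ≈ᴹ κ (word (leftWord p q A) · v)
    left-word-form zero (suc zero) .0 _ _ ≡.refl = transport (Cᴹ 0 1) ((ℓ₁ , true) ∷ []) (leftWord 0 1 0) leftWord-0/1 C-0/1
    left-word-form zero (suc (suc q)) A _ cop _ = contradiction (cop {suc (suc q)} (divides 0 ≡.refl , ∣-refl)) λ ()
      where open import Data.Nat.Divisibility using (divides; ∣-refl)
    left-word-form (suc p) (suc q) A _ cop N≡ = go A (suc-injective N≡)
      where
      go : ∀ A → p + suc q ≡ A → Cᴹ (suc p) (suc q) ≈ᴹ κ (word (leftWord (suc p) (suc q) A) · v)
      go .(p + suc q) ≡.refl = transport (Cᴹ (suc p) (suc q)) (coreWord (suc p) (suc q) (p + q) ++ (ℓ₃ , true) ∷ (ℓ₁ , true) ∷ []) (leftWord (suc p) (suc q) (p + suc q))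
        (≡.trans (cong (leftWord (suc p) (suc q)) (+-suc p q)) (Boundary.leftWord-core p q (p + q) (cong suc (+-suc p q))))
        (≈ᴹ-trans (C-core k₁ k₂ k₃ p q cop) (κ-cong (left-form (coreWord (suc p) (suc q) (p + q)))))

    module CG = M.CGC 𝓜
    module Rt = Cj.Root 𝓜

    private
      u : LP
      u = 𝐱^ (ℤ.- + 1 , ℤ.- + 1 , ℤ.- + 1)

      a b c a' b' c' : LP
      a = x ℓ₃
      b = x ℓ₁
      c = x ℓ₂
      a' = x⁻¹ ℓ₃
      b' = x⁻¹ ℓ₁
      c' = x⁻¹ ℓ₂

      -- The six terms of `𝓜` times a monomial, kept apart so that each monomial can be compared by
      -- evaluating its exponent while the `kᵢ` stay symbolic.
      sixTerms : LP → LP → LP → LP → LP → LP → LP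
      sixTerms m₁ m₂ m₃ m₄ m₅ m₆ = m₁ ⊞ m₂ ⊞ m₃ ⊞ κs ℓ₁ ⊠ m₄ ⊞ κs ℓ₂ ⊠ m₅ ⊞ κs ℓ₃ ⊠ m₆

      sixTerms-cong : ∀ {m₁ m₂ m₃ m₄ m₅ m₆ n₁ n₂ n₃ n₄ n₅ n₆} →
        (m₁ ≡ n₁) × (m₂ ≡ n₂) × (m₃ ≡ n₃) × (m₄ ≡ n₄) × (m₅ ≡ n₅) × (m₆ ≡ n₆) →
        sixTerms m₁ m₂ m₃ m₄ m₅ m₆ ≋ sixTerms n₁ n₂ n₃ n₄ n₅ n₆
      sixTerms-cong (≡.refl , ≡.refl , ≡.refl , ≡.refl , ≡.refl , ≡.refl) = refl

    opaque
      unfolding _⊞_ _⊠_ ⊟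

      𝓜-form : 𝓜 ≋ (X₁ ⊠ X₁ ⊞ X₂ ⊠ X₂ ⊞ X₃ ⊠ X₃ ⊞ κs ℓ₁ ⊠ X₂ ⊠ X₃ ⊞ κs ℓ₂ ⊠ X₁ ⊠ X₃ ⊞ κs ℓ₃ ⊠ X₁ ⊠ X₂) ⊠ u
      𝓜-form = refl

      uX₁X₂X₃ : u ⊠ (X₁ ⊠ X₂ ⊠ X₃) ≋ 𝟙
      uX₁X₂X₃ = refl

      T-monomials : (X₁ ⊠ X₁ ⊠ u ⊠ 𝟙 ≡ ξ⁻¹ ⊠ (a ⊠ b ⊠ c)) × (X₂ ⊠ X₂ ⊠ u ⊠ 𝟙 ≡ ξ⁻¹ ⊠ (a' ⊠ b ⊠ c)) ×
        (X₃ ⊠ X₃ ⊠ u ⊠ 𝟙 ≡ ξ⁻¹ ⊠ (a' ⊠ b' ⊠ c)) × (X₂ ⊠ X₃ ⊠ u ⊠ 𝟙 ≡ ξ⁻¹ ⊠ (a' ⊠ c)) ×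
        (X₁ ⊠ X₃ ⊠ u ⊠ 𝟙 ≡ ξ⁻¹ ⊠ (a' ⊠ b')) × (X₁ ⊠ X₂ ⊠ u ⊠ 𝟙 ≡ ξ⁻¹ ⊠ (b ⊠ c))
      T-monomials = ≡.refl , ≡.refl , ≡.refl , ≡.refl , ≡.refl , ≡.refl

      root-monomials : (X₁ ⊠ X₁ ⊠ u ⊠ X₃ ≡ b' ⊠ c') × (X₂ ⊠ X₂ ⊠ u ⊠ X₃ ≡ b ⊠ c) × (X₃ ⊠ X₃ ⊠ u ⊠ X₃ ≡ b' ⊠ c) ×
        (X₂ ⊠ X₃ ⊠ u ⊠ X₃ ≡ c) × (X₁ ⊠ X₃ ⊠ u ⊠ X₃ ≡ b') × (X₁ ⊠ X₂ ⊠ u ⊠ X₃ ≡ 𝟙)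
      root-monomials = ≡.refl , ≡.refl , ≡.refl , ≡.refl , ≡.refl , ≡.refl

      middle-monomials : ((ξ⁻¹ ⊠ c) ⊠ (ξ ⊠ c') ≋ 𝟙) × ((ξ⁻¹ ⊠ (b' ⊠ c)) ⊠ (ξ ⊠ c') ≋ (ξ ⊠ (b' ⊠ c')) ⊠ (c ⊠ ξ⁻¹)) ×
        ((ξ⁻¹ ⊠ b') ⊠ (ξ ⊠ c') ≋ b' ⊠ c') × ((b' ⊠ c') ⊠ (ξ ⊠ c') ≋ X₁) × ((ξ ⊠ c') ⊠ (c ⊠ ξ⁻¹) ≋ 𝟙)
      middle-monomials = refl , refl , refl , refl , refl

      X₃-form : ξ ⊠ (b' ⊠ c') ≋ X₃
      X₃-form = refl

      X₂-form : ξ ⊠ c' ≋ X₂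
      X₂-form = refl

      κ-J-entries : (⊟ ((ξ ⊠ ξ⁻¹) ⊠ (a ⊠ b ⊠ c)) ≋ ⊟ 𝟙 ⊠ 𝟙) × (𝟘 ≋ ⊟ 𝟙 ⊠ 𝟘) × (⊟ (a' ⊠ b' ⊠ c') ≋ ⊟ 𝟙 ⊠ 𝟙)
      κ-J-entries = refl , refl , refl

    opaque
      unfolding _⊞_ _⊠_ ⊟ Cᴹ

      C₁₀-matrix : mk ((ξ ⊠ x⁻¹ ℓ₂) ⊠ 𝓜) (ξ ⊠ x⁻¹ ℓ₂) (⊟ (κs ℓ₂ ⊠ 𝓜) ⊞ ⊟ (x ℓ₂ ⊠ ξ⁻¹)) (⊟ (κs ℓ₂)) ≈ᴹ Cᴹ 1 0
      C₁₀-matrix = entries refl refl refl refl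

    private
      expansion : ∀ w → 𝓜 ⊠ w ≋ sixTerms (X₁ ⊠ X₁ ⊠ u ⊠ w) (X₂ ⊠ X₂ ⊠ u ⊠ w) (X₃ ⊠ X₃ ⊠ u ⊠ w) (X₂ ⊠ X₃ ⊠ u ⊠ w) (X₁ ⊠ X₃ ⊠ u ⊠ w) (X₁ ⊠ X₂ ⊠ u ⊠ w)
      expansion = Rt.invariant-expansion X₁ X₂ X₃ u (κs ℓ₁) (κs ℓ₂) (κs ℓ₃) 𝓜-form

      𝓜-expanded : 𝓜 ⊠ 𝟙 ≋ ξ⁻¹ ⊠ (a ⊠ b ⊠ c ⊞ κs ℓ₃ ⊠ (b ⊠ c) ⊞ a' ⊠ b ⊠ c ⊞ κs ℓ₁ ⊠ (a' ⊠ c) ⊞ a' ⊠ b' ⊠ c ⊞ κs ℓ₂ ⊠ (a' ⊠ b'))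
      𝓜-expanded = trans (expansion 𝟙) (trans (sixTerms-cong T-monomials)
        (sym (Rt.distribute ξ⁻¹ (a ⊠ b ⊠ c) (b ⊠ c) (a' ⊠ b ⊠ c) (a' ⊠ c) (a' ⊠ b' ⊠ c) (a' ⊠ b') (κs ℓ₁) (κs ℓ₂) (κs ℓ₃))))

    -- The point where `𝓜` enters the words: the lower left entry collects exactly its six terms.
    κ-J-tail≈-T : κ (J · tail) ≈ᴹ (⊟ 𝟙) ∙ CG.T
    κ-J-tail≈-T = ≈ᴹ-trans κ-J-tail (entries (proj₁ κ-J-entries) (proj₁ (proj₂ κ-J-entries)) (Cj.neg-one 𝓜 _ 𝓜-expanded) (proj₂ (proj₂ κ-J-entries)))

    C-1/0 : Cᴹ 1 0 ≈ᴹ κ (adj v · (word [] · tail))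
    C-1/0 = ≈ᴹ-sym (≈ᴹ-trans κ-1/0 (≈ᴹ-trans
      (Rt.-T-product (ξ ⊠ x⁻¹ ℓ₂) (x ℓ₂ ⊠ ξ⁻¹) (κs ℓ₂) (κ (J · tail)) κ-J-tail≈-T) C₁₀-matrix))

    right-word-form : ∀ r s B → 1 ≤ r → Coprime r s → r + s ≡ suc B → Cᴹ r s ≈ᴹ κ (adj v · (word (rightWord r s B) · tail))
    right-word-form (suc zero) zero .0 _ _ ≡.refl = C-1/0
    right-word-form (suc (suc r)) zero B _ cop _ = contradiction (cop {suc (suc r)} (∣-refl , divides 0 ≡.refl)) λ ()
      where open import Data.Nat.Divisibility using (divides; ∣-refl)
    right-word-form (suc p) (suc q) B _ cop N≡ = go B (suc-injective N≡)
      where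
      go : ∀ B → p + suc q ≡ B → Cᴹ (suc p) (suc q) ≈ᴹ κ (adj v · (word (rightWord (suc p) (suc q) B) · tail))
      go .(p + suc q) ≡.refl = transport' (Cᴹ (suc p) (suc q)) ((ℓ₂ , true) ∷ coreWord (suc p) (suc q) (p + q)) (rightWord (suc p) (suc q) (p + suc q))
        (≡.trans (cong (rightWord (suc p) (suc q)) (+-suc p q)) (Boundary.rightWord-core p q (p + q) (cong suc (+-suc p q))))
        (≈ᴹ-trans (C-core k₁ k₂ k₃ p q cop) (κ-cong (right-form (coreWord (suc p) (suc q) (p + q)))))

    private
      assemble : ∀ {P Q R} w w' cw u ℓ → P ≈ᴹ κ (word w · v) → R ≈ᴹ κ (adj v · (word w' · tail)) → Q ≈ᴹ κ (word cw · tail) →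
        cw ≡ u ++ (ℓ , false) ∷ mirror u → w ++ w' ≡ u ++ (ℓ , true) ∷ mirror u → CG.Rel (κs ℓ) P Q R
      assemble {P} {Q} {R} w w' cw u ℓ hP hR hQ ≡.refl e = ≈ᴹ-trans hQ (≈ᴹ-trans (palindrome-form u ℓ)
        (≈ᴹ-trans (Rt.-∙-T (κs ℓ) (κ (J · tail)) (κ (word (u ++ (ℓ , true) ∷ mirror u) · tail)) κ-J-tail≈-T)
          (M.+ᴹ-cong {κ (word (u ++ (ℓ , true) ∷ mirror u) · tail)} {P · R} (≈ᴹ-sym PR) ≈ᴹ-refl)))
        where
        PR : P · R ≈ᴹ κ (word (u ++ (ℓ , true) ∷ mirror u) · tail)
        PR = ≈ᴹ-trans (M.·-cong {P} {κ (word w · v)} {R} {κ (adj v · (word w' · tail))} hP hR)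
          (≡.subst (λ z → κ (word w · v) · κ (adj v · (word w' · tail)) ≈ᴹ κ (word z · tail)) e (product-form w w'))

    C-product : ∀ p q r s → q * r ≡ suc (p * s) → CG.Rel (κs (slot (p + r) (q + s))) (Cᴹ p q) (Cᴹ (p + r) (q + s)) (Cᴹ r s)
    C-product p q r s det = go (p + q) (r + s) ≡.refl ≡.refl
      where
      open Concatenation p q r s det
      coprime-pq : Coprime p q
      coprime-pq = coprime-det {q} {r} {p} {s} det
      coprime-rs : Coprime r s
      coprime-rs {i} (i∣r , i∣s) = coprime-det {r} {q} {s} {p} (≡.trans (*-comm r q) (≡.trans det (cong suc (*-comm p s)))) (i∣s , i∣r)
      go : ∀ a b → p + q ≡ a → r + s ≡ b → CG.Rel (κs (slot (p + r) (q + s))) (Cᴹ p q) (Cᴹ (p + r) (q + s)) (Cᴹ r s)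
      go zero _ a≡ _ = contradiction (≡.subst (1 ≤_) a≡ 1≤a) λ ()
      go (suc A) zero _ b≡ = contradiction (≡.subst (1 ≤_) b≡ 1≤b) λ ()
      go (suc A) (suc B) a≡ b≡ = assemble (leftWord p q A) (rightWord r s B) (coreWord (p + r) (q + s) (A + B))
        (applyUpTo (λ i → lt (p + r) (q + s) (2 + i)) (A + B)) (slot (p + r) (q + s))
        (left-word-form p q A 1≤q coprime-pq a≡)
        (right-word-form r s B 1≤r coprime-rs b≡)
        (core-form (p + r) (q + s) (A + B) 1≤m 1≤n coprime-mn (N≡2+M p q r s det A B a≡ b≡))
        (Middle.coreWord-palindrome (p + r) (q + s) coprime-mn (A + B) (N≡2+M p q r s det A B a≡ b≡))
        (leftWord++rightWord p q r s det A B a≡ b≡)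

    private
      C₀ : Cᴹ 0 1 ≈ᴹ mk (b ⊠ c ⊞ κs ℓ₁ ⊠ c ⊞ b' ⊠ c ⊞ κs ℓ₂ ⊠ b') (ξ ⊠ (b' ⊠ c'))
                        (κs ℓ₁ ⊠ (ξ⁻¹ ⊠ c) ⊞ ξ⁻¹ ⊠ (b' ⊠ c) ⊞ κs ℓ₂ ⊠ (ξ⁻¹ ⊠ b')) (b' ⊠ c')
      C₀ = ≈ᴹ-trans C-0/1 (≈ᴹ-trans κ-0/1 H₀-entries)

      hM : 𝓜 ⊠ (ξ ⊠ (b' ⊠ c')) ≋ b' ⊠ c' ⊞ (b ⊠ c ⊞ κs ℓ₁ ⊠ c ⊞ b' ⊠ c ⊞ κs ℓ₂ ⊠ b') ⊞ κs ℓ₃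
      hM = trans (M.*-cong refl X₃-form) (trans (expansion X₃) (trans (sixTerms-cong root-monomials)
        (Rt.invariant-regroup (b ⊠ c) c (b' ⊠ c) b' (b' ⊠ c') (κs ℓ₁) (κs ℓ₂) (κs ℓ₃))))

    e₁₂-0/1 : Mat.e₁₂ (Cᴹ 0 1) ≋ X₃
    e₁₂-0/1 = trans (M.≈₁₂ C₀) X₃-form

    e₁₂-1/0 : Mat.e₁₂ (Cᴹ 1 0) ≋ X₂
    e₁₂-1/0 = trans (sym (M.≈₁₂ C₁₀-matrix)) X₂-form

    isC-0/1 : CG.IsC (κs ℓ₃) (Cᴹ 0 1)
    isC-0/1 = CG.isC
      (trans (M.det-cong C-0/1) (det-κ (word ((ℓ₁ , true) ∷ []) · v) (det-·-𝟙 x-inverse (word ((ℓ₁ , true) ∷ [])) v (det-word x-inverse ((ℓ₁ , true) ∷ [])) det-v)))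
      (trans (CG.F-cong C₀) (Rt.left-root (b ⊠ c) c (b' ⊠ c) b' (b' ⊠ c') (ξ⁻¹ ⊠ c) (ξ⁻¹ ⊠ (b' ⊠ c)) (ξ⁻¹ ⊠ b') (ξ ⊠ (b' ⊠ c')) 𝟙 𝟙 𝟙 (κs ℓ₁) (κs ℓ₂) (κs ℓ₃) hM))

    isC-1/0 : CG.IsC (κs ℓ₂) (Cᴹ 1 0)
    isC-1/0 = CG.IsC-cong (≈ᴹ-sym C₁₀-matrix)
      (Rt.right-root (ξ ⊠ c') (c ⊠ ξ⁻¹) (κs ℓ₂) (proj₂ (proj₂ (proj₂ (proj₂ middle-monomials)))))

    F-root : CG.F (Cᴹ 0 1 · Cᴹ 1 0) ≋ κs ℓ₁
    F-root = trans (CG.F-cong (M.·-cong C₀ (≈ᴹ-sym C₁₀-matrix)))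
      (Rt.middle-root (b ⊠ c) c (b' ⊠ c) b' (b' ⊠ c') (ξ⁻¹ ⊠ c) (ξ⁻¹ ⊠ (b' ⊠ c)) (ξ⁻¹ ⊠ b') (ξ ⊠ (b' ⊠ c')) (ξ ⊠ c') (c ⊠ ξ⁻¹) X₁
        (κs ℓ₁) (κs ℓ₂) (κs ℓ₃) hM (proj₁ middle-monomials) (proj₁ (proj₂ middle-monomials)) (proj₁ (proj₂ (proj₂ middle-monomials))))

    e₁₂-root : Mat.e₁₂ (Cᴹ 0 1 · Cᴹ 1 0 +ᴹ (⊟ (κs ℓ₁)) ∙ CG.T) ≋ CG.jump (ξ ⊠ (b' ⊠ c')) (ξ ⊠ c') X₁ (κs ℓ₃) (κs ℓ₂)
    e₁₂-root = trans (M.≈₁₂ (M.+ᴹ-cong (M.·-cong C₀ (≈ᴹ-sym C₁₀-matrix)) (≈ᴹ-refl {(⊟ (κs ℓ₁)) ∙ CG.T})))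
      (Rt.jump-root (b ⊠ c) c (b' ⊠ c) b' (b' ⊠ c') (ξ⁻¹ ⊠ c) (ξ⁻¹ ⊠ (b' ⊠ c)) (ξ⁻¹ ⊠ b') (ξ ⊠ (b' ⊠ c')) (ξ ⊠ c') (c ⊠ ξ⁻¹) X₁
        (κs ℓ₁) (κs ℓ₂) (κs ℓ₃) hM (proj₁ (proj₂ (proj₂ (proj₂ middle-monomials)))) (κs ℓ₁))

-- Induction on the Farey tree.

module FareyTriples where

  open import Defs
  open LaurentRing
  open MatrixAlgebra
  open Staircases
  open Concatenations
  open TransferMatrices
  open FenceMatrices
  open WordForms
  open import Data.Bool using (_xor_)
  open import Data.Integer using (+_)
  open import Data.Nat using (ℕ; suc; _+_; _*_)
  open import Data.Nat.Properties
  import Data.Nat.Tactic.RingSolver as ℕ-Solver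
  open import Data.Product using (_×_; _,_; proj₁; proj₂)
  open import Relation.Binary.PropositionalEquality as ≡ using (_≡_; cong; cong₂)
  open M using (Mat; ≈₁₂; refl; sym; trans)

  -- Doubled terms do not affect parities. The child therefore takes the slot of the vertex it
  -- replaces, as a mutated variable keeps its position.
  slot-sum : ∀ p q r s → slot (p + (p + r)) (q + (q + s)) ≡ slot r s
  slot-sum p q r s = cong₂ parity (lem p r) (lem q s)
    where
    lem : ∀ a b → odd (a + (a + b)) ≡ odd b
    lem a b = ≡.trans (cong odd (≡.sym (+-assoc a a b))) (≡.trans (odd-+ (a + a) b) (cong (_xor odd b) (odd-double a)))

  data Permuted : Lbl → Lbl → Lbl → Set where
    p₁₂₃ : Permuted ℓ₁ ℓ₂ ℓ₃
    p₁₃₂ : Permuted ℓ₁ ℓ₃ ℓ₂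
    p₂₁₃ : Permuted ℓ₂ ℓ₁ ℓ₃
    p₂₃₁ : Permuted ℓ₂ ℓ₃ ℓ₁
    p₃₁₂ : Permuted ℓ₃ ℓ₁ ℓ₂
    p₃₂₁ : Permuted ℓ₃ ℓ₂ ℓ₁

  Permuted-swap₂₃ : ∀ {l m n} → Permuted l m n → Permuted l n m
  Permuted-swap₂₃ p₁₂₃ = p₁₃₂
  Permuted-swap₂₃ p₁₃₂ = p₁₂₃
  Permuted-swap₂₃ p₂₁₃ = p₂₃₁
  Permuted-swap₂₃ p₂₃₁ = p₂₁₃
  Permuted-swap₂₃ p₃₁₂ = p₃₂₁
  Permuted-swap₂₃ p₃₂₁ = p₃₁₂

  Permuted-swap₁₃ : ∀ {l m n} → Permuted l m n → Permuted n m l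
  Permuted-swap₁₃ p₁₂₃ = p₃₂₁
  Permuted-swap₁₃ p₁₃₂ = p₂₃₁
  Permuted-swap₁₃ p₂₁₃ = p₃₁₂
  Permuted-swap₁₃ p₂₃₁ = p₁₃₂
  Permuted-swap₁₃ p₃₁₂ = p₂₁₃
  Permuted-swap₁₃ p₃₂₁ = p₁₂₃

  vertex-det : ∀ {p q m n r s} → FareyVertex p q m n r s → (m ≡ p + r) × (n ≡ q + s) × (q * r ≡ suc (p * s))
  vertex-det root = ≡.refl , ≡.refl , ≡.refl
  vertex-det (left {a} {b} {c} {d} {e} {f} V) with vertex-det V
  ... | ≡.refl , ≡.refl , det = ≡.refl , ≡.refl , ≡.trans (*-distribˡ-+ b a e) (≡.trans (cong (λ z → b * a + z) det)
        (≡.trans (+-suc (b * a) (a * f)) (cong suc (shuffle a b f))))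
    where
    shuffle : ∀ a b f → b * a + a * f ≡ a * (b + f)
    shuffle = ℕ-Solver.solve-∀
  vertex-det (right {a} {b} {c} {d} {e} {f} V) with vertex-det V
  ... | ≡.refl , ≡.refl , det = ≡.refl , ≡.refl , Concatenation.det-left a b e f det

  module Tree (k₁ k₂ k₃ : ℕ) where
    open Setup k₁ k₂ k₃
    open Fences k₁ k₂ k₃
    open Forms k₁ k₂ k₃

    pick : LP → LP → LP → Lbl → LP
    pick a b c ℓ₁ = a
    pick a b c ℓ₂ = b
    pick a b c ℓ₃ = c

    -- Mutation fixes positions in a labelled cluster, while the tree reorders its triples; the
    -- labels record which position each entry occupies.
    record Cluster (y₁ : LP) (l₁ : Lbl) (y₂ : LP) (l₂ : Lbl) (y₃ : LP) (l₃ : Lbl) : Set where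
      constructor cluster
      field
        {a b c} : LP
        labeled : LCluster a b c
        perm : Permuted l₁ l₂ l₃
        y₁≋ : y₁ ≋ pick a b c l₁
        y₂≋ : y₂ ≋ pick a b c l₂
        y₃≋ : y₃ ≋ pick a b c l₃

    swap₂₃ : ∀ {y₁ l₁ y₂ l₂ y₃ l₃} → Cluster y₁ l₁ y₂ l₂ y₃ l₃ → Cluster y₁ l₁ y₃ l₃ y₂ l₂
    swap₂₃ (cluster lc π h₁ h₂ h₃) = cluster lc (Permuted-swap₂₃ π) h₁ h₃ h₂

    swap₁₃ : ∀ {y₁ l₁ y₂ l₂ y₃ l₃} → Cluster y₁ l₁ y₂ l₂ y₃ l₃ → Cluster y₃ l₃ y₂ l₂ y₁ l₁
    swap₁₃ (cluster lc π h₁ h₂ h₃) = cluster lc (Permuted-swap₁₃ π) h₃ h₂ h₁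

    opaque
      unfolding _⊞_ _⊠_ ⊟

      exchange : ∀ {n k x y z} → n ⊠ z ≋ x ⊠ x ⊞ k ⊠ x ⊠ y ⊞ y ⊠ y → n ⊗ z ≈ x ⊗ x ⊕ k ⊗ x ⊗ y ⊕ y ⊗ y
      exchange h = coeffs h

    mutate₃ : ∀ {y₁ l₁ y₂ l₂ y₃ l₃ n} → Cluster y₁ l₁ y₂ l₂ y₃ l₃ →
      n ⊠ y₃ ≋ y₁ ⊠ y₁ ⊞ κs l₃ ⊠ y₁ ⊠ y₂ ⊞ y₂ ⊠ y₂ → Cluster y₁ l₁ y₂ l₂ n l₃
    mutate₃ {n = n} (cluster lc p₁₂₃ h₁ h₂ h₃) e = cluster (μ₃ lc n (exchange (M.mutation-cong e h₁ h₂ h₃))) p₁₂₃ h₁ h₂ refl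
    mutate₃ {n = n} (cluster lc p₂₁₃ h₁ h₂ h₃) e = cluster (μ₃ lc n (exchange (M.mutation-swap (M.mutation-cong e h₁ h₂ h₃)))) p₂₁₃ h₁ h₂ refl
    mutate₃ {n = n} (cluster lc p₁₃₂ h₁ h₂ h₃) e = cluster (μ₂ lc n (exchange (M.mutation-cong e h₁ h₂ h₃))) p₁₃₂ h₁ h₂ refl
    mutate₃ {n = n} (cluster lc p₃₁₂ h₁ h₂ h₃) e = cluster (μ₂ lc n (exchange (M.mutation-swap (M.mutation-cong e h₁ h₂ h₃)))) p₃₁₂ h₁ h₂ refl
    mutate₃ {n = n} (cluster lc p₂₃₁ h₁ h₂ h₃) e = cluster (μ₁ lc n (exchange (M.mutation-cong e h₁ h₂ h₃))) p₂₃₁ h₁ h₂ refl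
    mutate₃ {n = n} (cluster lc p₃₂₁ h₁ h₂ h₃) e = cluster (μ₁ lc n (exchange (M.mutation-swap (M.mutation-cong e h₁ h₂ h₃)))) p₃₂₁ h₁ h₂ refl

    e₁₂ : ℕ → ℕ → LP
    e₁₂ p q = Mat.e₁₂ (Cᴹ p q)

    -- The induction hypothesis. Besides the CGC conditions it carries the Markov equation, from
    -- which the exchange relations follow, and the slots of the variables.
    record Triple (p q m n r s : ℕ) (l₁ l₂ l₃ : Lbl) : Set where
      field
        isC-P : CG.IsC (κs l₁) (Cᴹ p q)
        isC-Q : CG.IsC (κs l₂) (Cᴹ m n)
        isC-R : CG.IsC (κs l₃) (Cᴹ r s)
        relation : CG.Rel (κs l₂) (Cᴹ p q) (Cᴹ m n) (Cᴹ r s)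
        markov : CG.Markov (e₁₂ p q) (e₁₂ m n) (e₁₂ r s) (κs l₁) (κs l₂) (κs l₃)
        clusters : Cluster (e₁₂ p q) l₁ (e₁₂ m n) l₂ (e₁₂ r s) l₃

    triple-left : ∀ {p q m n r s p' q' l₁ l₂ l₃} → Triple p q m n r s l₁ l₂ l₃ →
      CG.Rel (κs l₃) (Cᴹ p q) (Cᴹ p' q') (Cᴹ m n) → Triple p q p' q' m n l₁ l₃ l₂
    triple-left {p} {q} {m} {n} {r} {s} {p'} {q'} {l₁} {l₂} {l₃} t new = record
      { isC-P = isC-P ; isC-Q = CG.isC-leftChild isC-P isC-Q isC-R relation new ; isC-R = isC-Q
      ; relation = new ; markov = CG.Markov-jump markov jump ; clusters = swap₂₃ (mutate₃ clusters (CG.Vieta markov jump)) }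
      where
      open Triple t
      jump = CG.e₁₂-leftChild isC-P relation new

    triple-right : ∀ {p q m n r s p' q' l₁ l₂ l₃} → Triple p q m n r s l₁ l₂ l₃ →
      CG.Rel (κs l₁) (Cᴹ m n) (Cᴹ p' q') (Cᴹ r s) → Triple m n p' q' r s l₂ l₁ l₃
    triple-right {p} {q} {m} {n} {r} {s} {p'} {q'} {l₁} {l₂} {l₃} t new = record
      { isC-P = isC-Q ; isC-Q = CG.isC-rightChild isC-P isC-Q isC-R relation new ; isC-R = isC-R
      ; relation = new
      ; markov = CG.Markov-swap (CG.Markov-jump (CG.Markov-swap markov) jump)
      ; clusters = swap₁₃ (swap₂₃ (mutate₃ (swap₁₃ clusters) (CG.Vieta (CG.Markov-swap markov) jump))) }
      where
      open Triple t
      jump = CG.e₁₂-rightChild isC-R relation new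

    root-triple : Triple 0 1 1 1 1 0 ℓ₃ ℓ₁ ℓ₂
    root-triple = record
      { isC-P = isC-0/1
      ; isC-Q = CG.isC-product {Cᴹ 0 1} {Cᴹ 1 0} {Cᴹ 1 1} (κs ℓ₁) (CG.IsC.det≈𝟙 isC-0/1) (CG.IsC.det≈𝟙 isC-1/0) F-root relation
      ; isC-R = isC-1/0
      ; relation = relation
      ; markov = CG.Markov-cong e₁₂-0/1 e₁₂-1/0 (CG.Markov-jump initial jump)
      -- `Vieta` lists the two unchanged variables as `X₃`, `X₂` and `μ₁` lists them as `X₂`, `X₃`,
      -- hence the swap.
      ; clusters = cluster (μ₁ init (e₁₂ 1 1) (exchange (M.mutation-swap (CG.Vieta initial jump)))) p₃₁₂ e₁₂-0/1 refl e₁₂-1/0 }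
      where
      relation : CG.Rel (κs ℓ₁) (Cᴹ 0 1) (Cᴹ 1 1) (Cᴹ 1 0)
      relation = C-product 0 1 1 0 ≡.refl
      initial : CG.Markov X₃ X₂ X₁ (κs ℓ₃) (κs ℓ₂) (κs ℓ₁)
      initial = Rt.Markov-root X₁ X₂ X₃ _ (κs ℓ₁) (κs ℓ₂) (κs ℓ₃) 𝓜-form uX₁X₂X₃
      jump : e₁₂ 1 1 ≋ CG.jump X₃ X₂ X₁ (κs ℓ₃) (κs ℓ₂)
      jump = trans (≈₁₂ relation) (trans e₁₂-root (CG.jump-cong X₃-form X₂-form))

    triple : ∀ {p q m n r s} → FareyVertex p q m n r s → Triple p q m n r s (slot p q) (slot m n) (slot r s)
    triple root = root-triple
    triple (left {a} {b} {c} {d} {e} {f} V) = ≡.subst (λ l → Triple a b (a + c) (b + d) c d (slot a b) l (slot c d)) (≡.sym slot≡)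
      (triple-left (triple V) (≡.subst (λ l → CG.Rel (κs l) (Cᴹ a b) (Cᴹ (a + c) (b + d)) (Cᴹ c d)) slot≡
        (C-product a b c d (proj₂ (proj₂ (vertex-det (left V)))))))
      where
      slot≡ : slot (a + c) (b + d) ≡ slot e f
      slot≡ = ≡.trans (cong₂ (λ u v → slot (a + u) (b + v)) (proj₁ (vertex-det V)) (proj₁ (proj₂ (vertex-det V)))) (slot-sum a b e f)
    triple (right {a} {b} {c} {d} {e} {f} V) = ≡.subst (λ l → Triple c d (c + e) (d + f) e f (slot c d) l (slot e f)) (≡.sym slot≡)
      (triple-right (triple V) (≡.subst (λ l → CG.Rel (κs l) (Cᴹ c d) (Cᴹ (c + e) (d + f)) (Cᴹ e f)) slot≡
        (C-product c d e f (proj₂ (proj₂ (vertex-det (right V)))))))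
      where
      slot≡ : slot (c + e) (d + f) ≡ slot a b
      slot≡ = ≡.trans (cong₂ slot (≡.trans (cong (_+ e) (≡.trans (proj₁ (vertex-det V)) (+-comm a e))) (+-comm (e + a) e))
                                  (≡.trans (cong (_+ f) (≡.trans (proj₁ (proj₂ (vertex-det V))) (+-comm b f))) (+-comm (f + b) f)))
        (slot-sum e f a b)

-- Integral coefficients, all coprime pairs, and assembly of the statement.

module Integrality where

  open import Defs
  open LaurentRing
  open MatrixAlgebra
  open Staircases
  open Concatenations
  open Words
  open TransferMatrices
  open FenceMatrices
  open WordForms
  open FareyTriples
  open import Data.Bool using (true; false)
  open import Data.Integer as ℤ using (ℤ; +_; -[1+_])
  open import Data.List using (List; []; _∷_)
  open import Data.List.Relation.Unary.All as All using (All; []; _∷_)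
  import Data.List.Relation.Unary.All.Properties as Allₚ
  open import Data.Nat as ℕ using (ℕ; zero; suc; _+_; _*_; _≤_; _<_; z≤n; s≤s)
  open import Data.Nat.Properties
  import Data.Nat.Divisibility as ∣
  import Data.Nat.Tactic.RingSolver as ℕ-Solver
  open import Data.Nat.Coprimality using (Coprime)
  import Data.Nat.Coprimality as Coprimality
  open import Data.Product using (_×_; _,_; proj₁; proj₂; Σ; ∃)
  open import Data.Rational as ℚ using (ℚ)
  import Data.Rational.Properties as ℚₚ
  open import Data.Sum using (_⊎_; inj₁; inj₂)
  open import Relation.Binary.Definitions using (Tri; tri<; tri≈; tri>)
  open import Relation.Binary.PropositionalEquality as ≡ using (_≡_; cong; cong₂)
  open M using (Mat; _≈ᴹ_; entries; ≈₁₁; ≈₁₂; ≈₂₁; ≈₂₂; _·_; 𝟘; 𝟙; refl; sym; trans)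

  IsInteger : ℚ → Set
  IsInteger c = Σ ℤ λ n → c ≡ n ℚ./ 1

  integer-+ : ∀ {c d} → IsInteger c → IsInteger d → IsInteger (c ℚ.+ d)
  integer-+ (m , ≡.refl) (n , ≡.refl) = m ℤ.+ n , ≡.sym (/1-+ m n)

  integer-* : ∀ {c d} → IsInteger c → IsInteger d → IsInteger (c ℚ.* d)
  integer-* (m , ≡.refl) (n , ≡.refl) = m ℤ.* n , ≡.sym (/1-* m n)

  integer-neg : ∀ {c} → IsInteger c → IsInteger (ℚ.- c)
  integer-neg (m , ≡.refl) = ℤ.- m , ≡.sym (/1-neg m)

  denominator-/1 : ∀ n → ℚ.denominatorℕ (n ℚ./ 1) ≡ 1
  denominator-/1 (+ n) = cong ℚ.denominatorℕ (ℚₚ.normalize-coprime (Coprimality.sym (Coprimality.1-coprimeTo n)))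
  denominator-/1 -[1+ n ] = cong (λ c → ℚ.denominatorℕ (ℚ.- c)) (ℚₚ.normalize-coprime (Coprimality.sym (Coprimality.1-coprimeTo (suc n))))

  IntegerTerms : LP → Set
  IntegerTerms = All (λ t → IsInteger (proj₁ t))

  -- Individual terms of p may be non-integral (k and 1/k occur), so we ask for another representative.
  HasIntegers : LP → Set
  HasIntegers p = Σ LP λ p' → (p ≋ p') × IntegerTerms p'

  at-integer : ∀ {c} f e → IsInteger c → IsInteger (at c f e)
  at-integer f e h with f =ₑ e
  ... | true  = h
  ... | false = + 0 , ≡.refl

  coeff-integer : ∀ p e → IntegerTerms p → IsInteger (coeff p e)
  coeff-integer [] e [] = + 0 , ≡.refl
  coeff-integer ((c , f) ∷ p) e (h ∷ hs) = ≡.subst IsInteger (≡.sym (coeff-∷ c f p e)) (integer-+ (at-integer f e h) (coeff-integer p e hs))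

  integral : ∀ {p} → HasIntegers p → Integral p
  integral (p' , h , hs) e with coeff-integer p' e hs
  ... | n , eq = ≡.trans (cong ℚ.denominatorℕ (≡.trans (coeffs h e) eq)) (denominator-/1 n)

  HasIntegers-≋ : ∀ {p q} → p ≋ q → HasIntegers q → HasIntegers p
  HasIntegers-≋ h (q' , h' , hs) = q' , trans h h' , hs

  scale-integers : ∀ {a} f q → IsInteger a → IntegerTerms q → IntegerTerms (scale a f q)
  scale-integers f [] h [] = []
  scale-integers f (_ ∷ q) h (g ∷ gs) = integer-* h g ∷ scale-integers f q h gs

  ⊗-integers : ∀ p q → IntegerTerms p → IntegerTerms q → IntegerTerms (p ⊗ q)
  ⊗-integers [] q [] gs = []
  ⊗-integers ((a , f) ∷ p) q (h ∷ hs) gs = Allₚ.++⁺ (scale-integers f q h gs) (⊗-integers p q hs gs)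

  ⊝-integers : ∀ p → IntegerTerms p → IntegerTerms (⊝ p)
  ⊝-integers [] [] = []
  ⊝-integers (_ ∷ p) (h ∷ hs) = integer-neg h ∷ ⊝-integers p hs

  opaque
    unfolding _⊞_ _⊠_ ⊟

    HasIntegers-⊞ : ∀ {p q} → HasIntegers p → HasIntegers q → HasIntegers (p ⊞ q)
    HasIntegers-⊞ {p} {q} (p' , h , hs) (q' , g , gs) = p' ⊕ q' , T.+-cong h g , Allₚ.++⁺ hs gs

    HasIntegers-⊠ : ∀ {p q} → HasIntegers p → HasIntegers q → HasIntegers (p ⊠ q)
    HasIntegers-⊠ {p} {q} (p' , h , hs) (q' , g , gs) = p' ⊗ q' , T.*-cong {p} {p'} {q} {q'} h g , ⊗-integers p' q' hs gs

    HasIntegers-⊟ : ∀ {p} → HasIntegers p → HasIntegers (⊟ p)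
    HasIntegers-⊟ {p} (p' , h , hs) = ⊝ p' , T.-‿cong h , ⊝-integers p' hs

  HasIntegers-mono : ∀ n e → HasIntegers (mono (n ℚ./ 1) e)
  HasIntegers-mono n e = mono (n ℚ./ 1) e , refl , (n , ≡.refl) ∷ []

  record IntegerMat (X : Mat) : Set where
    constructor integerMat
    field
      int₁₁ : HasIntegers (Mat.e₁₁ X)
      int₁₂ : HasIntegers (Mat.e₁₂ X)
      int₂₁ : HasIntegers (Mat.e₂₁ X)
      int₂₂ : HasIntegers (Mat.e₂₂ X)

  IntegerMat-≈ : ∀ {X Y} → X ≈ᴹ Y → IntegerMat Y → IntegerMat X
  IntegerMat-≈ h (integerMat a b c d) = integerMat (HasIntegers-≋ (≈₁₁ h) a) (HasIntegers-≋ (≈₁₂ h) b) (HasIntegers-≋ (≈₂₁ h) c) (HasIntegers-≋ (≈₂₂ h) d)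

  IntegerMat-· : ∀ {X Y} → IntegerMat X → IntegerMat Y → IntegerMat (X · Y)
  IntegerMat-· {X} {Y} (integerMat a b c d) (integerMat a' b' c' d') = integerMat
    (HasIntegers-⊞ (HasIntegers-⊠ a a') (HasIntegers-⊠ b c')) (HasIntegers-⊞ (HasIntegers-⊠ a b') (HasIntegers-⊠ b d'))
    (HasIntegers-⊞ (HasIntegers-⊠ c a') (HasIntegers-⊠ d c')) (HasIntegers-⊞ (HasIntegers-⊠ c b') (HasIntegers-⊠ d d'))

  IntegerMat-adj : ∀ {X} → IntegerMat X → IntegerMat (M.adj X)
  IntegerMat-adj (integerMat a b c d) = integerMat d (HasIntegers-⊟ b) (HasIntegers-⊟ c) a

  private
    int0 : HasIntegers 𝟘
    int0 = HasIntegers-mono (+ 0) e₀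
    int1 : HasIntegers 𝟙
    int1 = HasIntegers-mono (+ 1) e₀

    int-x^ : ∀ e → HasIntegers (𝐱^ e)
    int-x^ e = HasIntegers-mono (+ 1) e

    int-𝔸 : IntegerMat M.𝔸
    int-𝔸 = integerMat int1 int1 int0 int1
    int-𝔹 : IntegerMat M.𝔹
    int-𝔹 = integerMat int1 int0 int1 int1

  Middle-vertex : ℕ → ℕ → Set
  Middle-vertex p q = ∃ λ a → ∃ λ b → ∃ λ e → ∃ λ f → FareyVertex a b p q e f

  -- (p,q) = x (a,b) + y (e,f) in the cone of the vertex; the smaller of x, y is subtracted from the larger.
  descend : ∀ fuel {a b c d e f} → FareyVertex a b c d e f → ∀ p q x y → Coprime p q → 1 ≤ x → 1 ≤ y → x + y ≤ fuel →
    p ≡ x * a + y * e → q ≡ x * b + y * f → Middle-vertex p q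
  descend zero V p q (suc x) y _ _ _ () _ _
  descend (suc fuel) {a} {b} {c} {d} {e} {f} V p q x y cop 1≤x 1≤y x+y≤ hp hq = compare (<-cmp x y)
    where
    c≡ = proj₁ (vertex-det V)
    d≡ = proj₁ (proj₂ (vertex-det V))
    difference : ∀ {m n} → m < n → ∃ λ k → n ≡ m + suc k
    difference {m} m<n with m≤n⇒∃[o]m+o≡n m<n
    ... | k , h = k , ≡.trans (≡.sym h) (≡.sym (+-suc m k))
    shrink : ∀ u v → 1 ≤ v → (v + u) + v ≤ suc fuel → u + v ≤ fuel
    shrink u (suc v) _ h = ≤-trans (+-monoˡ-≤ (suc v) (m≤n+m u v)) (ℕ.s≤s⁻¹ h)
    shuffle : ∀ y k a e → (y + k) * a + y * e ≡ k * a + y * (a + e)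
    shuffle = ℕ-Solver.solve-∀
    shuffle' : ∀ x k a e → x * a + (x + k) * e ≡ x * (a + e) + k * e
    shuffle' = ℕ-Solver.solve-∀
    compare : Tri (x < y) (x ≡ y) (y < x) → Middle-vertex p q
    -- Here `p = x (a + e)` and `q = x (b + f)`, so coprimality forces `x = 1` and the pair is the
    -- middle of the vertex.
    compare (tri≈ _ ≡.refl _) = a , b , e , f , ≡.subst₂ (λ u v → FareyVertex a b u v e f)
        (≡.trans c≡ (≡.sym (collapse hp))) (≡.trans d≡ (≡.sym (collapse hq))) V
      where
      x≡1 : x ≡ 1
      x≡1 = cop {x} (∣.divides (a + e) (≡.trans hp (≡.trans (≡.sym (*-distribˡ-+ x a e)) (*-comm x (a + e))))
                   , ∣.divides (b + f) (≡.trans hq (≡.trans (≡.sym (*-distribˡ-+ x b f)) (*-comm x (b + f)))))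
      collapse : ∀ {u v w} → u ≡ x * v + x * w → u ≡ v + w
      collapse {u} {v} {w} h = ≡.trans h (≡.trans (cong (λ z → z * v + z * w) x≡1) (cong₂ _+_ (*-identityˡ v) (*-identityˡ w)))
    compare (tri> _ _ y<x) = go (difference y<x)
      where
      go : (∃ λ k → x ≡ y + suc k) → Middle-vertex p q
      go (k , ≡.refl) = descend fuel (left V) p q (suc k) y cop (s≤s z≤n) 1≤y (shrink (suc k) y 1≤y x+y≤)
        (≡.trans hp (≡.trans (shuffle y (suc k) a e) (cong (λ z → suc k * a + y * z) (≡.sym c≡))))
        (≡.trans hq (≡.trans (shuffle y (suc k) b f) (cong (λ z → suc k * b + y * z) (≡.sym d≡))))
    compare (tri< x<y _ _) = go (difference x<y)
      where
      go : (∃ λ k → y ≡ x + suc k) → Middle-vertex p q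
      go (k , ≡.refl) = descend fuel (right V) p q x (suc k) cop 1≤x (s≤s z≤n)
        (≡.subst (_≤ fuel) (+-comm (suc k) x) (shrink (suc k) x 1≤x (≡.subst (_≤ suc fuel) (+-comm x (x + suc k)) x+y≤)))
        (≡.trans hp (≡.trans (shuffle' x (suc k) a e) (cong (λ z → x * z + suc k * e) (≡.sym c≡))))
        (≡.trans hq (≡.trans (shuffle' x (suc k) b f) (cong (λ z → x * z + suc k * f) (≡.sym d≡))))

  module CGCTriples (k₁ k₂ k₃ : ℕ) where
    open Setup k₁ k₂ k₃
    open Fences k₁ k₂ k₃
    open Forms k₁ k₂ k₃
    open Tree k₁ k₂ k₃

    private
      int-crossing : ∀ ℓ b → IntegerMat (crossing ℓ b)
      int-crossing ℓ true = integerMat (int-x^ _) int0 (HasIntegers-mono (+ kOf ℓ) e₀) (int-x^ _)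
      int-crossing ℓ false = integerMat (int-x^ _) (HasIntegers-mono (+ kOf ℓ) e₀) int0 (int-x^ _)

      int-letter : ∀ l → IntegerMat (letter l)
      int-letter (ℓ₁ , b) = int-crossing ℓ₁ b
      int-letter (ℓ₂ , b) = IntegerMat-· (IntegerMat-· int-𝔹 (int-crossing ℓ₂ b)) int-𝔸
      int-letter (ℓ₃ , b) = IntegerMat-· (IntegerMat-· int-𝔸 (int-crossing ℓ₃ b)) int-𝔹

      int-word : ∀ w → IntegerMat (word w)
      int-word [] = integerMat int1 int0 int0 int1
      int-word (l ∷ w) = IntegerMat-· (int-letter l) (int-word w)

      int-κ : ∀ {X} → IntegerMat X → IntegerMat (κ X)
      int-κ h = IntegerMat-· (IntegerMat-· (integerMat (int-x^ _) (int-x^ _) int0 int1) h)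
                             (integerMat (int-x^ _) (HasIntegers-⊟ int1) int0 int1)

    -- The word form contains `k` but never `1/k`, so integrality follows factor by factor. For 1/0
    -- the inverse of `v` is its adjugate, which needs no division.
    C-integers : ∀ p q → Coprime p q → IntegerMat (Cᴹ p q)
    C-integers p (suc q) cop = IntegerMat-≈ (left-word-form p (suc q) (p + q) (s≤s z≤n) cop (+-suc p q))
      (int-κ (IntegerMat-· (int-word (leftWord p (suc q) (p + q))) (int-letter (ℓ₂ , true))))
    C-integers p zero cop = ≡.subst (λ p → IntegerMat (Cᴹ p 0)) (≡.sym (cop {p} (∣.∣-refl , ∣.divides 0 ≡.refl)))
      (IntegerMat-≈ C-1/0 (int-κ (IntegerMat-· (IntegerMat-adj (int-letter (ℓ₂ , true))) (IntegerMat-· (int-word []) (int-word tailWord)))))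

    clusterVar : ∀ {a b c y} l → LCluster a b c → y ≋ pick a b c l → ClusterVarWithParity y (kOf l)
    clusterVar ℓ₁ lc h = _ , _ , _ , lc , inj₁ (coeffs h , ≡.refl)
    clusterVar ℓ₂ lc h = _ , _ , _ , lc , inj₂ (inj₁ (coeffs h , ≡.refl))
    clusterVar ℓ₃ lc h = _ , _ , _ , lc , inj₂ (inj₂ (coeffs h , ≡.refl))

    nonLabeled : ∀ {y₁ l₁ y₂ l₂ y₃ l₃} → Cluster y₁ l₁ y₂ l₂ y₃ l₃ → NonLabeledCluster y₁ y₂ y₃
    nonLabeled (cluster lc π h₁ h₂ h₃) = _ , _ , _ , lc , arrange π h₁ h₂ h₃
      where
      arrange : ∀ {a b c y₁ y₂ y₃ l₁ l₂ l₃} → Permuted l₁ l₂ l₃ →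
        y₁ ≋ pick a b c l₁ → y₂ ≋ pick a b c l₂ → y₃ ≋ pick a b c l₃ →
        ((y₁ ≈ a) × (y₂ ≈ b) × (y₃ ≈ c)) ⊎ ((y₁ ≈ a) × (y₂ ≈ c) × (y₃ ≈ b)) ⊎ ((y₁ ≈ b) × (y₂ ≈ a) × (y₃ ≈ c))
        ⊎ ((y₁ ≈ b) × (y₂ ≈ c) × (y₃ ≈ a)) ⊎ ((y₁ ≈ c) × (y₂ ≈ a) × (y₃ ≈ b)) ⊎ ((y₁ ≈ c) × (y₂ ≈ b) × (y₃ ≈ a))
      arrange p₁₂₃ h₁ h₂ h₃ = inj₁ (coeffs h₁ , coeffs h₂ , coeffs h₃)
      arrange p₁₃₂ h₁ h₂ h₃ = inj₂ (inj₁ (coeffs h₁ , coeffs h₂ , coeffs h₃))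
      arrange p₂₁₃ h₁ h₂ h₃ = inj₂ (inj₂ (inj₁ (coeffs h₁ , coeffs h₂ , coeffs h₃)))
      arrange p₂₃₁ h₁ h₂ h₃ = inj₂ (inj₂ (inj₂ (inj₁ (coeffs h₁ , coeffs h₂ , coeffs h₃))))
      arrange p₃₁₂ h₁ h₂ h₃ = inj₂ (inj₂ (inj₂ (inj₂ (inj₁ (coeffs h₁ , coeffs h₂ , coeffs h₃)))))
      arrange p₃₂₁ h₁ h₂ h₃ = inj₂ (inj₂ (inj₂ (inj₂ (inj₂ (coeffs h₁ , coeffs h₂ , coeffs h₃)))))

    entrywise : ∀ {X Y} → X ≈ᴹ Y → (Mat.e₁₁ X ≈ Mat.e₁₁ Y) × (Mat.e₁₂ X ≈ Mat.e₁₂ Y) × (Mat.e₂₁ X ≈ Mat.e₂₁ Y) × (Mat.e₂₂ X ≈ Mat.e₂₂ Y)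
    entrywise (entries h₁ h₂ h₃ h₄) = coeffs h₁ , coeffs h₂ , coeffs h₃ , coeffs h₄

    opaque
      unfolding _⊞_ _⊠_ ⊟ Cᴹ

      isCGC : ∀ p q l → IntegerMat (Cᴹ p q) → CG.IsC (κs l) (Cᴹ p q) → ClusterVarWithParity (e₁₂ p q) (kOf l) → IsCGC (C p q)
      isCGC p q l (integerMat i₁₁ i₁₂ i₂₁ i₂₂) c cv =
        (integral i₁₁ , integral i₁₂ , integral i₂₁ , integral i₂₂ , coeffs (CG.IsC.det≈𝟙 c)) , kOf l , cv , coeffs (CG.trace c)

      relation-S : ∀ p q m n r s l → CG.IsC (κs l) (Cᴹ m n) → CG.Rel (κs l) (Cᴹ p q) (Cᴹ m n) (Cᴹ r s) →
        C m n ≈ₘ (C p q ·ₘ C r s) -ₘ S (C m n)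
      relation-S p q m n r s l c rel = entrywise (CG.product-minus-S {Cᴹ p q} {Cᴹ m n} {Cᴹ r s} {κs l} c rel)

      nonLabeled-C : ∀ p q m n r s → NonLabeledCluster (e₁₂ p q) (e₁₂ m n) (e₁₂ r s) →
        NonLabeledCluster (m₁₂ (C p q)) (m₁₂ (C m n)) (m₁₂ (C r s))
      nonLabeled-C p q m n r s h = h

    isCGCTriple : ∀ {p q m n r s} → FareyVertex p q m n r s → IsCGCTriple (C p q) (C m n) (C r s)
    isCGCTriple {p} {q} {m} {n} {r} {s} V =
        isCGC p q (slot p q) (C-integers p q coprime-pq) isC-P (clusterVar (slot p q) labeled y₁≋)
      , isCGC m n (slot m n) (C-integers m n coprime-mn) isC-Q (clusterVar (slot m n) labeled y₂≋)
      , isCGC r s (slot r s) (C-integers r s coprime-rs) isC-R (clusterVar (slot r s) labeled y₃≋)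
      , relation-S p q m n r s (slot m n) isC-Q relation
      , nonLabeled-C p q m n r s (nonLabeled clusters)
      where
      open Triple (triple V)
      open Cluster clusters
      unimodular = proj₂ (proj₂ (vertex-det V))
      coprime-pq : Coprime p q
      coprime-pq = coprime-det {q} {r} {p} {s} unimodular
      coprime-rs : Coprime r s
      coprime-rs = Coprimality.sym (coprime-det {r} {q} {s} {p} (≡.trans (*-comm r q) (≡.trans unimodular (cong suc (*-comm p s)))))
      coprime-mn : Coprime m n
      coprime-mn = ≡.subst₂ Coprime (≡.sym (proj₁ (vertex-det V))) (≡.sym (proj₁ (proj₂ (vertex-det V)))) (Concatenation.coprime-mn p q r s unimodular)

    isCGC-coprime : ∀ p q → Coprime p q → IsCGC (C p q)
    isCGC-coprime zero q cop = ≡.subst (λ q → IsCGC (C 0 q)) (≡.sym (cop {q} (∣.divides 0 ≡.refl , ∣.∣-refl)))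
      (proj₁ (isCGCTriple root))
    isCGC-coprime p@(suc _) zero cop = ≡.subst (λ p → IsCGC (C p 0)) (≡.sym (cop {p} (∣.∣-refl , ∣.divides 0 ≡.refl)))
      (proj₁ (proj₂ (proj₂ (isCGCTriple root))))
    -- At the root `(p, q) = q (0, 1) + p (1, 0)`, so the descent starts with coefficients `q` and
    -- `p` and with their sum as fuel.
    isCGC-coprime p@(suc _) q@(suc _) cop = middle (descend (q + p) root p q q p cop (s≤s z≤n) (s≤s z≤n) ≤-refl
        (≡.sym (≡.trans (cong (_+ p * 1) (*-zeroʳ q)) (*-identityʳ p)))
        (≡.sym (≡.trans (cong₂ _+_ (*-identityʳ q) (*-zeroʳ p)) (+-identityʳ q))))
      where
      middle : Middle-vertex p q → IsCGC (C p q)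
      middle (_ , _ , _ , _ , V) = proj₁ (proj₂ (isCGCTriple V))

open import Defs
open import Data.Nat using (ℕ)
open import Data.Nat.Coprimality using (Coprime)
open import Data.Product using (_×_; _,_)
open Integrality using (module CGCTriples)

theorem9p3 : (k₁ k₂ k₃ : ℕ) →
    ((p q : ℕ) → Coprime p q → Setup.IsCGC k₁ k₂ k₃ (Setup.C k₁ k₂ k₃ p q))
    × ((p q m n r s : ℕ) → FareyVertex p q m n r s →
    Setup.IsCGCTriple k₁ k₂ k₃ (Setup.C k₁ k₂ k₃ p q) (Setup.C k₁ k₂ k₃ m n) (Setup.C k₁ k₂ k₃ r s))
theorem9p3 k₁ k₂ k₃ = CGCTriples.isCGC-coprime k₁ k₂ k₃ , λ p q m n r s V → CGCTriples.isCGCTriple k₁ k₂ k₃ V
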